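{- Let $T=\mathrm{PSL}_2(q)$ with $q\geq 4$ a prime power, let $G$ be a primitive almost simple permutation group with socle $T$ (so $T\le G\le \mathrm{Aut}(T)=\mathrm{P\Gamma L}_2(q)$), and let $M$ be a point stabilizer of $G$. Then $M$ is not a perfect code of $G$ if and only if one of the following holds: (a) $q>7$, $q\equiv -1\pmod 8$, $|G/T|$ is odd, and $M\cap T\cong D_{q-1}$; (b) $q>9$, $q\equiv 1\pmod 8$, $|G/T|$ is odd, and $M\cap T\cong D_{q+1}$; (c) $q\equiv 1\pmod 8$, $|G/T|\equiv 2\pmod 4$, $G\not\le \mathrm{P\Sigma L}_2(q)$, $G\not\ge \mathrm{PGL}_2(q)$, and $M\cap T\cong D_{q+1}$.
   Context: All groups are finite. A perfect code in a simple undirected graph with vertex set $V$ is an independent subset $C\subseteq V$ such that every vertex in $V\setminus C$ is adjacent to exactly one vertex of $C$. For a group $G$ with identity $e$ and an inverse-closed $S\subseteq G\setminus\{e\}$, the Cayley graph $\mathrm{Cay}(G,S)$ has vertex set $G$ and edges $\{g,sg\}$ ($s\in S$, $g\in G$). A subset $C$ of $G$ is a perfect code of $G$ if it is a perfect code in some Cayley graph $\mathrm{Cay}(G,S)$. $D_{2n}$ denotes the dihedral group of order $2n$. Inside $\mathrm{P\Gamma L}_2(q)$, $\mathrm{PGL}_2(q)$ is the image of $\mathrm{GL}_2(q)$ modulo scalars and $\mathrm{P\Sigma L}_2(q)=\mathrm{PSL}_2(q)\rtimes\langle\phi\rangle$ where $\phi$ is the Frobenius field automorphism. -}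

module Defs where

open import Level using (0ℓ)
open import Data.Nat as N using (ℕ; zero; suc)
open import Data.Nat.DivMod using (_mod_; _%_)
open import Data.Fin using (Fin; toℕ)
open import Data.Bool using (Bool; true; false; if_then_else_; _xor_)
open import Data.Product using (Σ; ∃; _×_; _,_)
open import Data.Sum using (_⊎_)
open import Data.List using (List; length)
open import Data.List.Relation.Unary.All using (All)
open import Data.List.Relation.Unary.Any using (Any)
open import Data.List.Relation.Unary.AllPairs using (AllPairs)
open import Data.List.Relation.Unary.Unique.Propositional using (Unique)
open import Data.List.Membership.Propositional using (_∈_)
open import Relation.Binary.PropositionalEquality using (_≡_; _≢_)
open import Relation.Nullary using (¬_)
open import Algebra.Core using (Op₁; Op₂)
open import Algebra.Structures using (IsCommutativeRing)

record FiniteField (q : ℕ) : Set₁ where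
  infixl 7 _*_
  infixl 6 _+_
  field
    Carrier : Set
    _+_ _*_ : Op₂ Carrier
    -_ : Op₁ Carrier
    0# 1# : Carrier
    isCommutativeRing : IsCommutativeRing _≡_ _+_ _*_ -_ 0# 1#
    0≢1 : 0# ≢ 1#
    inverse : ∀ x → x ≢ 0# → ∃ λ y → x * y ≡ 1#
    elements : List Carrier
    elements-unique : Unique elements
    elements-complete : ∀ x → x ∈ elements
    elements-length : length elements ≡ q

-- The dihedral group D_{2n} (order 2n), n = suc k, as Z_n × Z_2 with
-- (r^a s^ε)(r^b s^δ) = r^(a ± b) s^(ε+δ).

DihCarrier : ℕ → Set
DihCarrier k = Fin (suc k) × Bool

dihMul : (k : ℕ) → DihCarrier k → DihCarrier k → DihCarrier k
dihMul k (a , ε) (b , δ) =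
  ((toℕ a N.+ (if ε then suc k N.∸ toℕ b else toℕ b)) mod suc k) , (ε xor δ)

-- PΓL₂(q) and its subgroups, for a finite field K of order q.
-- Raw elements are pairs (A , σ) of a 2×2 matrix and a map σ : F → F,
-- with product (A , σ)(B , τ) = (A σ(B) , σ ∘ τ) (semidirect product
-- GL₂(q) ⋊ Aut(F)); elements of PΓL₂(q) are the pairs with det A ≠ 0 and
-- σ a field automorphism, taken modulo scalar matrices (relation _≈_).

module ProjectiveGroups {q : ℕ} (K : FiniteField q) where
  open FiniteField K

  record Mat : Set where
    constructor mat
    field
      m₁₁ m₁₂ m₂₁ m₂₂ : Carrier
  open Mat public

  _·ₘ_ : Mat → Mat → Mat
  A ·ₘ B = mat (m₁₁ A * m₁₁ B + m₁₂ A * m₂₁ B) (m₁₁ A * m₁₂ B + m₁₂ A * m₂₂ B)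
               (m₂₁ A * m₁₁ B + m₂₂ A * m₂₁ B) (m₂₁ A * m₁₂ B + m₂₂ A * m₂₂ B)

  mapMat : (Carrier → Carrier) → Mat → Mat
  mapMat f A = mat (f (m₁₁ A)) (f (m₁₂ A)) (f (m₂₁ A)) (f (m₂₂ A))

  scale : Carrier → Mat → Mat
  scale l A = mapMat (l *_) A

  det : Mat → Carrier
  det A = m₁₁ A * m₂₂ A + - (m₁₂ A * m₂₁ A)

  idMat : Mat
  idMat = mat 1# 0# 0# 1#

  record Elem : Set where
    constructor ⟨_,_⟩
    field
      matrix : Mat
      aut : Carrier → Carrier
  open Elem public

  infixl 7 _·_
  _·_ : Elem → Elem → Elem
  x · y = ⟨ matrix x ·ₘ mapMat (aut x) (matrix y) , (λ z → aut x (aut y z)) ⟩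

  one : Elem
  one = ⟨ idMat , (λ z → z) ⟩

  infix 4 _≈_
  _≈_ : Elem → Elem → Set
  x ≈ y = (∀ z → aut x z ≡ aut y z) × ∃ λ l → l ≢ 0# × matrix y ≡ scale l (matrix x)

  IsFieldAut : (Carrier → Carrier) → Set
  IsFieldAut σ = (∀ x y → σ (x + y) ≡ σ x + σ y)
               × (∀ x y → σ (x * y) ≡ σ x * σ y)
               × (σ 1# ≡ 1#)
               × (∀ x y → σ x ≡ σ y → x ≡ y)
               × (∀ y → ∃ λ x → σ x ≡ y)

  Subset : Set₁
  Subset = Elem → Set

  infix 4 _⊆_
  _⊆_ : Subset → Subset → Set
  H ⊆ L = ∀ x → H x → L x

  _∩_ : Subset → Subset → Subset
  (H ∩ L) x = H x × L x

  PΓL : Subset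
  PΓL x = (det (matrix x) ≢ 0#) × IsFieldAut (aut x)

  PGL : Subset
  PGL x = PΓL x × (∀ z → aut x z ≡ z)

  PSL : Subset
  PSL x = PGL x × ∃ λ l → det (scale l (matrix x)) ≡ 1#

  pow : Carrier → ℕ → Carrier
  pow z zero = 1#
  pow z (suc n) = z * pow z n

  iter : ℕ → (Carrier → Carrier) → Carrier → Carrier
  iter zero f z = z
  iter (suc n) f z = f (iter n f z)

  -- PΣL₂(q) = PSL₂(q) ⋊ ⟨φ⟩, φ the Frobenius z ↦ z^p (p = characteristic)
  PΣL : (p : ℕ) → Subset
  PΣL p x = PΓL x
          × (∃ λ k → ∀ z → aut x z ≡ iter k (λ w → pow w p) z)
          × (∃ λ l → det (scale l (matrix x)) ≡ 1#)

  record IsSubgroup (H : Subset) : Set where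
    field
      ⊆PΓL : H ⊆ PΓL
      respects : ∀ x y → x ≈ y → H x → H y
      has-one : H one
      closed : ∀ x y → H x → H y → H (x · y)
      inverses : ∀ x → H x → ∃ λ y → H y × y · x ≈ one

  IsMaximal : Subset → Subset → Set₁
  IsMaximal G M = M ⊆ G × ¬ (G ⊆ M)
                × (∀ L → IsSubgroup L → M ⊆ L → L ⊆ G → (L ⊆ M) ⊎ (G ⊆ L))

  IsCoreFree : Subset → Subset → Set
  IsCoreFree G M = ∀ x → (∀ g h → G g → G h → h · g ≈ one → M (g · x · h)) → x ≈ one

  HasOrder : Subset → ℕ → Set
  HasOrder H n = ∃ λ (L : List Elem) → length L ≡ n × All H L
               × AllPairs (λ x y → ¬ (x ≈ y)) L × (∀ x → H x → Any (x ≈_) L)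

  IndexIs : Subset → Subset → ℕ → Set
  IndexIs G T i = ∃ λ t → HasOrder T t × HasOrder G (i N.* t)

  IsoDihedral : Subset → ℕ → Set
  IsoDihedral H m = ∃ λ k → 2 N.* suc k ≡ m × Σ (DihCarrier k → Elem) λ f →
      (∀ x → H (f x))
    × (∀ y → H y → ∃ λ x → f x ≈ y)
    × (∀ x y → f x ≈ f y → x ≡ y)
    × (∀ x y → f (dihMul k x y) ≈ f x · f y)

  -- C ⊆ G is a perfect code of the group G: it is a perfect code in
  -- Cay(G,S) (edges {g, s g}) for some inverse-closed S ⊆ G ∖ {e}
  IsPerfectCode : Subset → Subset → Set₁
  IsPerfectCode G C = Σ Subset λ S →
      S ⊆ G
    × (∀ s → S s → ¬ (s ≈ one))
    × (∀ s → S s → ∃ λ t → S t × t · s ≈ one)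
    × (∀ c c′ s → C c → C c′ → S s → ¬ (c′ ≈ s · c))
    × (∀ g → G g → ¬ C g → ∃ λ c → C c × ∃ λ s → S s × g ≈ s · c)
    × (∀ g c c′ s s′ → G g → ¬ C g → C c → C c′ → S s → S s′
         → g ≈ s · c → g ≈ s′ · c′ → c ≈ c′)

  CondA : Subset → Subset → Set
  CondA G M = 7 N.< q × q % 8 ≡ 7
            × (∃ λ i → IndexIs G PSL i × i % 2 ≡ 1)
            × IsoDihedral (M ∩ PSL) (q N.∸ 1)

  CondB : Subset → Subset → Set
  CondB G M = 9 N.< q × q % 8 ≡ 1
            × (∃ λ i → IndexIs G PSL i × i % 2 ≡ 1)
            × IsoDihedral (M ∩ PSL) (q N.+ 1)

  CondC : ℕ → Subset → Subset → Set
  CondC p G M = q % 8 ≡ 1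
              × (∃ λ i → IndexIs G PSL i × i % 4 ≡ 2)
              × ¬ (G ⊆ PΣL p) × ¬ (PGL ⊆ G)
              × IsoDihedral (M ∩ PSL) (q N.+ 1)

{-# OPTIONS --safe #-}
-- If M is not a perfect code, some x ∈ T outside M has x² in a Sylow 2-subgroup Q of M which it normalizes, while xM
-- contains no involution. A Frobenius argument shows that w = x² is an involution inverting a torus whose normalizer in
-- G is M, and that ⟨w⟩ is a Sylow 2-subgroup of M ∩ T. Writing x as 1 + Z with Z² = -1 a lift of w, det x = 2 is a
-- square, so q ≡ ±1 mod 8; involutions of G outside PSL would lie in xM, which restricts |G/T|. For q = 7, 9 the
-- subgroup M is not maximal (S₄ and A₅). Conversely, in the three cases such an x exists and a perfect code M would
-- yield an involution in xQ. All counting is classical: excluded middle for small types follows from maximality of M,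
-- applied to the subgroup {x ∈ G | x ∈ M or P}.
module Submission where

-- Commuting elements of PGL₂(q) have matrices that commute or anticommute, and in odd
-- characteristic anticommuting makes both of them involutions. Commuting as matrices is transitive
-- through nontrivial elements, so it is the relation to work with: for it the centralizer A of w in
-- M ∩ T meets its other conjugates trivially. The elements of M ∩ T outside the nontrivial parts of
-- the conjugates of A number n = |M ∩ T : A|, exactly as many as the conjugates of w. Products of
-- two such conjugates all lie in this set, so multiplication by one of them is a bijection onto it;
-- w inverts the whole set, hence its elements commute with each other. A product b = wu with u ≠ w
-- spans the torus, and maximality turns inclusion of M in the normalizer of this torus into
-- equality. The two dihedral orders come from one condition: the traceless matrix J spanning the
-- torus has nonsquare determinant. The torus is split exactly when -det J is a square, that is,
-- when -1 is a nonsquare, which separates q - 1 from q + 1.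

module GroupSolver where

 open import Level using (0ℓ)
 open import Algebra.Bundles using (Group)
 import Algebra.Properties.Group as GroupProperties
 open import Data.Nat using (ℕ)
 open import Data.Bool using (Bool; true; false; not)
 open import Data.Fin using (Fin)
 import Data.Fin.Properties as Fin
 open import Data.List using (List; []; _∷_)
 open import Data.Product using (_×_; _,_)
 open import Data.Vec using (Vec; lookup)
 open import Relation.Nullary using (yes; no)
 import Data.Bool.Properties as Bool
 open import Relation.Binary.PropositionalEquality using (refl)
 import Relation.Binary.Reflection as Reflection

 module Solver (G : Group 0ℓ 0ℓ) where
  open Group G using (Carrier; _≈_; setoid; _⁻¹; assoc; identityˡ; identityʳ; inverseˡ; inverseʳ; ∙-cong; ∙-congˡ; ∙-congʳ; ⁻¹-cong)
   renaming (_∙_ to _·_; ε to e; refl to ≈-refl; sym to ≈-sym; trans to ≈-trans)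
  open GroupProperties G using (⁻¹-anti-homo-∙; ⁻¹-involutive; ε⁻¹≈ε)

  data Expr (n : ℕ) : Set where
   var : Fin n → Expr n
   :ε : Expr n
   _:∙_ : Expr n → Expr n → Expr n
   _:⁻ : Expr n → Expr n

  infixl 7 _:∙_
  infix 8 _:⁻

  Env : ℕ → Set
  Env n = Vec Carrier n

  ⟦_⟧ : ∀ {n} → Expr n → Env n → Carrier
  ⟦ var i ⟧ ρ = lookup ρ i
  ⟦ :ε ⟧ ρ = e
  ⟦ x :∙ y ⟧ ρ = ⟦ x ⟧ ρ · ⟦ y ⟧ ρ
  ⟦ x :⁻ ⟧ ρ = ⟦ x ⟧ ρ ⁻¹

  Letter : ℕ → Set
  Letter n = Fin n × Bool

  letter : ∀ {n} → Env n → Letter n → Carrier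
  letter ρ (i , true) = lookup ρ i
  letter ρ (i , false) = lookup ρ i ⁻¹

  word : ∀ {n} → Env n → List (Letter n) → Carrier
  word ρ [] = e
  word ρ (l ∷ w) = letter ρ l · word ρ w

  -- A letter that meets its inverse at the head of the word cancels with it, so a reduced word
  -- stays reduced.
  push : ∀ {n} → Letter n → List (Letter n) → List (Letter n)
  push l [] = l ∷ []
  push (i , b) ((j , c) ∷ w) with i Fin.≟ j | b Bool.≟ not c
  ... | yes _ | yes _ = w
  ... | _ | _ = (i , b) ∷ (j , c) ∷ w

  -- The Boolean is the sign with which the expression is read; the word is an accumulator on the right.
  reduce : ∀ {n} → Bool → Expr n → List (Letter n) → List (Letter n)
  reduce b (var i) w = push (i , b) w
  reduce b :ε w = w
  reduce true (x :∙ y) w = reduce true x (reduce true y w)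
  reduce false (x :∙ y) w = reduce false y (reduce false x w)
  reduce b (x :⁻) w = reduce (not b) x w

  sign : Bool → Carrier → Carrier
  sign true x = x
  sign false x = x ⁻¹

  cancel : ∀ {n} (ρ : Env n) i c → letter ρ (i , not c) · letter ρ (i , c) ≈ e
  cancel ρ i true = inverseˡ _
  cancel ρ i false = inverseʳ _

  push-correct : ∀ {n} (ρ : Env n) l w → word ρ (push l w) ≈ letter ρ l · word ρ w
  push-correct ρ l [] = ≈-refl
  push-correct ρ (i , b) ((j , c) ∷ w) with i Fin.≟ j | b Bool.≟ not c
  ... | yes refl | yes refl = ≈-sym (≈-trans (≈-sym (assoc _ _ _)) (≈-trans (∙-congʳ (cancel ρ i c)) (identityˡ _)))
  ... | yes _ | no _ = ≈-refl
  ... | no _ | yes _ = ≈-refl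
  ... | no _ | no _ = ≈-refl

  letter-sign : ∀ {n} (ρ : Env n) b i → letter ρ (i , b) ≈ sign b (lookup ρ i)
  letter-sign ρ true i = ≈-refl
  letter-sign ρ false i = ≈-refl

  sign-not : ∀ b x → sign b (x ⁻¹) ≈ sign (not b) x
  sign-not true x = ≈-refl
  sign-not false x = ⁻¹-involutive x

  reduce-correct : ∀ {n} (ρ : Env n) b x w → word ρ (reduce b x w) ≈ sign b (⟦ x ⟧ ρ) · word ρ w
  reduce-correct ρ b (var i) w = ≈-trans (push-correct ρ (i , b) w) (∙-congʳ (letter-sign ρ b i))
  reduce-correct ρ true :ε w = ≈-sym (identityˡ _)
  reduce-correct ρ false :ε w = ≈-sym (≈-trans (∙-congʳ ε⁻¹≈ε) (identityˡ _))
  reduce-correct ρ true (x :∙ y) w = ≈-trans (reduce-correct ρ true x _)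
   (≈-trans (∙-congˡ (reduce-correct ρ true y w)) (≈-sym (assoc _ _ _)))
  reduce-correct ρ false (x :∙ y) w = ≈-trans (reduce-correct ρ false y _)
   (≈-trans (∙-congˡ (reduce-correct ρ false x w))
    (≈-trans (≈-sym (assoc _ _ _)) (∙-congʳ (≈-sym (⁻¹-anti-homo-∙ _ _)))))
  reduce-correct ρ b (x :⁻) w = ≈-trans (reduce-correct ρ (not b) x w) (∙-congʳ (≈-sym (sign-not b _)))

  ⟦_⇓⟧ : ∀ {n} → Expr n → Env n → Carrier
  ⟦ x ⇓⟧ ρ = word ρ (reduce true x [])

  correct : ∀ {n} (x : Expr n) (ρ : Env n) → ⟦ x ⇓⟧ ρ ≈ ⟦ x ⟧ ρ
  correct x ρ = ≈-trans (reduce-correct ρ true x []) (identityʳ _)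

  open Reflection setoid var ⟦_⟧ ⟦_⇓⟧ correct public using (solve; _⊜_)

-- Polynomial identities with integer coefficients in a commutative ring.

module IntSolver where

 open import Level using (0ℓ)
 open import Algebra.Bundles using (CommutativeRing)
 open import Data.Nat as ℕ using (ℕ; zero; suc)
 open import Data.Integer as ℤ using (ℤ; +_; -[1+_]; _⊖_)
 import Data.Integer.Properties as ℤ
 import Data.Sign as Sign
 open import Data.Maybe using (Maybe; just; nothing)
 open import Relation.Nullary using (yes; no)
 open import Relation.Binary.PropositionalEquality as ≡ using (_≡_)
 open import Algebra.Solver.Ring.AlmostCommutativeRing using (fromCommutativeRing; _-Raw-AlmostCommutative⟶_; AlmostCommutativeRing)
 import Algebra.Properties.Ring as RingProperties
 import Algebra.Properties.AbelianGroup as AbelianGroupProperties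
 import Algebra.Properties.Semiring.Mult.TCOptimised as Mult
 import Algebra.Solver.Ring as Solver

 module IntegerSolver (R : CommutativeRing 0ℓ 0ℓ) where
  open CommutativeRing R
  open RingProperties ring using (-‿distribˡ-*; -‿distribʳ-*; -‿involutive; -0#≈0#)
  open AbelianGroupProperties +-abelianGroup using (⁻¹-∙-comm)
  open Mult semiring public using (_×_; ×1-homo-*; ×-homo-+; 1+×)
  open import Relation.Binary.Reasoning.Setoid setoid

  -- Integer coefficients have decidable equality, which the carrier need not have, and numerals
  -- such as 1 + 1 get normalised. With this form of the multiple, `⟦ + 1 ⟧` is `1#` by computation.
  ⟦_⟧ : ℤ → Carrier
  ⟦ + n ⟧ = n × 1#
  ⟦ -[1+ n ] ⟧ = - (suc n × 1#)

  cancel-1 : ∀ a b → a - b ≈ (1# + a) - (1# + b)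
  cancel-1 a b = begin
   a - b                       ≈⟨ +-identityˡ (a - b) ⟨
   0# + (a - b)                ≈⟨ +-congʳ (-‿inverseʳ 1#) ⟨
   (1# - 1#) + (a - b)         ≈⟨ +-assoc 1# (- 1#) (a - b) ⟩
   1# + (- 1# + (a - b))       ≈⟨ +-congˡ (+-assoc (- 1#) a (- b)) ⟨
   1# + (- 1# + a - b)         ≈⟨ +-congˡ (+-congʳ (+-comm (- 1#) a)) ⟩
   1# + (a - 1# - b)           ≈⟨ +-congˡ (+-assoc a (- 1#) (- b)) ⟩
   1# + (a + (- 1# - b))       ≈⟨ +-assoc 1# a (- 1# - b) ⟨
   (1# + a) + (- 1# - b)       ≈⟨ +-congˡ (⁻¹-∙-comm 1# b) ⟩
   (1# + a) - (1# + b)         ∎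

  ⟦⊖⟧ : ∀ m n → ⟦ m ⊖ n ⟧ ≈ m × 1# - n × 1#
  ⟦⊖⟧ m zero = sym (trans (+-congˡ -0#≈0#) (+-identityʳ _))
  ⟦⊖⟧ zero (suc n) = sym (+-identityˡ _)
  ⟦⊖⟧ (suc m) (suc n) = trans (reflexive (≡.cong ⟦_⟧ (ℤ.[1+m]⊖[1+n]≡m⊖n m n))) (trans (⟦⊖⟧ m n) (trans (cancel-1 _ _) (sym (+-cong (1+× m 1#) (-‿cong (1+× n 1#))))))

  ⟦-⟧ : ∀ i → ⟦ ℤ.- i ⟧ ≈ - ⟦ i ⟧
  ⟦-⟧ (+ zero) = sym -0#≈0#
  ⟦-⟧ (+ suc n) = refl
  ⟦-⟧ -[1+ n ] = sym (-‿involutive _)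

  ⟦+⟧ : ∀ i j → ⟦ i ℤ.+ j ⟧ ≈ ⟦ i ⟧ + ⟦ j ⟧
  ⟦+⟧ (+ m) (+ n) = ×-homo-+ 1# m n
  ⟦+⟧ (+ m) -[1+ n ] = ⟦⊖⟧ m (suc n)
  ⟦+⟧ -[1+ m ] (+ n) = trans (⟦⊖⟧ n (suc m)) (+-comm _ _)
  ⟦+⟧ -[1+ m ] -[1+ n ] = trans (-‿cong (trans (reflexive (≡.cong (λ k → suc k × 1#) (≡.sym (ℕ-suc m n)))) (×-homo-+ 1# (suc m) (suc n)))) (sym (⁻¹-∙-comm _ _))
   where
   open import Data.Nat.Properties using (+-suc)
   ℕ-suc : ∀ m n → m ℕ.+ suc n ≡ suc (m ℕ.+ n)
   ℕ-suc = +-suc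

  ⟦+◃⟧ : ∀ n → ⟦ Sign.+ ℤ.◃ n ⟧ ≈ n × 1#
  ⟦+◃⟧ n = reflexive (≡.cong ⟦_⟧ (ℤ.+◃n≡+n n))

  ⟦-◃⟧ : ∀ n → ⟦ Sign.- ℤ.◃ n ⟧ ≈ - (n × 1#)
  ⟦-◃⟧ n = trans (reflexive (≡.cong ⟦_⟧ (ℤ.-◃n≡-n n))) (⟦-⟧ (+ n))

  ⟦*⟧ : ∀ i j → ⟦ i ℤ.* j ⟧ ≈ ⟦ i ⟧ * ⟦ j ⟧
  ⟦*⟧ (+ m) (+ n) = trans (⟦+◃⟧ (m ℕ.* n)) (×1-homo-* m n)
  ⟦*⟧ (+ m) -[1+ n ] = trans (⟦-◃⟧ (m ℕ.* suc n)) (trans (-‿cong (×1-homo-* m (suc n))) (-‿distribʳ-* _ _))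
  ⟦*⟧ -[1+ m ] (+ n) = trans (⟦-◃⟧ (suc m ℕ.* n)) (trans (-‿cong (×1-homo-* (suc m) n)) (-‿distribˡ-* _ _))
  ⟦*⟧ -[1+ m ] -[1+ n ] = trans (⟦+◃⟧ (suc m ℕ.* suc n)) (trans (×1-homo-* (suc m) (suc n))
   (trans (sym (-‿involutive _)) (trans (-‿cong (-‿distribˡ-* _ _)) (-‿distribʳ-* _ _))))

  almostCommutativeRing : AlmostCommutativeRing 0ℓ 0ℓ
  almostCommutativeRing = fromCommutativeRing R

  morphism : ℤ.+-*-rawRing -Raw-AlmostCommutative⟶ almostCommutativeRing
  morphism = record { ⟦_⟧ = ⟦_⟧ ; +-homo = ⟦+⟧ ; *-homo = ⟦*⟧ ; -‿homo = ⟦-⟧ ; 0-homo = refl ; 1-homo = refl }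

  coefficient-≟ : ∀ i j → Maybe (⟦ i ⟧ ≈ ⟦ j ⟧)
  coefficient-≟ i j with i ℤ.≟ j
  ... | yes ≡.refl = just refl
  ... | no _ = nothing

  open Solver ℤ.+-*-rawRing almostCommutativeRing morphism coefficient-≟ public using (solve; _:=_; _:+_; _:*_; :-_; _:-_; con; Polynomial)

  :0 :1 : ∀ {n} → Polynomial n
  :0 = con (+ 0)
  :1 = con (+ 1)

-- The Frobenius map in characteristic p.

module Characteristic where

 open import Level using (0ℓ)
 open import Algebra.Bundles using (CommutativeRing)
 open import Data.Nat as ℕ using (ℕ; zero; suc; _<_; z≤n; s≤s; _∸_; _!)
 import Data.Nat.Properties as ℕ
 open import Data.Nat.Combinatorics using (_C_; nCn≡1; nCk≡n!/k![n-k]!; k![n∸k]!∣n!)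
 open import Data.Nat.Divisibility using (_∣_; divides; ∣⇒≤; m∣m*n)
 open import Data.Nat.DivMod using (m/n*n≡m)
 open import Data.Nat.Primality using (Prime; euclidsLemma; prime⇒nonTrivial; ¬prime[1])
 open import Data.Fin as Fin using (Fin; zero; suc; toℕ; fromℕ; inject₁)
 import Data.Fin.Properties as Fin
 open import Data.Sum using (inj₁; inj₂)
 open import Data.Empty using (⊥-elim)
 open import Relation.Nullary using (¬_)
 import Relation.Binary.PropositionalEquality as ≡
 open ≡ using (_≡_)
 import Algebra.Properties.CommutativeSemiring.Binomial as Binomial
 import Algebra.Properties.Semiring.Mult as Mult
 import Algebra.Properties.Semiring.Exp as Exp
 import Algebra.Properties.Monoid.Sum as Sum

 prime∤factorial : ∀ {p} → Prime p → ∀ k → k < p → ¬ (p ∣ k !)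
 prime∤factorial pr zero k<p d = ¬prime[1] (≡.subst Prime (ℕ.≤-antisym (∣⇒≤ d) k<p) pr)
 prime∤factorial pr (suc k) k<p d with euclidsLemma (suc k) (k !) pr d
 ... | inj₁ e = ℕ.<⇒≱ k<p (∣⇒≤ e)
 ... | inj₂ e = prime∤factorial pr k (ℕ.<-trans (ℕ.n<1+n k) k<p) e

 -- p divides p!, which is the product of this binomial coefficient and the factorials of two
 -- numbers below p.
 prime∣binomial : ∀ {p} → Prime p → ∀ k → 0 < k → k < p → p ∣ p C k
 prime∣binomial {p} pr k 0<k k<p with euclidsLemma (p C k) (k ! ℕ.* (p ∸ k) !) pr (≡.subst (p ∣_) (≡.sym eq) p∣p!)
  where
  instance
   nz = ℕ._!*_!≢0 k (p ∸ k)
  eq : (p C k) ℕ.* (k ! ℕ.* (p ∸ k) !) ≡ p !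
  eq = ≡.trans (≡.cong (ℕ._* (k ! ℕ.* (p ∸ k) !)) (nCk≡n!/k![n-k]! (ℕ.<⇒≤ k<p))) (m/n*n≡m (k![n∸k]!∣n! (ℕ.<⇒≤ k<p)))
  p∣p! : p ∣ p !
  p∣p! = p∣p!′ p (ℕ.<-trans 0<k k<p)
   where
   p∣p!′ : ∀ p → 0 < p → p ∣ p !
   p∣p!′ (suc p) _ = m∣m*n (p !)
 ... | inj₁ d = d
 ... | inj₂ d with euclidsLemma (k !) ((p ∸ k) !) pr d
 ...   | inj₁ e = ⊥-elim (prime∤factorial pr k k<p e)
 ...   | inj₂ e = ⊥-elim (prime∤factorial pr (p ∸ k) (ℕ.∸-monoʳ-< 0<k (ℕ.<⇒≤ k<p)) e)

 module FrobeniusPower (R : CommutativeRing 0ℓ 0ℓ) where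
  open CommutativeRing R hiding (zero)
  open Mult semiring using (_×_; ×-assoc-*; ×-assocˡ; ×-congʳ)
  open Exp semiring using (_^_; ^-congˡ; ^-assocʳ)
  open Sum +-monoid using (sum; sum-cong-≋; sum-init-last; sum-replicate-zero)
  open import Relation.Binary.Reasoning.Setoid setoid

  module _ {p} (pr : Prime p) (char : p × 1# ≈ 0#) where

   multiple-zero : ∀ {n} → p ∣ n → ∀ z → n × z ≈ 0#
   multiple-zero {n} (divides k ≡.refl) z = begin
    (k ℕ.* p) × z        ≈⟨ ×-assocˡ z k p ⟨
    k × (p × z)          ≈⟨ ×-congʳ k (begin
     p × z                ≈⟨ ×-congʳ p (*-identityˡ z) ⟨
     p × (1# * z)         ≈⟨ ×-assoc-* p 1# z ⟨
     (p × 1#) * z         ≈⟨ *-congʳ char ⟩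
     0# * z               ≈⟨ zeroˡ z ⟩
     0#                   ∎) ⟩
    k × 0#               ≈⟨ k×0 k ⟩
    0#                   ∎
    where
    k×0 : ∀ k → k × 0# ≈ 0#
    k×0 zero = refl
    k×0 (suc k) = trans (+-identityˡ _) (k×0 k)

   -- The inner binomial coefficients are multiples of p, so only the first and the last term of the
   -- expansion remain.
   frobenius-+ : ∀ x y → (x + y) ^ p ≈ x ^ p + y ^ p
   frobenius-+ x y = go p ≡.refl
    where
    open Binomial commutativeSemiring using (theorem; binomialTerm; binomialExpansion)
    go : ∀ n → n ≡ p → (x + y) ^ n ≈ x ^ n + y ^ n
    go zero ≡.refl = ⊥-elim (ℕ.<⇒≱ (ℕ.nonTrivial⇒n>1 0 {{prime⇒nonTrivial pr}}) z≤n)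
    go (suc n) ≡.refl = begin
     (x + y) ^ suc n                          ≈⟨ theorem (suc n) x y ⟩
     term zero + sum (λ i → term (suc i))     ≈⟨ +-congˡ (sum-init-last (λ i → term (suc i))) ⟩
     term zero + (sum (λ i → term (suc (inject₁ i))) + term (suc (fromℕ n)))
      ≈⟨ +-cong first (+-cong middle last) ⟩
     y ^ suc n + (0# + x ^ suc n)             ≈⟨ +-congˡ (+-identityˡ _) ⟩
     y ^ suc n + x ^ suc n                    ≈⟨ +-comm _ _ ⟩
     x ^ suc n + y ^ suc n                    ∎
     where
     term : Fin (suc (suc n)) → Carrier
     term = binomialTerm x y (suc n)
     first : term zero ≈ y ^ suc n
     first = trans (+-identityʳ _) (*-identityˡ _)
     last : term (suc (fromℕ n)) ≈ x ^ suc n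
     last = begin
      (suc n C suc (toℕ (fromℕ n))) × (x ^ suc (toℕ (fromℕ n)) * y ^ (n ∸ toℕ (fromℕ n)))
       ≡⟨ ≡.cong (λ k → (suc n C suc k) × (x ^ suc k * y ^ (n ∸ k))) (Fin.toℕ-fromℕ n) ⟩
      (suc n C suc n) × (x ^ suc n * y ^ (n ∸ n))
       ≡⟨ ≡.cong₂ (λ c k → c × (x ^ suc n * y ^ k)) (nCn≡1 (suc n)) (ℕ.n∸n≡0 n) ⟩
      1 × (x ^ suc n * 1#)   ≈⟨ +-identityʳ _ ⟩
      x ^ suc n * 1#         ≈⟨ *-identityʳ _ ⟩
      x ^ suc n              ∎
     middle : sum (λ i → term (suc (inject₁ i))) ≈ 0#
     middle = trans (sum-cong-≋ (λ i → multiple-zero (≡.subst (λ k → suc n ∣ suc n C suc k) (≡.sym (Fin.toℕ-inject₁ i))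
      (prime∣binomial pr (suc (toℕ i)) (s≤s z≤n) (s≤s (Fin.toℕ<n i)))) _)) (sum-replicate-zero n)

   frobenius-power : ∀ e x y → (x + y) ^ (p ℕ.^ e) ≈ x ^ (p ℕ.^ e) + y ^ (p ℕ.^ e)
   frobenius-power zero x y = trans (*-identityʳ _) (sym (+-cong (*-identityʳ x) (*-identityʳ y)))
   frobenius-power (suc e) x y = begin
    (x + y) ^ (p ℕ.* p ℕ.^ e)                       ≈⟨ ^-assocʳ (x + y) p (p ℕ.^ e) ⟨
    ((x + y) ^ p) ^ (p ℕ.^ e)                       ≈⟨ ^-congˡ (p ℕ.^ e) (frobenius-+ x y) ⟩
    (x ^ p + y ^ p) ^ (p ℕ.^ e)                     ≈⟨ frobenius-power e (x ^ p) (y ^ p) ⟩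
    (x ^ p) ^ (p ℕ.^ e) + (y ^ p) ^ (p ℕ.^ e)       ≈⟨ +-cong (^-assocʳ x p (p ℕ.^ e)) (^-assocʳ y p (p ℕ.^ e)) ⟩
    x ^ (p ℕ.* p ℕ.^ e) + y ^ (p ℕ.* p ℕ.^ e)       ∎

open import Defs
open import Data.Product using (Σ; ∃; _×_; _,_; proj₁; proj₂)
open import Data.Sum as Sum using (_⊎_; inj₁; inj₂; [_,_]′)
open import Data.Empty using (⊥; ⊥-elim)
open import Data.Unit using (⊤; tt)
open import Level using (0ℓ)
open import Function using (_∘_; id)
open import Relation.Nullary using (¬_; Dec; yes; no)
open import Relation.Binary.PropositionalEquality using (_≡_; _≢_; refl; sym; trans; cong; cong₂; subst; subst₂; isEquivalence; module ≡-Reasoning)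
open import Algebra.Bundles using (CommutativeRing)
open import Algebra.Structures using (IsGroup)
import Data.Fin.Properties as Fin
import Data.List.Relation.Unary.Any.Properties as Any

-- Parity of natural numbers.

module Parity where

 open import Data.Nat using (ℕ; zero; suc; _+_; _*_)
 open import Data.Nat.Properties
 open import Data.Nat.DivMod using (_%_; [m+kn]%n≡m%n; m≡m%n+[m/n]*n; _/_)
 open import Data.Nat.Tactic.RingSolver using (solve-∀)

 Even Odd : ℕ → Set
 Even n = ∃ λ k → n ≡ k + k
 Odd n = ∃ λ k → n ≡ suc (k + k)

 even⊎odd : ∀ n → Even n ⊎ Odd n
 even⊎odd zero = inj₁ (0 , refl)
 even⊎odd (suc n) with even⊎odd n
 ... | inj₁ (k , refl) = inj₂ (k , refl)
 ... | inj₂ (k , refl) = inj₁ (suc k , cong suc (sym (+-suc k k)))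

 suc-even : ∀ {n} → Even n → Odd (suc n)
 suc-even (k , refl) = k , refl

 even-odd-⊥ : ∀ {n} → Even n → Odd n → ⊥
 even-odd-⊥ (zero , refl) (l , ())
 even-odd-⊥ (suc k , refl) (zero , eq) with () ← trans (sym (+-suc k k)) (suc-injective eq)
 even-odd-⊥ (suc k , refl) (suc l , eq) = even-odd-⊥ (k , refl)
  (l , suc-injective (trans (sym (+-suc k k)) (trans (suc-injective eq) (cong suc (+-suc l l)))))

 ¬even⇒odd : ∀ {n} → ¬ Even n → Odd n
 ¬even⇒odd {n} ne with even⊎odd n
 ... | inj₁ e = ⊥-elim (ne e)
 ... | inj₂ o = o

 even+even : ∀ {m n} → Even m → Even n → Even (m + n)
 even+even (k , refl) (l , refl) = k + l , eq k l
  where eq : ∀ k l → k + k + (l + l) ≡ k + l + (k + l)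
        eq = solve-∀

 odd+odd : ∀ {m n} → Odd m → Odd n → Even (m + n)
 odd+odd (k , refl) (l , refl) = suc (k + l) , eq k l
  where eq : ∀ k l → suc (k + k) + suc (l + l) ≡ suc (k + l) + suc (k + l)
        eq = solve-∀

 even+odd : ∀ {m n} → Even m → Odd n → Odd (m + n)
 even+odd (k , refl) (l , refl) = k + l , eq k l
  where eq : ∀ k l → k + k + suc (l + l) ≡ suc (k + l + (k + l))
        eq = solve-∀

 even*ˡ : ∀ {m} n → Even m → Even (m * n)
 even*ˡ n (k , refl) = k * n , *-distribʳ-+ n k k

 even*ʳ : ∀ m {n} → Even n → Even (m * n)
 even*ʳ m (k , refl) = m * k , *-distribˡ-+ m k k

 odd*odd : ∀ {m n} → Odd m → Odd n → Odd (m * n)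
 odd*odd (k , refl) (l , refl) = k + l + (k * l + k * l) , eq k l
  where eq : ∀ k l → suc (k + k) * suc (l + l) ≡ suc (k + l + (k * l + k * l) + (k + l + (k * l + k * l)))
        eq = solve-∀

 odd-*ˡ : ∀ m n → Odd (m * n) → Odd m
 odd-*ˡ m n o = ¬even⇒odd λ e → even-odd-⊥ (even*ˡ n e) o

 odd-*ʳ : ∀ m n → Odd (m * n) → Odd n
 odd-*ʳ m n o = ¬even⇒odd λ e → even-odd-⊥ (even*ʳ m e) o

 double-injective : ∀ {k l} → k + k ≡ l + l → k ≡ l
 double-injective {k} {l} eq = *-cancelˡ-≡ k l 2 (trans (two k) (trans eq (sym (two l))))
  where two : ∀ k → 2 * k ≡ k + k
        two k = cong (k +_) (+-identityʳ k)

 %2≡1⇒odd : ∀ n → n % 2 ≡ 1 → Odd n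
 %2≡1⇒odd n eq = n / 2 , trans (m≡m%n+[m/n]*n n 2) (trans (cong₂ _+_ eq refl) (cong suc (double (n / 2))))
  where double : ∀ k → k * 2 ≡ k + k
        double = solve-∀

 odd⇒%2≡1 : ∀ {n} → Odd n → n % 2 ≡ 1
 odd⇒%2≡1 (k , refl) = trans (cong (_% 2) (double k)) ([m+kn]%n≡m%n 1 k 2)
  where double : ∀ k → suc (k + k) ≡ 1 + k * 2
        double = solve-∀

-- Counting in finite sets, and fixed points of involutions modulo two.

module Counting where

 open import Data.Nat using (ℕ; zero; suc; _+_; _*_; _≤_; _<_; z≤n; s≤s)
 open import Data.Nat.Properties
 open import Data.Fin using (Fin; zero; suc; toℕ)
 open import Relation.Binary using (tri<; tri≈; tri>)
 open Parity

 module Classical (em : (P : Set) → Dec P) where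

  dne : {P : Set} → ¬ ¬ P → P
  dne {P} h with em P
  ... | yes p = p
  ... | no ¬p = ⊥-elim (h ¬p)

  bit : {P : Set} → Dec P → ℕ
  bit (yes _) = 1
  bit (no _) = 0

  opaque
   # : ∀ {n} → (Fin n → Set) → ℕ
   # {zero} P = 0
   # {suc n} P = bit (em (P zero)) + # (P ∘ suc)

  bit-mono : ∀ {P Q : Set} → (P → Q) → (d : Dec P) (d′ : Dec Q) → bit d ≤ bit d′
  bit-mono f (no _) _ = z≤n
  bit-mono f (yes p) (yes _) = s≤s z≤n
  bit-mono f (yes p) (no ¬q) = ⊥-elim (¬q (f p))

  bit-yes : ∀ {P : Set} → P → (d : Dec P) → bit d ≡ 1
  bit-yes p (yes _) = refl
  bit-yes p (no ¬p) = ⊥-elim (¬p p)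

  bit-no : ∀ {P : Set} → ¬ P → (d : Dec P) → bit d ≡ 0
  bit-no ¬p (yes p) = ⊥-elim (¬p p)
  bit-no ¬p (no _) = refl

  opaque
   unfolding #

   #-mono : ∀ {n} {P Q : Fin n → Set} → (∀ i → P i → Q i) → # P ≤ # Q
   #-mono {zero} f = z≤n
   #-mono {suc n} f = +-mono-≤ (bit-mono (f zero) _ _) (#-mono (f ∘ suc))

  #-cong : ∀ {n} {P Q : Fin n → Set} → (∀ i → P i → Q i) → (∀ i → Q i → P i) → # P ≡ # Q
  #-cong f g = ≤-antisym (#-mono f) (#-mono g)

  opaque
   unfolding #

   #-none : ∀ {n} {P : Fin n → Set} → (∀ i → ¬ P i) → # P ≡ 0
   #-none {zero} f = refl
   #-none {suc n} f = cong₂ _+_ (bit-no (f zero) (em _)) (#-none (f ∘ suc))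

  opaque
   unfolding #

   #-all : ∀ {n} {P : Fin n → Set} → (∀ i → P i) → # P ≡ n
   #-all {zero} f = refl
   #-all {suc n} f = cong₂ _+_ (bit-yes (f zero) (em _)) (#-all (f ∘ suc))

  opaque
   unfolding #

   #-disjoint : ∀ {n} {P Q R : Fin n → Set} → (∀ i → R i → P i ⊎ Q i) → (∀ i → P i → R i) →
    (∀ i → Q i → R i) → (∀ i → P i → Q i → ⊥) → # R ≡ # P + # Q
   #-disjoint {zero} c p q d = refl
   #-disjoint {suc n} {P} {Q} {R} c p q d = trans
    (cong₂ _+_ (head (c zero) (p zero) (q zero) (d zero) (em _) (em _) (em _))
     (#-disjoint (c ∘ suc) (p ∘ suc) (q ∘ suc) (d ∘ suc)))
    (interchange (bit (em (P zero))) _ _ _)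
    where
    head : ∀ {A B C : Set} → (C → A ⊎ B) → (A → C) → (B → C) → (A → B → ⊥) →
     (a : Dec A) (b : Dec B) (c : Dec C) → bit c ≡ bit a + bit b
    head c p q d (yes a) (yes b) _ = ⊥-elim (d a b)
    head c p q d (yes a) (no _) e = bit-yes (p a) e
    head c p q d (no _) (yes b) e = bit-yes (q b) e
    head c p q d (no ¬a) (no ¬b) e = bit-no (λ r → [ ¬a , ¬b ]′ (c r)) e
    interchange : ∀ a b c d → a + b + (c + d) ≡ a + c + (b + d)
    interchange = solve-∀
     where open import Data.Nat.Tactic.RingSolver using (solve-∀)

  #-split : ∀ {n} {P : Fin n → Set} (R : Fin n → Set) →
   # P ≡ # (λ i → P i × R i) + # (λ i → P i × ¬ R i)
  #-split {P = P} R = #-disjoint cover (λ _ → proj₁) (λ _ → proj₁) (λ i p q → proj₂ q (proj₂ p))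
   where
   cover : ∀ i → P i → (P i × R i) ⊎ (P i × ¬ R i)
   cover i p with em (R i)
   ... | yes r = inj₁ (p , r)
   ... | no ¬r = inj₂ (p , ¬r)

  opaque
   unfolding #

   #-singleton : ∀ {n} {P : Fin n → Set} (i : Fin n) → P i → (∀ j → P j → j ≡ i) → # P ≡ 1
   #-singleton {suc n} zero p u =
    cong₂ _+_ (bit-yes p (em _)) (#-none λ j q → Fin.0≢1+n (sym (u (suc j) q)))
   #-singleton {suc n} (suc i) p u =
    cong₂ _+_ (bit-no (λ q → Fin.0≢1+n (u zero q)) (em _)) (#-singleton i p λ j q → Fin.suc-injective (u (suc j) q))

  #-remove : ∀ {n} {P : Fin n → Set} (i : Fin n) → P i → # P ≡ suc (# (λ j → P j × j ≢ i))
  #-remove {P = P} i p = trans (#-split (_≡ i))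
   (cong (_+ # (λ j → P j × j ≢ i)) (#-singleton i (p , refl) λ j → proj₂))

  #-pos : ∀ {n} {P : Fin n → Set} (i : Fin n) → P i → 0 < # P
  #-pos i p = subst (0 <_) (sym (#-remove i p)) (s≤s z≤n)

  opaque
   #-witness : ∀ {n} {P : Fin n → Set} → 0 < # P → ∃ P
   #-witness {P = P} h = dne λ none → <⇒≢ h (sym (#-none λ i p → none (i , p)))

  opaque
   unfolding #

   #-inj : ∀ {m n} {P : Fin m → Set} {Q : Fin n → Set} (f : ∀ i → P i → Fin n) →
    (∀ i p → Q (f i p)) → (∀ i p j q → f i p ≡ f j q → i ≡ j) → # P ≤ # Q
   #-inj {zero} f fq inj = z≤n
   #-inj {suc m} {n} {P} {Q} f fq inj with em (P zero)
   ... | no _ = #-inj (f ∘ suc) (fq ∘ suc) λ i p j q eq → Fin.suc-injective (inj _ p _ q eq)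
   ... | yes p₀ = subst (suc (# (P ∘ suc)) ≤_) (sym (#-remove (f zero p₀) (fq zero p₀)))
    (s≤s (#-inj (f ∘ suc) (λ i p → fq (suc i) p , λ eq → Fin.0≢1+n (sym (inj _ p _ p₀ eq)))
     λ i p j q eq → Fin.suc-injective (inj _ p _ q eq)))

  #-surj : ∀ {m n} {P : Fin m → Set} {Q : Fin n → Set} (f : ∀ i → P i → Fin n) →
   (∀ j → Q j → ∃ λ i → Σ (P i) λ p → f i p ≡ j) → (∀ i p p′ → f i p ≡ f i p′) → # Q ≤ # P
  #-surj f s irr = #-inj (λ j q → proj₁ (s j q)) (λ j q → proj₁ (proj₂ (s j q)))
   λ j q j′ q′ eq → trans (sym (proj₂ (proj₂ (s j q)))) (trans (move eq) (proj₂ (proj₂ (s j′ q′))))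
   where move : ∀ {i i′ p p′} → i ≡ i′ → f i p ≡ f i′ p′
         move refl = irr _ _ _

  #-bij : ∀ {m n} {P : Fin m → Set} {Q : Fin n → Set} (f : Fin m → Fin n) →
   (∀ i → P i → Q (f i)) → (∀ i j → P i → P j → f i ≡ f j → i ≡ j) →
   (∀ j → Q j → ∃ λ i → P i × f i ≡ j) → # P ≡ # Q
  #-bij f fq inj s = ≤-antisym (#-inj (λ i _ → f i) fq λ i p j q → inj i j p q)
   (#-surj (λ i _ → f i) s λ _ _ _ → refl)

  opaque
   -- A missed element could be deleted from the target, which would then be too small for the
   -- injection.
   inj⇒surj : ∀ {m n} {P : Fin m → Set} {Q : Fin n → Set} (f : Fin m → Fin n) →
    (∀ i → P i → Q (f i)) → (∀ i j → P i → P j → f i ≡ f j → i ≡ j) → # Q ≤ # P →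
    ∀ j → Q j → ∃ λ i → P i × f i ≡ j
   inj⇒surj {P = P} f fq inj le j qj = dne λ none → <⇒≱
    (≤-trans (s≤s (#-inj (λ i _ → f i) (λ i p → fq i p , λ eq → none (i , p , eq)) λ i p k q → inj i k p q))
     (≤-reflexive (sym (#-remove j qj)))) le

  #-fibres : ∀ {m n} {P : Fin m → Set} {R : Fin n → Set} (f : Fin m → Fin n) (k : ℕ) →
   (∀ i → P i → R (f i)) → (∀ r → R r → # (λ i → P i × f i ≡ r) ≡ k) → # P ≡ # R * k
  #-fibres f k = go _ f refl
   where
   -- Induction on the number of points in R: one point is removed together with its whole fibre.
   go : ∀ c {m n} {P : Fin m → Set} {R : Fin n → Set} (f : Fin m → Fin n) → # R ≡ c →
    (∀ i → P i → R (f i)) → (∀ r → R r → # (λ i → P i × f i ≡ r) ≡ k) → # P ≡ c * k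
   go zero f eq fr fib = #-none λ i p → <⇒≢ (#-pos (f i) (fr i p)) (sym eq)
   go (suc c) {P = P} {R} f eq fr fib =
    let (r , rr) = #-witness (subst (0 <_) (sym eq) (s≤s z≤n))
    in trans (#-split (λ i → f i ≡ r)) (cong₂ _+_ (fib r rr)
     (go c {R = λ j → R j × j ≢ r} f (suc-injective (trans (sym (#-remove r rr)) eq))
      (λ i p → fr i (proj₁ p) , proj₂ p)
      λ s rs → trans (#-cong (λ i x → proj₁ (proj₁ x) , proj₂ x)
       (λ i x → (proj₁ x , λ e → proj₂ rs (trans (sym (proj₂ x)) e)) , proj₂ x))
       (fib s (proj₁ rs))))

  #-involution : ∀ {n} {P : Fin n → Set} (f : Fin n → Fin n) → (∀ i → P i → P (f i)) →
   (∀ i → P i → f (f i) ≡ i) → ∃ λ k → # P ≡ (k + k) + # (λ i → P i × f i ≡ i)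
  #-involution {n} {P} f fp ff = k , trans (#-split (λ i → f i ≡ i))
   (trans (+-comm _ (# (λ i → P i × f i ≢ i))) (cong (_+ # (λ i → P i × f i ≡ i)) moved))
   where
   Lt Gt : Fin n → Set
   Lt i = P i × toℕ i < toℕ (f i)
   Gt i = P i × toℕ (f i) < toℕ i
   k = # Lt
   cover : ∀ i → P i × f i ≢ i → Lt i ⊎ Gt i
   cover i (p , ne) with <-cmp (toℕ i) (toℕ (f i))
   ... | tri< lt _ _ = inj₁ (p , lt)
   ... | tri≈ _ eq _ = ⊥-elim (ne (sym (Fin.toℕ-injective eq)))
   ... | tri> _ _ gt = inj₂ (p , gt)
   -- f exchanges the points that it moves up with those that it moves down, so the two kinds are
   -- equally many.
   moved : # (λ i → P i × f i ≢ i) ≡ k + k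
   moved = trans (#-disjoint cover
    (λ i x → proj₁ x , λ eq → <⇒≢ (proj₂ x) (cong toℕ (sym eq)))
    (λ i x → proj₁ x , λ eq → <⇒≢ (proj₂ x) (cong toℕ eq))
    (λ i x y → <-asym (proj₂ x) (proj₂ y)))
    (cong (k +_) (sym (#-bij f
     (λ i x → fp i (proj₁ x) , subst (_< toℕ (f i)) (cong toℕ (sym (ff i (proj₁ x)))) (proj₂ x))
     (λ i j x y eq → trans (sym (ff i (proj₁ x))) (trans (cong f eq) (ff j (proj₁ y))))
     λ j x → f j , (fp j (proj₁ x) , subst (toℕ (f j) <_) (cong toℕ (sym (ff j (proj₁ x)))) (proj₂ x)) , ff j (proj₁ x))))

  odd-fixed : ∀ {n} {P : Fin n → Set} (f : Fin n → Fin n) → (∀ i → P i → P (f i)) →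
   (∀ i → P i → f (f i) ≡ i) → Odd (# P) → Odd (# (λ i → P i × f i ≡ i))
  odd-fixed f fp ff o with k , eq ← #-involution f fp ff =
   ¬even⇒odd λ e → even-odd-⊥ (subst Even (sym eq) (even+even (k , refl) e)) o

  even-fixed : ∀ {n} {P : Fin n → Set} (f : Fin n → Fin n) → (∀ i → P i → P (f i)) →
   (∀ i → P i → f (f i) ≡ i) → Even (# P) → Even (# (λ i → P i × f i ≡ i))
  even-fixed f fp ff e with k , eq ← #-involution f fp ff with even⊎odd (# (λ i → _ × f i ≡ i))
  ... | inj₁ e′ = e′
  ... | inj₂ o = ⊥-elim (even-odd-⊥ e (subst Odd (sym eq) (even+odd (k , refl) o)))

  opaque
   odd-witness : ∀ {n} {P : Fin n → Set} → Odd (# P) → ∃ P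
   odd-witness (k , eq) = #-witness (subst (0 <_) (sym eq) (s≤s z≤n))

  opaque
   even-second : ∀ {n} {P : Fin n → Set} (i : Fin n) → P i → Even (# P) → ∃ λ j → P j × j ≢ i
   even-second i p e = odd-witness (¬even⇒odd λ e′ → even-odd-⊥ e (subst Odd (sym (#-remove i p)) (suc-even e′)))

  opaque
   least : ∀ {n} (P : Fin n → Set) → ∃ P → ∃ λ i → P i × (∀ j → P j → toℕ i ≤ toℕ j)
   least {suc n} P (i , p) with em (P zero)
   ... | yes p₀ = zero , p₀ , λ _ _ → z≤n
   least {suc n} P (zero , p) | no ¬p₀ = ⊥-elim (¬p₀ p)
   least {suc n} P (suc i , p) | no ¬p₀ with j , pj , min ← least (P ∘ suc) (i , p) =
    suc j , pj , λ { zero q → ⊥-elim (¬p₀ q) ; (suc k) q → s≤s (min k q) }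

  -- Logically equivalent predicates have the same least element even when they are different terms.
  -- This makes coset representatives canonical.
  least-cong : ∀ {n} {P Q : Fin n → Set} (x : ∃ P) (y : ∃ Q) → (∀ i → P i → Q i) → (∀ i → Q i → P i) →
   proj₁ (least P x) ≡ proj₁ (least Q y)
  least-cong {P = P} {Q} x y f g with least P x | least Q y
  ... | i , p , min | j , q , min′ = Fin.toℕ-injective (≤-antisym (min j (g j q)) (min′ i (f i p)))

-- Finite groups: cosets, 2-groups acting on cosets, Sylow 2-subgroups.

module Groups where

 open import Algebra.Bundles using (Group)
 import Algebra.Properties.Group as GroupProperties
 open import Data.Nat using (ℕ; zero; suc; _+_; _*_; _<_; NonZero; >-nonZero)
 open import Data.Nat.Properties
 open import Data.Fin using (Fin; zero; suc)
 open Parity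
 open Counting
 open GroupSolver

 module FiniteGroup (em : (P : Set) → Dec P) {N : ℕ} {_∙_ : Fin N → Fin N → Fin N} {ε : Fin N}
  {_⁻¹ : Fin N → Fin N} (isGroup : IsGroup _≡_ _∙_ ε _⁻¹) where

  open Classical em

  infixl 7 _·_
  infix 8 _⁻
  X : Set
  X = Fin N
  _·_ : X → X → X
  _·_ = _∙_
  _⁻ : X → X
  _⁻ = _⁻¹

  group : Group 0ℓ 0ℓ
  group = record { isGroup = isGroup }

  open Group group public using (assoc; identityˡ; identityʳ; inverseˡ; inverseʳ)
  open GroupProperties group public using (∙-cancelˡ; ∙-cancelʳ; ⁻¹-involutive; ⁻¹-injective; inverseˡ-unique)
  open Solver group public

  Pred : Set₁
  Pred = X → Set

  _⊆_ : Pred → Pred → Set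
  P ⊆ Q = ∀ x → P x → Q x

  record Subgroup (P : Pred) : Set where
   field
    unit : P ε
    mul : ∀ {x y} → P x → P y → P (x · y)
    inv : ∀ {x} → P x → P (x ⁻)
  open Subgroup public

  move : (P : Pred) → ∀ {x y} → x ≡ y → P x → P y
  move P refl p = p

  conj : X → X → X
  conj g x = g ⁻ · x · g

  Normalizes : X → Pred → Set
  Normalizes g P = ∀ x → P x → P (conj g x)

  SameCoset : Pred → X → X → Set
  SameCoset P g h = P (g ⁻ · h)

  ∩-subgroup : ∀ {P Q} → Subgroup P → Subgroup Q → Subgroup (λ x → P x × Q x)
  ∩-subgroup p q = record
   { unit = unit p , unit q
   ; mul = λ x y → mul p (proj₁ x) (proj₁ y) , mul q (proj₂ x) (proj₂ y)
   ; inv = λ x → inv p (proj₁ x) , inv q (proj₂ x) }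

  conj-injective : ∀ g x y → conj g x ≡ conj g y → x ≡ y
  conj-injective g x y eq = ∙-cancelˡ (g ⁻) _ _ (∙-cancelʳ g _ _ eq)

  conj-mul : ∀ g x y → conj g x · conj g y ≡ conj g (x · y)
  conj-mul = solve 3 (λ g x y → g :⁻ :∙ x :∙ g :∙ (g :⁻ :∙ y :∙ g) ⊜ g :⁻ :∙ (x :∙ y) :∙ g) refl

  conj-square-one : ∀ g x → x · x ≡ ε → conj g x · conj g x ≡ ε
  conj-square-one g x eq = trans (conj-mul g x x) (trans (cong (conj g) eq) (solve 1 (λ g → g :⁻ :∙ :ε :∙ g ⊜ :ε) refl g))

  invol-inv : ∀ {s} → s · s ≡ ε → s ⁻ ≡ s
  invol-inv {s} e = sym (inverseˡ-unique s s e)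

  involution-commutes : ∀ {a b} → a · a ≡ ε → b · b ≡ ε → (a · b) · (a · b) ≡ ε → a · b ≡ b · a
  involution-commutes {a} {b} ea eb e = trans (sym (invol-inv e))
   (trans (solve 2 (λ a b → (a :∙ b) :⁻ ⊜ b :⁻ :∙ a :⁻) refl a b) (cong₂ _·_ (invol-inv eb) (invol-inv ea)))

  commute-conj : ∀ {a g} → conj g a ≡ a → a · g ≡ g · a
  commute-conj {a} {g} e = trans (solve 2 (λ a g → a :∙ g ⊜ g :∙ (g :⁻ :∙ a :∙ g)) refl a g) (cong (g ·_) e)

  conj-commute : ∀ {a g} → a · g ≡ g · a → conj g a ≡ a
  conj-commute {a} {g} e = trans (assoc (g ⁻) a g) (trans (cong (g ⁻ ·_) e) (solve 2 (λ g a → g :⁻ :∙ (g :∙ a) ⊜ a) refl g a))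

  surj-conj : ∀ {P} g → Normalizes g P → ∀ x → P x → ∃ λ y → P y × conj g y ≡ x
  surj-conj g n = inj⇒surj (conj g) n (λ x y _ _ → conj-injective g x y) ≤-refl

  normalizes-⁻ : ∀ {P} g → Normalizes g P → Normalizes (g ⁻) P
  normalizes-⁻ {P} g n x p with y , py , refl ← surj-conj g n x p =
   move P (solve 2 (λ g y → y ⊜ g :⁻ :⁻ :∙ (g :⁻ :∙ y :∙ g) :∙ g :⁻) refl g y) py

  normalizes-conj⁻ : ∀ {P} g → Normalizes g P → ∀ x → P x → P (g · x · g ⁻)
  normalizes-conj⁻ {P} g n x p = move P (cong (λ h → h · x · g ⁻) (⁻¹-involutive g)) (normalizes-⁻ g n x p)

  opaque
   pick : (R : Pred) → X → X
   pick R d with em (∃ R)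
   ... | yes (x , _) = x
   ... | no _ = d

   pick-spec : (R : Pred) (d : X) → ∃ R → R (pick R d)
   pick-spec R d e with em (∃ R)
   ... | yes (x , r) = r
   ... | no none = ⊥-elim (none e)

  module Cosets {P : Pred} (sP : Subgroup P) where

   same-refl : ∀ {g} → SameCoset P g g
   same-refl {g} = move P (sym (inverseˡ g)) (unit sP)

   same-sym : ∀ {g h} → SameCoset P g h → SameCoset P h g
   same-sym {g} {h} p = move P (solve 2 (λ g h → (g :⁻ :∙ h) :⁻ ⊜ h :⁻ :∙ g) refl g h) (inv sP p)

   same-trans : ∀ {g h k} → SameCoset P g h → SameCoset P h k → SameCoset P g k
   same-trans {g} {h} {k} p q =
    move P (solve 3 (λ g h k → g :⁻ :∙ h :∙ (h :⁻ :∙ k) ⊜ g :⁻ :∙ k) refl g h k) (mul sP p q)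

   same-mulʳ : ∀ g {p} → P p → SameCoset P g (g · p)
   same-mulʳ g {p} x = move P (solve 2 (λ g p → p ⊜ g :⁻ :∙ (g :∙ p)) refl g p) x

   same-mulˡ : ∀ k {g h} → SameCoset P g h → SameCoset P (k · g) (k · h)
   same-mulˡ k {g} {h} = move P (solve 3 (λ k g h → g :⁻ :∙ h ⊜ (k :∙ g) :⁻ :∙ (k :∙ h)) refl k g h)

   opaque
    -- The least element of the coset gP. Cosets are counted through these representatives.
    rep : X → X
    rep g = proj₁ (least (SameCoset P g) (g , same-refl))

    same-rep : ∀ g → SameCoset P g (rep g)
    same-rep g = proj₁ (proj₂ (least (SameCoset P g) (g , same-refl)))

    rep-cong : ∀ {g h} → SameCoset P g h → rep g ≡ rep h
    rep-cong p = least-cong _ _ (λ i q → same-trans (same-sym p) q) (λ i q → same-trans p q)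

   rep-same : ∀ {g h} → rep g ≡ rep h → SameCoset P g h
   rep-same {g} {h} eq = same-trans (same-rep g) (subst (λ r → SameCoset P r h) (sym eq) (same-sym (same-rep h)))

   rep-idem : ∀ g → rep (rep g) ≡ rep g
   rep-idem g = rep-cong (same-sym (same-rep g))

   IsRep : Pred
   IsRep g = rep g ≡ g

   rep-unique : ∀ {g h} → IsRep g → IsRep h → SameCoset P g h → g ≡ h
   rep-unique rg rh s = trans (sym rg) (trans (rep-cong s) rh)

   opaque
    decompose : ∀ g {r} → rep g ≡ r → ∃ λ p → P p × g ≡ r · p
    decompose g {r} refl = r ⁻ · g , same-sym (same-rep g) , solve 2 (λ r g → g ⊜ r :∙ (r :⁻ :∙ g)) refl r g

   index : Pred → ℕ
   index U = # (λ g → U g × IsRep g)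

   Invariant : Pred → Set
   Invariant U = ∀ u p → U u → P p → U (u · p)

   invariant-same : ∀ {U} → Invariant U → ∀ {g h} → U g → SameCoset P g h → U h
   invariant-same {U} i {g} {h} u s = move U (solve 2 (λ g h → g :∙ (g :⁻ :∙ h) ⊜ h) refl g h) (i g _ u s)

   subgroup-invariant : ∀ {U} → Subgroup U → P ⊆ U → Invariant U
   subgroup-invariant sU le u p uu pp = mul sU uu (le p pp)

   invariant-rep : ∀ {U} → Invariant U → ∀ {g} → U g → U (rep g) × IsRep (rep g)
   invariant-rep i {g} u = invariant-same i u (same-rep g) , rep-idem g

   -- Stated for any union U of left cosets, because double cosets are counted in the same way as
   -- subgroups.
   coset-count : ∀ {U} → Invariant U → # U ≡ index U * # P
   coset-count {U} i = #-fibres rep (# P) (λ g → invariant-rep i) λ r (u , rr) → sym (#-bij (r ·_)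
    (λ p pp → i r p u pp , trans (rep-cong (same-sym (same-mulʳ r pp))) rr)
    (λ p q _ _ → ∙-cancelˡ r p q)
    λ g (_ , eq) → let (p , pp , e) = decompose g eq in p , pp , sym e)

   order-pos : NonZero (# P)
   order-pos = >-nonZero (#-pos ε (unit sP))

   -- The involution g ↦ g⁻¹ on the cosets of P in a group normalizing P fixes P.
   opaque
    even-index-inv : ∀ {S} → Subgroup S → P ⊆ S → (∀ g → S g → Normalizes g P) → Even (index S) →
     ∃ λ g → S g × ¬ P g × P (g · g)
    even-index-inv {S} sS le n e =
     let (g , ((sg , rg) , eq) , ne) = even-second (rep ε) ((repS (unit sS) , trans (rep-cong (f-same (unit sS))) (cong rep (solve 0 (:ε :⁻ ⊜ :ε) refl))))
          (even-fixed f closed invol e)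
     in g , sg , (λ pg → ne (trans (sym rg) (rep-cong (same-sym (move P (solve 1 (λ g → g ⊜ :ε :⁻ :∙ g) refl g) pg))))) ,
      move P (cong (_· g) (⁻¹-involutive g)) (rep-same (trans eq (sym rg)))
     where
     f : X → X
     f g = rep (g ⁻)
     inv-same : ∀ {g h} → S h → SameCoset P g h → SameCoset P (g ⁻) (h ⁻)
     inv-same {g} {h} sh p = move P (solve 2 (λ g h → h :∙ (g :⁻ :∙ h) :⁻ :∙ h :⁻ ⊜ g :⁻ :⁻ :∙ h :⁻) refl g h)
      (normalizes-conj⁻ h (n h sh) _ (inv sP p))
     repS : ∀ {g} → S g → S (rep g) × IsRep (rep g)
     repS = invariant-rep (subgroup-invariant sS le)
     f-same : ∀ {g} → S g → SameCoset P (rep g ⁻) (g ⁻)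
     f-same {g} sg = inv-same sg (same-sym (same-rep g))
     closed : ∀ g → S g × IsRep g → S (f g) × IsRep (f g)
     closed g (sg , _) = repS (inv sS sg)
     invol : ∀ g → S g × IsRep g → f (f g) ≡ g
     invol g (sg , rg) = trans (rep-cong (f-same (inv sS sg))) (trans (cong rep (⁻¹-involutive g)) rg)

   opaque
    -- Right multiplication by g permutes the left cosets of P in G, as g normalizes P, and it is an
    -- involution, as g² ∈ P. Their number is odd, so hgP = hP for some h, whence g ∈ P.
    odd-index-norm : ∀ {G} → Subgroup G → P ⊆ G → Odd (index G) → ∀ g → G g → Normalizes g P → P (g · g) → P g
    odd-index-norm {G} sG le o g gg n p² =
     let (h , (gh , rh) , eq) = odd-witness (odd-fixed f (λ h x → invariant-rep (subgroup-invariant sG le) (mul sG (proj₁ x) gg)) invol o)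
     in move P (solve 2 (λ h g → h :⁻ :∙ (h :∙ g) ⊜ g) refl h g) (same-sym (rep-same (trans eq (sym rh))))
     where
     f : X → X
     f h = rep (h · g)
     right : ∀ {h k} → SameCoset P h k → SameCoset P (h · g) (k · g)
     right {h} {k} p = move P (solve 3 (λ h k g → g :⁻ :∙ (h :⁻ :∙ k) :∙ g ⊜ (h :∙ g) :⁻ :∙ (k :∙ g)) refl h k g) (n _ p)
     invol : ∀ h → G h × IsRep h → f (f h) ≡ h
     invol h (_ , rh) = trans (rep-cong (right (same-sym (same-rep (h · g)))))
      (trans (rep-cong (same-sym (move P (solve 2 (λ h g → g :∙ g ⊜ h :⁻ :∙ (h :∙ g :∙ g)) refl h g) p²))) rh)

  open Cosets public using (index; order-pos; even-index-inv; odd-index-norm)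

  lagrange : ∀ {P H} (sP : Subgroup P) → Subgroup H → P ⊆ H → # H ≡ index sP H * # P
  lagrange sP sH le = Cosets.coset-count sP (Cosets.subgroup-invariant sP sH le)

  index-tower : ∀ {P Q H} (sP : Subgroup P) (sQ : Subgroup Q) → Subgroup H → P ⊆ Q → Q ⊆ H →
   index sP H ≡ index sQ H * index sP Q
  index-tower {P} {Q} {H} sP sQ sH p q = *-cancelʳ-≡ _ _ (# P) {{order-pos sP}}
   (trans (sym (lagrange sP sH (λ x → q x ∘ p x)))
   (trans (lagrange sQ sH q) (trans (cong (index sQ H *_) (lagrange sP sQ p)) (sym (*-assoc (index sQ H) _ _)))))

  -- The union of P and gP: the subgroup generated by P and g whenever g normalizes P and g² ∈ P.
  Adjoin : Pred → X → Pred
  Adjoin P g x = P x ⊎ P (g ⁻ · x)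

  adjoin-subgroup : ∀ {P} → Subgroup P → ∀ g → Normalizes g P → P (g · g) → Subgroup (Adjoin P g)
  adjoin-subgroup {P} sP g n p² = record
   { unit = inj₁ (unit sP) ; mul = mul′ ; inv = inv′ }
   where
   mul′ : ∀ {x y} → Adjoin P g x → Adjoin P g y → Adjoin P g (x · y)
   mul′ (inj₁ p) (inj₁ q) = inj₁ (mul sP p q)
   mul′ {x} {y} (inj₁ p) (inj₂ q) = inj₂ (move P
    (solve 3 (λ g x y → g :⁻ :∙ x :∙ g :∙ (g :⁻ :∙ y) ⊜ g :⁻ :∙ (x :∙ y)) refl g x y) (mul sP (n x p) q))
   mul′ {x} {y} (inj₂ p) (inj₁ q) = inj₂ (move P (assoc (g ⁻) x y) (mul sP p q))
   mul′ {x} {y} (inj₂ p) (inj₂ q) = inj₁ (move P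
    (solve 3 (λ g x y → g :∙ g :∙ (g :⁻ :∙ (g :⁻ :∙ x) :∙ g) :∙ (g :⁻ :∙ y) ⊜ x :∙ y) refl g x y)
    (mul sP (mul sP p² (n _ p)) q))
   inv′ : ∀ {x} → Adjoin P g x → Adjoin P g (x ⁻)
   inv′ (inj₁ p) = inj₁ (inv sP p)
   inv′ {x} (inj₂ p) = inj₂ (move P
    (solve 2 (λ g x → g :⁻ :∙ (g :⁻ :∙ x) :⁻ :∙ g :∙ (g :∙ g) :⁻ ⊜ g :⁻ :∙ x :⁻) refl g x)
    (mul sP (n _ (inv sP p)) (inv sP p²)))

  adjoin-order : ∀ {P} → Subgroup P → ∀ g → ¬ P g → # (Adjoin P g) ≡ # P + # P
  adjoin-order {P} sP g ¬p = trans
   (#-disjoint {P = P} {Q = λ x → P (g ⁻ · x)} (λ _ → id) (λ _ → inj₁) (λ _ → inj₂)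
    λ x p q → ¬p (move P (solve 2 (λ g x → x :∙ (g :⁻ :∙ x) :⁻ ⊜ g) refl g x) (mul sP p (inv sP q))))
   (cong (# P +_) (sym (#-bij (g ·_)
    (λ x → move P (solve 2 (λ g x → x ⊜ g :⁻ :∙ (g :∙ x)) refl g x))
    (λ x y _ _ → ∙-cancelˡ g x y)
    λ y p → g ⁻ · y , p , solve 2 (λ g y → g :∙ (g :⁻ :∙ y) ⊜ y) refl g y)))

  -- 2-groups, presented by a chain of subgroups each of index at most two in the next.
  data TwoGroup : Pred → Set₁ where
   trivial : ∀ {P} → Subgroup P → (∀ x → P x → x ≡ ε) → TwoGroup P
   extend : ∀ {P Q} → Subgroup P → TwoGroup Q → ∀ g → Normalizes g Q → Q (g · g) → Q ⊆ P → P g → P ⊆ Adjoin Q g → TwoGroup P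

  sub₂ : ∀ {P} → TwoGroup P → Subgroup P
  sub₂ (trivial s _) = s
  sub₂ (extend s _ _ _ _ _ _ _) = s

  two-adjoin : ∀ {Q} → TwoGroup Q → ∀ g → Normalizes g Q → Q (g · g) → TwoGroup (Adjoin Q g)
  two-adjoin {Q} t g n q = extend (adjoin-subgroup (sub₂ t) g n q) t g n q (λ _ → inj₁)
   (inj₂ (move Q (sym (inverseˡ g)) (unit (sub₂ t)))) (λ _ → id)

  SameParity : ℕ → ℕ → Set
  SameParity m n = (Odd m → Odd n) × (Even m → Even n)

  module FixedPoints {n : ℕ} (Y : Fin n → Set) (act : X → Fin n → Fin n) where

   Fixed : Pred → Fin n → Set
   Fixed P y = Y y × (∀ p → P p → act p y ≡ y)

   -- Go up the chain of subgroups: since g normalizes Q and g² ∈ Q, it acts as an involution on the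
   -- points fixed by Q, and passing to its fixed points keeps the parity.
   fixed-parity : ∀ {P} → TwoGroup P → (∀ p y → P p → Y y → Y (act p y)) →
    (∀ p q y → P p → P q → Y y → act p (act q y) ≡ act (p · q) y) → (∀ y → Y y → act ε y ≡ y) →
    SameParity (# Y) (# (Fixed P))
   fixed-parity (trivial s t) c m u = subst Odd eq , subst Even eq
    where eq = #-cong (λ y h → h , λ p pp → trans (cong (λ p → act p y) (t p pp)) (u y h)) (λ y → proj₁)
   fixed-parity {P} (extend {Q = Q} s t g n q² le pg cov) c m u =
    (λ o → subst Odd (sym eq) (odd-fixed (act g) closed invol (proj₁ ih o))) ,
    (λ e → subst Even (sym eq) (even-fixed (act g) closed invol (proj₂ ih e)))
    where
    ih : SameParity (# Y) (# (Fixed Q))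
    ih = fixed-parity t (λ p y pp → c p y (le p pp)) (λ p q y pp qq → m p q y (le p pp) (le q qq)) u
    closed : ∀ y → Fixed Q y → Fixed Q (act g y)
    closed y (h , f) = c g y pg h , λ q qq → trans (m q g y (le q qq) pg h)
     (trans (cong (λ p → act p y) (solve 2 (λ q g → q :∙ g ⊜ g :∙ (g :⁻ :∙ q :∙ g)) refl q g))
     (trans (sym (m g (conj g q) y pg (le _ (n q qq)) h)) (cong (act g) (f _ (n q qq)))))
    invol : ∀ y → Fixed Q y → act g (act g y) ≡ y
    invol y (h , f) = trans (m g g y pg pg h) (f _ q²)
    eq : # (Fixed P) ≡ # (λ y → Fixed Q y × act g y ≡ y)
    eq = #-cong (λ y (h , f) → (h , λ q qq → f q (le q qq)) , f g pg)
     λ y ((h , f) , fg) → h , λ p pp → [ f p , (λ q → trans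
      (cong (λ p → act p y) (solve 2 (λ g p → p ⊜ g :∙ (g :⁻ :∙ p)) refl g p))
      (trans (sym (m g (g ⁻ · p) y pg (le _ q) h)) (trans (cong (act g) (f _ q)) fg))) ]′ (cov p pp)

  module CosetAction {H} (sH : Subgroup H) where
   open Cosets sH hiding (index; order-pos; even-index-inv; odd-index-norm)

   -- A left-invariant union U of cosets of H, with P acting by left multiplication.
   coset-parity : ∀ {P} → TwoGroup P → ∀ {U} → Invariant U → (∀ p u → P p → U u → U (p · u)) →
    SameParity (index sH U) (# (λ g → (U g × IsRep g) × (∀ p → P p → H (conj g p))))
   coset-parity {P} t {U} i l = subst (SameParity (index sH U)) eq (fixed-parity t
    (λ p y pp (u , _) → invariant-rep i (l p y pp u))
    (λ p q y _ _ _ → trans (rep-cong (same-mulˡ p (same-sym (same-rep (q · y))))) (cong rep (sym (assoc p q y))))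
    (λ y (_ , ry) → trans (cong rep (identityˡ y)) ry))
    where
    open FixedPoints (λ g → U g × IsRep g) (λ p g → rep (p · g))
    eq : # (Fixed P) ≡ # (λ g → (U g × IsRep g) × (∀ p → P p → H (conj g p)))
    eq = #-cong
     (λ g (u , f) → u , λ p pp → move H (sym (assoc (g ⁻) p g)) (rep-same (trans (proj₂ u) (sym (f p pp)))))
     (λ g (u , f) → u , λ p pp → trans (sym (rep-cong (move H (assoc (g ⁻) p g) (f p pp)))) (proj₂ u))

   opaque
    -- P fixes the coset gH exactly when g⁻¹Pg lies in H. This is Sylow conjugacy in the form used
    -- below.
    odd-coset-fixed : ∀ {P} → TwoGroup P → ∀ {U} → Invariant U → (∀ p u → P p → U u → U (p · u)) → Odd (index sH U) →
     ∃ λ g → U g × (∀ p → P p → H (conj g p))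
    odd-coset-fixed t i l o = let (g , (u , _) , f) = odd-witness (proj₁ (coset-parity t i l) o) in g , u , f

  open CosetAction public using (odd-coset-fixed)

  opaque
   -- The cosets of Q fixed by Q are those in the normalizer of Q in H. Like the index, their number
   -- is even, so inversion on this quotient group fixes a coset besides Q itself.
   two-extension : ∀ {Q H} (t : TwoGroup Q) → Subgroup H → Q ⊆ H → Even (index (sub₂ t) H) →
    ∃ λ g → H g × ¬ Q g × Normalizes g Q × Q (g · g)
   two-extension {Q} {H} t sH le e =
    let (g , (hg , n) , ¬q , q²) = even-index-inv sQ sS (λ q qq → le q qq , norm-Q q qq) (λ g → proj₂)
         (subst Even eq (proj₂ (CosetAction.coset-parity sQ t (Cosets.subgroup-invariant sQ sH le)
          λ p u pp → mul sH (le p pp)) e))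
    in g , hg , ¬q , n , q²
    where
    sQ : Subgroup Q
    sQ = sub₂ t
    open Cosets sQ using (IsRep)
    S : Pred
    S g = H g × Normalizes g Q
    norm-Q : ∀ q → Q q → Normalizes q Q
    norm-Q q qq x xx = mul sQ (mul sQ (inv sQ qq) xx) qq
    sS : Subgroup S
    sS = record
     { unit = unit sH , norm-Q ε (unit sQ)
     ; mul = λ {x} {y} (h , n) (k , m) → mul sH h k , λ z q →
      move Q (solve 3 (λ x y z → y :⁻ :∙ (x :⁻ :∙ z :∙ x) :∙ y ⊜ (x :∙ y) :⁻ :∙ z :∙ (x :∙ y)) refl x y z) (m _ (n z q))
     ; inv = λ {x} (h , n) → inv sH h , normalizes-⁻ x n }
    eq : # (λ g → (H g × IsRep g) × (∀ p → Q p → Q (conj g p))) ≡ index sQ S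
    eq = #-cong (λ g ((h , r) , n) → (h , n) , r) (λ g ((h , n) , r) → (h , r) , n)

  record SylowTwo (M : Pred) : Set₁ where
   field
    Syl : Pred
    two : TwoGroup Syl
    ⊆M : Syl ⊆ M
    odd-index : Odd (index (sub₂ two) M)

  opaque
   sylow-exists : ∀ {M} → Subgroup M → SylowTwo M
   sylow-exists {M} sM = go (suc (# M)) (trivial (record
    { unit = refl ; mul = λ { refl refl → identityˡ ε } ; inv = λ { refl → solve 0 (:ε :⁻ ⊜ :ε) refl } }) (λ x → id))
    (λ { x refl → unit sM }) (m≤n+m (suc (# M)) _)
    where
    open ≤-Reasoning
    -- Every extension doubles Q, so `# Q + fuel` stays above `# M`; once the fuel is spent, Q would
    -- be larger than M.
    go : ∀ fuel {Q} → TwoGroup Q → Q ⊆ M → # M < # Q + fuel → SylowTwo M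
    go fuel {Q} t le bound with even⊎odd (index (sub₂ t) M)
    ... | inj₂ o = record { Syl = Q ; two = t ; ⊆M = le ; odd-index = o }
    go zero {Q} t le bound | inj₁ e = ⊥-elim (<⇒≱ (subst (# M <_) (+-identityʳ (# Q)) bound) (#-mono le))
    go (suc fuel) {Q} t le bound | inj₁ e = step (two-extension t sM le e)
     where
     step : (∃ λ g → M g × ¬ Q g × Normalizes g Q × Q (g · g)) → SylowTwo M
     step (g , mg , ¬q , n , q²) = go fuel (two-adjoin t g n q²) le′ (begin-strict
      # M                          <⟨ bound ⟩
      # Q + suc fuel               ≡⟨ +-suc (# Q) fuel ⟩
      suc (# Q) + fuel             ≤⟨ +-monoˡ-≤ fuel (+-monoˡ-≤ (# Q) (#-pos ε (unit (sub₂ t)))) ⟩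
      # Q + # Q + fuel             ≡⟨ cong (_+ fuel) (adjoin-order (sub₂ t) g ¬q) ⟨
      # (Adjoin Q g) + fuel        ∎)
      where
      le′ : Adjoin Q g ⊆ M
      le′ x (inj₁ q) = le x q
      le′ x (inj₂ q) = move M (solve 2 (λ g x → g :∙ (g :⁻ :∙ x) ⊜ x) refl g x) (mul sM mg (le (g ⁻ · x) q))

-- Perfect codes as inverse-closed transversals.

module Codes where

 open import Data.Nat using (ℕ; suc; _+_; _∸_; _≤_; _<_; z≤n; s≤s)
 open import Data.Nat.Properties
 open import Data.Fin using (Fin; suc; toℕ; fromℕ<)
 open import Relation.Binary using (tri<; tri≈; tri>)
 open Parity
 open Counting
 open Groups

 module Rank (em : (P : Set) → Dec P) where
  open Classical em

  rank : ∀ {n} → (Fin n → Set) → Fin n → ℕ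
  rank Y r = # (λ j → Y j × toℕ j < toℕ r)

  rank-cong : ∀ {n} {Y Z : Fin n → Set} → (∀ i → Y i → Z i) → (∀ i → Z i → Y i) → ∀ r → rank Y r ≡ rank Z r
  rank-cong f g r = #-cong (λ i (y , l) → f i y , l) (λ i (z , l) → g i z , l)

  rank-<-mono : ∀ {n} {Y : Fin n → Set} {i j} → Y i → toℕ i < toℕ j → rank Y i < rank Y j
  rank-<-mono {Y = Y} {i} {j} yi lt = subst (rank Y i <_) (sym (#-remove i (yi , lt)))
   (s≤s (#-mono λ k (yk , l) → (yk , <-trans l lt) , λ { refl → <-irrefl refl l }))

  rank-injective : ∀ {n} {Y : Fin n → Set} {i j} → Y i → Y j → rank Y i ≡ rank Y j → i ≡ j
  rank-injective {i = i} {j} yi yj eq with <-cmp (toℕ i) (toℕ j)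
  ... | tri< lt _ _ = ⊥-elim (<⇒≢ (rank-<-mono yi lt) eq)
  ... | tri≈ _ e _ = Fin.toℕ-injective e
  ... | tri> _ _ gt = ⊥-elim (<⇒≢ (rank-<-mono yj gt) (sym eq))

  rank-bound : ∀ {n} {Y : Fin n → Set} {i} → Y i → rank Y i < # Y
  rank-bound {i = i} yi = subst (rank _ i <_) (sym (#-remove i yi))
   (s≤s (#-mono λ k (yk , l) → yk , λ { refl → <-irrefl refl l }))

  opaque
   -- Pigeonhole: the ranks of the elements of Y are distinct and below `# Y`, so none of these
   -- numbers is omitted.
   unrank : ∀ {n} {Y : Fin n → Set} k → k < # Y → ∃ λ i → Y i × rank Y i ≡ k
   unrank {n} {Y} k lt = dne λ none → <⇒≱
    (≤-trans (s≤s (#-inj {P = Y} {Q = λ j → j ≢ fromℕ< lt} (λ i yi → fromℕ< (rank-bound yi))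
     (λ i yi eq → none (i , yi , trans (sym (Fin.toℕ-fromℕ< (rank-bound yi))) (trans (cong toℕ eq) (Fin.toℕ-fromℕ< lt))))
     λ i yi j yj eq → rank-injective yi yj (Fin.fromℕ<-injective _ _ (rank-bound yi) (rank-bound yj) eq)))
     (≤-reflexive (trans (cong suc (#-cong (λ j ne → _ , ne) (λ j → proj₂))) (trans (sym (#-remove {P = λ _ → ⊤} (fromℕ< lt) _)) (#-all λ _ → _)))))
    ≤-refl
    where open import Data.Unit using (⊤)

 module PerfectCodes (em : (P : Set) → Dec P) {N : ℕ} {_∙_ : Fin N → Fin N → Fin N} {ε : Fin N}
  {_⁻¹ : Fin N → Fin N} (isGroup : IsGroup _≡_ _∙_ ε _⁻¹) where

  open Classical em
  open Rank em
  open FiniteGroup em isGroup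

  -- An equation g = s·c with c ∈ M says that s lies in gM. The condition on the Cayley graph
  -- therefore becomes: S is inverse-closed, misses M and meets every other left coset of M exactly
  -- once.
  record PerfectCode (G M : Pred) : Set₁ where
   field
    S : Pred
    S⊆G : S ⊆ G
    S⁻ : ∀ {s} → S s → S (s ⁻)
    S∩M : ∀ {s} → S s → ¬ M s
    meets : ∀ g → G g → ¬ M g → ∃ λ s → S s × M (g ⁻ · s)
    meets-once : ∀ {s t} → S s → S t → M (s ⁻ · t) → s ≡ t

  module _ {G M : Pred} (sG : Subgroup G) (sM : Subgroup M) (M⊆G : M ⊆ G) where
   open Cosets sM hiding (index; order-pos; even-index-inv; odd-index-norm)

   -- y lies in the double coset MxM.
   Double : X → Pred
   Double x y = ∃ λ m → M m × M ((m · x) ⁻ · y)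

   double-refl : ∀ x → Double x x
   double-refl x = ε , unit sM , move M (solve 1 (λ x → :ε ⊜ (:ε :∙ x) :⁻ :∙ x) refl x) (unit sM)

   double-sym : ∀ {x y} → Double x y → Double y x
   double-sym {x} {y} (m , mm , p) = m ⁻ , inv sM mm ,
    move M (solve 3 (λ m x y → ((m :∙ x) :⁻ :∙ y) :⁻ ⊜ (m :⁻ :∙ y) :⁻ :∙ x) refl m x y) (inv sM p)

   double-trans : ∀ {x y z} → Double x y → Double y z → Double x z
   double-trans {x} {y} {z} (m , mm , p) (k , kk , q) = k · m , mul sM kk mm ,
    move M (solve 5 (λ m k x y z → (m :∙ x) :⁻ :∙ y :∙ ((k :∙ y) :⁻ :∙ z) ⊜ (k :∙ m :∙ x) :⁻ :∙ z) refl m k x y z) (mul sM p q)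

   double-inv : ∀ {x y} → Double x y → Double (x ⁻) (y ⁻)
   double-inv {x} {y} (m , mm , p) = ((m · x) ⁻ · y) ⁻ , inv sM p ,
    move M (solve 3 (λ m x y → m :⁻ ⊜ (((m :∙ x) :⁻ :∙ y) :⁻ :∙ x :⁻) :⁻ :∙ y :⁻) refl m x y) (inv sM mm)

   same-double : ∀ {x y} → SameCoset M x y → Double x y
   same-double {x} {y} p = ε , unit sM , move M (cong (λ z → z ⁻ · y) (sym (identityˡ x))) p

   double-G : ∀ {x y} → Double x y → G x → G y
   double-G {x} {y} (m , mm , p) gx = move G (solve 3 (λ m x y → m :∙ x :∙ ((m :∙ x) :⁻ :∙ y) ⊜ y) refl m x y)
    (mul sG (mul sG (M⊆G _ mm) gx) (M⊆G _ p))

   double-M : ∀ {x y} → Double x y → M y → M x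
   double-M {x} {y} (m , mm , p) my = move M (solve 3 (λ m x y → m :⁻ :∙ (y :∙ ((m :∙ x) :⁻ :∙ y) :⁻) ⊜ x) refl m x y)
    (mul sM (inv sM mm) (mul sM my (inv sM p)))

   double-invariant : ∀ x → Invariant (Double x)
   double-invariant x u p d mp = double-trans d (same-double (same-mulʳ u mp))

   doubleIndex : X → ℕ
   doubleIndex x = index sM (Double x)

   doubleIndex-cong : ∀ {x y} → Double x y → doubleIndex x ≡ doubleIndex y
   doubleIndex-cong d = #-cong (λ i (e , r) → double-trans (double-sym d) e , r) (λ i (e , r) → double-trans d e , r)

   -- Inversion maps MxM onto Mx⁻¹M, and both consist of left cosets of the same size.
   doubleIndex-inv : ∀ x → doubleIndex x ≡ doubleIndex (x ⁻)
   doubleIndex-inv x = *-cancelʳ-≡ _ _ (# M) {{order-pos sM}}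
    (trans (sym (Cosets.coset-count sM (double-invariant x)))
    (trans (#-bij _⁻ (λ y → double-inv) (λ y z _ _ → ⁻¹-injective)
     λ y d → y ⁻ , subst (λ z → Double z (y ⁻)) (⁻¹-involutive x) (double-inv d) , ⁻¹-involutive y)
    (Cosets.coset-count sM (double-invariant (x ⁻)))))

   -- In every double coset MrM the left coset of rank i is matched with the left coset of rank n-1-i of
   -- Mr⁻¹M, where n is the number of left cosets in either; only a middle coset is matched with itself.
   Reps : X → Pred
   Reps x r = Double x r × IsRep r

   Matched : X → X → Set
   Matched r r′ = (IsRep r × Reps (r ⁻) r′) × rank (Reps (r ⁻)) r′ + suc (rank (Reps r) r) ≡ doubleIndex r

   reps-cong : ∀ {x y} → Double x y → ∀ i → Reps x i → Reps y i
   reps-cong d i (e , r) = double-trans (double-sym d) e , r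

   rank-reps : ∀ {x y} → Double x y → ∀ r → rank (Reps x) r ≡ rank (Reps y) r
   rank-reps d = rank-cong (reps-cong d) (reps-cong (double-sym d))

   double-swap : ∀ {r r′} → Double (r ⁻) r′ → Double r (r′ ⁻)
   double-swap {r} {r′} d = subst (λ z → Double z (r′ ⁻)) (⁻¹-involutive r) (double-inv d)

   matched-sym : ∀ {r r′} → Matched r r′ → Matched r′ r
   matched-sym {r} {r′} ((ir , (d , ir′)) , eq) = (ir′ , (double-sym (double-swap d) , ir)) , (begin
    rank (Reps (r′ ⁻)) r + suc (rank (Reps r′) r′)  ≡⟨ cong₂ (λ a b → a + suc b) (rank-reps (double-sym (double-swap d)) r) (rank-reps (double-sym d) r′) ⟩
    rank (Reps r) r + suc (rank (Reps (r ⁻)) r′)    ≡⟨ +-suc (rank (Reps r) r) _ ⟩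
    suc (rank (Reps r) r) + rank (Reps (r ⁻)) r′    ≡⟨ +-comm (suc (rank (Reps r) r)) _ ⟩
    rank (Reps (r ⁻)) r′ + suc (rank (Reps r) r)    ≡⟨ eq ⟩
    doubleIndex r                                   ≡⟨ doubleIndex-inv r ⟩
    doubleIndex (r ⁻)                               ≡⟨ doubleIndex-cong d ⟩
    doubleIndex r′                                  ∎)
    where open ≡-Reasoning

   matched-functional : ∀ {r r′ r″} → Matched r r′ → Matched r r″ → r′ ≡ r″
   matched-functional {r} ((_ , y) , eq) ((_ , z) , eq′) =
    rank-injective y z (+-cancelʳ-≡ (suc (rank (Reps r) r)) _ _ (trans eq (sym eq′)))

   matched-exists : ∀ r → IsRep r → ∃ (Matched r)
   matched-exists r ir with r′ , y , eq ← unrank {Y = Reps (r ⁻)} (doubleIndex r ∸ suc (rank (Reps r) r))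
    (subst (doubleIndex r ∸ suc (rank (Reps r) r) <_) (doubleIndex-inv r) (∸-monoʳ-< (s≤s z≤n) (rank-bound (double-refl r , ir)))) =
    r′ , (ir , y) , trans (cong (_+ suc (rank (Reps r) r)) eq) (m∸n+n≡m (rank-bound (double-refl r , ir)))

   -- An element of the coset of r whose inverse lies in the matched coset of r′. In a coset matched
   -- with itself, s must be its own inverse, or else S would meet that coset twice.
   Candidate : X → X → Pred
   Candidate r r′ s = rep s ≡ r × rep (s ⁻) ≡ r′ × (r ≡ r′ → s · s ≡ ε)

   Least : Pred → Pred
   Least P s = P s × (∀ t → P t → toℕ s ≤ toℕ t)

   least-unique : ∀ {P s t} → Least P s → Least P t → s ≡ t
   least-unique {s = s} {t} (p , f) (q , g) = Fin.toℕ-injective (≤-antisym (f t q) (g s p))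

   candidate-sym : ∀ {r r′ s} → Candidate r r′ s → Candidate r′ r (s ⁻)
   candidate-sym {s = s} (a , b , c) = b , trans (cong rep (⁻¹-involutive s)) a ,
    λ e → trans (solve 1 (λ s → s :⁻ :∙ s :⁻ ⊜ (s :∙ s) :⁻) refl s) (trans (cong _⁻ (c (sym e))) (solve 0 (:ε :⁻ ⊜ :ε) refl))

   -- The smaller of two matched cosets receives its least candidate and the larger one the inverse
   -- of that candidate, which makes the choice closed under inversion.
   Chosen : X → X → X → Set
   Chosen r r′ s = (toℕ r ≤ toℕ r′ × Least (Candidate r r′) s) ⊎ (toℕ r′ ≤ toℕ r × Least (Candidate r′ r) (s ⁻))

   chosen-sym : ∀ {r r′ s} → Chosen r r′ s → Chosen r′ r (s ⁻)
   chosen-sym {r} {r′} {s} (inj₁ (l , c)) = inj₂ (l , subst (Least (Candidate r r′)) (sym (⁻¹-involutive s)) c)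
   chosen-sym (inj₂ x) = inj₁ x

   chosen-unique : ∀ {r r′ s t} → Chosen r r′ s → Chosen r r′ t → s ≡ t
   chosen-unique (inj₁ (_ , c)) (inj₁ (_ , d)) = least-unique c d
   chosen-unique (inj₂ (_ , c)) (inj₂ (_ , d)) = ⁻¹-injective (least-unique c d)
   chosen-unique (inj₁ (l , c)) (inj₂ (k , d)) with refl ← Fin.toℕ-injective (≤-antisym l k) =
    trans (least-unique c d) (trans (sym (invol-inv (proj₂ (proj₂ (proj₁ d)) refl))) (⁻¹-involutive _))
   chosen-unique (inj₂ (k , d)) (inj₁ (l , c)) with refl ← Fin.toℕ-injective (≤-antisym l k) =
    trans (trans (sym (⁻¹-involutive _)) (invol-inv (proj₂ (proj₂ (proj₁ d)) refl))) (least-unique d c)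

   -- Only a coset matched with itself needs an involution. Such a coset contains an s with s² ∈ M,
   -- and its double coset consists of an odd number of left cosets; these are the hypotheses of
   -- `involutive`.
   module _ (involutive : ∀ x → G x → ¬ M x → M (x · x) → Odd (doubleIndex x) → ∃ λ m → M m × (x · m) · (x · m) ≡ ε) where

    candidate-exists : ∀ {r r′} → G r → ¬ M r → Matched r r′ → ∃ (Candidate r r′)
    candidate-exists {r} {r′} gr ¬mr ((ir , ((m , mm , p) , ir′)) , eq) with em (r ≡ r′)
    ... | no ne = s , trans (rep-cong (same-sym (same-mulʳ r (inv sM mm)))) ir ,
     trans (rep-cong same) ir′ , λ e → ⊥-elim (ne e)
     where
     s = r · m ⁻
     same : SameCoset M (s ⁻) r′
     same = move M (solve 3 (λ m r r′ → (m :∙ r :⁻) :⁻ :∙ r′ ⊜ (r :∙ m :⁻) :⁻ :⁻ :∙ r′) refl m r r′) p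
    ... | yes refl = from-involution (involutive s (mul sG gr (M⊆G _ (inv sM mm))) (λ ms → ¬mr (double-M r-s ms)) s² odd)
     where
     s = r · m ⁻
     rs : SameCoset M r s
     rs = same-mulʳ r (inv sM mm)
     r-s : Double r s
     r-s = same-double rs
     same : SameCoset M (s ⁻) r
     same = move M (solve 2 (λ m r → (m :∙ r :⁻) :⁻ :∙ r ⊜ (r :∙ m :⁻) :⁻ :⁻ :∙ r) refl m r) p
     s² : M (s · s)
     s² = move M (cong (_· s) (⁻¹-involutive s)) (same-trans same rs)
     -- As many cosets of the double coset precede r as follow it.
     odd : Odd (doubleIndex s)
     odd = rank (Reps r) r , (begin
      doubleIndex s                                 ≡⟨ doubleIndex-cong r-s ⟨
      doubleIndex r                                 ≡⟨ eq ⟨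
      rank (Reps (r ⁻)) r + suc (rank (Reps r) r)   ≡⟨ cong (_+ suc (rank (Reps r) r)) (rank-reps (m , mm , p) r) ⟩
      rank (Reps r) r + suc (rank (Reps r) r)       ≡⟨ +-suc _ _ ⟩
      suc (rank (Reps r) r + rank (Reps r) r)       ∎)
      where open ≡-Reasoning
     from-involution : (∃ λ m → M m × (s · m) · (s · m) ≡ ε) → ∃ (Candidate r r)
     from-involution (k , mk , e) = s · k , t-rep , trans (cong rep (invol-inv e)) t-rep , λ _ → e
      where
      t-rep : rep (s · k) ≡ r
      t-rep = trans (rep-cong (same-trans (same-sym (same-mulʳ s mk)) (same-sym rs))) ir

    chosen-exists : ∀ {r r′} → G r → ¬ M r → Matched r r′ → ∃ λ s → Chosen r r′ s
    chosen-exists {r} {r′} gr ¬mr mt with ≤-total (toℕ r) (toℕ r′)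
    ... | inj₁ l = let (s , c) = least (Candidate r r′) (candidate-exists gr ¬mr mt) in s , inj₁ (l , c)
    ... | inj₂ l = let (c , cand) = candidate-exists gr ¬mr mt
                       (s , d) = least (Candidate r′ r) (c ⁻ , candidate-sym cand)
     in s ⁻ , inj₂ (l , subst (Least (Candidate r′ r)) (sym (⁻¹-involutive s)) d)

    chosen-candidate : ∀ {r r′ s} → Chosen r r′ s → Candidate r r′ s
    chosen-candidate (inj₁ (_ , c , _)) = c
    chosen-candidate {r} {r′} {s} (inj₂ (_ , c , _)) = subst (Candidate r r′) (⁻¹-involutive s) (candidate-sym c)

    perfectCode : PerfectCode G M
    perfectCode = record
     { S = S
     ; S⊆G = λ s (g , _) → g
     ; S⁻ = λ {s} (g , n , mt , c) → inv sG g , (λ m → n (move M (⁻¹-involutive s) (inv sM m))) ,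
      subst (Matched (rep (s ⁻))) (sym (cong rep (⁻¹-involutive s))) (matched-sym mt) ,
      subst (λ r → Chosen (rep (s ⁻)) r (s ⁻)) (sym (cong rep (⁻¹-involutive s))) (chosen-sym c)
     ; S∩M = λ (_ , n , _) → n
     ; meets = meets
     ; meets-once = once }
     where
     S : Pred
     S s = G s × ¬ M s × Matched (rep s) (rep (s ⁻)) × Chosen (rep s) (rep (s ⁻)) s
     meets : ∀ g → G g → ¬ M g → ∃ λ s → S s × M (g ⁻ · s)
     meets g gg ¬mg =
      let gr = double-G (same-double (same-rep g)) gg
          ¬mr = λ m → ¬mg (double-M (same-double (same-rep g)) m)
          (r′ , mt) = matched-exists (rep g) (rep-idem g)
          (s , c) = chosen-exists gr ¬mr mt
          (a , b , _) = chosen-candidate c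
          gs = rep-same (sym a)
      in s , (double-G (same-double gs) gg , (λ m → ¬mg (double-M (same-double gs) m)) ,
       subst₂ Matched (sym a) (sym b) mt , subst₂ (λ r r′ → Chosen r r′ s) (sym a) (sym b) c) , gs
     once : ∀ {s t} → S s → S t → M (s ⁻ · t) → s ≡ t
     once {s} {t} (_ , _ , mt , c) (_ , _ , mt′ , c′) p with e ← rep-cong p =
      chosen-unique c (subst₂ (λ r r′ → Chosen r r′ t) (sym e)
       (sym (matched-functional mt (subst (λ r → Matched r (rep (t ⁻))) (sym e) mt′))) c′)

-- Group-theoretic criteria for and against perfect codes.

module Criteria where

 open import Data.Nat using (ℕ; _+_; _*_)
 open import Data.Nat.Properties
 open import Data.Fin using (Fin)
 open Parity
 open Counting
 open Groups
 open Codes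

 module CodeCriteria (em : (P : Set) → Dec P) {N : ℕ} {_∙_ : Fin N → Fin N → Fin N} {ε : Fin N}
  {_⁻¹ : Fin N → Fin N} (isGroup : IsGroup _≡_ _∙_ ε _⁻¹) where

  open Classical em
  open FiniteGroup em isGroup
  open PerfectCodes em isGroup

  -- M ∩ xMx⁻¹, the stabilizer in M of the left coset xM. For x² ∈ M it is normalized by x.
  Conjugate∩ : Pred → X → Pred
  Conjugate∩ M x m = M m × M (conj x m)

  conjugate∩-subgroup : ∀ {M} → Subgroup M → ∀ x → Subgroup (Conjugate∩ M x)
  conjugate∩-subgroup {M} sM x = record
   { unit = unit sM , move M (solve 1 (λ x → :ε ⊜ x :⁻ :∙ :ε :∙ x) refl x) (unit sM)
   ; mul = λ {m} {n} (a , b) (c , d) → mul sM a c , move M (conj-mul x m n) (mul sM b d)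
   ; inv = λ {m} (a , b) → inv sM a , move M (solve 2 (λ x m → (x :⁻ :∙ m :∙ x) :⁻ ⊜ x :⁻ :∙ m :⁻ :∙ x) refl x m) (inv sM b) }

  conjugate∩-normalizes : ∀ {M} → Subgroup M → ∀ {x} → M (x · x) → Normalizes x (Conjugate∩ M x)
  conjugate∩-normalizes {M} sM {x} x² m (a , b) = b ,
   move M (solve 2 (λ x m → (x :∙ x) :⁻ :∙ m :∙ (x :∙ x) ⊜ x :⁻ :∙ (x :⁻ :∙ m :∙ x) :∙ x) refl x m)
    (mul sM (mul sM (inv sM x²) a) x²)

  -- A Sylow 2-subgroup Syl of M with an element g outside M exhibiting that M is not a perfect code.
  record Obstruction (G M : Pred) : Set₁ where
   field
    Syl : Pred
    two : TwoGroup Syl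
    Syl⊆M : Syl ⊆ M
    odd-index : Odd (index (sub₂ two) M)
    g : X
    Gg : G g
    ¬Mg : ¬ M g
    normal : Normalizes g Syl
    square : Syl (g · g)
    no-involution : ∀ m → M m → (g · m) · (g · m) ≢ ε

  module _ {G M : Pred} (sG : Subgroup G) (sM : Subgroup M) (M⊆G : M ⊆ G) where
   open Cosets sM hiding (index; order-pos; even-index-inv; odd-index-norm)

   -- D = M ∩ xMx⁻¹ contains the Sylow subgroup Q, which therefore has even index in D ∪ xD. Hence
   -- some g outside Q normalizes Q and has g² ∈ Q. As Q has odd index in M, g is not in M, so it
   -- lies in xD and gM = xM.
   sylow-obstruction : (s : SylowTwo M) → ∀ x → G x → ¬ M x → M (x · x) →
    (∀ m → M m → (x · m) · (x · m) ≢ ε) → (∀ p → SylowTwo.Syl s p → M (conj x p)) → Obstruction G M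
   sylow-obstruction s x gx ¬x x² no-inv norm = build ext
    where
    open SylowTwo s
    sQ : Subgroup Syl
    sQ = sub₂ two
    D : Pred
    D = Conjugate∩ M x
    sD : Subgroup D
    sD = conjugate∩-subgroup sM x
    Q⊆D : Syl ⊆ D
    Q⊆D p pp = ⊆M p pp , norm p pp
    x²D : D (x · x)
    x²D = x² , move M (solve 1 (λ x → x :∙ x ⊜ x :⁻ :∙ (x :∙ x) :∙ x) refl x) x²
    sH : Subgroup (Adjoin D x)
    sH = adjoin-subgroup sD x (conjugate∩-normalizes sM x²) x²D
    even-H : Even (index sQ (Adjoin D x))
    even-H = index sQ D , *-cancelʳ-≡ _ _ (# Syl) {{order-pos sQ}}
     (trans (sym (lagrange sQ sH λ p pp → inj₁ (Q⊆D p pp)))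
     (trans (adjoin-order sD x λ d → ¬x (proj₁ d))
     (trans (cong₂ _+_ (lagrange sQ sD Q⊆D) (lagrange sQ sD Q⊆D)) (sym (*-distribʳ-+ (# Syl) (index sQ D) _)))))
    ext : ∃ λ g → Adjoin D x g × ¬ Syl g × Normalizes g Syl × Syl (g · g)
    ext = two-extension two sH (λ p pp → inj₁ (Q⊆D p pp)) even-H
    build : (∃ λ g → Adjoin D x g × ¬ Syl g × Normalizes g Syl × Syl (g · g)) → Obstruction G M
    build (g , inj₁ d , ¬q , n , q²) = ⊥-elim (¬q (odd-index-norm sQ sM ⊆M odd-index g (proj₁ d) n q²))
    build (g , inj₂ d , ¬q , n , q²) = record
     { Syl = Syl ; two = two ; Syl⊆M = ⊆M ; odd-index = odd-index ; g = g
     ; Gg = move G (solve 2 (λ x g → x :∙ (x :⁻ :∙ g) ⊜ g) refl x g) (mul sG gx (M⊆G _ (proj₁ d)))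
     ; ¬Mg = λ mg → ¬x (move M (solve 2 (λ x g → g :∙ (x :⁻ :∙ g) :⁻ ⊜ x) refl x g) (mul sM mg (inv sM (proj₁ d))))
     ; normal = n ; square = q²
     ; no-involution = λ k mk e → no-inv (x ⁻ · g · k) (mul sM (proj₁ d) mk)
      (trans (solve 3 (λ x g k → x :∙ (x :⁻ :∙ g :∙ k) :∙ (x :∙ (x :⁻ :∙ g :∙ k)) ⊜ g :∙ k :∙ (g :∙ k)) refl x g k) e) }

   -- The conjugate mxm⁻¹ lies in mxM = rM, so it carries the Sylow subgroup into M because r does;
   -- conjugation by m ∈ M preserves the other properties of x.
   translate-obstruction : (s : SylowTwo M) → ∀ x m r → G x → ¬ M x → M (x · x) →
    (∀ m → M m → (x · m) · (x · m) ≢ ε) → M m → SameCoset M (m · x) r → (∀ p → SylowTwo.Syl s p → M (conj r p)) →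
    Obstruction G M
   translate-obstruction s x m r gx ¬x x² no-inv mm mxr f = sylow-obstruction s (m · x · m ⁻)
    (mul sG (mul sG (M⊆G m mm) gx) (M⊆G _ (inv sM mm)))
    (λ mx → ¬x (move M (solve 2 (λ m x → m :⁻ :∙ (m :∙ x :∙ m :⁻) :∙ m ⊜ x) refl m x) (mul sM (mul sM (inv sM mm) mx) mm)))
    (move M (solve 2 (λ m x → m :∙ (x :∙ x) :∙ m :⁻ ⊜ m :∙ x :∙ m :⁻ :∙ (m :∙ x :∙ m :⁻)) refl m x) (mul sM (mul sM mm x²) (inv sM mm)))
    (λ k mk e → no-inv (m ⁻ · k · m) (mul sM (mul sM (inv sM mm) mk) mm)
     (trans (solve 3 (λ m x k → x :∙ (m :⁻ :∙ k :∙ m) :∙ (x :∙ (m :⁻ :∙ k :∙ m)) ⊜ m :⁻ :∙ (m :∙ x :∙ m :⁻ :∙ k :∙ (m :∙ x :∙ m :⁻ :∙ k)) :∙ m) refl m x k)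
      (trans (cong (conj m) e) (solve 1 (λ m → m :⁻ :∙ :ε :∙ m ⊜ :ε) refl m))))
    λ p pp → move M (solve 4 (λ r m x p → (r :⁻ :∙ (m :∙ x :∙ m :⁻)) :⁻ :∙ (r :⁻ :∙ p :∙ r) :∙ (r :⁻ :∙ (m :∙ x :∙ m :⁻)) ⊜ (m :∙ x :∙ m :⁻) :⁻ :∙ p :∙ (m :∙ x :∙ m :⁻)) refl r m x p)
     (mul sM (mul sM (inv sM rx) (f p pp)) rx)
    where
    rx : SameCoset M r (m · x · m ⁻)
    rx = same-trans (same-sym mxr) (same-mulʳ (m · x) (inv sM mm))

   -- If every critical coset contained an involution, M would be a perfect code; so some xM
   -- contains none. A Sylow 2-subgroup of M acts on the odd number of left cosets in MxM, and a
   -- fixed coset rM tells which conjugate of x to take.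
   obstruction : ¬ PerfectCode G M → Obstruction G M
   obstruction npc = from-bad (dne λ none → npc (perfectCode sG sM M⊆G λ x gx nx x² o →
    dne λ ni → none (x , gx , nx , x² , o , λ m mm e → ni (m , mm , e))))
    where
    from-fixed : ∀ x → G x → ¬ M x → M (x · x) → (∀ m → M m → (x · m) · (x · m) ≢ ε) → (s : SylowTwo M) →
     (∃ λ r → Double sG sM M⊆G x r × (∀ p → SylowTwo.Syl s p → M (conj r p))) → Obstruction G M
    from-fixed x gx nx x² ni s (r , (m , mm , mxr) , f) = translate-obstruction s x m r gx nx x² ni mm mxr f
    from-bad : (∃ λ x → G x × ¬ M x × M (x · x) × Odd (doubleIndex sG sM M⊆G x) × (∀ m → M m → (x · m) · (x · m) ≢ ε)) → Obstruction G M
    from-bad (x , gx , nx , x² , o , ni) = from-fixed x gx nx x² ni s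
     (odd-coset-fixed sM two (double-invariant sG sM M⊆G x)
      (λ p u pp d → double-trans sG sM M⊆G d (p , ⊆M p pp , move M (sym (inverseˡ (p · u))) (unit sM))) o)
     where
     s : SylowTwo M
     s = sylow-exists sM
     open SylowTwo s

   -- t is an involution of the coset xM; it lies in x(M ∩ xMx⁻¹), and acts on an odd number of cosets of Q ∪ xQ.
   involution-in-coset : ∀ {Q} (sQ : Subgroup Q) → Q ⊆ M → Odd (index sQ M) → ∀ x → ¬ M x →
    Normalizes x Q → Q (x · x) → ∀ t → M (x ⁻ · t) → t · t ≡ ε → ∃ λ q → Q q × (x · q) · (x · q) ≡ ε
   involution-in-coset {Q} sQ Q⊆M o x ¬x n x²Q t Mk t²≡ε = finish (odd-coset-fixed sP two-t (Cosets.subgroup-invariant sP sH P⊆H) (λ p u pp → mul sH (C2⊆H p pp)) odd-H)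
    where
    x² : M (x · x)
    x² = Q⊆M _ x²Q
    D : Pred
    D = Conjugate∩ M x
    sD : Subgroup D
    sD = conjugate∩-subgroup sM x
    Q⊆D : Q ⊆ D
    Q⊆D q qq = Q⊆M q qq , Q⊆M _ (n q qq)
    tower : index sQ M ≡ index sD M * index sQ D
    tower = index-tower sQ sD sM Q⊆D (λ _ → proj₁)
    Dk : D (x ⁻ · t)
    Dk = Mk , move M (trans (solve 2 (λ x t → (x :∙ x) :⁻ :∙ (x :⁻ :∙ t) :⁻ ⊜ x :⁻ :∙ (x :⁻ :∙ t :⁻) :∙ x) refl x t)
     (cong (λ z → x ⁻ · (x ⁻ · z) · x) (invol-inv t²≡ε)))
     (mul sM (inv sM x²) (inv sM Mk))
    D-norm : Normalizes x D
    D-norm = conjugate∩-normalizes sM x²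
    x²D : D (x · x)
    x²D = Q⊆D _ x²Q
    H : Pred
    H = Adjoin D x
    sH : Subgroup H
    sH = adjoin-subgroup sD x D-norm x²D
    P : Pred
    P = Adjoin Q x
    sP : Subgroup P
    sP = adjoin-subgroup sQ x n x²Q
    P⊆H : P ⊆ H
    P⊆H p = [ inj₁ ∘ Q⊆D p , inj₂ ∘ Q⊆D _ ]′
    odd-H : Odd (index sP H)
    odd-H = subst Odd (*-cancelʳ-≡ _ _ (# P) {{order-pos sP}} (trans (trans
     (cong (index sQ D *_) (adjoin-order sQ x (¬x ∘ Q⊆M x)))
     (trans (*-distribˡ-+ (index sQ D) _ _) (cong₂ _+_ (sym (lagrange sQ sD Q⊆D)) (sym (lagrange sQ sD Q⊆D)))))
     (trans (sym (adjoin-order sD x (¬x ∘ proj₁))) (lagrange sP sH P⊆H))))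
     (odd-*ʳ (index sD M) _ (subst Odd tower o))
    Ht : H t
    Ht = inj₂ Dk
    C2 : Pred
    C2 = Adjoin (_≡ ε) t
    trivial-two : TwoGroup (_≡ ε)
    trivial-two = trivial (record { unit = refl ; mul = λ { refl refl → identityˡ ε } ; inv = λ { refl → solve 0 (:ε :⁻ ⊜ :ε) refl } }) (λ _ → id)
    two-t : TwoGroup C2
    two-t = two-adjoin trivial-two t (λ { y refl → solve 1 (λ t → t :⁻ :∙ :ε :∙ t ⊜ :ε) refl t }) t²≡ε
    Ct : C2 t
    Ct = inj₂ (inverseˡ t)
    C2⊆H : C2 ⊆ H
    C2⊆H y (inj₁ refl) = unit sH
    C2⊆H y (inj₂ e) = move H (trans (sym (identityʳ t)) (trans (cong (t ·_) (sym e)) (solve 2 (λ t y → t :∙ (t :⁻ :∙ y) ⊜ y) refl t y))) Ht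
    t∈M : ∀ h → H h → Q (conj h t) → M t
    t∈M h (inj₁ d) q = move M (solve 2 (λ h t → h :∙ (h :⁻ :∙ t :∙ h) :∙ h :⁻ ⊜ t) refl h t) (mul sM (mul sM (proj₁ d) (Q⊆M _ q)) (inv sM (proj₁ d)))
    t∈M h (inj₂ d) q = move M (solve 3 (λ x h t → x :∙ (x :⁻ :∙ h :∙ (h :⁻ :∙ t :∙ h) :∙ (x :⁻ :∙ h) :⁻) :∙ x :⁻ ⊜ t) refl x h t)
     (proj₁ (normalizes-conj⁻ x D-norm _ (mul sD (mul sD d (Q⊆D _ q)) (inv sD d))))
    finish : (∃ λ h → H h × (∀ p → C2 p → P (conj h p))) → ∃ λ q → Q q × (x · q) · (x · q) ≡ ε
    finish (h , Hh , f) with f t Ct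
    ... | inj₂ q = x ⁻ · conj h t , q , trans (cong (λ z → z · z) (solve 2 (λ x y → x :∙ (x :⁻ :∙ y) ⊜ y) refl x (conj h t))) (conj-square-one h t t²≡ε)
    ... | inj₁ q = ⊥-elim (¬x (move M (solve 2 (λ x t → t :∙ (x :⁻ :∙ t) :⁻ ⊜ x) refl x t) (mul sM (t∈M h Hh q) (inv sM Mk))))

   -- Send rM to s⁻¹M, where s is the element of S in rM. As x² ∈ M, this is an involution on the
   -- left cosets in MxM, whose number |M : M ∩ xMx⁻¹| divides the odd |M : Q|. At a fixed coset s =
   -- s⁻¹, and conjugation by an element of M brings s into xM.
   involution-of-code : PerfectCode G M → ∀ {Q} (sQ : Subgroup Q) → Q ⊆ M → Odd (index sQ M) → ∀ x → G x → ¬ M x →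
    Normalizes x Q → Q (x · x) → ∃ λ q → Q q × (x · q) · (x · q) ≡ ε
   involution-of-code code {Q} sQ Q⊆M o x gx ¬x n x²Q = finish (odd-witness (odd-fixed f closed invol odd-double))
    where
    open PerfectCode code
    Dbl : X → Pred
    Dbl = Double sG sM M⊆G
    x² : M (x · x)
    x² = Q⊆M _ x²Q
    D : Pred
    D = Conjugate∩ M x
    sD : Subgroup D
    sD = conjugate∩-subgroup sM x
    Q⊆D : Q ⊆ D
    Q⊆D q qq = Q⊆M q qq , Q⊆M _ (n q qq)
    tower : index sQ M ≡ index sD M * index sQ D
    tower = index-tower sQ sD sM Q⊆D (λ _ → proj₁)
    -- Orbit and stabilizer: m ↦ mxM induces a bijection from the cosets of M ∩ xMx⁻¹ in M to the
    -- left cosets in MxM.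
    double-index : index sD M ≡ doubleIndex sG sM M⊆G x
    double-index = #-bij (λ m → rep (m · x))
     (λ m (mm , _) → (m , mm , same-rep (m · x)) , rep-idem (m · x))
     (λ m k (mm , rm) (mk , rk) eq → Cosets.rep-unique sD rm rk
      (mul sM (inv sM mm) mk , move M (solve 3 (λ m k x → (m :∙ x) :⁻ :∙ (k :∙ x) ⊜ x :⁻ :∙ (m :⁻ :∙ k) :∙ x) refl m k x) (rep-same eq)))
     λ r ((m , mm , p) , ir) → let (m′ , i′) = Cosets.invariant-rep sD (Cosets.subgroup-invariant sD sM (λ _ → proj₁)) mm in
      Cosets.rep sD m , (m′ , i′) , trans (rep-cong (same-trans
       (move M (solve 3 (λ m k x → x :⁻ :∙ (k :⁻ :∙ m) :∙ x ⊜ (k :∙ x) :⁻ :∙ (m :∙ x)) refl m (Cosets.rep sD m) x)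
        (proj₂ (Cosets.same-sym sD (Cosets.same-rep sD m)))) p)) ir
    odd-double : Odd (doubleIndex sG sM M⊆G x)
    odd-double = subst Odd double-index (odd-*ˡ _ _ (subst Odd tower o))
    Met : X → Pred
    Met r s = S s × M (r ⁻ · s)
    section : X → X
    section r = pick (Met r) r
    met : ∀ {r} → Dbl x r → Met r (section r)
    met {r} d = pick-spec (Met r) r (meets r (double-G sG sM M⊆G d gx) λ mr → ¬x (double-M sG sM M⊆G d mr))
    x-x⁻ : Dbl x (x ⁻)
    x-x⁻ = same-double sG sM M⊆G (move M (solve 1 (λ x → (x :∙ x) :⁻ ⊜ x :⁻ :∙ x :⁻) refl x) (inv sM x²))
    met-double : ∀ {r} → Dbl x r → Dbl x (section r ⁻)
    met-double d = double-trans sG sM M⊆G x-x⁻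
     (double-inv sG sM M⊆G (double-trans sG sM M⊆G d (same-double sG sM M⊆G (proj₂ (met d)))))
    f : X → X
    f r = rep (section r ⁻)
    closed : ∀ r → Dbl x r × IsRep r → Dbl x (f r) × IsRep (f r)
    closed r (d , _) = invariant-rep (double-invariant sG sM M⊆G x) (met-double d)
    invol : ∀ r → Dbl x r × IsRep r → f (f r) ≡ r
    invol r (d , ir) = trans (rep-cong (move M (cong (λ z → z ⁻ · r) (sym (trans (cong _⁻ same) (⁻¹-involutive _)))) (same-sym (proj₂ (met d))))) ir
     where
     same : section (f r) ≡ section r ⁻
     same = meets-once (proj₁ (met (proj₁ (closed r (d , ir))))) (S⁻ (proj₁ (met d)))
      (same-trans (same-sym (proj₂ (met (proj₁ (closed r (d , ir)))))) (same-sym (same-rep (section r ⁻))))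
    fixed-involution : ∀ r → Dbl x r → f r ≡ r → IsRep r → section r · section r ≡ ε
    fixed-involution r d e ir = trans (cong (_· section r) (meets-once (proj₁ (met d)) (S⁻ (proj₁ (met d)))
     (same-trans (same-sym (proj₂ (met d))) (same-sym (rep-same (trans e (sym ir))))))) (inverseˡ (section r))
    from-section : ∀ s → s · s ≡ ε → Dbl x s → ∃ λ q → Q q × (x · q) · (x · q) ≡ ε
    from-section s e (m , mm , p) = involution-in-coset sQ Q⊆M o x ¬x n x²Q (conj m s)
     (move M (solve 3 (λ m x s → (m :∙ x) :⁻ :∙ s :∙ m ⊜ x :⁻ :∙ (m :⁻ :∙ s :∙ m)) refl m x s) (mul sM p mm))
     (conj-square-one m s e)
    finish : (∃ λ r → (Dbl x r × IsRep r) × f r ≡ r) → ∃ λ q → Q q × (x · q) · (x · q) ≡ ε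
    finish (r , (d , ir) , e) = from-section (section r) (fixed-involution r d e ir)
     (double-trans sG sM M⊆G d (same-double sG sM M⊆G (proj₂ (met d))))

-- Reduction to the socle, and the Frobenius structure of M ∩ T.

module FrobeniusComplements where

 open import Data.Nat using (ℕ; suc; _+_; _*_)
 open import Data.Nat.Properties
 open import Data.Fin using (Fin)
 open Parity
 open Counting
 open Groups
 open Codes
 open Criteria

 module Factorisation (em : (P : Set) → Dec P) {N : ℕ} {_∙_ : Fin N → Fin N → Fin N} {ε : Fin N}
  {_⁻¹ : Fin N → Fin N} (isGroup : IsGroup _≡_ _∙_ ε _⁻¹) where

  open Classical em
  open FiniteGroup em isGroup
  open CodeCriteria em isGroup

  -- Since H = AB, the map a ↦ aB induces a bijection from the cosets of A ∩ B in A to those of B in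
  -- H.
  index-product : ∀ {A B H} (sA : Subgroup A) (sB : Subgroup B) → Subgroup H → A ⊆ H → B ⊆ H →
   (∀ h → H h → ∃ λ a → A a × B (a ⁻ · h)) → index (∩-subgroup sA sB) A ≡ index sB H
  index-product {A} {B} sA sB sH A⊆H B⊆H f = #-bij (Cosets.rep sB)
   (λ a (aa , _) → Cosets.invariant-rep sB (Cosets.subgroup-invariant sB sH B⊆H) (A⊆H a aa))
   (λ a c (aa , ra) (ac , rc) eq → Cosets.rep-unique sAB ra rc (mul sA (inv sA aa) ac , Cosets.rep-same sB eq))
   λ h (hh , rh) → let (a , aa , p) = f h hh in
    Cosets.rep sAB a , Cosets.invariant-rep sAB (Cosets.subgroup-invariant sAB sA (λ _ → proj₁)) aa ,
    trans (Cosets.rep-cong sB (Cosets.same-trans sB (proj₂ (Cosets.same-sym sAB (Cosets.same-rep sAB a))) p)) rh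
   where
   sAB : Subgroup (λ x → A x × B x)
   sAB = ∩-subgroup sA sB

  Product : Pred → Pred → Pred
  Product Q T y = ∃ λ q → Q q × T (q ⁻ · y)

  module _ {T : Pred} (sT : Subgroup T) (T-normal : ∀ g → Normalizes g T) where

   product-subgroup : ∀ {Q} → Subgroup Q → Subgroup (Product Q T)
   product-subgroup sQ = record
    { unit = ε , unit sQ , move T (solve 0 (:ε ⊜ :ε :⁻ :∙ :ε) refl) (unit sT)
    ; mul = λ {x} {y} (q , qq , t) (r , rr , u) → q · r , mul sQ qq rr ,
     move T (solve 4 (λ q r x y → r :⁻ :∙ (q :⁻ :∙ x) :∙ r :∙ (r :⁻ :∙ y) ⊜ (q :∙ r) :⁻ :∙ (x :∙ y)) refl q r x y)
      (mul sT (T-normal r _ t) u)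
    ; inv = λ {x} (q , qq , t) → q ⁻ , inv sQ qq ,
     move T (solve 2 (λ q x → q :⁻ :⁻ :∙ (q :⁻ :∙ x) :⁻ :∙ q :⁻ ⊜ q :⁻ :⁻ :∙ x :⁻) refl q x) (T-normal (q ⁻) _ (inv sT t)) }

   product-normalizes : ∀ {Q} g → Normalizes g Q → Normalizes g (Product Q T)
   product-normalizes g n y (q , qq , t) = conj g q , n q qq ,
    move T (solve 3 (λ g q y → g :⁻ :∙ (q :⁻ :∙ y) :∙ g ⊜ (g :⁻ :∙ q :∙ g) :⁻ :∙ (g :⁻ :∙ y :∙ g)) refl g q y) (T-normal g _ t)

   product-left : ∀ {Q} q → Q q → Product Q T q
   product-left q qq = q , qq , move T (sym (inverseˡ q)) (unit sT)

   -- An obstruction whose element x lies in T.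
   record SocleObstruction (M : Pred) : Set₁ where
    field
     Syl : Pred
     two : TwoGroup Syl
     Syl⊆M : Syl ⊆ M
     -- M ∩ T ∩ Syl has odd index in M ∩ T; M₀ is any predicate equivalent to M ∩ T.
     odd-T : ∀ {M₀} (sM₀ : Subgroup M₀) → (∀ y → M₀ y → M y × T y) → (∀ y → M y → T y → M₀ y) →
      Odd (index (∩-subgroup sM₀ (sub₂ two)) M₀)
     x : X
     Tx : T x
     ¬Mx : ¬ M x
     normal : Normalizes x Syl
     square : Syl (x · x)
     no-involution : ∀ m → M m → (x · m) · (x · m) ≢ ε

   module _ {G M : Pred} (sG : Subgroup G) (sM : Subgroup M) (M⊆G : M ⊆ G) (T⊆G : T ⊆ G)
    (G⊆MT : ∀ g → G g → ∃ λ m → M m × T (m ⁻ · g)) where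

    -- With Q for `Syl`, G = MT gives |G : QT| = |M : M ∩ QT|, a divisor of the odd |M : Q|. As g
    -- normalizes QT and g² ∈ QT, it lies in QT. Write g = qx with q ∈ Q and x ∈ T; the properties
    -- of g pass to x.
    socle-obstruction : Obstruction G M → SocleObstruction M
    socle-obstruction o = build (odd-index-norm sQT sG QT⊆G odd-QT g Gg (product-normalizes g normal) (product-left _ square))
     where
     open Obstruction o
     sQ : Subgroup Syl
     sQ = sub₂ two
     QT : Pred
     QT = Product Syl T
     sQT : Subgroup QT
     sQT = product-subgroup sQ
     QT⊆G : QT ⊆ G
     QT⊆G y (q , qq , t) = move G (solve 2 (λ q y → q :∙ (q :⁻ :∙ y) ⊜ y) refl q y) (mul sG (M⊆G q (Syl⊆M q qq)) (T⊆G _ t))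
     sMQ : Subgroup (λ y → M y × QT y)
     sMQ = ∩-subgroup sM sQT
     Q⊆MQ : Syl ⊆ (λ y → M y × QT y)
     Q⊆MQ q qq = Syl⊆M q qq , product-left q qq
     tower : index sQ M ≡ index sMQ M * index sQ (λ y → M y × QT y)
     tower = index-tower sQ sMQ sM Q⊆MQ (λ _ → proj₁)
     odd-QT : Odd (index sQT G)
     odd-QT = subst Odd (index-product sM sQT sG M⊆G QT⊆G (λ h Gh → let (m , mm , t) = G⊆MT h Gh in
      m , mm , ε , unit sQ , move T (solve 2 (λ m h → m :⁻ :∙ h ⊜ :ε :⁻ :∙ (m :⁻ :∙ h)) refl m h) t)) (odd-*ˡ _ _ (subst Odd tower odd-index))
     odd-T : ∀ {M₀} (sM₀ : Subgroup M₀) → (∀ y → M₀ y → M y × T y) → (∀ y → M y → T y → M₀ y) → Odd (index (∩-subgroup sM₀ sQ) M₀)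
     odd-T {M₀} sM₀ to from = subst Odd (sym (index-product sM₀ sQ sMQ
      (λ y m → proj₁ (to y m) , ε , unit sQ , move T (solve 1 (λ y → y ⊜ :ε :⁻ :∙ y) refl y) (proj₂ (to y m)))
      Q⊆MQ
      λ h (mh , (q , qq , t)) → h · q ⁻ ,
       from _ (mul sM mh (inv sM (Syl⊆M q qq)))
        (move T (solve 2 (λ h q → q :⁻ :⁻ :∙ (q :⁻ :∙ h) :∙ q :⁻ ⊜ h :∙ q :⁻) refl h q) (T-normal (q ⁻) _ t)) ,
       move Syl (solve 2 (λ h q → q ⊜ (h :∙ q :⁻) :⁻ :∙ h) refl h q) qq))
      (odd-*ʳ (index sMQ M) _ (subst Odd tower odd-index))
     build : QT g → SocleObstruction M
     build (q , qq , t) = record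
      { Syl = Syl ; two = two ; Syl⊆M = Syl⊆M ; odd-T = odd-T ; x = q ⁻ · g ; Tx = t
      ; ¬Mx = λ m → ¬Mg (move M (solve 2 (λ q g → q :∙ (q :⁻ :∙ g) ⊜ g) refl q g) (mul sM (Syl⊆M q qq) m))
      ; normal = λ y yy → move Syl (solve 3 (λ q g y → g :⁻ :∙ (q :∙ y :∙ q :⁻) :∙ g ⊜ (q :⁻ :∙ g) :⁻ :∙ y :∙ (q :⁻ :∙ g)) refl q g y)
       (normal _ (mul sQ (mul sQ qq yy) (inv sQ qq)))
      ; square = move Syl (solve 2 (λ q g → q :⁻ :∙ (g :∙ g :∙ (g :⁻ :∙ q :⁻ :∙ g)) ⊜ q :⁻ :∙ g :∙ (q :⁻ :∙ g)) refl q g)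
       (mul sQ (inv sQ qq) (mul sQ square (normal _ (inv sQ qq))))
      ; no-involution = λ m mm e → no-involution (conj g (q ⁻) · m) (mul sM (Syl⊆M _ (normal _ (inv sQ qq))) mm)
       (trans (cong (λ z → z · z) (solve 3 (λ q g m → g :∙ (g :⁻ :∙ q :⁻ :∙ g :∙ m) ⊜ q :⁻ :∙ g :∙ m) refl q g m)) e) }

   -- Cm is the relation "commute as matrices"; elements of T which commute without being related are involutions.
   record Commutation (Cm : X → X → Set) : Set where
    field
     cm-sym : ∀ {a b} → T a → T b → Cm a b → Cm b a
     cm-trans : ∀ {a b c} → T a → T b → T c → b ≢ ε → Cm a b → Cm b c → Cm a c
     cm-comm : ∀ {a b} → T a → T b → Cm a b → a · b ≡ b · a
     comm-cm : ∀ {a b} → T a → T b → a · b ≡ b · a → Cm a b ⊎ (a · a ≡ ε × b · b ≡ ε)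
     cm-mul : ∀ {a b c} → T a → T b → T c → Cm a c → Cm b c → Cm (a · b) c
     cm-inv : ∀ {a c} → T a → T c → Cm a c → Cm (a ⁻) c
     cm-one : ∀ {c} → T c → Cm ε c
     cm-refl : ∀ {c} → T c → Cm c c
     cm-conj : ∀ g {a b} → T a → T b → Cm a b → Cm (conj g a) (conj g b)
     cm-involution : ∀ {a b} → T a → T b → a · a ≡ ε → b · b ≡ ε → a ≢ ε → b ≢ ε → Cm a b → a ≡ b

   module Frobenius {M M₀ : Pred} (sM : Subgroup M) (sM₀ : Subgroup M₀) (M₀⊆ : ∀ y → M₀ y → M y × T y)
    (⊆M₀ : ∀ y → M y → T y → M₀ y) {Cm : X → X → Set} (commutation : Commutation Cm) where
    open Commutation commutation

    M₀⊆T : M₀ ⊆ T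
    M₀⊆T y m = proj₂ (M₀⊆ y m)

    M₀-conj : ∀ {m y} → M m → M₀ y → M₀ (conj m y)
    M₀-conj {m} {y} mm my = ⊆M₀ _ (mul sM (mul sM (inv sM mm) (proj₁ (M₀⊆ y my))) mm) (T-normal m y (M₀⊆T y my))

    record CentralInvolution (o : SocleObstruction M) : Set where
     open SocleObstruction o
     field
      w : X
      M₀w : M₀ w
      w≢ε : w ≢ ε
      w² : w · w ≡ ε
      Cm-x : Cm x w
      Cm-Syl : ∀ r → Syl r → T r → Cm r w

    -- With Q for `Syl`, P = Q ∪ xQ is a 2-group and P ∩ T has even order, hence an odd number of
    -- involutions; conjugation by P fixes one of them, w. It lies in Q because xM contains no
    -- involution. For the same reason neither x nor xr with r ∈ Q ∩ T is an involution, so both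
    -- commute with w as matrices, and then so does r.
    central-involution : (o : SocleObstruction M) → CentralInvolution o
    central-involution o = build (odd-witness (proj₁ (fixed-parity two-P closed comp one) odd-inv))
     where
     open SocleObstruction o
     sQ : Subgroup Syl
     sQ = sub₂ two
     Q₀ : Pred
     Q₀ y = Syl y × T y
     sQ₀ : Subgroup Q₀
     sQ₀ = ∩-subgroup sQ sT
     x²≢ε : x · x ≢ ε
     x²≢ε e = no-involution ε (unit sM) (trans (cong₂ _·_ (identityʳ x) (identityʳ x)) e)
     P R : Pred
     P = Adjoin Syl x
     R y = P y × T y
     two-P : TwoGroup P
     two-P = two-adjoin two x normal square
     sP : Subgroup P
     sP = sub₂ two-P
     sR : Subgroup R
     sR = ∩-subgroup sP sT
     Px : P x
     Px = inj₂ (move Syl (sym (inverseˡ x)) (unit sQ))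
     even-R : Even (# R)
     even-R = # Q₀ , trans (#-cong to from) (adjoin-order sQ₀ x (λ (q , _) → ¬Mx (Syl⊆M x q)))
      where
      to : ∀ y → R y → Adjoin Q₀ x y
      to y (inj₁ q , t) = inj₁ (q , t)
      to y (inj₂ q , t) = inj₂ (q , mul sT (inv sT Tx) t)
      from : ∀ y → Adjoin Q₀ x y → R y
      from y (inj₁ (q , t)) = inj₁ q , t
      from y (inj₂ (q , t)) = inj₂ q , move T (solve 2 (λ x y → x :∙ (x :⁻ :∙ y) ⊜ y) refl x y) (mul sT Tx t)
     Inv : Pred
     Inv y = (R y × y ⁻ ≡ y) × y ≢ ε
     odd-inv : Odd (# Inv)
     odd-inv = ¬even⇒odd λ e → even-odd-⊥ (even-fixed _⁻ (λ y → inv sR) (λ y _ → ⁻¹-involutive y) even-R)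
      (subst Odd (sym (#-remove ε (unit sR , solve 0 (:ε :⁻ ⊜ :ε) refl))) (suc-even e))
     act : X → X → X
     act p y = p · y · p ⁻
     closed : ∀ p y → P p → Inv y → Inv (act p y)
     closed p y Pp (((Py , Ty) , e) , ne) = ((mul sP (mul sP Pp Py) (inv sP Pp) ,
      move T (cong (λ z → z · y · p ⁻) (⁻¹-involutive p)) (T-normal (p ⁻) y Ty)) ,
      trans (solve 2 (λ p y → (p :∙ y :∙ p :⁻) :⁻ ⊜ p :∙ y :⁻ :∙ p :⁻) refl p y) (cong (λ z → p · z · p ⁻) e)) ,
      λ f → ne (trans (solve 2 (λ p y → y ⊜ p :⁻ :∙ (p :∙ y :∙ p :⁻) :∙ p) refl p y)
       (trans (cong (conj p) f) (solve 1 (λ p → p :⁻ :∙ :ε :∙ p ⊜ :ε) refl p)))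
     comp : ∀ p q y → P p → P q → Inv y → act p (act q y) ≡ act (p · q) y
     comp p q y _ _ _ = solve 3 (λ p q y → p :∙ (q :∙ y :∙ q :⁻) :∙ p :⁻ ⊜ p :∙ q :∙ y :∙ (p :∙ q) :⁻) refl p q y
     one : ∀ y → Inv y → act ε y ≡ y
     one y _ = solve 1 (λ y → :ε :∙ y :∙ :ε :⁻ ⊜ y) refl y
     open FixedPoints Inv act
     build : ∃ (Fixed P) → CentralInvolution o
     build (w , (((Pw , Tw) , e) , ne) , f) = record
      { w = w ; M₀w = ⊆M₀ w (Syl⊆M w Qw) Tw ; w≢ε = ne ; w² = w² ; Cm-x = Cm-x ; Cm-Syl = Cm-r }
      where
      w² : w · w ≡ ε
      w² = trans (cong (_· w) (sym e)) (inverseˡ w)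
      commutes : ∀ p → P p → p · w ≡ w · p
      commutes p Pp = trans (solve 2 (λ p w → p :∙ w ⊜ p :∙ w :∙ p :⁻ :∙ p) refl p w) (cong (_· p) (f p Pp))
      Qw : Syl w
      Qw = [ id , outside ]′ Pw
       where
       outside : Syl (x ⁻ · w) → Syl w
       outside q = ⊥-elim (no-involution (x ⁻ · w) (Syl⊆M _ q)
        (trans (cong (λ z → z · z) (solve 2 (λ x w → x :∙ (x :⁻ :∙ w) ⊜ w) refl x w)) w²))
      Cm-x : Cm x w
      Cm-x with comm-cm Tx Tw (commutes x Px)
      ... | inj₁ c = c
      ... | inj₂ (e , _) = ⊥-elim (x²≢ε e)
      Cm-r : ∀ r → Syl r → T r → Cm r w
      Cm-r r q t with comm-cm (mul sT Tx t) Tw (commutes _ (mul sP Px (inj₁ q)))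
      ... | inj₂ (e , _) = ⊥-elim (no-involution r (Syl⊆M r q) e)
      ... | inj₁ c = subst (λ z → Cm z w) (solve 2 (λ x r → x :⁻ :∙ (x :∙ r) ⊜ r) refl x r)
       (cm-mul (inv sT Tx) (mul sT Tx t) Tw (cm-inv Tx Tw Cm-x) c)

    module _ (o : SocleObstruction M) (ci : CentralInvolution o) where
     open SocleObstruction o
     open CentralInvolution ci

     Tw : T w
     Tw = M₀⊆T w M₀w

     -- Otherwise ⟨w,s⟩ is a Klein four-group, and it fixes one of the oddly many cosets of M₀ ∩ Syl in M₀.
     centralizer-cm : ∀ s → M₀ s → s · w ≡ w · s → Cm s w
     centralizer-cm s M₀s e with comm-cm (M₀⊆T s M₀s) Tw e
     ... | inj₁ c = c
     ... | inj₂ (s² , _) = dne λ n → contra n (odd-coset-fixed sQ₀ two-V (Cosets.subgroup-invariant sQ₀ sM₀ (λ _ → proj₁))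
      (λ p u pp → mul sM₀ (V⊆M₀ p pp)) (odd-T sM₀ M₀⊆ ⊆M₀))
      where
      sQ₀ : Subgroup (λ y → M₀ y × Syl y)
      sQ₀ = ∩-subgroup sM₀ (sub₂ two)
      C : Pred
      C = Adjoin (_≡ ε) w
      V : Pred
      V = Adjoin C s
      two-C : TwoGroup C
      two-C = two-adjoin (trivial (record { unit = refl ; mul = λ { refl refl → identityˡ ε } ; inv = λ { refl → solve 0 (:ε :⁻ ⊜ :ε) refl } }) (λ _ → id))
       w (λ { y refl → solve 1 (λ t → t :⁻ :∙ :ε :∙ t ⊜ :ε) refl w }) w²
      Cw : C w
      Cw = inj₂ (inverseˡ w)
      C-cases : ∀ y → C y → y ≡ ε ⊎ y ≡ w
      C-cases y (inj₁ e) = inj₁ e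
      C-cases y (inj₂ e) = inj₂ (trans (solve 2 (λ w y → y ⊜ w :∙ (w :⁻ :∙ y)) refl w y) (trans (cong (w ·_) e) (identityʳ w)))
      C-norm : Normalizes s C
      C-norm y c with C-cases y c
      ... | inj₁ refl = inj₁ (solve 1 (λ t → t :⁻ :∙ :ε :∙ t ⊜ :ε) refl s)
      ... | inj₂ refl = move C (sym (conj-commute (sym e))) Cw
      two-V : TwoGroup V
      two-V = two-adjoin two-C s C-norm (inj₁ s²)
      C⊆M₀ : C ⊆ M₀
      C⊆M₀ y c with C-cases y c
      ... | inj₁ refl = unit sM₀
      ... | inj₂ refl = M₀w
      V⊆M₀ : V ⊆ M₀
      V⊆M₀ y (inj₁ c) = C⊆M₀ y c
      V⊆M₀ y (inj₂ c) = move M₀ (solve 2 (λ s y → s :∙ (s :⁻ :∙ y) ⊜ y) refl s y) (mul sM₀ M₀s (C⊆M₀ _ c))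
      s≢ε : ¬ Cm s w → s ≢ ε
      s≢ε n refl = n (cm-one Tw)
      conj-≢ : ∀ h y → y ≢ ε → conj h y ≢ ε
      conj-≢ h y ne f = ne (conj-injective h y ε (trans f (solve 1 (λ h → :ε ⊜ h :⁻ :∙ :ε :∙ h) refl h)))
      contra : ¬ Cm s w → (∃ λ h → M₀ h × (∀ p → V p → M₀ (conj h p) × Syl (conj h p))) → ⊥
      contra n (h , M₀h , f) = n (subst (λ z → Cm z w) (conj-injective h w s (trans (to-w w Cw' w≢ε w²) (sym (to-w s Vs (s≢ε n) s²)))) (cm-refl Tw))
       where
       Cw' : V w
       Cw' = inj₁ Cw
       Vs : V s
       Vs = inj₂ (move C (sym (inverseˡ s)) (inj₁ refl))
       -- The conjugates of w and of s by h are involutions in Syl ∩ T. These commute with w as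
       -- matrices, so both are equal to w.
       to-w : ∀ y → V y → y ≢ ε → y · y ≡ ε → conj h y ≡ w
       to-w y Vy ne e = let (m , q) = f y Vy in
        cm-involution (M₀⊆T _ m) Tw (conj-square-one h y e) w² (conj-≢ h y ne) w≢ε (Cm-Syl _ q (M₀⊆T _ m))

     -- By `centralizer-cm` this is the whole centralizer of w in M₀. It takes the part of the
     -- Frobenius complement.
     A : Pred
     A y = M₀ y × Cm y w

     sA : Subgroup A
     sA = record
      { unit = unit sM₀ , cm-one Tw
      ; mul = λ (m , c) (n , d) → mul sM₀ m n , cm-mul (M₀⊆T _ m) (M₀⊆T _ n) Tw c d
      ; inv = λ (m , c) → inv sM₀ m , cm-inv (M₀⊆T _ m) Tw c }

     A-w : ∀ {y} → A y → y · y ≡ ε → y ≢ ε → y ≡ w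
     A-w (m , c) e ne = cm-involution (M₀⊆T _ m) Tw e w² ne w≢ε c

     conj-w² : ∀ g → conj g w · conj g w ≡ ε
     conj-w² g = conj-square-one g w w²

     conj-ε : ∀ g → conj g ε ≡ ε
     conj-ε g = solve 1 (λ g → g :⁻ :∙ :ε :∙ g ⊜ :ε) refl g

     conj-≢ε : ∀ g {y} → y ≢ ε → conj g y ≢ ε
     conj-≢ε g ne f = ne (conj-injective g _ ε (trans f (sym (conj-ε g))))

     -- The conjugate of w by g commutes with that of a, which is nontrivial and commutes with w. By
     -- transitivity the two involutions commute as matrices, so they coincide and g centralizes w.
     trivial-intersection : ∀ g → M₀ g → ∀ a → A a → a ≢ ε → A (conj g a) → A g
     trivial-intersection g M₀g a (m , c) ne (m′ , c′) = M₀g , centralizer-cm g M₀g (sym (commute-conj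
      (cm-involution Tgw Tw (conj-w² g) w² (conj-≢ε g w≢ε) w≢ε
       (cm-trans Tgw Tga Tw (conj-≢ε g ne) (cm-sym Tga Tgw (cm-conj g (M₀⊆T a m) Tw c)) c′))))
      where
      Tgw = T-normal g w Tw
      Tga = M₀⊆T _ m′

     Conjugate : Pred
     Conjugate y = M₀ y × y ≢ ε × ∃ λ g → M₀ g × A (conj g y)

     -- The identity together with the elements of M₀ not conjugate into A: the Frobenius kernel, so
     -- far only a set.
     Kernel : Pred
     Kernel y = M₀ y × ¬ (y ≢ ε × ∃ λ g → M₀ g × A (conj g y))

     Invols : Pred
     Invols u = ∃ λ g → M₀ g × u ≡ g · w · g ⁻

     n : ℕ
     n = index sA M₀

     open Cosets sA using (rep; IsRep; rep-idem; rep-cong; rep-same; same-rep; same-sym; rep-unique)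

     A⊆M₀ : A ⊆ M₀
     A⊆M₀ _ = proj₁

     M₀-rep : ∀ {g} → M₀ g → M₀ (rep g) × IsRep (rep g)
     M₀-rep = Cosets.invariant-rep sA (Cosets.subgroup-invariant sA sM₀ A⊆M₀)

     A∖ε : ℕ
     A∖ε = # (λ y → A y × y ≢ ε)

     conjugator-unique : ∀ {y g h} → y ≢ ε → M₀ g → M₀ h → A (conj g y) → A (conj h y) → A (g ⁻ · h)
     conjugator-unique {y} {g} {h} ne Mg Mh a b = trivial-intersection (g ⁻ · h) (mul sM₀ (inv sM₀ Mg) Mh) (conj g y) a (conj-≢ε g ne)
      (move A (solve 3 (λ g h y → h :⁻ :∙ y :∙ h ⊜ (g :⁻ :∙ h) :⁻ :∙ (g :⁻ :∙ y :∙ g) :∙ (g :⁻ :∙ h)) refl g h y) b)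

     conjugator : X → X
     conjugator y = rep (pick (λ g → M₀ g × A (conj g y)) y)

     A-conj-A : ∀ {a y} → A a → A y → A (conj a y)
     A-conj-A a y = mul sA (mul sA (inv sA a) y) a

     conjugator-spec : ∀ y → Conjugate y → (M₀ (conjugator y) × IsRep (conjugator y)) × A (conj (conjugator y) y)
     conjugator-spec y (_ , ne , e) = let (Mg , a) = pick-spec (λ g → M₀ g × A (conj g y)) y e
                                          g = pick (λ g → M₀ g × A (conj g y)) y in
      M₀-rep Mg , move A (solve 3 (λ g r y → (g :⁻ :∙ r) :⁻ :∙ (g :⁻ :∙ y :∙ g) :∙ (g :⁻ :∙ r) ⊜ r :⁻ :∙ y :∙ r) refl g (rep g) y)
       (A-conj-A (same-rep g) a)

     -- The fibre of `conjugator` over r consists of the nontrivial elements of rAr⁻¹; by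
     -- `trivial-intersection` an element belongs to the conjugate for one coset rA only.
     #Conjugate : # Conjugate ≡ n * A∖ε
     #Conjugate = #-fibres conjugator A∖ε (λ y c → proj₁ (conjugator-spec y c)) λ r (Mr , ir) → #-bij (conj r)
      (λ { y (c , refl) → proj₂ (conjugator-spec y c) , conj-≢ε (conjugator y) (proj₁ (proj₂ c)) })
      (λ y z _ _ → conj-injective r y z)
      λ a (Aa , ne) → let y = r · a · r ⁻
                          e : conj r y ≡ a
                          e = solve 2 (λ r a → r :⁻ :∙ (r :∙ a :∙ r :⁻) :∙ r ⊜ a) refl r a
                          y≢ε : y ≢ ε
                          y≢ε f = ne (trans (sym e) (trans (cong (conj r) f) (conj-ε r)))
                          c : Conjugate y
                          c = mul sM₀ (mul sM₀ Mr (proj₁ Aa)) (inv sM₀ Mr) , y≢ε , r , Mr , move A (sym e) Aa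
                          s = conjugator-spec y c
       in y , (c , rep-unique (proj₂ (proj₁ s)) ir (conjugator-unique y≢ε (proj₁ (proj₁ s)) Mr (proj₂ s) (move A (sym e) Aa))) , e

     -- |M₀| = n|A|, and the nontrivial elements of the conjugates of A account for n(|A| - 1) of
     -- these.
     #Kernel : # Kernel ≡ n
     #Kernel = +-cancelˡ-≡ (n * A∖ε) _ _ (begin
      n * A∖ε + # Kernel      ≡⟨ cong (_+ # Kernel) #Conjugate ⟨
      # Conjugate + # Kernel  ≡⟨ #-split (λ y → y ≢ ε × ∃ λ g → M₀ g × A (conj g y)) ⟨
      # M₀                    ≡⟨ lagrange sA sM₀ A⊆M₀ ⟩
      n * # A                 ≡⟨ cong (n *_) (#-remove ε (unit sA)) ⟩
      n * suc A∖ε             ≡⟨ *-suc n A∖ε ⟩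
      n + n * A∖ε             ≡⟨ +-comm n _ ⟩
      n * A∖ε + n             ∎)
      where open ≡-Reasoning

     #Involutions : # Invols ≡ n
     #Involutions = sym (#-bij (λ r → r · w · r ⁻)
      (λ r (Mr , _) → r , Mr , refl)
      (λ r s (Mr , ir) (Ms , is) e → rep-unique ir is (centralize Mr Ms e))
      λ { u (g , Mg , refl) → rep g , M₀-rep Mg , conj-rep Mg })
      where
      centralize : ∀ {r s} → M₀ r → M₀ s → r · w · r ⁻ ≡ s · w · s ⁻ → A (r ⁻ · s)
      centralize {r} {s} Mr Ms e = Mrs , centralizer-cm _ Mrs
       (trans (solve 3 (λ r s w → r :⁻ :∙ s :∙ w ⊜ r :⁻ :∙ (s :∙ w :∙ s :⁻) :∙ s) refl r s w)
       (trans (cong (λ z → r ⁻ · z · s) (sym e)) (solve 3 (λ r s w → r :⁻ :∙ (r :∙ w :∙ r :⁻) :∙ s ⊜ w :∙ (r :⁻ :∙ s)) refl r s w)))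
       where Mrs = mul sM₀ (inv sM₀ Mr) Ms
      conj-rep : ∀ {g} → M₀ g → rep g · w · rep g ⁻ ≡ g · w · g ⁻
      conj-rep {g} Mg = trans (solve 3 (λ g r w → r :∙ w :∙ r :⁻ ⊜ g :∙ (g :⁻ :∙ r :∙ w) :∙ r :⁻) refl g (rep g) w)
       (trans (cong (λ z → g · z · rep g ⁻) (cm-comm (M₀⊆T _ (proj₁ a)) Tw (proj₂ a)))
        (solve 3 (λ g r w → g :∙ (w :∙ (g :⁻ :∙ r)) :∙ r :⁻ ⊜ g :∙ w :∙ g :⁻) refl g (rep g) w))
       where a = same-rep g

     involution-M₀ : ∀ {u} → Invols u → M₀ u
     involution-M₀ (g , Mg , refl) = mul sM₀ (mul sM₀ Mg M₀w) (inv sM₀ Mg)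

     involution-² : ∀ {u} → Invols u → u · u ≡ ε
     involution-² (g , Mg , refl) = trans (solve 2 (λ g w → g :∙ w :∙ g :⁻ :∙ (g :∙ w :∙ g :⁻) ⊜ g :∙ (w :∙ w) :∙ g :⁻) refl g w)
      (trans (cong (λ z → g · z · g ⁻) w²) (solve 1 (λ g → g :∙ :ε :∙ g :⁻ ⊜ :ε) refl g))

     involution-≢ε : ∀ {u} → Invols u → u ≢ ε
     involution-≢ε (g , Mg , refl) e = w≢ε (trans (solve 2 (λ g w → w ⊜ g :⁻ :∙ (g :∙ w :∙ g :⁻) :∙ g) refl g w) (trans (cong (conj g) e) (conj-ε g)))

     involution-conj : ∀ {u} g → M₀ g → Invols u → Invols (conj g u)
     involution-conj g Mg (h , Mh , refl) = g ⁻ · h , mul sM₀ (inv sM₀ Mg) Mh ,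
      solve 3 (λ g h w → g :⁻ :∙ (h :∙ w :∙ h :⁻) :∙ g ⊜ g :⁻ :∙ h :∙ w :∙ (g :⁻ :∙ h) :⁻) refl g h w

     involution-w : Invols w
     involution-w = ε , unit sM₀ , solve 1 (λ w → w ⊜ :ε :∙ w :∙ :ε :⁻) refl w

     conj-involution : ∀ {u v} → u · u ≡ ε → v · v ≡ ε → conj u (u · v) ≡ (u · v) ⁻
     conj-involution {u} {v} eu ev = trans (solve 2 (λ u v → u :⁻ :∙ (u :∙ v) :∙ u ⊜ v :∙ u) refl u v)
      (trans (sym (cong₂ _·_ (invol-inv ev) (invol-inv eu))) (solve 2 (λ u v → v :⁻ :∙ u :⁻ ⊜ (u :∙ v) :⁻) refl u v))

     -- u inverts uv. If a conjugate of uv were a nontrivial element of A, the same conjugate of u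
     -- would lie in A by trivial intersection and equal w; then that of v would equal w as well,
     -- and uv = 1.
     product-kernel : ∀ {u v} → Invols u → Invols v → Kernel (u · v)
     product-kernel {u} {v} Iu Iv = mul sM₀ (involution-M₀ Iu) (involution-M₀ Iv) , contra
      where
      contra : ¬ (u · v ≢ ε × ∃ λ g → M₀ g × A (conj g (u · v)))
      contra (ne , g , Mg , a) = conj-≢ε g ne (trans (sym (conj-mul g u v)) (trans (cong₂ _·_ u≡w v≡w) w²))
       where
       u′ = conj g u
       v′ = conj g v
       Iu′ = involution-conj g Mg Iu
       Iv′ = involution-conj g Mg Iv
       a′ : A (u′ · v′)
       a′ = move A (sym (conj-mul g u v)) a
       Au : A u′
       Au = trivial-intersection u′ (involution-M₀ Iu′) (u′ · v′) a′ (λ f → conj-≢ε g ne (trans (sym (conj-mul g u v)) f))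
        (move A (sym (conj-involution (involution-² Iu′) (involution-² Iv′))) (inv sA a′))
       u≡w : u′ ≡ w
       u≡w = A-w Au (involution-² Iu′) (involution-≢ε Iu′)
       v≡w : v′ ≡ w
       v≡w = A-w (move A (solve 2 (λ u v → u :⁻ :∙ (u :∙ v) ⊜ v) refl u′ v′) (mul sA (inv sA Au) a′)) (involution-² Iv′) (involution-≢ε Iv′)

     -- v ↦ uv injects the n conjugates of w into the kernel, which has n elements.
     kernel-product : ∀ {u} → Invols u → ∀ y → Kernel y → ∃ λ v → Invols v × u · v ≡ y
     kernel-product {u} Iu = inj⇒surj (u ·_) (λ v Iv → product-kernel Iu Iv) (λ v v′ _ _ → ∙-cancelˡ u v v′)
      (≤-reflexive (trans #Kernel (sym #Involutions)))

     -- Any conjugate r of w can be made the second factor: write vu = rs and invert.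
     reroute : ∀ {u v r} → Invols u → Invols v → Invols r → ∃ λ s → Invols s × u · v ≡ s · r
     reroute {u} {v} {r} Iu Iv Ir = let (s , Is , e) = kernel-product Ir (v · u) (product-kernel Iv Iu) in s , Is , (begin
      u · v          ≡⟨ cong₂ _·_ (invol-inv (involution-² Iu)) (invol-inv (involution-² Iv)) ⟨
      u ⁻ · v ⁻      ≡⟨ solve 2 (λ u v → u :⁻ :∙ v :⁻ ⊜ (v :∙ u) :⁻) refl u v ⟩
      (v · u) ⁻      ≡⟨ cong _⁻ e ⟨
      (r · s) ⁻      ≡⟨ solve 2 (λ r s → (r :∙ s) :⁻ ⊜ s :⁻ :∙ r :⁻) refl r s ⟩
      s ⁻ · r ⁻      ≡⟨ cong₂ _·_ (invol-inv (involution-² Is)) (invol-inv (involution-² Ir)) ⟩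
      s · r          ∎)
      where open ≡-Reasoning

     product-inverted : ∀ {u v} → Invols u → Invols v → conj w (u · v) ≡ (u · v) ⁻
     product-inverted {u} {v} Iu Iv = from (kernel-product involution-w (u · v) (product-kernel Iu Iv))
      where
      from : (∃ λ r → Invols r × w · r ≡ u · v) → conj w (u · v) ≡ (u · v) ⁻
      from (r , Ir , e) = subst (λ z → conj w z ≡ z ⁻) e (conj-involution w² (involution-² Ir))

     collapse : ∀ {a s r} v → a ≡ s · r → r · r ≡ ε → a · (r · v) ≡ s · v
     collapse {s = s} {r} v refl e = trans (solve 3 (λ s r v → s :∙ r :∙ (r :∙ v) ⊜ s :∙ (r :∙ r) :∙ v) refl s r v)
      (cong (_· v) (trans (cong (s ·_) e) (identityʳ s)))

     -- The kernel {uv} is an abelian group, since it is inverted by w.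
     products-commute : ∀ {u v r t} → Invols u → Invols v → Invols r → Invols t →
      (u · v) · (r · t) ≡ (r · t) · (u · v)
     products-commute {u} {v} {r} {t} Iu Iv Ir It = ⁻¹-injective (trans (sym (inverted (reroute Iu Iv Ir)))
      (trans (sym (conj-mul w (u · v) (r · t))) (trans (cong₂ _·_ (product-inverted Iu Iv) (product-inverted Ir It)) (inv-mul (u · v) (r · t)))))
      where
      inv-mul : ∀ b c → b ⁻ · c ⁻ ≡ (c · b) ⁻
      inv-mul = solve 2 (λ b c → b :⁻ :∙ c :⁻ ⊜ (c :∙ b) :⁻) refl
      inverted : (∃ λ s → Invols s × u · v ≡ s · r) → conj w ((u · v) · (r · t)) ≡ ((u · v) · (r · t)) ⁻
      inverted (s , Is , e) = subst (λ z → conj w z ≡ z ⁻) (sym (collapse t e (involution-² Ir))) (product-inverted Is It)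

     -- An involution that is not conjugate into A lies in the kernel and equals wu; then u commutes
     -- with w, so u = w and the product is trivial.
     all-involutions : ∀ v → M₀ v → v · v ≡ ε → v ≢ ε → Invols v
     all-involutions v Mv v² ne = by-cases (em (∃ λ g → M₀ g × A (conj g v)))
      where
      from-product : (∃ λ u → Invols u × w · u ≡ v) → v ≡ ε
      from-product (u , Iu , refl) = trans (cong (w ·_) (A-w (involution-M₀ Iu , centralizer-cm u (involution-M₀ Iu)
       (sym (involution-commutes w² (involution-² Iu) v²))) (involution-² Iu) (involution-≢ε Iu))) w²
      by-cases : Dec (∃ λ g → M₀ g × A (conj g v)) → Invols v
      by-cases (yes (g , Mg , a)) = g , Mg , trans (solve 2 (λ g v → v ⊜ g :∙ (g :⁻ :∙ v :∙ g) :∙ g :⁻) refl g v)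
       (cong (λ z → g · z · g ⁻) (A-w a (conj-square-one g v v²) (conj-≢ε g ne)))
      by-cases (no none) = ⊥-elim (ne (from-product (kernel-product involution-w v (Mv , λ (_ , e) → none e))))

     -- M normalizes the torus through b. Either b = w, taken when w has no other conjugate in M₀,
     -- or b = wu is inverted by w. The first kind will be refuted, because x commutes with w.
     record Axis : Set where
      field
       b : X
       Tb : T b
       b≢ε : b ≢ ε
       Cm-M : ∀ m → M m → Cm (conj m b) b
       kind : b ≡ w ⊎ (b · b ≢ ε × conj w b ≡ b ⁻)

     involutions-M-invariant : ∀ m → M m → ∀ {v} → Invols v → Invols (conj m v)
     involutions-M-invariant m mm {v} Iv = all-involutions (conj m v) (M₀-conj mm (involution-M₀ Iv))
      (conj-square-one m v (involution-² Iv)) (conj-≢ε m (involution-≢ε Iv))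

     axis : Axis
     axis = by-cases (em (∃ λ u → Invols u × u ≢ w))
      where
      product-axis : ∀ u → Invols u → u ≢ w → Axis
      product-axis u Iu ne = record { b = w · u ; Tb = Tb ; b≢ε = λ e → b²≢ε (trans (cong₂ _·_ e e) (identityˡ ε))
       ; kind = inj₂ (b²≢ε , conj-involution w² (involution-² Iu)) ; Cm-M = Cm-M }
       where
       Tb : T (w · u)
       Tb = mul sT Tw (M₀⊆T u (involution-M₀ Iu))
       b²≢ε : (w · u) · (w · u) ≢ ε
       b²≢ε e = ne (A-w (involution-M₀ Iu , centralizer-cm u (involution-M₀ Iu) (sym (involution-commutes w² (involution-² Iu) e))) (involution-² Iu) (involution-≢ε Iu))
       commutes : ∀ m → M m → conj m (w · u) · (w · u) ≡ (w · u) · conj m (w · u)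
       commutes m mm = trans (cong (_· (w · u)) (sym (conj-mul m w u)))
        (trans (products-commute (involutions-M-invariant m mm involution-w) (involutions-M-invariant m mm Iu) involution-w Iu)
         (cong ((w · u) ·_) (conj-mul m w u)))
       Cm-M : ∀ m → M m → Cm (conj m (w · u)) (w · u)
       Cm-M m mm = [ id , (λ (_ , e) → ⊥-elim (b²≢ε e)) ]′ (comm-cm (T-normal m _ Tb) Tb (commutes m mm))
      by-cases : Dec (∃ λ u → Invols u × u ≢ w) → Axis
      by-cases (yes (u , Iu , ne)) = product-axis u Iu ne
      by-cases (no none) = record { b = w ; Tb = Tw ; b≢ε = w≢ε ; kind = inj₁ refl
       ; Cm-M = λ m mm → subst (λ z → Cm z w) (sym (dne λ ne → none (conj m w , involutions-M-invariant m mm involution-w , ne))) (cm-refl Tw) }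

-- Prime divisors and coprime parts.

module Primes where

 open import Data.Nat
 open import Data.Nat.Properties
 open import Data.Nat.Divisibility
 open import Data.Nat.Coprimality using (Coprime; coprime-divisor; coprime-/gcd)
 open import Data.Nat.GCD using (gcd; gcd[m,n]∣m; gcd[m,n]∣n; gcd[m,n]≢0)
 open import Data.Nat.Primality
 open import Data.Nat.Primality.Factorisation using (factorise; PrimeFactorisation)
 open import Data.Nat.Induction using (<-rec)
 open import Data.List using ([]; _∷_)
 open import Data.Nat.ListAction using (product)
 open import Data.List.Relation.Unary.All using ([]; _∷_)

 prime-divisor : ∀ n → 1 < n → ∃ λ r → Prime r × r ∣ n
 prime-divisor n@(suc _) 1<n = from (factorise n)
  where
  from : PrimeFactorisation n → ∃ λ r → Prime r × r ∣ n
  from record { factors = [] ; isFactorisation = refl } = ⊥-elim (<-irrefl refl 1<n)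
  from record { factors = r ∷ rs ; isFactorisation = e ; factorsPrime = p ∷ _ } = r , p , divides (product rs) (trans e (*-comm r (product rs)))

 prime-coprime : ∀ {r m} → Prime r → ¬ (r ∣ m) → Coprime m r
 prime-coprime {r} pr n (d∣m , d∣r) with prime⇒irreducible pr d∣r
 ... | inj₁ d≡1 = d≡1
 ... | inj₂ refl = ⊥-elim (n d∣m)

 divides-strip : ∀ {r m} → Prime r → ¬ (r ∣ m) → ∀ i {n} → m ∣ r ^ i * n → m ∣ n
 divides-strip {m = m} pr n zero {k} d = subst (m ∣_) (*-identityˡ k) d
 divides-strip {r} {m} pr n (suc i) {k} d = divides-strip pr n i (coprime-divisor (prime-coprime pr n) (subst (m ∣_) (*-assoc r (r ^ i) k) d))

 power-divides : ∀ {r m} → Prime r → ¬ (r ∣ m) → ∀ i {n} → r ^ i ∣ m * n → r ^ i ∣ n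
 power-divides pr n zero d = 1∣ _
 power-divides {r} {m} pr n (suc i) {k} d with euclidsLemma m k pr (∣-trans (m∣m*n (r ^ i)) d)
 ... | inj₁ r∣m = ⊥-elim (n r∣m)
 ... | inj₂ (divides q refl) = subst (r * r ^ i ∣_) (*-comm r q) (*-monoʳ-∣ r (power-divides pr n i
  (*-cancelˡ-∣ r {{prime⇒nonZero pr}} (subst (r * r ^ i ∣_) (trans (sym (*-assoc m q r)) (*-comm (m * q) r)) d))))

 coprime-product : ∀ {r m} → Prime r → ¬ (r ∣ m) → ∀ i {n} → m ∣ n → r ^ i ∣ n → r ^ i * m ∣ n
 coprime-product {r} {m} pr n i d (divides q refl) =
  subst (r ^ i * m ∣_) (*-comm (r ^ i) q) (*-monoʳ-∣ (r ^ i) (divides-strip pr n i (subst (m ∣_) (*-comm q (r ^ i)) d)))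

 p-part : ∀ {r} → Prime r → ∀ n → 0 < n → ∃ λ i → ∃ λ m → n ≡ r ^ i * m × ¬ (r ∣ m)
 p-part {r} pr = <-rec _ step
  where
  1<r : 1 < r
  1<r = nonTrivial⇒n>1 r {{prime⇒nonTrivial pr}}
  step : ∀ n → (∀ {m} → m < n → 0 < m → ∃ λ i → ∃ λ k → m ≡ r ^ i * k × ¬ (r ∣ k)) → 0 < n → ∃ λ i → ∃ λ k → n ≡ r ^ i * k × ¬ (r ∣ k)
  step n rec pos with r ∣? n
  ... | no nd = 0 , n , sym (*-identityˡ n) , nd
  ... | yes (divides q refl) = extend (rec {q} (m<m*n q r {{>-nonZero q>0}} 1<r) q>0)
   where
   q>0 : 0 < q
   q>0 = n≢0⇒n>0 λ { refl → <-irrefl refl pos }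
   extend : (∃ λ i → ∃ λ k → q ≡ r ^ i * k × ¬ (r ∣ k)) → ∃ λ i → ∃ λ k → q * r ≡ r ^ i * k × ¬ (r ∣ k)
   extend (i , k , refl , nd) = suc i , k , trans (*-comm (r ^ i * k) r) (sym (*-assoc r (r ^ i) k)) , nd

 -- A prime power dividing k but not m, split off as m = rⁱm′ and k = rⁱ⁺¹k′.
 excess-prime : ∀ m k → 0 < m → 0 < k → ¬ (k ∣ m) → ∃ λ r → Prime r × ∃ λ i → ∃ λ m′ → ∃ λ k′ →
  m ≡ r ^ i * m′ × ¬ (r ∣ m′) × k ≡ r ^ suc i * k′
 excess-prime m k m>0 k>0 k∤m = from (prime-divisor k₁ k₁>1)
  where
  d = gcd m k
  d∣m = gcd[m,n]∣m m k
  d∣k = gcd[m,n]∣n m k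
  d≢0 : d ≢ 0
  d≢0 = gcd[m,n]≢0 m k (inj₁ λ { refl → <-irrefl refl m>0 })
  instance
   d-nonZero : NonZero d
   d-nonZero = ≢-nonZero d≢0
  m₁ = m / d
  k₁ = k / d
  m≡ : m ≡ m₁ * d
  m≡ = sym (m/n*n≡m d∣m)
   where open import Data.Nat.DivMod using (m/n*n≡m)
  k≡ : k ≡ k₁ * d
  k≡ = sym (m/n*n≡m d∣k)
   where open import Data.Nat.DivMod using (m/n*n≡m)
  k₁>1 : 1 < k₁
  k₁>1 = by-size k₁ refl
   where
   by-size : ∀ x → k₁ ≡ x → 1 < x
   by-size 0 e = ⊥-elim (<-irrefl (sym (trans k≡ (cong (_* d) e))) k>0)
   by-size 1 e = ⊥-elim (k∤m (subst (_∣ m) (sym (trans k≡ (trans (cong (_* d) e) (*-identityˡ d)))) d∣m))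
   by-size (suc (suc x)) e = s≤s (s≤s z≤n)
  from : (∃ λ r → Prime r × r ∣ k₁) → ∃ λ r → Prime r × ∃ λ i → ∃ λ m′ → ∃ λ k′ → m ≡ r ^ i * m′ × ¬ (r ∣ m′) × k ≡ r ^ suc i * k′
  from (r , pr , divides q e) with i , g , eg , nd ← p-part pr d (n≢0⇒n>0 d≢0) =
   r , pr , i , g * m₁ , q * g ,
   trans m≡ (trans (*-comm m₁ d) (trans (cong (_* m₁) eg) (*-assoc (r ^ i) g m₁))) ,
   (λ dv → coprime-case (euclidsLemma g m₁ pr dv)) ,
   trans k≡ (trans (cong₂ _*_ e eg) (arrange q r (r ^ i) g))
   where
   coprime-case : (r ∣ g) ⊎ (r ∣ m₁) → ⊥
   coprime-case (inj₁ x) = nd x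
   coprime-case (inj₂ x) = ¬prime[1] (subst Prime (coprime-/gcd m k (x , divides q e)) pr)
   arrange : ∀ q r s g → q * r * (s * g) ≡ r * s * (q * g)
   arrange = solve-∀
    where open import Data.Nat.Tactic.RingSolver using (solve-∀)

-- Orders of elements and a criterion for cyclicity.

module Cyclic where

 open import Data.Nat
 open import Data.Nat.Properties
 open import Data.Nat.DivMod using (_%_; _/_; m≡m%n+[m/n]*n; m%n<n)
 open import Data.Nat.Divisibility using (_∣_; divides; ∣⇒≤; ∣-antisym; _∣?_; *-cancelˡ-∣)
 open import Data.Nat.Primality using (Prime; prime⇒nonZero; prime⇒nonTrivial)
 open import Data.Fin as Fin using (Fin; toℕ)
 open import Relation.Binary using (tri<; tri≈; tri>)
 open Counting
 open Groups
 open Primes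

 module CyclicGroups (em : (P : Set) → Dec P) {N : ℕ} {_∙_ : Fin N → Fin N → Fin N} {ε : Fin N}
  {_⁻¹ : Fin N → Fin N} (isGroup : IsGroup _≡_ _∙_ ε _⁻¹) where

  open Classical em
  open FiniteGroup em isGroup

  leastℕ : (P : ℕ → Set) → ∃ P → ∃ λ n → P n × (∀ m → P m → n ≤ m)
  leastℕ P (n , p) = go P n p
   where
   go : (P : ℕ → Set) → ∀ n → P n → ∃ λ n → P n × (∀ m → P m → n ≤ m)
   go P zero p = zero , p , λ _ _ → z≤n
   go P (suc n) p = by-cases (em (P 0)) (go (P ∘ suc) n p)
    where
    by-cases : Dec (P 0) → (∃ λ n → P (suc n) × (∀ m → P (suc m) → n ≤ m)) → ∃ λ n → P n × (∀ m → P m → n ≤ m)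
    by-cases (yes p₀) _ = 0 , p₀ , λ _ _ → z≤n
    by-cases (no n₀) (k , pk , min) = suc k , pk , λ { zero q → ⊥-elim (n₀ q) ; (suc m) q → s≤s (min m q) }

  infixr 9 _^^_
  _^^_ : X → ℕ → X
  g ^^ zero = ε
  g ^^ suc n = g · g ^^ n

  ^^-+ : ∀ g m n → g ^^ (m + n) ≡ g ^^ m · g ^^ n
  ^^-+ g zero n = sym (identityˡ _)
  ^^-+ g (suc m) n = trans (cong (g ·_) (^^-+ g m n)) (sym (assoc g _ _))

  ^^-* : ∀ g m n → g ^^ (m * n) ≡ (g ^^ n) ^^ m
  ^^-* g zero n = refl
  ^^-* g (suc m) n = trans (^^-+ g n (m * n)) (cong (g ^^ n ·_) (^^-* g m n))

  ε^^ : ∀ n → ε ^^ n ≡ ε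
  ε^^ zero = refl
  ε^^ (suc n) = trans (identityˡ _) (ε^^ n)

  ^^-commute : ∀ {g h} n → g · h ≡ h · g → g · h ^^ n ≡ h ^^ n · g
  ^^-commute {g} zero e = trans (identityʳ g) (sym (identityˡ g))
  ^^-commute {g} {h} (suc n) e = trans (sym (assoc g h _)) (trans (cong (_· h ^^ n) e) (trans (assoc h g _)
   (trans (cong (h ·_) (^^-commute n e)) (sym (assoc h _ g)))))

  ^^-mul : ∀ {g h} n → g · h ≡ h · g → (g · h) ^^ n ≡ g ^^ n · h ^^ n
  ^^-mul zero e = sym (identityˡ ε)
  ^^-mul {g} {h} (suc n) e = trans (cong (g · h ·_) (^^-mul n e)) (trans (solve 4 (λ g h a b → g :∙ h :∙ (a :∙ b) ⊜ g :∙ (h :∙ a) :∙ b) refl g h (g ^^ n) (h ^^ n))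
   (trans (cong (λ z → g · z · h ^^ n) (^^-commute n (sym e))) (solve 4 (λ g h a b → g :∙ (a :∙ h) :∙ b ⊜ g :∙ a :∙ (h :∙ b)) refl g h (g ^^ n) (h ^^ n))))

  power-∈ : ∀ {A g} → Subgroup A → A g → ∀ n → A (g ^^ n)
  power-∈ sA a zero = unit sA
  power-∈ sA a (suc n) = mul sA a (power-∈ sA a n)

  record IsOrder (g : X) (m : ℕ) : Set where
   field
    positive : 0 < m
    power : g ^^ m ≡ ε
    divisible : ∀ n → g ^^ n ≡ ε → m ∣ n
  open IsOrder public

  power-difference : ∀ g {i j} → i ≤ j → g ^^ i ≡ g ^^ j → g ^^ (j ∸ i) ≡ ε
  power-difference g {i} {j} le e = ∙-cancelˡ (g ^^ i) _ _ (trans (sym (^^-+ g i (j ∸ i)))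
   (trans (cong (g ^^_) (m+[n∸m]≡n le)) (trans (sym e) (sym (identityʳ _)))))

  opaque
   -- Two of the N + 1 powers g⁰, ..., gᴺ coincide, so some positive power is trivial; division with
   -- remainder by the least such exponent gives divisibility.
   order : ∀ g → ∃ (IsOrder g)
   order g = from (leastℕ (λ n → 0 < n × g ^^ n ≡ ε) (periodic (Fin.pigeonhole {N} {suc N} ≤-refl (λ i → g ^^ toℕ i))))
    where
    periodic : (∃ λ (i : Fin (suc N)) → ∃ λ (j : Fin (suc N)) → i Fin.< j × g ^^ toℕ i ≡ g ^^ toℕ j) → ∃ λ n → 0 < n × g ^^ n ≡ ε
    periodic (i , j , lt , e) = toℕ j ∸ toℕ i , m<n⇒0<n∸m lt , power-difference g {toℕ i} {toℕ j} (<⇒≤ lt) e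
    from : (∃ λ m → (0 < m × g ^^ m ≡ ε) × (∀ n → 0 < n × g ^^ n ≡ ε → m ≤ n)) → ∃ (IsOrder g)
    from (m@(suc _) , (pos , e) , min) = m , record { positive = pos ; power = e ; divisible = div }
     where
     remainder : ∀ n → g ^^ n ≡ ε → g ^^ (n % m) ≡ ε
     remainder n f = trans (sym (identityʳ _)) (trans (cong (g ^^ (n % m) ·_) (sym (trans (^^-* g (n / m) m) (trans (cong (_^^ (n / m)) e) (ε^^ (n / m))))))
      (trans (sym (^^-+ g (n % m) (n / m * m))) (trans (cong (g ^^_) (sym (m≡m%n+[m/n]*n n m))) f)))
     div : ∀ n → g ^^ n ≡ ε → m ∣ n
     div n f = by-remainder (n % m) refl
      where
      by-remainder : ∀ r → n % m ≡ r → m ∣ n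
      by-remainder zero z = divides (n / m) (trans (m≡m%n+[m/n]*n n m) (cong (_+ n / m * m) z))
      by-remainder (suc r) z = ⊥-elim (<⇒≱ (m%n<n n m) (min (n % m) (subst (0 <_) (sym z) (s≤s z≤n) , remainder n f)))

  -- The inverse of x is a power of x, so closure under products already gives inverses.
  finite-subgroup : ∀ {P} → P ε → (∀ {x y} → P x → P y → P (x · y)) → Subgroup P
  finite-subgroup {P} u m = record { unit = u ; mul = m ; inv = λ {x} p → move P (sym (inverse x (order x))) (powers p (proj₁ (order x) ∸ 1)) }
   where
   powers : ∀ {x} → P x → ∀ n → P (x ^^ n)
   powers p zero = u
   powers p (suc n) = m p (powers p n)
   inverse : ∀ x → (o : ∃ (IsOrder x)) → x ⁻ ≡ x ^^ (proj₁ o ∸ 1)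
   inverse x (suc n , o) = sym (trans (solve 2 (λ x y → y ⊜ x :⁻ :∙ (x :∙ y)) refl x (x ^^ n)) (trans (cong (x ⁻ ·_) (power o)) (identityʳ _)))
   inverse x (zero , o) with () ← positive o

  powers-injective : ∀ {g m} → IsOrder g m → ∀ {i j} → i < m → j < m → g ^^ i ≡ g ^^ j → i ≡ j
  powers-injective {g} {m} o {i} {j} li lj e with <-cmp i j
  ... | tri≈ _ eq _ = eq
  ... | tri< lt _ _ = ⊥-elim (no-gap o lt lj e)
   where
   no-gap : ∀ {g m i j} → IsOrder g m → i < j → j < m → g ^^ i ≡ g ^^ j → ⊥
   no-gap {g} {m} {i} {j} o lt lj e = <⇒≱ (≤-<-trans (m∸n≤m j i) lj) (∣⇒≤ {{>-nonZero (m<n⇒0<n∸m lt)}} (divisible o (j ∸ i) (power-difference g (<⇒≤ lt) e)))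
  ... | tri> _ _ gt = ⊥-elim (<⇒≱ (≤-<-trans (m∸n≤m i j) li) (∣⇒≤ {{>-nonZero (m<n⇒0<n∸m gt)}} (divisible o (i ∸ j) (power-difference g (<⇒≤ gt) (sym e)))))

  #powers : ∀ {g m} → IsOrder g m → ∀ (P : Pred) → (∀ i → P (g ^^ i)) → m ≤ # P
  #powers {g} {m} o P f = subst (_≤ # P) (#-all {P = λ (_ : Fin m) → ⊤} _)
   (#-inj {P = λ _ → ⊤} (λ i _ → g ^^ toℕ i) (λ i _ → f (toℕ i)) λ i _ j _ e → Fin.toℕ-injective (powers-injective o (Fin.toℕ<n i) (Fin.toℕ<n j) e))

  coprime-power-order : ∀ {g m} i r m′ → Prime r → IsOrder g m → m ≡ r ^ i * m′ → IsOrder (g ^^ (r ^ i)) m′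
  coprime-power-order {g} {m} i r m′ pr o refl = record
   { positive = n≢0⇒n>0 λ { refl → <⇒≢ (positive o) (sym (*-zeroʳ (r ^ i))) }
   ; power = trans (sym (^^-* g m′ (r ^ i))) (trans (cong (g ^^_) (*-comm m′ (r ^ i))) (power o))
   ; divisible = λ n e → *-cancelˡ-∣ (r ^ i) {{m^n≢0 r i {{prime⇒nonZero pr}}}} (divisible o (r ^ i * n)
    (trans (cong (g ^^_) (*-comm (r ^ i) n)) (trans (^^-* g n (r ^ i)) e))) }

  product-order : ∀ {g h r m i} → Prime r → ¬ (r ∣ m) → g · h ≡ h · g → IsOrder g m → IsOrder h (r ^ i) → IsOrder (g · h) (r ^ i * m)
  product-order {g} {h} {r} {m} {i} pr nd c o o′ = record
   { positive = *-mono-≤ (positive o′) (positive o)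
   ; power = trans (^^-mul (r ^ i * m) c) (trans (cong₂ _·_ (trans (^^-* g (r ^ i) m) (trans (cong (_^^ (r ^ i)) (power o)) (ε^^ (r ^ i))))
    (trans (cong (h ^^_) (*-comm (r ^ i) m)) (trans (^^-* h m (r ^ i)) (trans (cong (_^^ m) (power o′)) (ε^^ m))))) (identityˡ ε))
   ; divisible = λ n e → coprime-product pr nd i
    (divides-strip pr nd i (divisible o (r ^ i * n) (trans (sym (identityʳ _)) (trans (cong (g ^^ (r ^ i * n) ·_) (sym (killed h n (r ^ i) (power o′)))) (both n e (r ^ i))))))
    (power-divides pr nd i (divisible o′ (m * n) (trans (sym (identityˡ _)) (trans (cong (_· h ^^ (m * n)) (sym (killed g n m (power o)))) (both n e m))))) }
   where
   killed : ∀ g n k → g ^^ k ≡ ε → g ^^ (k * n) ≡ ε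
   killed g n k e = trans (cong (g ^^_) (*-comm k n)) (trans (^^-* g n k) (trans (cong (_^^ n) e) (ε^^ n)))
   both : ∀ n → (g · h) ^^ n ≡ ε → ∀ k → g ^^ (k * n) · h ^^ (k * n) ≡ ε
   both n e k = trans (sym (^^-mul (k * n) c)) (trans (^^-* (g · h) k n) (trans (cong (_^^ k) e) (ε^^ k)))

  -- An abelian group with few solutions of aᵐ = 1 is cyclic. The bound is asked only when m is the
  -- order of an element, because for the tori it will be proved for odd m.
  module _ {A : Pred} (sA : Subgroup A) (comm : ∀ {a b} → A a → A b → a · b ≡ b · a)
   (bound : ∀ g m → A g → IsOrder g m → # (λ a → A a × a ^^ m ≡ ε) ≤ m) where

   MaximalOrder : X → ℕ → Set
   MaximalOrder g m = A g × IsOrder g m × (∀ h k → A h → IsOrder h k → k ≤ m)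

   maximal-order : ∃ λ g → ∃ (MaximalOrder g)
   maximal-order = from (leastℕ P (N , ε , 0 , unit sA , z≤n , +-identityˡ N))
    where
    -- d measures how far an order falls short of N, so the least d belongs to a largest order.
    P : ℕ → Set
    P d = ∃ λ g → ∃ λ m → A g × m ≤ proj₁ (order g) × m + d ≡ N
    order≤N : ∀ g m → IsOrder g m → m ≤ N
    order≤N g m o = ≤-trans (#powers o (λ _ → ⊤) _) (≤-reflexive (#-all _))
    order-unique : ∀ {g m} → IsOrder g m → m ≡ proj₁ (order g)
    order-unique {g} o = ∣-antisym (divisible o _ (power (proj₂ (order g)))) (divisible (proj₂ (order g)) _ (power o))
    from : (∃ λ d → P d × (∀ d′ → P d′ → d ≤ d′)) → ∃ λ g → ∃ (MaximalOrder g)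
    from (d , (g , m , Ag , m≤ , e) , min) = g , proj₁ (order g) , Ag , proj₂ (order g) , λ h k Ah o →
     ≤-trans (+-cancelʳ-≤ d k m (≤-trans (+-monoʳ-≤ k (min (N ∸ k) (h , k , Ah , ≤-reflexive (order-unique o) , m+[n∸m]≡n (order≤N h k o))))
      (≤-reflexive (trans (m+[n∸m]≡n (order≤N h k o)) (sym e))))) m≤

   -- Otherwise the order of h contains some prime r to a higher power than m does. Replacing the
   -- r-part of g by a suitable power of h then gives an element of order rm.
   maximal-exponent : ∀ {g m} → MaximalOrder g m → ∀ h → A h → h ^^ m ≡ ε
   maximal-exponent {g} {m} (Ag , o , max) h Ah = from-order (order h)
    where
    from-order : ∃ (IsOrder h) → h ^^ m ≡ ε
    from-order (k , o′) with k ∣? m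
    ... | yes (divides q refl) = trans (^^-* h q k) (trans (cong (_^^ q) (power o′)) (ε^^ q))
    ... | no k∤m = ⊥-elim (too-big (excess-prime m k (positive o) (positive o′) k∤m))
     where
     too-big : (∃ λ r → Prime r × ∃ λ i → ∃ λ m′ → ∃ λ k′ → m ≡ r ^ i * m′ × ¬ (r ∣ m′) × k ≡ r ^ suc i * k′) → ⊥
     too-big (r , pr , i , m′ , k′ , refl , nd , refl) = <⇒≱ (≤-<-trans (≤-reflexive (sym (*-identityˡ (r ^ i * m′))))
      (<-≤-trans (*-monoˡ-< (r ^ i * m′) {{>-nonZero (positive o)}} (nonTrivial⇒n>1 r {{prime⇒nonTrivial pr}})) (≤-reflexive (sym (*-assoc r (r ^ i) m′)))))
      (max _ _ (mul sA (power-∈ sA Ag (r ^ i)) (power-∈ sA Ah k′))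
       (product-order {i = suc i} pr nd (comm (power-∈ sA Ag (r ^ i)) (power-∈ sA Ah k′)) (coprime-power-order i r m′ pr o refl) part))
      where
      part : IsOrder (h ^^ k′) (r ^ suc i)
      part = record
       { positive = m^n>0 r {{prime⇒nonZero pr}} (suc i)
       ; power = trans (sym (^^-* h (r ^ suc i) k′)) (power o′)
       ; divisible = λ n e → *-cancelˡ-∣ k′ {{k′≢0}} (subst (_∣ k′ * n) (*-comm (r ^ suc i) k′) (divisible o′ (k′ * n) (trans (cong (h ^^_) (*-comm k′ n)) (trans (^^-* h n k′) e)))) }
       where
       k′≢0 : NonZero k′
       k′≢0 = ≢-nonZero λ { refl → <⇒≢ (positive o′) (sym (*-zeroʳ (r ^ suc i))) }

   cyclic : ∃ λ g → A g × IsOrder g (# A) × (∀ a → A a → ∃ λ k → k < # A × a ≡ g ^^ k)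
   cyclic = from maximal-order
    where
    from : (∃ λ g → ∃ (MaximalOrder g)) → ∃ λ g → A g × IsOrder g (# A) × (∀ a → A a → ∃ λ k → k < # A × a ≡ g ^^ k)
    from (g , m , mo@(Ag , o , _)) = g , Ag , subst (IsOrder g) m≡ o , λ a Aa → subst (λ n → ∃ λ k → k < n × a ≡ g ^^ k) m≡ (generate a Aa)
     where
     A≤m : # A ≤ m
     A≤m = ≤-trans (#-mono λ a Aa → Aa , maximal-exponent mo a Aa) (bound g m Ag o)
     m≡ : m ≡ # A
     m≡ = ≤-antisym (#powers o A (power-∈ sA Ag)) A≤m
     generate : ∀ a → A a → ∃ λ k → k < m × a ≡ g ^^ k
     generate a Aa with i , _ , e ← inj⇒surj {P = λ (_ : Fin m) → ⊤} (λ i → g ^^ toℕ i) (λ i _ → power-∈ sA Ag (toℕ i))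
      (λ i j _ _ e → Fin.toℕ-injective (powers-injective o (Fin.toℕ<n i) (Fin.toℕ<n j) e))
      (≤-trans A≤m (≤-reflexive (sym (#-all {P = λ (_ : Fin m) → ⊤} _)))) a Aa = toℕ i , Fin.toℕ<n i , sym e

-- Finite quotients: lists of pairwise inequivalent representatives.

module Lists where

 open import Data.Nat using (ℕ; zero; suc)
 open import Data.Fin using (Fin; zero; suc)
 open import Data.List using (List; []; _∷_; length; lookup)
 open import Data.List.Relation.Unary.All using (All; []; _∷_)
 open import Data.List.Relation.Unary.Any as Any using (Any; here; there)
 open import Data.List.Relation.Unary.AllPairs using (AllPairs; []; _∷_)
 open import Relation.Binary using (IsEquivalence)
 open import Data.Nat.Properties using (≤-antisym)
 open Counting

 all-lookup : ∀ {A : Set} {P : A → Set} {xs : List A} → All P xs → ∀ i → P (lookup xs i)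
 all-lookup (p ∷ ps) zero = p
 all-lookup (p ∷ ps) (suc i) = all-lookup ps i

 separated-injective : ∀ {A : Set} {_≈_ : A → A → Set} → (∀ {x y} → x ≈ y → y ≈ x) → ∀ {xs} →
  AllPairs (λ x y → ¬ (x ≈ y)) xs → ∀ {i j} → lookup xs i ≈ lookup xs j → i ≡ j
 separated-injective s (p ∷ ps) {zero} {zero} e = refl
 separated-injective s (p ∷ ps) {zero} {suc j} e = ⊥-elim (all-lookup p j e)
 separated-injective s (p ∷ ps) {suc i} {zero} e = ⊥-elim (all-lookup p i (s e))
 separated-injective s (p ∷ ps) {suc i} {suc j} e = cong suc (separated-injective s ps e)

 module Representatives (em : (P : Set) → Dec P) {A : Set} {_≈_ : A → A → Set} (isEquivalence : IsEquivalence _≈_)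
  (xs : List A) where
  open IsEquivalence isEquivalence using () renaming (refl to ≈-refl; sym to ≈-sym; trans to ≈-trans)
  open Classical em

  reps′ : (A → Set) → List A → List A
  reps′ Q [] = []
  reps′ Q (x ∷ xs) with em (Q x × ¬ Any (x ≈_) (reps′ Q xs))
  ... | yes _ = x ∷ reps′ Q xs
  ... | no _ = reps′ Q xs

  reps-all′ : ∀ Q xs → All Q (reps′ Q xs)
  reps-all′ Q [] = []
  reps-all′ Q (x ∷ xs) with em (Q x × ¬ Any (x ≈_) (reps′ Q xs))
  ... | yes (q , _) = q ∷ reps-all′ Q xs
  ... | no _ = reps-all′ Q xs

  any-≉ : ∀ {x ys} → ¬ Any (x ≈_) ys → All (λ y → ¬ (x ≈ y)) ys
  any-≉ {ys = []} n = []
  any-≉ {ys = y ∷ ys} n = (λ e → n (here e)) ∷ any-≉ (λ a → n (there a))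

  reps-separated′ : ∀ Q xs → AllPairs (λ x y → ¬ (x ≈ y)) (reps′ Q xs)
  reps-separated′ Q [] = []
  reps-separated′ Q (x ∷ xs) with em (Q x × ¬ Any (x ≈_) (reps′ Q xs))
  ... | yes (_ , n) = any-≉ n ∷ reps-separated′ Q xs
  ... | no _ = reps-separated′ Q xs

  Respects : (A → Set) → Set
  Respects Q = ∀ x y → x ≈ y → Q x → Q y

  reps-complete′ : ∀ {Q} → Respects Q → ∀ xs y → Q y → Any (y ≈_) xs → Any (y ≈_) (reps′ Q xs)
  reps-complete′ {Q} r (x ∷ xs) y qy a with em (Q x × ¬ Any (x ≈_) (reps′ Q xs)) | a
  ... | yes _ | here e = here e
  ... | yes _ | there a = there (reps-complete′ r xs y qy a)
  ... | no n | here e = Any.map (≈-trans e) (dne λ none → n (r y x e qy , none))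
  ... | no n | there a = reps-complete′ r xs y qy a

  module Enumeration {Q : A → Set} (respects : Respects Q) (covers : ∀ x → Q x → Any (x ≈_) xs) where
   opaque
    reps : List A
    reps = reps′ Q xs

    reps-all : All Q reps
    reps-all = reps-all′ Q xs

    reps-separated : AllPairs (λ x y → ¬ (x ≈ y)) reps
    reps-separated = reps-separated′ Q xs

    complete : ∀ x → Q x → Any (x ≈_) reps
    complete x q = reps-complete′ respects xs x q (covers x q)

   N : ℕ
   N = length reps

   el : Fin N → A
   el = lookup reps

   el-Q : ∀ i → Q (el i)
   el-Q = all-lookup reps-all

   el-injective : ∀ {i j} → el i ≈ el j → i ≡ j
   el-injective = separated-injective ≈-sym reps-separated

   opaque
    ix : ∀ x → Q x → Fin N
    ix x q = Any.index (complete x q)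

    el-ix : ∀ x q → x ≈ el (ix x q)
    el-ix x q = Any.lookup-index (complete x q)

   -- Links the lists by which orders of subsets are defined with counting over indices: both run
   -- through H once modulo `≈`.
   list-count : ∀ {H} → Respects H → (∀ x → H x → Q x) → ∀ (ys : List A) → All H ys →
    AllPairs (λ x y → ¬ (x ≈ y)) ys → (∀ x → H x → Any (x ≈_) ys) → # (λ i → H (el i)) ≡ length ys
   list-count {H} rH H⊆Q ys all sep comp = trans (≤-antisym
    (#-inj (λ i h → Any.index (comp (el i) h)) (λ _ _ → _)
     (λ i h j h′ e → el-injective (≈-trans (Any.lookup-index (comp (el i) h))
      (subst (λ k → lookup ys k ≈ el j) (sym e) (≈-sym (Any.lookup-index (comp (el j) h′)))))))
    (#-inj {P = λ _ → ⊤} (λ i _ → ix (lookup ys i) (H⊆Q _ (all-lookup all i)))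
     (λ i _ → rH _ _ (el-ix _ _) (all-lookup all i))
     (λ i _ j _ e → separated-injective ≈-sym sep (≈-trans (el-ix _ _) (subst (λ k → el k ≈ lookup ys j) (sym e) (≈-sym (el-ix _ _)))))))
    (#-all λ _ → _)

-- The isomorphism with a dihedral group.

module DihedralMaps where

 open import Data.Nat as ℕ using (ℕ; suc; _<_)
 import Data.Nat.Properties as ℕ
 open import Data.Nat.DivMod using (_%_; _/_; _mod_; m≡m%n+[m/n]*n; m%n<n)
 open import Data.Fin as Fin using (Fin; toℕ; fromℕ<)
 open import Data.Bool using (Bool; true; false; _xor_)
 open Counting
 open Groups
 open Cyclic

 module DihedralMap (em : (P : Set) → Dec P) {N : ℕ} {_∙_ : Fin N → Fin N → Fin N} {ε : Fin N}
  {_⁻¹ : Fin N → Fin N} (isGroup : IsGroup _≡_ _∙_ ε _⁻¹) where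

  open FiniteGroup em isGroup
  open CyclicGroups em isGroup

  -- H is the union of C and Cw, where c generates C and w inverts it. The isomorphism takes a
  -- rotation number a and a reflection bit s to cᵃwˢ.
  module Rotations {H C : Pred} (H-mul : ∀ {i j} → H i → H j → H (i · j)) (sC : Subgroup C) (C⊑H : ∀ i → C i → H i)
   {k : ℕ} {c w : X} (Cc : C c) (o : IsOrder c (suc k)) (gen : ∀ a → C a → ∃ λ m → m < suc k × a ≡ c ^^ m)
   (Hw : H w) (w² : w · w ≡ ε) (w∉C : ¬ C w) (inverts : ∀ c → C c → w · c ≡ c ⁻ · w) (H-cases : ∀ i → H i → C i ⊎ C (i · w)) where

   n : ℕ
   n = suc k

   cⁿ : c ^^ n ≡ ε
   cⁿ = power o

   w^ : Bool → X
   w^ true = w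
   w^ false = ε
   φ : DihCarrier k → X
   φ (a , β) = (c ^^ toℕ a) · w^ β
   C-pow : ∀ m → C (c ^^ m)
   C-pow = power-∈ sC Cc
   φ-H : ∀ x → H (φ x)
   φ-H (a , true) = H-mul (C⊑H _ (C-pow (toℕ a))) Hw
   φ-H (a , false) = H-mul (C⊑H _ (C-pow (toℕ a))) (C⊑H ε (unit sC))
   pow-mod : ∀ m → c ^^ toℕ (m mod n) ≡ c ^^ m
   pow-mod m = trans (cong (c ^^_) (Fin.toℕ-fromℕ< (m%n<n m n))) (trans (sym (identityʳ _)) (trans (cong ((c ^^ (m % n)) ·_) (sym killed))
    (trans (sym (^^-+ c (m % n) (m / n ℕ.* n))) (cong (c ^^_) (sym (m≡m%n+[m/n]*n m n))))))
    where
    killed : c ^^ (m / n ℕ.* n) ≡ ε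
    killed = trans (^^-* c (m / n) n) (trans (cong (_^^ (m / n)) cⁿ) (ε^^ (m / n)))
   inverse-pow : ∀ (a : Fin n) → c ^^ (n ℕ.∸ toℕ a) ≡ (c ^^ toℕ a) ⁻
   inverse-pow a = inverseˡ-unique _ _ (trans (sym (^^-+ c (n ℕ.∸ toℕ a) (toℕ a))) (trans (cong (c ^^_) (ℕ.m∸n+n≡m (ℕ.<⇒≤ (Fin.toℕ<n a)))) cⁿ))
   w^-mul : ∀ β → w · w^ β ≡ w^ (true xor β)
   w^-mul true = w²
   w^-mul false = identityʳ w
   φ-mul : ∀ x y → φ (dihMul k x y) ≡ φ x · φ y
   φ-mul (a , false) (a′ , β) = trans (cong (_· w^ β) (trans (pow-mod (toℕ a ℕ.+ toℕ a′)) (^^-+ c (toℕ a) (toℕ a′))))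
    (solve 3 (λ x y z → x :∙ y :∙ z ⊜ x :∙ :ε :∙ (y :∙ z)) refl (c ^^ toℕ a) (c ^^ toℕ a′) (w^ β))
   φ-mul (a , true) (a′ , β) = trans (cong₂ _·_ (trans (pow-mod (toℕ a ℕ.+ (n ℕ.∸ toℕ a′))) (trans (^^-+ c (toℕ a) (n ℕ.∸ toℕ a′)) (cong ((c ^^ toℕ a) ·_) (inverse-pow a′)))) (sym (w^-mul β)))
    (trans (solve 4 (λ x y z w → x :∙ y :⁻ :∙ (w :∙ z) ⊜ x :∙ (y :⁻ :∙ w) :∙ z) refl (c ^^ toℕ a) (c ^^ toℕ a′) (w^ β) w)
    (trans (cong (λ t → (c ^^ toℕ a) · t · w^ β) (sym (inverts _ (C-pow (toℕ a′)))))
     (solve 4 (λ x y z w → x :∙ (w :∙ y) :∙ z ⊜ x :∙ w :∙ (y :∙ z)) refl (c ^^ toℕ a) (c ^^ toℕ a′) (w^ β) w)))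
   pow-injective : ∀ {a a′ : Fin n} → c ^^ toℕ a ≡ c ^^ toℕ a′ → a ≡ a′
   pow-injective {a} {a′} eq = Fin.toℕ-injective (powers-injective o (Fin.toℕ<n a) (Fin.toℕ<n a′) eq)
   w-power : ∀ i j → (c ^^ i) · w ≡ (c ^^ j) · ε → ⊥
   w-power i j eq = w∉C (move C (trans (cong ((c ^^ i) ⁻ ·_) (sym eq)) (solve 2 (λ x w → x :⁻ :∙ (x :∙ w) ⊜ w) refl (c ^^ i) w))
    (mul sC (inv sC (C-pow i)) (mul sC (C-pow j) (unit sC))))
   φ-injective : ∀ x y → φ x ≡ φ y → x ≡ y
   φ-injective (a , true) (a′ , true) eq = cong (_, true) (pow-injective (∙-cancelʳ w _ _ eq))
   φ-injective (a , false) (a′ , false) eq = cong (_, false) (pow-injective (∙-cancelʳ ε _ _ eq))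
   φ-injective (a , true) (a′ , false) eq = ⊥-elim (w-power (toℕ a) (toℕ a′) eq)
   φ-injective (a , false) (a′ , true) eq = ⊥-elim (w-power (toℕ a′) (toℕ a) (sym eq))
   φ-surjective : ∀ i → H i → ∃ λ x → φ x ≡ i
   φ-surjective i Hi = [ rotation , reflection ]′ (H-cases i Hi)
    where
    reindex : ∀ {m} (lt : m < n) → c ^^ toℕ (fromℕ< lt) ≡ c ^^ m
    reindex {m} lt = cong (c ^^_) (Fin.toℕ-fromℕ< lt)
    rotation : C i → ∃ λ x → φ x ≡ i
    rotation Ci with m , lt , eq ← gen i Ci = (fromℕ< lt , false) , trans (identityʳ _) (trans (reindex lt) (sym eq))
    reflection : C (i · w) → ∃ λ x → φ x ≡ i
    reflection Ciw with m , lt , eq ← gen (i · w) Ciw = (fromℕ< lt , true) ,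
     trans (cong (_· w) (trans (reindex lt) (sym eq))) (trans (assoc i w w) (trans (cong (i ·_) w²) (identityʳ i)))

open Parity
open Counting
open Primes
open Cyclic
open Lists
open IntSolver
open Groups
open Codes
open Criteria
open FrobeniusComplements
open Characteristic
open DihedralMaps

import Algebra.Properties.Semiring.Mult as Mult
open import Data.Nat as ℕ using (ℕ; zero; suc; _≤_; _<_; z≤n; s≤s; NonZero)
import Data.Nat.Properties as ℕ
open import Data.Nat.Primality using (Prime)
open import Data.Nat.DivMod using (_%_; _/_; m≡m%n+[m/n]*n; m%n<n; [m+kn]%n≡m%n; n%n≡0)
open import Data.Nat.Tactic.RingSolver using (solve-∀)
open import Data.Fin as Fin using (Fin; zero; suc; toℕ)
open import Data.List as List using (List; []; _∷_; allFin)
open import Data.List.Relation.Unary.All as All using (All; []; _∷_; all?)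
open import Data.List.Relation.Unary.Any as Any using (Any; here; there; any?)
open import Data.List.Membership.Propositional using (_∈_; find)
open import Data.List.Membership.Propositional.Properties using (∈-map⁺; ∈-allFin; ∈-cartesianProductWith⁺)
open import Data.Bool using (Bool; true; false)

open import Data.List using (lookup)
import Data.List.Relation.Unary.Any as Any
import Algebra.Properties.CommutativeMonoid.Sum as BigSum
import Data.Fin.Permutation as Perm

-- Finite fields and polynomial functions on them.

module FieldTheory (em : (P : Set) → Dec P) {q : ℕ} (K : FiniteField q) where
 open Classical em
 open FiniteField K public
 open ProjectiveGroups K public

 commutativeRing : CommutativeRing 0ℓ 0ℓ
 commutativeRing = record { isCommutativeRing = isCommutativeRing }

 open CommutativeRing commutativeRing public
  using (semiring; +-commutativeMonoid; +-comm; +-assoc; +-identityˡ; +-identityʳ; *-comm; *-assoc; *-identityˡ; *-identityʳ; zeroˡ; zeroʳ; distribˡ; distribʳ; -‿inverseʳ; -‿inverseˡ)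
 open IntegerSolver commutativeRing public using (solve; _:=_; _:+_; _:*_; :-_; _:-_; con; :0; :1)

 infixl 6 _-_
 _-_ : Carrier → Carrier → Carrier
 x - y = x + - y

 opaque
  recip : Carrier → Carrier
  recip x with em (x ≡ 0#)
  ... | yes _ = 0#
  ... | no ne = proj₁ (inverse x ne)

  *-recip : ∀ {x} → x ≢ 0# → x * recip x ≡ 1#
  *-recip {x} ne with em (x ≡ 0#)
  ... | yes e = ⊥-elim (ne e)
  ... | no ne′ = proj₂ (inverse x ne′)

 recip-* : ∀ {x} → x ≢ 0# → recip x * x ≡ 1#
 recip-* ne = trans (*-comm _ _) (*-recip ne)

 1≢0 : 1# ≢ 0#
 1≢0 e = 0≢1 (sym e)

 *-cancelˡ : ∀ {c x y} → c ≢ 0# → c * x ≡ c * y → x ≡ y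
 *-cancelˡ {c} {x} {y} ne e = trans (expand x) (trans (cong (recip c *_) e) (sym (expand y)))
  where
  expand : ∀ x → x ≡ recip c * (c * x)
  expand x = trans (sym (*-identityˡ x)) (trans (cong (_* x) (sym (recip-* ne))) (*-assoc _ _ _))

 zero-product : ∀ {x y} → x * y ≡ 0# → x ≢ 0# → y ≡ 0#
 zero-product {x} {y} e ne = *-cancelˡ ne (trans e (sym (zeroʳ x)))

 *-nonzero : ∀ {x y} → x ≢ 0# → y ≢ 0# → x * y ≢ 0#
 *-nonzero nx ny e = ny (zero-product e nx)

 nonzero-*ˡ : ∀ {x y} → x * y ≢ 0# → x ≢ 0#
 nonzero-*ˡ {y = y} ne refl = ne (zeroˡ y)

 recip-nonzero : ∀ {x} → x ≢ 0# → recip x ≢ 0#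
 recip-nonzero {x} ne e = 1≢0 (trans (sym (*-recip ne)) (trans (cong (x *_) e) (zeroʳ x)))

 -≡0 : ∀ {x y} → x - y ≡ 0# → x ≡ y
 -≡0 {x} {y} e = trans (solve 2 (λ x y → x := x :- y :+ y) refl x y) (trans (cong (_+ y) e) (+-identityˡ y))

 ≡⇒-≡0 : ∀ {x y} → x ≡ y → x - y ≡ 0#
 ≡⇒-≡0 {x} refl = -‿inverseʳ x

 square-roots : ∀ {x y} → x * x ≡ y * y → x ≡ y ⊎ x ≡ - y
 square-roots {x} {y} e with em (x ≡ y)
 ... | yes x≡y = inj₁ x≡y
 ... | no ne = inj₂ (-≡0 (trans (solve 2 (λ x y → x :- (:- y) := x :+ y) refl x y)
  (zero-product (trans (solve 2 (λ x y → (x :- y) :* (x :+ y) := x :* x :- y :* y) refl x y) (≡⇒-≡0 e)) (ne ∘ -≡0))))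

 at : Fin q → Carrier
 at i = lookup elements (Fin.cast (sym elements-length) i)

 ix : Carrier → Fin q
 ix x = Fin.cast elements-length (Any.index (elements-complete x))

 at-ix : ∀ x → at (ix x) ≡ x
 at-ix x = trans (cong (lookup elements) (trans (Fin.cast-trans elements-length (sym elements-length) _) (Fin.cast-is-id refl _)))
  (sym (Any.lookup-index (elements-complete x)))

 at-injective : ∀ {i j} → at i ≡ at j → i ≡ j
 at-injective {i} {j} e = Fin.toℕ-injective (trans (sym (Fin.toℕ-cast _ i)) (trans (cong Fin.toℕ (separated-injective sym elements-unique e)) (Fin.toℕ-cast _ j)))

 ix-at : ∀ i → ix (at i) ≡ i
 ix-at i = at-injective (at-ix (at i))

 #K : (Carrier → Set) → ℕ
 #K P = # (λ i → P (at i))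

 ix-injective : ∀ {x y} → ix x ≡ ix y → x ≡ y
 ix-injective {x} {y} e = trans (sym (at-ix x)) (trans (cong at e) (at-ix y))

 #K-all : {P : Carrier → Set} → (∀ x → P x) → #K P ≡ q
 #K-all f = #-all (λ i → f (at i))

 #K-remove : {P : Carrier → Set} (x : Carrier) → P x → #K P ≡ suc (#K (λ y → P y × y ≢ x))
 #K-remove {P} x p = trans (#-remove (ix x) (subst P (sym (at-ix x)) p))
  (cong suc (#-cong (λ j (pj , ne) → pj , λ e → ne (trans (sym (ix-at j)) (cong ix e))) λ j (pj , ne) → pj , λ e → ne (trans (cong at e) (at-ix x))))

 #K-nonzero : suc (#K (λ x → x ≢ 0#)) ≡ q
 #K-nonzero = trans (cong suc (#-cong (λ i ne → _ , ne) (λ i → proj₂))) (trans (sym (#K-remove {P = λ _ → ⊤} 0# tt)) (#K-all λ _ → tt))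
  where open import Data.Unit using (⊤; tt)

 -- Polynomial functions in Horner form. The number counts coefficients, so the degree is below n,
 -- and 0 leaves only the zero function.
 Polynomial : ℕ → (Carrier → Carrier) → Set
 Polynomial zero f = ∀ x → f x ≡ 0#
 Polynomial (suc n) f = ∃ λ c → ∃ λ g → Polynomial n g × (∀ x → f x ≡ c + x * g x)

 poly-zero : ∀ n → Polynomial n (λ _ → 0#)
 poly-zero zero x = refl
 poly-zero (suc n) = 0# , (λ _ → 0#) , poly-zero n , solve 1 (λ x → :0 := :0 :+ x :* :0) refl

 poly-weaken : ∀ n {f} → Polynomial n f → Polynomial (suc n) f
 poly-weaken zero p = 0# , (λ _ → 0#) , poly-zero zero , λ x → trans (p x) (solve 1 (λ x → :0 := :0 :+ x :* :0) refl x)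
 poly-weaken (suc n) (c , g , pg , e) = c , g , poly-weaken n pg , e

 poly-const : ∀ n c → Polynomial (suc n) (λ _ → c)
 poly-const n c = c , (λ _ → 0#) , poly-zero n , solve 2 (λ c x → c := c :+ x :* :0) refl c

 poly-X* : ∀ n {f} → Polynomial n f → Polynomial (suc n) (λ x → x * f x)
 poly-X* n {f} p = 0# , f , p , λ x → sym (+-identityˡ _)

 poly-+ : ∀ n {f g} → Polynomial n f → Polynomial n g → Polynomial n (λ x → f x + g x)
 poly-+ zero p r x = trans (cong₂ _+_ (p x) (r x)) (+-identityˡ 0#)
 poly-+ (suc n) (c , h , ph , e) (d , k , pk , e′) = c + d , (λ x → h x + k x) , poly-+ n ph pk , λ x →
  trans (cong₂ _+_ (e x) (e′ x)) (solve 5 (λ c d x h k → c :+ x :* h :+ (d :+ x :* k) := c :+ d :+ x :* (h :+ k)) refl c d x (h x) (k x))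

 poly-scale : ∀ n {f} a → Polynomial n f → Polynomial n (λ x → a * f x)
 poly-scale zero a p x = trans (cong (a *_) (p x)) (zeroʳ a)
 poly-scale (suc n) a (c , h , ph , e) = a * c , (λ x → a * h x) , poly-scale n a ph , λ x →
  trans (cong (a *_) (e x)) (solve 4 (λ a c x h → a :* (c :+ x :* h) := a :* c :+ x :* (a :* h)) refl a c x (h x))

 poly-divide : ∀ n {f} r → Polynomial (suc n) f → ∃ λ h → Polynomial n h × (∀ x → f x ≡ (x - r) * h x + f r)
 poly-divide zero {f} r (c , g , pg , e) = (λ _ → 0#) , (λ _ → refl) , λ x →
  trans (const x) (trans (sym (const r)) (solve 3 (λ x r f → f := (x :- r) :* :0 :+ f) refl x r (f r)))
  where
  const : ∀ x → f x ≡ c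
  const x = trans (e x) (trans (cong (λ z → c + x * z) (pg x)) (solve 2 (λ c x → c :+ x :* :0 := c) refl c x))
 poly-divide (suc n) {f} r (c , g , pg , e) with h , ph , eq ← poly-divide n r pg =
  (λ x → g r + x * h x) , (g r , h , ph , λ _ → refl) , λ x → trans (e x) (trans (cong (λ z → c + x * z) (eq x))
   (trans (solve 5 (λ c x r h g → c :+ x :* ((x :- r) :* h :+ g) := (x :- r) :* (g :+ x :* h) :+ (c :+ r :* g)) refl c x r (h x) (g r))
    (cong ((x - r) * (g r + x * h x) +_) (sym (e r)))))

 -- Splitting off the factor of one root lowers both the number of coefficients and the number of
 -- required roots by one, down to the zero function.
 poly-roots : ∀ n {f} → Polynomial n f → n ℕ.≤ #K (λ x → f x ≡ 0#) → ∀ x → f x ≡ 0#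
 poly-roots zero p _ = p
 poly-roots (suc n) {f} p le = from (#-witness (ℕ.<-≤-trans (s≤s z≤n) le))
  where
  from : (∃ λ i → f (at i) ≡ 0#) → ∀ x → f x ≡ 0#
  from (i , fi) x with h , ph , eq ← poly-divide n (at i) p =
   trans (factor x) (trans (cong ((x - at i) *_) (poly-roots n ph le′ x)) (zeroʳ _))
   where
   factor : ∀ x → f x ≡ (x - at i) * h x
   factor x = trans (eq x) (trans (cong ((x - at i) * h x +_) fi) (+-identityʳ _))
   le′ : n ℕ.≤ #K (λ x → h x ≡ 0#)
   le′ = ℕ.≤-trans (ℕ.≤-pred (subst (suc n ℕ.≤_) (#-remove i fi) le))
    (#-mono λ j (fj , ne) → zero-product (trans (sym (factor (at j))) fj) (λ e → ne (at-injective (-≡0 e))))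

 pow-+ : ∀ x m n → pow x (m ℕ.+ n) ≡ pow x m * pow x n
 pow-+ x zero n = sym (*-identityˡ _)
 pow-+ x (suc m) n = trans (cong (x *_) (pow-+ x m n)) (sym (*-assoc x _ _))

 pow-* : ∀ x m n → pow x (m ℕ.* n) ≡ pow (pow x n) m
 pow-* x zero n = refl
 pow-* x (suc m) n = trans (pow-+ x n (m ℕ.* n)) (cong (pow x n *_) (pow-* x m n))

 pow-distrib : ∀ x y n → pow (x * y) n ≡ pow x n * pow y n
 pow-distrib x y zero = sym (*-identityˡ 1#)
 pow-distrib x y (suc n) = trans (cong (x * y *_) (pow-distrib x y n))
  (solve 4 (λ x y a b → x :* y :* (a :* b) := x :* a :* (y :* b)) refl x y (pow x n) (pow y n))

 pow-1 : ∀ n → pow 1# n ≡ 1#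
 pow-1 zero = refl
 pow-1 (suc n) = trans (*-identityˡ _) (pow-1 n)

 pow-nonzero : ∀ {x} n → x ≢ 0# → pow x n ≢ 0#
 pow-nonzero zero ne = 1≢0
 pow-nonzero (suc n) ne = *-nonzero ne (pow-nonzero n ne)

 poly-pow : ∀ n → Polynomial (suc n) (λ x → pow x n)
 poly-pow zero = poly-const zero 1#
 poly-pow (suc n) = poly-X* (suc n) (poly-pow n)

 Square : Carrier → Set
 Square x = ∃ λ s → x ≡ s * s

 square-* : ∀ {x y} → Square x → Square y → Square (x * y)
 square-* (s , refl) (t , refl) = s * t , solve 2 (λ s t → s :* s :* (t :* t) := s :* t :* (s :* t)) refl s t

 square-recip : ∀ {x} → x ≢ 0# → Square x → Square (recip x)
 square-recip {x} ne (s , refl) = recip s , *-cancelˡ ne (trans (*-recip ne)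
  (sym (trans (solve 2 (λ s r → s :* s :* (r :* r) := s :* r :* (s :* r)) refl s (recip s))
   (trans (cong₂ _*_ (*-recip (nonzero-*ˡ ne)) (*-recip (nonzero-*ˡ ne))) (*-identityˡ 1#)))))

 square-quotient : ∀ {x y} → y ≢ 0# → Square y → Square (x * y) → Square x
 square-quotient {x} {y} ne sy sxy = subst Square (trans (*-assoc x y _) (trans (cong (x *_) (*-recip ne)) (*-identityʳ x)))
  (square-* sxy (square-recip ne sy))

 two : Carrier
 two = 1# + 1#

 open Mult semiring public using (×1-homo-*; ×-homo-+) renaming (_×_ to _⋆_)

 -- Adding 1 permutes K, so the sum of the elements of K equals itself plus q·1.
 q×1 : q ⋆ 1# ≡ 0#
 q×1 = trans (sym (sum-replicate q)) (trans (solve 2 (λ s r → r := s :+ r :- s) refl (sum {q} at) (sum {q} (λ _ → 1#)))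
  (≡⇒-≡0 (trans (sym (∑-distrib-+ {q} at (λ _ → 1#))) (trans (sum-cong-≗ (λ i → sym (at-ix (at i + 1#)))) (sym (sum-permute {q} {q} at π))))))
  where
  open BigSum +-commutativeMonoid
  π : Perm.Permutation q q
  π = Perm.permutation (λ i → ix (at i + 1#)) (λ i → ix (at i - 1#))
   (λ i → trans (cong ix (trans (cong (_+ 1#) (at-ix _)) (solve 2 (λ x o → x :- o :+ o := x) refl (at i) 1#))) (ix-at i))
   (λ i → trans (cong ix (trans (cong (_- 1#) (at-ix _)) (solve 2 (λ x o → x :+ o :- o := x) refl (at i) 1#))) (ix-at i))

open import Data.Nat.Divisibility using (_∣_; divides; ∣⇒≤)
import Data.Sum as Sum′

-- The cyclic group of units, squares and Euler's criterion.

module UnitTheory (em : (P : Set) → Dec P) {q : ℕ} (K : FiniteField q) where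
 open Classical em
 open FieldTheory em K

 private
  module E = Representatives em isEquivalence elements
  nonzero-respects : ∀ x y → x ≡ y → x ≢ 0# → y ≢ 0#
  nonzero-respects x y refl ne = ne

  open E.Enumeration {Q = _≢ 0#} nonzero-respects (λ x _ → elements-complete x) using () renaming (el to elᵤ; el-Q to elᵤ≢0; el-injective to elᵤ-injective; complete to completeᵤ; N to units; ix to ixᵤ; el-ix to el-ixᵤ) public

  opaque
   _∙_ : Fin units → Fin units → Fin units
   i ∙ j = ixᵤ (elᵤ i * elᵤ j) (*-nonzero (elᵤ≢0 i) (elᵤ≢0 j))

   ε : Fin units
   ε = ixᵤ 1# 1≢0

   _⁻¹ : Fin units → Fin units
   i ⁻¹ = ixᵤ (recip (elᵤ i)) (recip-nonzero (elᵤ≢0 i))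

   el-∙ : ∀ i j → elᵤ (i ∙ j) ≡ elᵤ i * elᵤ j
   el-∙ i j = sym (el-ixᵤ _ _)

   el-ε : elᵤ ε ≡ 1#
   el-ε = sym (el-ixᵤ _ _)

   el-⁻¹ : ∀ i → elᵤ (i ⁻¹) ≡ recip (elᵤ i)
   el-⁻¹ i = sym (el-ixᵤ _ _)

  isGroup : IsGroup _≡_ _∙_ ε _⁻¹
  isGroup = record
   { isMonoid = record
    { isSemigroup = record
     { isMagma = record { isEquivalence = isEquivalence ; ∙-cong = cong₂ _∙_ }
     ; assoc = λ i j k → elᵤ-injective (trans (el-∙ _ _) (trans (cong (_* elᵤ k) (el-∙ i j)) (trans (*-assoc _ _ _) (trans (cong (elᵤ i *_) (sym (el-∙ j k))) (sym (el-∙ _ _)))))) }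
    ; identity = (λ i → elᵤ-injective (trans (el-∙ _ _) (trans (cong (_* elᵤ i) el-ε) (*-identityˡ _)))) ,
     (λ i → elᵤ-injective (trans (el-∙ _ _) (trans (cong (elᵤ i *_) el-ε) (*-identityʳ _)))) }
   ; inverse = (λ i → elᵤ-injective (trans (el-∙ _ _) (trans (cong (_* elᵤ i) (el-⁻¹ i)) (trans (recip-* (elᵤ≢0 i)) (sym el-ε))))) ,
    (λ i → elᵤ-injective (trans (el-∙ _ _) (trans (cong (elᵤ i *_) (el-⁻¹ i)) (trans (*-recip (elᵤ≢0 i)) (sym el-ε)))))
   ; ⁻¹-cong = cong _⁻¹ }

  open FiniteGroup em isGroup using (Subgroup)
  open CyclicGroups em isGroup

  el-pow : ∀ i n → elᵤ (i ^^ n) ≡ pow (elᵤ i) n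
  el-pow i zero = el-ε
  el-pow i (suc n) = trans (el-∙ _ _) (cong (elᵤ i *_) (el-pow i n))

  whole : Subgroup (λ _ → ⊤)
  whole = record { unit = tt ; mul = λ _ _ → tt ; inv = λ _ → tt }

  -- Otherwise Xᵐ - 1, which has m + 1 coefficients, has more than m roots and vanishes everywhere,
  -- but its value at 0 is -1.
  bound : ∀ g m → ⊤ → IsOrder g m → # (λ a → ⊤ × a ^^ m ≡ ε) ≤ m
  bound g m _ o = ℕ.≮⇒≥ λ lt → 1≢0 (trans (solve 0 (:1 := :0 :- (:- :1)) refl)
   (trans (cong (_- (- 1#)) (sym (trans (cong (_- 1#) (sym (pow-0 (IsOrder.positive o)))) (poly-roots (suc m) polynomial (ℕ.≤-trans lt roots) 0#))))
    (solve 0 (:0 :- :1 :- (:- :1) := :0) refl)))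
   where
   polynomial : Polynomial (suc m) (λ x → pow x m - 1#)
   polynomial = poly-+ (suc m) (poly-pow m) (poly-const m (- 1#))
   pow-0 : ∀ {m} → 0 < m → pow 0# m ≡ 0#
   pow-0 {suc m} _ = zeroˡ _
   roots : # (λ a → ⊤ × a ^^ m ≡ ε) ≤ #K (λ x → pow x m - 1# ≡ 0#)
   roots = #-inj (λ a _ → ix (elᵤ a)) (λ a (_ , e) → subst (λ x → pow x m - 1# ≡ 0#) (sym (at-ix (elᵤ a)))
    (≡⇒-≡0 (trans (sym (el-pow a m)) (trans (cong elᵤ e) el-ε))))
    λ a _ b _ e → elᵤ-injective (ix-injective e)

  comm : ∀ a b → a ∙ b ≡ b ∙ a
  comm a b = elᵤ-injective (trans (el-∙ a b) (trans (*-comm _ _) (sym (el-∙ b a))))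

  generator : ∃ λ g → ⊤ × IsOrder g (# (λ (_ : Fin units) → ⊤)) × (∀ a → ⊤ → ∃ λ k → k < # (λ (_ : Fin units) → ⊤) × a ≡ g ^^ k)
  generator = cyclic whole (λ {a} {b} _ _ → comm a b) bound

  #units : # (λ (_ : Fin units) → ⊤) ≡ units
  #units = #-all _

 opaque
  γ : Carrier
  γ = elᵤ (proj₁ generator)

  γ≢0 : γ ≢ 0#
  γ≢0 = elᵤ≢0 (proj₁ generator)

  γ-order : ∀ n → pow γ n ≡ 1# → units ∣ n
  γ-order n e = subst (_∣ n) #units (IsOrder.divisible (proj₁ (proj₂ (proj₂ generator))) n
   (elᵤ-injective (trans (el-pow _ n) (trans e (sym el-ε)))))

  γ-units : pow γ units ≡ 1#
  γ-units = trans (sym (el-pow _ units)) (trans (cong elᵤ (subst (λ n → proj₁ generator ^^ n ≡ ε) #units (IsOrder.power (proj₁ (proj₂ (proj₂ generator)))))) el-ε)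

  γ-generates : ∀ x → x ≢ 0# → ∃ λ k → k < units × x ≡ pow γ k
  γ-generates x ne = from (proj₂ (proj₂ (proj₂ generator)) (ixᵤ x ne) tt)
   where
   from : (∃ λ k → k < # (λ (_ : Fin units) → ⊤) × ixᵤ x ne ≡ proj₁ generator ^^ k) → ∃ λ k → k < units × x ≡ pow (elᵤ (proj₁ generator)) k
   from (k , lt , e) = k , subst (k <_) #units lt , trans (el-ixᵤ x ne) (trans (cong elᵤ e) (el-pow _ k))

 suc-units : suc units ≡ q
 suc-units = trans (cong suc (sym (trans (sym #K≡) #units))) #K-nonzero
  where
  #K≡ : # (λ (_ : Fin units) → ⊤) ≡ #K (λ x → x ≢ 0#)
  #K≡ = #-bij (λ a → ix (elᵤ a)) (λ a _ → subst (_≢ 0#) (sym (at-ix (elᵤ a))) (elᵤ≢0 a)) (λ a b _ _ e → elᵤ-injective (ix-injective e))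
   λ j ne → ixᵤ (at j) ne , tt , trans (cong ix (sym (el-ixᵤ _ _))) (ix-at j)

 fermat : ∀ x → x ≢ 0# → pow x units ≡ 1#
 fermat x ne = from (γ-generates x ne)
  where
  from : (∃ λ k → k < units × x ≡ pow γ k) → pow x units ≡ 1#
  from (k , _ , refl) = trans (sym (pow-* γ units k)) (trans (cong (pow γ) (ℕ.*-comm units k)) (trans (pow-* γ k units) (trans (cong (λ z → pow z k) γ-units) (pow-1 k))))

 -- On a set of odd size the involution x ↦ x + 1 would have a fixed point.
 two≡0⇒even : two ≡ 0# → Even q
 two≡0⇒even e = subst Even (#K-all {λ _ → ⊤} _) (Sum′.fromInj₁ (λ o → ⊥-elim (no-fixed (odd-witness (odd-fixed f _ invol o)))) (even⊎odd _))
  where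
  f : Fin q → Fin q
  f i = ix (at i + 1#)
  invol : ∀ i → ⊤ → f (f i) ≡ i
  invol i _ = trans (cong ix (trans (cong (_+ 1#) (at-ix _)) (trans (+-assoc _ _ _) (trans (cong (at i +_) e) (+-identityʳ _))))) (ix-at i)
  no-fixed : (∃ λ i → ⊤ × f i ≡ i) → ⊥
  no-fixed (i , _ , fi) = 1≢0 (trans (solve 2 (λ x o → o := x :+ o :- x) refl (at i) 1#)
   (≡⇒-≡0 (trans (sym (at-ix _)) (cong at fi))))

 module OddUnits (two≢0 : two ≢ 0#) where

  minus-one≢one : - 1# ≢ 1#
  minus-one≢one e = two≢0 (trans (cong (1# +_) (sym e)) (-‿inverseʳ 1#))

  minus-one≢0 : - 1# ≢ 0#
  minus-one≢0 e = 1≢0 (trans (solve 0 (:1 := :- (:- :1)) refl) (trans (cong -_ e) (solve 0 (:- :0 := :0) refl)))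

  minus-one² : - 1# * - 1# ≡ 1#
  minus-one² = solve 0 ((:- :1) :* (:- :1) := :1) refl

  -- Write -1 = γᵏ. Then `units` divides 2k; if it were odd, it would divide k, and -1 would be 1.
  units-even : Even units
  units-even = [ id , (λ o → ⊥-elim (odd-contra o (γ-generates (- 1#) minus-one≢0))) ]′ (even⊎odd units)
   where
   odd-contra : Odd units → (∃ λ k → k < units × - 1# ≡ pow γ k) → ⊥
   odd-contra (h , e) (k , _ , f) = from (γ-order (k ℕ.+ k) (trans (pow-+ γ k k) (trans (cong₂ _*_ (sym f) (sym f)) minus-one²)))
    where
    from : units ∣ k ℕ.+ k → ⊥
    from (divides c d) = [ (λ (c′ , ec) → minus-one≢one (trans f (trans (cong (pow γ) (double-injective {k} {c′ ℕ.* units}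
     (trans d (trans (cong (ℕ._* units) ec) (ℕ.*-distribʳ-+ units c′ c′))))) (trans (pow-* γ c′ units) (trans (cong (λ z → pow z c′) γ-units) (pow-1 c′))))))
     , (λ oc → even-odd-⊥ (k , sym d) (odd*odd oc (h , e))) ]′ (even⊎odd c)

  -- (q - 1)/2, the exponent in Euler's criterion.
  h : ℕ
  h = proj₁ units-even

  units≡h+h : units ≡ h ℕ.+ h
  units≡h+h = proj₂ units-even

  q≡ : q ≡ suc (h ℕ.+ h)
  q≡ = trans (sym suc-units) (cong suc units≡h+h)

  h>0 : 0 < h
  h>0 = ℕ.n≢0⇒n>0 λ z → absurd (subst (λ n → ∃ λ k → k < n × 1# ≡ pow γ k) (trans units≡h+h (cong₂ ℕ._+_ z z)) (γ-generates 1# 1≢0))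
   where
   absurd : (∃ λ k → k < 0 × 1# ≡ pow γ k) → ⊥
   absurd (_ , () , _)

  γ-h : pow γ h ≡ - 1#
  γ-h = [ (λ e → ⊥-elim (ℕ.<⇒≱ (ℕ.m<m+n h h>0) (subst (_≤ h) units≡h+h (∣⇒≤ {{ℕ.>-nonZero h>0}} (γ-order h e))))) , id ]′
   (square-roots (trans (sym (pow-+ γ h h)) (trans (cong (pow γ) (sym units≡h+h)) (trans γ-units (sym (*-identityˡ 1#))))))

  pow-minus-one : ∀ {n} → Even n → pow (- 1#) n ≡ 1#
  pow-minus-one (k , refl) = trans (pow-+ (- 1#) k k) (trans (sym (pow-distrib (- 1#) (- 1#) k)) (trans (cong (λ z → pow z k) minus-one²) (pow-1 k)))

  pow-minus-one-odd : ∀ {n} → Odd n → pow (- 1#) n ≡ - 1#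
  pow-minus-one-odd (k , refl) = trans (cong (- 1# *_) (pow-minus-one (k , refl))) (*-identityʳ _)

  even-power-square : ∀ {k} → Even k → Square (pow γ k)
  even-power-square (l , refl) = pow γ l , pow-+ γ l l

  euler : ∀ k → pow (pow γ k) h ≡ pow (- 1#) k
  euler k = trans (sym (pow-* γ h k)) (trans (cong (pow γ) (ℕ.*-comm h k)) (trans (pow-* γ k h) (cong (λ z → pow z k) γ-h)))

  square-euler : ∀ {x} → x ≢ 0# → Square x → pow x h ≡ 1#
  square-euler ne (s , refl) = trans (pow-distrib s s h) (trans (sym (pow-+ s h h)) (trans (cong (pow s) (sym units≡h+h)) (fermat s (nonzero-*ˡ ne))))

  euler-square : ∀ {x} → x ≢ 0# → pow x h ≡ 1# → Square x
  euler-square {x} ne e = from (γ-generates x ne)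
   where
   from : (∃ λ k → k < units × x ≡ pow γ k) → Square x
   from (k , _ , f) = subst Square (sym f) ([ even-power-square , (λ o → ⊥-elim (minus-one≢one
    (trans (sym (pow-minus-one-odd o)) (trans (sym (euler k)) (trans (cong (λ z → pow z h) (sym f)) e))))) ]′ (even⊎odd k))

  nonsquare-odd : ∀ {x} → ¬ Square x → x ≢ 0# → ∃ λ k → Odd k × x ≡ pow γ k
  nonsquare-odd {x} ns ne = from (γ-generates x ne)
   where
   from : (∃ λ k → k < units × x ≡ pow γ k) → ∃ λ k → Odd k × x ≡ pow γ k
   from (k , _ , f) = k , ¬even⇒odd (λ e → ns (subst Square (sym f) (even-power-square e))) , f

  zero-square : Square 0#
  zero-square = 0# , sym (zeroˡ 0#)

  nonsquare≢0 : ∀ {x} → ¬ Square x → x ≢ 0#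
  nonsquare≢0 ns refl = ns zero-square

  nonsquare-* : ∀ {x y} → ¬ Square x → ¬ Square y → Square (x * y)
  nonsquare-* {x} {y} nx ny = from (nonsquare-odd nx (nonsquare≢0 nx)) (nonsquare-odd ny (nonsquare≢0 ny))
   where
   from : (∃ λ k → Odd k × x ≡ pow γ k) → (∃ λ k → Odd k × y ≡ pow γ k) → Square (x * y)
   from (k , ok , refl) (l , ol , refl) = subst Square (pow-+ γ k l) (even-power-square (odd+odd ok ol))

  γ-nonsquare : ¬ Square γ
  γ-nonsquare s = minus-one≢one (trans (sym γ-h) (square-euler γ≢0 s))

  -1-square : Square (- 1#) → Even h
  -1-square s = [ id , (λ o → ⊥-elim (minus-one≢one (trans (sym (pow-minus-one-odd o)) (square-euler minus-one≢0 s)))) ]′ (even⊎odd h)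

  even-h⇒-1-square : Even h → Square (- 1#)
  even-h⇒-1-square e = euler-square minus-one≢0 (pow-minus-one e)

open import Data.List using (cartesianProductWith; map)
open import Relation.Binary using (IsEquivalence)
open import Data.Vec as Vec using (Vec; []; _∷_)
import Data.Vec.Properties as Vec

-- Matrices over K, and PΓL₂(q) as a group on a finite index set.

module ProjectiveTheory (em : (P : Set) → Dec P) {q : ℕ} (K : FiniteField q) where
 open Classical em
 open FieldTheory em K public

 mat-≡ : ∀ {a b c d a′ b′ c′ d′} → a ≡ a′ → b ≡ b′ → c ≡ c′ → d ≡ d′ → mat a b c d ≡ mat a′ b′ c′ d′
 mat-≡ refl refl refl refl = refl

 ·ₘ-assoc : ∀ A B C → (A ·ₘ B) ·ₘ C ≡ A ·ₘ (B ·ₘ C)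
 ·ₘ-assoc (mat a b c d) (mat e f g h) (mat i j k l) = mat-≡ (entry a b i k) (entry a b j l) (entry c d i k) (entry c d j l)
  where
  entry : ∀ a b i k → (a * e + b * g) * i + (a * f + b * h) * k ≡ a * (e * i + f * k) + b * (g * i + h * k)
  entry a b i k = solve 8 (λ a b e f g h i k → (a :* e :+ b :* g) :* i :+ (a :* f :+ b :* h) :* k := a :* (e :* i :+ f :* k) :+ b :* (g :* i :+ h :* k)) refl a b e f g h i k

 ·ₘ-identityˡ : ∀ A → idMat ·ₘ A ≡ A
 ·ₘ-identityˡ (mat a b c d) = mat-≡ (top a c) (top b d) (bottom a c) (bottom b d)
  where
  top : ∀ a c → 1# * a + 0# * c ≡ a
  top = solve 2 (λ a c → :1 :* a :+ :0 :* c := a) refl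
  bottom : ∀ a c → 0# * a + 1# * c ≡ c
  bottom = solve 2 (λ a c → :0 :* a :+ :1 :* c := c) refl

 ·ₘ-identityʳ : ∀ A → A ·ₘ idMat ≡ A
 ·ₘ-identityʳ (mat a b c d) = mat-≡ (left a b) (right a b) (left c d) (right c d)
  where
  left : ∀ a c → a * 1# + c * 0# ≡ a
  left = solve 2 (λ a c → a :* :1 :+ c :* :0 := a) refl
  right : ∀ a c → a * 0# + c * 1# ≡ c
  right = solve 2 (λ a c → a :* :0 :+ c :* :1 := c) refl

 det-·ₘ : ∀ A B → det (A ·ₘ B) ≡ det A * det B
 det-·ₘ (mat a b c d) (mat e f g h) = solve 8 (λ a b c d e f g h →
  (a :* e :+ b :* g) :* (c :* f :+ d :* h) :- (a :* f :+ b :* h) :* (c :* e :+ d :* g) := (a :* d :- b :* c) :* (e :* h :- f :* g)) refl a b c d e f g h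

 det-scale : ∀ l A → det (scale l A) ≡ l * l * det A
 det-scale l (mat a b c d) = solve 5 (λ l a b c d → l :* a :* (l :* d) :- l :* b :* (l :* c) := l :* l :* (a :* d :- b :* c)) refl l a b c d

 scale-·ₘ : ∀ l A B → scale l A ·ₘ B ≡ scale l (A ·ₘ B)
 scale-·ₘ l (mat a b c d) (mat e f g h) = mat-≡ (entry a b e g) (entry a b f h) (entry c d e g) (entry c d f h)
  where
  entry : ∀ a b e g → l * a * e + l * b * g ≡ l * (a * e + b * g)
  entry a b e g = solve 5 (λ l a b e g → l :* a :* e :+ l :* b :* g := l :* (a :* e :+ b :* g)) refl l a b e g

 ·ₘ-scale : ∀ l A B → A ·ₘ scale l B ≡ scale l (A ·ₘ B)
 ·ₘ-scale l (mat a b c d) (mat e f g h) = mat-≡ (entry a b e g) (entry a b f h) (entry c d e g) (entry c d f h)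
  where
  entry : ∀ a b e g → a * (l * e) + b * (l * g) ≡ l * (a * e + b * g)
  entry a b e g = solve 5 (λ l a b e g → a :* (l :* e) :+ b :* (l :* g) := l :* (a :* e :+ b :* g)) refl l a b e g

 scale-scale : ∀ l m A → scale l (scale m A) ≡ scale (l * m) A
 scale-scale l m (mat a b c d) = mat-≡ (sym (*-assoc l m a)) (sym (*-assoc l m b)) (sym (*-assoc l m c)) (sym (*-assoc l m d))

 scale-1 : ∀ A → scale 1# A ≡ A
 scale-1 (mat a b c d) = mat-≡ (*-identityˡ a) (*-identityˡ b) (*-identityˡ c) (*-identityˡ d)

 adj : Mat → Mat
 adj (mat a b c d) = mat d (- b) (- c) a

 ·ₘ-adj : ∀ A → A ·ₘ adj A ≡ scale (det A) idMat
 ·ₘ-adj (mat a b c d) = mat-≡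
  (solve 4 (λ a b c d → a :* d :+ b :* (:- c) := (a :* d :- b :* c) :* :1) refl a b c d)
  (solve 4 (λ a b c d → a :* (:- b) :+ b :* a := (a :* d :- b :* c) :* :0) refl a b c d)
  (solve 4 (λ a b c d → c :* d :+ d :* (:- c) := (a :* d :- b :* c) :* :0) refl a b c d)
  (solve 4 (λ a b c d → c :* (:- b) :+ d :* a := (a :* d :- b :* c) :* :1) refl a b c d)

 adj-·ₘ : ∀ A → adj A ·ₘ A ≡ scale (det A) idMat
 adj-·ₘ (mat a b c d) = mat-≡
  (solve 4 (λ a b c d → d :* a :+ (:- b) :* c := (a :* d :- b :* c) :* :1) refl a b c d)
  (solve 4 (λ a b c d → d :* b :+ (:- b) :* d := (a :* d :- b :* c) :* :0) refl a b c d)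
  (solve 4 (λ a b c d → (:- c) :* a :+ a :* c := (a :* d :- b :* c) :* :0) refl a b c d)
  (solve 4 (λ a b c d → (:- c) :* b :+ a :* d := (a :* d :- b :* c) :* :1) refl a b c d)

 det-adj : ∀ A → det (adj A) ≡ det A
 det-adj (mat a b c d) = solve 4 (λ a b c d → d :* a :- (:- b) :* (:- c) := a :* d :- b :* c) refl a b c d

 det-id : det idMat ≡ 1#
 det-id = solve 0 (:1 :* :1 :- :0 :* :0 := :1) refl

 module FieldAut {σ : Carrier → Carrier} (σ-aut : IsFieldAut σ) where
  σ-+ : ∀ x y → σ (x + y) ≡ σ x + σ y
  σ-+ = proj₁ σ-aut
  σ-* : ∀ x y → σ (x * y) ≡ σ x * σ y
  σ-* = proj₁ (proj₂ σ-aut)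
  σ-1 : σ 1# ≡ 1#
  σ-1 = proj₁ (proj₂ (proj₂ σ-aut))
  σ-injective : ∀ x y → σ x ≡ σ y → x ≡ y
  σ-injective = proj₁ (proj₂ (proj₂ (proj₂ σ-aut)))
  σ-surjective : ∀ y → ∃ λ x → σ x ≡ y
  σ-surjective = proj₂ (proj₂ (proj₂ (proj₂ σ-aut)))

  σ-0 : σ 0# ≡ 0#
  σ-0 = trans (solve 1 (λ s → s := s :+ s :- s) refl (σ 0#))
   (trans (cong (_- σ 0#) (trans (sym (σ-+ 0# 0#)) (cong σ (+-identityˡ 0#)))) (-‿inverseʳ _))

  σ-neg : ∀ x → σ (- x) ≡ - σ x
  σ-neg x = -≡0 (trans (solve 2 (λ s t → s :- (:- t) := s :+ t) refl (σ (- x)) (σ x))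
   (trans (sym (σ-+ (- x) x)) (trans (cong σ (-‿inverseˡ x)) σ-0)))

  σ-nonzero : ∀ {x} → x ≢ 0# → σ x ≢ 0#
  σ-nonzero ne e = ne (σ-injective _ _ (trans e (sym σ-0)))

  σ⁻ : Carrier → Carrier
  σ⁻ y = proj₁ (σ-surjective y)

  σσ⁻ : ∀ y → σ (σ⁻ y) ≡ y
  σσ⁻ y = proj₂ (σ-surjective y)

  σ⁻σ : ∀ x → σ⁻ (σ x) ≡ x
  σ⁻σ x = σ-injective _ _ (σσ⁻ (σ x))

  σ⁻-aut : IsFieldAut σ⁻
  σ⁻-aut = (λ x y → σ-injective _ _ (trans (σσ⁻ _) (sym (trans (σ-+ _ _) (cong₂ _+_ (σσ⁻ x) (σσ⁻ y))))))
   , (λ x y → σ-injective _ _ (trans (σσ⁻ _) (sym (trans (σ-* _ _) (cong₂ _*_ (σσ⁻ x) (σσ⁻ y))))))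
   , σ-injective _ _ (trans (σσ⁻ 1#) (sym σ-1))
   , (λ x y e → trans (sym (σσ⁻ x)) (trans (cong σ e) (σσ⁻ y)))
   , λ y → σ y , σ⁻σ y

  map-·ₘ : ∀ A B → mapMat σ (A ·ₘ B) ≡ mapMat σ A ·ₘ mapMat σ B
  map-·ₘ A B = mat-≡ (entry _ _ _ _) (entry _ _ _ _) (entry _ _ _ _) (entry _ _ _ _)
   where
   entry : ∀ a b c d → σ (a * b + c * d) ≡ σ a * σ b + σ c * σ d
   entry a b c d = trans (σ-+ _ _) (cong₂ _+_ (σ-* a b) (σ-* c d))

  map-scale : ∀ l A → mapMat σ (scale l A) ≡ scale (σ l) (mapMat σ A)
  map-scale l A = mat-≡ (σ-* l _) (σ-* l _) (σ-* l _) (σ-* l _)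

  map-id : mapMat σ idMat ≡ idMat
  map-id = mat-≡ σ-1 σ-0 σ-0 σ-1

  det-map : ∀ A → det (mapMat σ A) ≡ σ (det A)
  det-map A = sym (trans (σ-+ _ _) (cong₂ _+_ (σ-* _ _) (trans (σ-neg _) (cong -_ (σ-* _ _)))))

 mapMat-cong : ∀ {σ τ : Carrier → Carrier} → (∀ z → σ z ≡ τ z) → ∀ A → mapMat σ A ≡ mapMat τ A
 mapMat-cong e A = mat-≡ (e _) (e _) (e _) (e _)

 mapMat-id : ∀ {σ : Carrier → Carrier} → (∀ z → σ z ≡ z) → ∀ A → mapMat σ A ≡ A
 mapMat-id e A = mat-≡ (e _) (e _) (e _) (e _)

 id-aut : ∀ {σ : Carrier → Carrier} → (∀ z → σ z ≡ z) → IsFieldAut σ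
 id-aut e = (λ x y → trans (e _) (sym (cong₂ _+_ (e x) (e y)))) , (λ x y → trans (e _) (sym (cong₂ _*_ (e x) (e y)))) ,
  e 1# , (λ x y f → trans (sym (e x)) (trans f (e y))) , λ y → y , e y

 ∘-aut : ∀ {σ τ} → IsFieldAut σ → IsFieldAut τ → IsFieldAut (λ z → σ (τ z))
 ∘-aut {σ} {τ} s t = (λ x y → trans (cong σ (T.σ-+ x y)) (S.σ-+ _ _)) , (λ x y → trans (cong σ (T.σ-* x y)) (S.σ-* _ _)) ,
  trans (cong σ T.σ-1) S.σ-1 , (λ x y e → T.σ-injective _ _ (S.σ-injective _ _ e)) ,
  λ y → T.σ⁻ (S.σ⁻ y) , trans (cong σ (T.σσ⁻ _)) (S.σσ⁻ y)
  where
  module S = FieldAut s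
  module T = FieldAut t

 aut-cong : ∀ {σ τ : Carrier → Carrier} → (∀ z → σ z ≡ τ z) → IsFieldAut σ → IsFieldAut τ
 aut-cong e s = (λ x y → trans (sym (e _)) (trans (S.σ-+ x y) (cong₂ _+_ (e x) (e y)))) ,
  (λ x y → trans (sym (e _)) (trans (S.σ-* x y) (cong₂ _*_ (e x) (e y)))) , trans (sym (e 1#)) S.σ-1 ,
  (λ x y f → S.σ-injective _ _ (trans (e x) (trans f (sym (e y))))) , λ y → S.σ⁻ y , trans (sym (e _)) (S.σσ⁻ y)
  where module S = FieldAut s

 infix 4 _∝_
 _∝_ : Mat → Mat → Set
 A ∝ B = ∃ λ l → l ≢ 0# × B ≡ scale l A

 ∝-refl : ∀ {A} → A ∝ A
 ∝-refl = 1# , 1≢0 , sym (scale-1 _)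

 ∝-sym : ∀ {A B} → A ∝ B → B ∝ A
 ∝-sym {A} (l , ne , refl) = recip l , recip-nonzero ne ,
  sym (trans (scale-scale (recip l) l A) (trans (cong (λ z → scale z A) (recip-* ne)) (scale-1 A)))

 ∝-trans : ∀ {A B C} → A ∝ B → B ∝ C → A ∝ C
 ∝-trans {A} (l , ne , refl) (m , ne′ , refl) = m * l , *-nonzero ne′ ne , scale-scale m l A

 ∝-reflexive : ∀ {A B} → A ≡ B → A ∝ B
 ∝-reflexive refl = ∝-refl

 ∝-·ₘ : ∀ {A B C D} → A ∝ B → C ∝ D → A ·ₘ C ∝ B ·ₘ D
 ∝-·ₘ {A} {C = C} (l , ne , refl) (m , ne′ , refl) = l * m , *-nonzero ne ne′ ,
  trans (scale-·ₘ l A (scale m C)) (trans (cong (scale l) (·ₘ-scale m A C)) (scale-scale l m _))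

 ∝-map : ∀ {σ} → IsFieldAut σ → ∀ {A B} → A ∝ B → mapMat σ A ∝ mapMat σ B
 ∝-map s {A} (l , ne , refl) = _ , S.σ-nonzero ne , S.map-scale l A
  where module S = FieldAut s

 ∝-det : ∀ {A B} → A ∝ B → det A ≢ 0# → det B ≢ 0#
 ∝-det {A} (l , ne , refl) dA = subst (_≢ 0#) (sym (det-scale l A)) (*-nonzero (*-nonzero ne ne) dA)

 ≈-refl : ∀ {x} → x ≈ x
 ≈-refl = (λ z → refl) , ∝-refl

 ≈-sym : ∀ {x y} → x ≈ y → y ≈ x
 ≈-sym (e , p) = (λ z → sym (e z)) , ∝-sym p

 ≈-trans : ∀ {x y z} → x ≈ y → y ≈ z → x ≈ z
 ≈-trans (e , p) (f , r) = (λ z → trans (e z) (f z)) , ∝-trans p r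

 ≈-isEquivalence : IsEquivalence _≈_
 ≈-isEquivalence = record { refl = ≈-refl ; sym = ≈-sym ; trans = ≈-trans }

 PΓL-respects : ∀ x y → x ≈ y → PΓL x → PΓL y
 PΓL-respects x y (e , p) (d , s) = ∝-det p d , aut-cong e s

 PΓL-one : PΓL one
 PΓL-one = (λ e → 1≢0 (trans (sym det-id) e)) , id-aut (λ _ → refl)

 PΓL-· : ∀ x y → PΓL x → PΓL y → PΓL (x · y)
 PΓL-· x y (d , s) (d′ , s′) =
  subst (_≢ 0#) (sym (trans (det-·ₘ _ _) (cong (det (matrix x) *_) (S.det-map (matrix y))))) (*-nonzero d (S.σ-nonzero d′)) , ∘-aut s s′
  where module S = FieldAut s

 ·-cong : ∀ {x x′ y y′} → PΓL x → x ≈ x′ → y ≈ y′ → x · y ≈ x′ · y′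
 ·-cong {x} {x′} {y} {y′} (d , s) (e , p) (e′ , p′) = (λ z → trans (e _) (cong (aut x′) (e′ z))) ,
  ∝-·ₘ p (subst (mapMat (aut x) (matrix y) ∝_) (mapMat-cong e (matrix y′)) (∝-map s p′))

 ·-assoc : ∀ x y z → PΓL x → x · y · z ≈ x · (y · z)
 ·-assoc x y z (d , s) = (λ _ → refl) , ∝-reflexive (trans (·ₘ-assoc _ _ _) (cong (matrix x ·ₘ_) (sym (S.map-·ₘ (matrix y) (mapMat (aut y) (matrix z))))))
  where module S = FieldAut s

 ·-identityˡ : ∀ x → one · x ≈ x
 ·-identityˡ x = (λ _ → refl) , ∝-reflexive (·ₘ-identityˡ _)

 ·-identityʳ : ∀ x → PΓL x → x · one ≈ x
 ·-identityʳ x (d , s) = (λ _ → refl) , ∝-reflexive (trans (cong (matrix x ·ₘ_) S.map-id) (·ₘ-identityʳ _))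
  where module S = FieldAut s

 inverse-of : ∀ x → PΓL x → Elem
 inverse-of x (d , s) = ⟨ mapMat S.σ⁻ (adj (matrix x)) , S.σ⁻ ⟩
  where module S = FieldAut s

 PΓL-inverse : ∀ x (p : PΓL x) → PΓL (inverse-of x p)
 PΓL-inverse x (d , s) = subst (_≢ 0#) (sym (S⁻.det-map _)) (S⁻.σ-nonzero (subst (_≢ 0#) (sym (det-adj (matrix x))) d)) , S.σ⁻-aut
  where
  module S = FieldAut s
  module S⁻ = FieldAut S.σ⁻-aut

 inverse-ofʳ : ∀ x (p : PΓL x) → x · inverse-of x p ≈ one
 inverse-ofʳ x (d , s) = S.σσ⁻ , ∝-sym (det (matrix x) , d ,
  trans (cong (matrix x ·ₘ_) (mat-≡ (S.σσ⁻ _) (S.σσ⁻ _) (S.σσ⁻ _) (S.σσ⁻ _))) (·ₘ-adj (matrix x)))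
  where module S = FieldAut s

 inverse-ofˡ : ∀ x (p : PΓL x) → inverse-of x p · x ≈ one
 inverse-ofˡ x (d , s) = S.σ⁻σ , ∝-sym (S.σ⁻ (det (matrix x)) , S⁻.σ-nonzero d ,
  trans (sym (S⁻.map-·ₘ _ _)) (trans (cong (mapMat S.σ⁻) (adj-·ₘ (matrix x))) (trans (S⁻.map-scale _ _) (cong (scale _) S⁻.map-id))))
  where
  module S = FieldAut s
  module S⁻ = FieldAut S.σ⁻-aut

 all-mats : List Mat
 all-mats = cartesianProductWith (λ (a , b) (c , d) → mat a b c d) pairs pairs
  where pairs = cartesianProductWith _,_ elements elements

 ∈-mats : ∀ A → A ∈ all-mats
 ∈-mats (mat a b c d) = ∈-cartesianProductWith⁺ (λ (a , b) (c , d) → mat a b c d) (pair a b) (pair c d)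
  where
  pair : ∀ a b → (a , b) ∈ cartesianProductWith _,_ elements elements
  pair a b = ∈-cartesianProductWith⁺ _,_ (elements-complete a) (elements-complete b)

 vectors : ∀ n → List (Vec Carrier n)
 vectors zero = [] ∷ []
 vectors (suc n) = cartesianProductWith _∷_ elements (vectors n)

 ∈-vectors : ∀ {n} (v : Vec Carrier n) → v ∈ vectors n
 ∈-vectors [] = here refl
 ∈-vectors (x ∷ v) = ∈-cartesianProductWith⁺ _∷_ (elements-complete x) (∈-vectors v)

 -- Maps on K are listed through their tables of values, which is enough because `≈` compares them
 -- pointwise.
 all-elems : List Elem
 all-elems = cartesianProductWith (λ A v → ⟨ A , (λ z → Vec.lookup v (ix z)) ⟩) all-mats (vectors q)

 any-elem : ∀ x → Any (x ≈_) all-elems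
 any-elem x = Any.map (λ { refl → (λ z → sym (trans (Vec.lookup∘tabulate _ (ix z)) (cong (aut x) (at-ix z)))) , ∝-refl })
  (∈-cartesianProductWith⁺ (λ A v → ⟨ A , (λ z → Vec.lookup v (ix z)) ⟩) (∈-mats (matrix x)) (∈-vectors (Vec.tabulate (λ i → aut x (at i)))))

 open Representatives em ≈-isEquivalence all-elems public using (module Enumeration)
 open Enumeration {Q = PΓL} PΓL-respects (λ x _ → any-elem x) public using (N; el; el-injective; list-count) renaming (el-Q to el-PΓL; ix to ixΓ; el-ix to el-ixΓ)

 tr : Mat → Carrier
 tr A = m₁₁ A + m₂₂ A

 -- The element α + βA of the algebra generated by A.
 lin : Carrier → Carrier → Mat → Mat
 lin α β (mat a b c d) = mat (α + β * a) (β * b) (β * c) (α + β * d)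

 neg : Mat → Mat
 neg = scale (- 1#)

 Scalar : Mat → Set
 Scalar (mat a b c d) = b ≡ 0# × c ≡ 0# × a ≡ d

 Commute : Mat → Mat → Set
 Commute A B = A ·ₘ B ≡ B ·ₘ A

 Anticomm : Mat → Mat → Set
 Anticomm A B = A ·ₘ B ≡ neg (B ·ₘ A)

 mat-inj : ∀ {a b c d a′ b′ c′ d′} → mat a b c d ≡ mat a′ b′ c′ d′ → a ≡ a′ × b ≡ b′ × c ≡ c′ × d ≡ d′
 mat-inj refl = refl , refl , refl , refl

 scalar-∝ : ∀ A → det A ≢ 0# → Scalar A → idMat ∝ A
 scalar-∝ (mat a b c d) ne (refl , refl , refl) = a , (λ { refl → ne (solve 0 (:0 :* :0 :- :0 :* :0 := :0) refl) }) ,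
  mat-≡ (sym (*-identityʳ a)) (sym (zeroʳ a)) (sym (zeroʳ a)) (sym (*-identityʳ a))

 ∝-scalar : ∀ {A} → idMat ∝ A → Scalar A
 ∝-scalar (l , _ , refl) = zeroʳ l , zeroʳ l , refl

 scale-scalar : ∀ l → Scalar (scale l idMat)
 scale-scalar l = zeroʳ l , zeroʳ l , refl

 private
  cancel : ∀ f x y z → f ≢ 0# → z ≡ f * (x - y) → z ≡ 0# → x ≡ y
  cancel f x y z ne e e′ = -≡0 (zero-product (trans (sym e) e′) ne)

 -- β is read off from a nonzero off-diagonal entry of B or, when B is diagonal, from the difference
 -- of its diagonal entries; AB = BA then forces the other entries of A.
 centralizer : ∀ A B → ¬ Scalar B → Commute A B → ∃ λ α → ∃ λ β → A ≡ lin α β B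
 centralizer (mat a b c d) (mat e f g h) ns comm with mat-inj comm
 ... | e₁₁ , e₁₂ , e₂₁ , _ = by-cases (em (f ≡ 0#)) (em (g ≡ 0#))
  where
  head : ∀ β → a ≡ a - β * e + β * e
  head β = solve 2 (λ a x → a := a :- x :+ x) refl a (β * e)
  by-cases : Dec (f ≡ 0#) → Dec (g ≡ 0#) → ∃ λ α → ∃ λ β → mat a b c d ≡ lin α β (mat e f g h)
  by-cases (no f≢0) _ = a - β * e , β , mat-≡ (head β) (sym βf) c≡ d≡
   where
   β = b * recip f
   βf : β * f ≡ b
   βf = trans (*-assoc b (recip f) f) (trans (cong (b *_) (recip-* f≢0)) (*-identityʳ b))
   c≡ : c ≡ β * g
   c≡ = cancel f c (β * g) ((e * a + f * c) - (a * e + β * f * g)) f≢0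
    (solve 6 (λ a c e f g β → (e :* a :+ f :* c) :- (a :* e :+ β :* f :* g) := f :* (c :- β :* g)) refl a c e f g β)
    (≡⇒-≡0 (trans (sym e₁₁) (cong (λ z → a * e + z * g) (sym βf))))
   d≡ : d ≡ a - β * e + β * h
   d≡ = cancel f d (a - β * e + β * h) ((e * (β * f) + f * d) - (a * f + β * f * h)) f≢0
    (solve 6 (λ a d e f h β → (e :* (β :* f) :+ f :* d) :- (a :* f :+ β :* f :* h) := f :* (d :- (a :- β :* e :+ β :* h))) refl a d e f h β)
    (≡⇒-≡0 (trans (cong (λ z → e * z + f * d) βf) (trans (sym e₁₂) (cong (λ z → a * f + z * h) (sym βf)))))
  by-cases (yes refl) (no g≢0) = a - β * e , β , mat-≡ (head β) b≡ (sym βg) d≡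
   where
   β = c * recip g
   βg : β * g ≡ c
   βg = trans (*-assoc c (recip g) g) (trans (cong (c *_) (recip-* g≢0)) (*-identityʳ c))
   b≡ : b ≡ β * 0#
   b≡ = cancel g b (β * 0#) ((a * e + b * g) - (e * a + 0# * c)) g≢0
    (solve 6 (λ a b c e g β → (a :* e :+ b :* g) :- (e :* a :+ :0 :* c) := g :* (b :- β :* :0)) refl a b c e g β) (≡⇒-≡0 e₁₁)
   d≡ : d ≡ a - β * e + β * h
   d≡ = cancel g d (a - β * e + β * h) ((β * g * e + d * g) - (g * a + h * (β * g))) g≢0
    (solve 6 (λ a d e g h β → (β :* g :* e :+ d :* g) :- (g :* a :+ h :* (β :* g)) := g :* (d :- (a :- β :* e :+ β :* h))) refl a d e g h β)
    (≡⇒-≡0 (trans (cong (λ z → z * e + d * g) βg) (trans e₂₁ (cong (λ z → g * a + h * z) (sym βg)))))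
  by-cases (yes refl) (yes refl) = a - β * e , β , mat-≡ (head β) b≡ c≡ d≡
   where
   e-h : e - h ≢ 0#
   e-h z = ns (refl , refl , -≡0 z)
   β = (a - d) * recip (e - h)
   β* : β * (e - h) ≡ a - d
   β* = trans (*-assoc _ _ _) (trans (cong ((a - d) *_) (recip-* e-h)) (*-identityʳ _))
   b≡ : b ≡ β * 0#
   b≡ = cancel (e - h) b (β * 0#) ((e * b + 0# * d) - (a * 0# + b * h)) e-h
    (solve 6 (λ a b d e h β → (e :* b :+ :0 :* d) :- (a :* :0 :+ b :* h) := (e :- h) :* (b :- β :* :0)) refl a b d e h β) (≡⇒-≡0 (sym e₁₂))
   c≡ : c ≡ β * 0#
   c≡ = cancel (e - h) c (β * 0#) ((c * e + d * 0#) - (0# * a + h * c)) e-h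
    (solve 6 (λ a c d e h β → (c :* e :+ d :* :0) :- (:0 :* a :+ h :* c) := (e :- h) :* (c :- β :* :0)) refl a c d e h β) (≡⇒-≡0 e₂₁)
   d≡ : d ≡ a - β * e + β * h
   d≡ = -≡0 (trans (solve 5 (λ a d e h β → d :- (a :- β :* e :+ β :* h) := β :* (e :- h) :- (a :- d)) refl a d e h β) (≡⇒-≡0 β*))

 lin-commute : ∀ α β γ δ B → Commute (lin α β B) (lin γ δ B)
 lin-commute α β γ δ (mat a b c d) = mat-≡
  (solve 8 (λ α β γ δ a b c d → (α :+ β :* a) :* (γ :+ δ :* a) :+ β :* b :* (δ :* c) := (γ :+ δ :* a) :* (α :+ β :* a) :+ δ :* b :* (β :* c)) refl α β γ δ a b c d)
  (solve 8 (λ α β γ δ a b c d → (α :+ β :* a) :* (δ :* b) :+ β :* b :* (γ :+ δ :* d) := (γ :+ δ :* a) :* (β :* b) :+ δ :* b :* (α :+ β :* d)) refl α β γ δ a b c d)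
  (solve 8 (λ α β γ δ a b c d → β :* c :* (γ :+ δ :* a) :+ (α :+ β :* d) :* (δ :* c) := δ :* c :* (α :+ β :* a) :+ (γ :+ δ :* d) :* (β :* c)) refl α β γ δ a b c d)
  (solve 8 (λ α β γ δ a b c d → β :* c :* (δ :* b) :+ (α :+ β :* d) :* (γ :+ δ :* d) := δ :* c :* (β :* b) :+ (γ :+ δ :* d) :* (α :+ β :* d)) refl α β γ δ a b c d)

 commute-trans : ∀ {A B C} → ¬ Scalar B → Commute A B → Commute B C → Commute A C
 commute-trans {A} {B} {C} ns c d with α , β , refl ← centralizer A B ns c | γ , δ , refl ← centralizer C B ns (sym d) = lin-commute α β γ δ B

 lin-01 : ∀ A → lin 0# 1# A ≡ A
 lin-01 (mat a b c d) = mat-≡ (trans (+-identityˡ _) (*-identityˡ a)) (*-identityˡ b) (*-identityˡ c) (trans (+-identityˡ _) (*-identityˡ d))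

 lin-0-scalar : ∀ α A → Scalar (lin α 0# A)
 lin-0-scalar α (mat a b c d) = zeroˡ b , zeroˡ c , cong (α +_) (trans (zeroˡ a) (sym (zeroˡ d)))

 lin-self : ∀ α β B → Commute (lin α β B) B
 lin-self α β B = subst (Commute (lin α β B)) (lin-01 B) (lin-commute α β 0# 1# B)

 scalar-commute : ∀ A B → Scalar A → Commute A B
 scalar-commute (mat a b c d) (mat e f g h) (refl , refl , refl) = mat-≡
  (solve 3 (λ a e g → a :* e :+ :0 :* g := e :* a :+ g :* :0) refl a e g ⟨≡⟩ solve 4 (λ a e f g → e :* a :+ g :* :0 := e :* a :+ f :* :0) refl a e f g)
  (solve 4 (λ a e f h → a :* f :+ :0 :* h := e :* :0 :+ f :* a) refl a e f h)
  (solve 4 (λ a e g h → :0 :* e :+ a :* g := g :* a :+ h :* :0) refl a e g h)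
  (solve 4 (λ a f g h → :0 :* f :+ a :* h := g :* :0 :+ h :* a) refl a f g h)
  where
  infixl 1 _⟨≡⟩_
  _⟨≡⟩_ : {x y z : Carrier} → x ≡ y → y ≡ z → x ≡ z
  _⟨≡⟩_ = trans

 commute-scale : ∀ {A B} l m → Commute A B → Commute (scale l A) (scale m B)
 commute-scale {A} {B} l m e = trans (trans (scale-·ₘ l A _) (cong (scale l) (·ₘ-scale m A B)))
  (trans (trans (scale-scale l m _) (trans (cong₂ scale (*-comm l m) e) (sym (scale-scale m l _))))
   (sym (trans (scale-·ₘ m B _) (cong (scale m) (·ₘ-scale l B A)))))

 commute-∝ : ∀ {A A′ B B′} → A ∝ A′ → B ∝ B′ → Commute A B → Commute A′ B′
 commute-∝ (l , _ , refl) (m , _ , refl) = commute-scale l m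

 commute-mul : ∀ {A B C} → Commute A C → Commute B C → Commute (A ·ₘ B) C
 commute-mul {A} {B} {C} c d = trans (·ₘ-assoc A B C) (trans (cong (A ·ₘ_) d) (trans (sym (·ₘ-assoc A C B))
  (trans (cong (_·ₘ B) c) (·ₘ-assoc C A B))))

 adj≡lin : ∀ A → adj A ≡ lin (tr A) (- 1#) A
 adj≡lin (mat a b c d) = mat-≡
  (solve 2 (λ a d → d := a :+ d :+ (:- :1) :* a) refl a d)
  (solve 1 (λ b → :- b := (:- :1) :* b) refl b)
  (solve 1 (λ b → :- b := (:- :1) :* b) refl c)
  (solve 2 (λ a d → a := a :+ d :+ (:- :1) :* d) refl a d)

 cayley-hamilton : ∀ A → A ·ₘ A ≡ lin (- det A) (tr A) A
 cayley-hamilton (mat a b c d) = mat-≡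
  (solve 4 (λ a b c d → a :* a :+ b :* c := :- (a :* d :- b :* c) :+ (a :+ d) :* a) refl a b c d)
  (solve 4 (λ a b c d → a :* b :+ b :* d := (a :+ d) :* b) refl a b c d)
  (solve 4 (λ a b c d → c :* a :+ d :* c := (a :+ d) :* c) refl a b c d)
  (solve 4 (λ a b c d → c :* b :+ d :* d := :- (a :* d :- b :* c) :+ (a :+ d) :* d) refl a b c d)

 traceless-square : ∀ A → tr A ≡ 0# → A ·ₘ A ≡ scale (- det A) idMat
 traceless-square A e = trans (cayley-hamilton A) (trans (cong (λ t → lin (- det A) t A) e) (lin-0 (- det A) A))
  where
  lin-0 : ∀ α A → lin α 0# A ≡ scale α idMat
  lin-0 α (mat a b c d) = mat-≡ (solve 2 (λ α a → α :+ :0 :* a := α :* :1) refl α a) (solve 2 (λ α a → :0 :* a := α :* :0) refl α b)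
   (solve 2 (λ α a → :0 :* a := α :* :0) refl α c) (solve 2 (λ α a → α :+ :0 :* a := α :* :1) refl α d)

 -- By Cayley and Hamilton, A² differs from tr A · A by a scalar matrix, and A is not scalar.
 square-scalar-traceless : ∀ A → ¬ Scalar A → Scalar (A ·ₘ A) → tr A ≡ 0#
 square-scalar-traceless (mat a b c d) ns s = from (subst Scalar (cayley-hamilton (mat a b c d)) s)
  where
  A = mat a b c d
  from : Scalar (lin (- det A) (tr A) A) → tr A ≡ 0#
  from (x , y , z) = dne λ t≢0 → ns (zero-product x t≢0 , zero-product y t≢0 , *-cancelˡ t≢0
   (trans (solve 2 (λ n x → x := n :+ x :- n) refl (- det A) (tr A * a)) (trans (cong (_- (- det A)) z) (solve 2 (λ n x → n :+ x :- n := x) refl (- det A) (tr A * d)))))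

 cancel-·ₘ : ∀ {G A B} → det G ≢ 0# → G ·ₘ A ≡ G ·ₘ B → A ≡ B
 cancel-·ₘ {G} {A} {B} ne e = scale-injective (trans (sym (expand A)) (trans (cong (adj G ·ₘ_) e) (expand B)))
  where
  expand : ∀ A → adj G ·ₘ (G ·ₘ A) ≡ scale (det G) A
  expand A = trans (sym (·ₘ-assoc _ G A)) (trans (cong (_·ₘ A) (adj-·ₘ G)) (trans (scale-·ₘ (det G) idMat A) (cong (scale (det G)) (·ₘ-identityˡ A))))
  scale-injective : ∀ {A B} → scale (det G) A ≡ scale (det G) B → A ≡ B
  scale-injective {mat a b c d} {mat a′ b′ c′ d′} e with x , y , z , w ← mat-inj e =
   mat-≡ (*-cancelˡ ne x) (*-cancelˡ ne y) (*-cancelˡ ne z) (*-cancelˡ ne w)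

 -- If BA = l·AB, comparing determinants gives l² = 1.
 projective-commute : ∀ {A B} → det A ≢ 0# → det B ≢ 0# → A ·ₘ B ∝ B ·ₘ A → Commute A B ⊎ Anticomm A B
 projective-commute {A} {B} dA dB (l , l≢0 , e) = by-cases (square-roots l²)
  where
  dAB : det (A ·ₘ B) ≢ 0#
  dAB = subst (_≢ 0#) (sym (det-·ₘ A B)) (*-nonzero dA dB)
  l² : l * l ≡ 1# * 1#
  l² = *-cancelˡ dAB (trans (*-comm _ _) (trans (sym (trans (cong det e) (det-scale l _)))
   (trans (det-·ₘ B A) (trans (*-comm _ _) (trans (sym (det-·ₘ A B)) (solve 1 (λ x → x := x :* (:1 :* :1)) refl _))))))
  by-cases : l ≡ 1# ⊎ l ≡ - 1# → Commute A B ⊎ Anticomm A B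
  by-cases (inj₁ refl) = inj₁ (sym (trans e (scale-1 _)))
  by-cases (inj₂ refl) = inj₂ (sym (trans (cong (scale (- 1#)) e) (trans (scale-scale _ _ _) (trans (cong (λ z → scale z (A ·ₘ B)) (solve 0 ((:- :1) :* (:- :1) := :1) refl)) (scale-1 _)))))

 anticommute-sym : ∀ {A B} → Anticomm A B → Anticomm B A
 anticommute-sym {A} {B} e = sym (trans (cong neg e) (trans (scale-scale _ _ _) (trans (cong (λ z → scale z (B ·ₘ A)) (solve 0 ((:- :1) :* (:- :1) := :1) refl)) (scale-1 _))))

 module Odd (two≢0 : two ≢ 0#) where

  half-zero : ∀ {x} → x + x ≡ 0# → x ≡ 0#
  half-zero {x} e = zero-product (trans (solve 1 (λ x → (:1 :+ :1) :* x := x :+ x) refl x) e) two≢0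

  -≢ : ∀ {x} → x ≢ 0# → x ≢ - x
  -≢ {x} ne e = ne (half-zero (trans (cong (x +_) e) (-‿inverseʳ x)))

  -- The traces of AB·adj B and of BA·adj B are both det B · tr A, and anticommuting makes them
  -- opposite.
  anticommute-traceless : ∀ {A B} → det B ≢ 0# → Anticomm A B → tr A ≡ 0#
  anticommute-traceless {A} {B} dB e = half-zero (zero-product (trans (sym (trace A B)) (cancels e)) dB)
   where
   cancels : Anticomm A B → tr ((A ·ₘ B) ·ₘ adj B) + tr ((B ·ₘ A) ·ₘ adj B) ≡ 0#
   cancels e = trans (cong (λ X → tr (X ·ₘ adj B) + tr ((B ·ₘ A) ·ₘ adj B)) e) (neg-tr (B ·ₘ A) (adj B))
    where
    neg-tr : ∀ X Y → tr (neg X ·ₘ Y) + tr (X ·ₘ Y) ≡ 0#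
    neg-tr (mat a b c d) (mat e f g h) = solve 8 (λ a b c d e f g h →
     (((:- :1) :* a) :* e :+ ((:- :1) :* b) :* g :+ (((:- :1) :* c) :* f :+ ((:- :1) :* d) :* h)) :+ (a :* e :+ b :* g :+ (c :* f :+ d :* h)) := :0) refl a b c d e f g h
   trace : ∀ A B → tr ((A ·ₘ B) ·ₘ adj B) + tr ((B ·ₘ A) ·ₘ adj B) ≡ det B * (tr A + tr A)
   trace (mat a b c d) (mat e f g h) = solve 8 (λ a b c d e f g h →
    (((a :* e :+ b :* g) :* h :+ (a :* f :+ b :* h) :* (:- g)) :+ ((c :* e :+ d :* g) :* (:- f) :+ (c :* f :+ d :* h) :* e)) :+
    (((e :* a :+ f :* c) :* h :+ (e :* b :+ f :* d) :* (:- g)) :+ ((g :* a :+ h :* c) :* (:- f) :+ (g :* b :+ h :* d) :* e)) :=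
    (e :* h :- f :* g) :* (a :+ d :+ (a :+ d))) refl a b c d e f g h

  -- A = α + βB and both traces vanish, so 2α = 0. Consequently two involutions that commute as
  -- matrices are equal.
  traceless-commute : ∀ {A B} → tr A ≡ 0# → tr B ≡ 0# → ¬ Scalar A → ¬ Scalar B → Commute A B → B ∝ A
  traceless-commute {A} {B} tA tB nA nB c with α , β , refl ← centralizer A B nB c = β , β≢0 , lin-α0 α≡0
   where
   α≡0 : α ≡ 0#
   α≡0 = half-zero (trans (trace α β B) (trans (cong₂ (λ x y → x - β * y) tA tB) (solve 1 (λ β → :0 :- β :* :0 := :0) refl β)))
    where
    trace : ∀ α β B → α + α ≡ tr (lin α β B) - β * tr B
    trace α β (mat a b c d) = solve 4 (λ α β a d → α :+ α := (α :+ β :* a) :+ (α :+ β :* d) :- β :* (a :+ d)) refl α β a d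
   lin-α0 : α ≡ 0# → lin α β B ≡ scale β B
   lin-α0 refl = mat-≡ (+-identityˡ _) refl refl (+-identityˡ _)
   β≢0 : β ≢ 0#
   β≢0 refl = nA (zeroˡ _ , zeroˡ _ , cong (α +_) (trans (zeroˡ _) (sym (zeroˡ _))))

 infixl 7 _∙_
 infix 8 _⁻¹

 opaque
  _∙_ : Fin N → Fin N → Fin N
  i ∙ j = ixΓ (el i · el j) (PΓL-· _ _ (el-PΓL i) (el-PΓL j))

  ε : Fin N
  ε = ixΓ one PΓL-one

  _⁻¹ : Fin N → Fin N
  i ⁻¹ = ixΓ (inverse-of (el i) (el-PΓL i)) (PΓL-inverse _ (el-PΓL i))

  el-∙ : ∀ i j → el i · el j ≈ el (i ∙ j)
  el-∙ i j = el-ixΓ _ _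

  el-ε : one ≈ el ε
  el-ε = el-ixΓ _ _

  el-⁻¹ : ∀ i → inverse-of (el i) (el-PΓL i) ≈ el (i ⁻¹)
  el-⁻¹ i = el-ixΓ _ _

 isGroup : IsGroup _≡_ _∙_ ε _⁻¹
 isGroup = record
  { isMonoid = record
   { isSemigroup = record
    { isMagma = record { isEquivalence = isEquivalence ; ∙-cong = cong₂ _∙_ }
    ; assoc = λ i j k → el-injective (≈-trans (≈-sym (el-∙ _ _)) (≈-trans (≈-sym (·-cong (PΓL-· _ _ (el-PΓL i) (el-PΓL j)) (el-∙ i j) (≈-refl {el k})))
     (≈-trans (·-assoc (el i) (el j) (el k) (el-PΓL i)) (≈-trans (·-cong (el-PΓL i) ≈-refl (el-∙ j k)) (el-∙ _ _))))) }
   ; identity = (λ i → el-injective (≈-trans (≈-sym (el-∙ _ _)) (≈-trans (≈-sym (·-cong PΓL-one el-ε ≈-refl)) (·-identityˡ _)))) ,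
    (λ i → el-injective (≈-trans (≈-sym (el-∙ _ _)) (≈-trans (≈-sym (·-cong (el-PΓL i) ≈-refl el-ε)) (·-identityʳ _ (el-PΓL i))))) }
  ; inverse = (λ i → el-injective (≈-trans (≈-sym (el-∙ _ _)) (≈-trans (≈-sym (·-cong (PΓL-inverse _ (el-PΓL i)) (el-⁻¹ i) ≈-refl)) (≈-trans (inverse-ofˡ _ (el-PΓL i)) el-ε)))) ,
   (λ i → el-injective (≈-trans (≈-sym (el-∙ _ _)) (≈-trans (≈-sym (·-cong (el-PΓL i) ≈-refl (el-⁻¹ i))) (≈-trans (inverse-ofʳ _ (el-PΓL i)) el-ε))))
  ; ⁻¹-cong = cong _⁻¹ }

 open FiniteGroup em isGroup public using (Pred; Subgroup; module Subgroup; unit; mul; inv; move; conj; Normalizes; index; order-pos;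
  lagrange; TwoGroup; sub₂; two-adjoin; trivial; extend; Adjoin; adjoin-subgroup; adjoin-order; two-extension; even-index-inv;
  odd-index-norm; ∩-subgroup; conj-mul; conj-square-one; commute-conj; conj-commute; invol-inv; index-tower;
  :ε; _:∙_; _:⁻; _⊜_; ⁻¹-involutive; ∙-cancelˡ; ∙-cancelʳ; inverseˡ; inverseʳ; identityˡ; identityʳ; module Cosets; conj-injective; inverseˡ-unique)
  renaming (_⊆_ to _⊑_; solve to g-solve; assoc to ∙-assoc)
 open PerfectCodes em isGroup public using (PerfectCode)
 open CodeCriteria em isGroup public using (Obstruction; obstruction; involution-of-code)
 open Factorisation em isGroup public

 -- PΓL₂(q) itself: each index names one class modulo scalars, so `≈` has become propositional
 -- equality.
 Γ : Set
 Γ = Fin N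

 mtx : Γ → Mat
 mtx i = matrix (el i)

 aut-of : Γ → Carrier → Carrier
 aut-of i = aut (el i)

 det-of : ∀ i → det (mtx i) ≢ 0#
 det-of i = proj₁ (el-PΓL i)

 aut-is : ∀ i → IsFieldAut (aut-of i)
 aut-is i = proj₂ (el-PΓL i)

 mat-∙ : ∀ i j → mtx i ·ₘ mapMat (aut-of i) (mtx j) ∝ mtx (i ∙ j)
 mat-∙ i j = proj₂ (el-∙ i j)

 aut-∙ : ∀ i j z → aut-of (i ∙ j) z ≡ aut-of i (aut-of j z)
 aut-∙ i j z = sym (proj₁ (el-∙ i j) z)

 aut-ε : ∀ z → aut-of ε z ≡ z
 aut-ε z = sym (proj₁ el-ε z)

 mat-ε : idMat ∝ mtx ε
 mat-ε = proj₂ el-ε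

 Γ-≡ : ∀ {i j} → (∀ z → aut-of i z ≡ aut-of j z) → mtx i ∝ mtx j → i ≡ j
 Γ-≡ e p = el-injective (e , p)

 ⟦_⟧ : Subset → Pred
 ⟦ H ⟧ i = H (el i)

 module _ {H : Subset} (sH : IsSubgroup H) where
  open IsSubgroup sH

  ⟦⟧-subgroup : Subgroup ⟦ H ⟧
  ⟦⟧-subgroup = record
   { unit = respects _ _ el-ε has-one
   ; mul = λ {i} {j} hi hj → respects _ _ (el-∙ i j) (closed _ _ hi hj)
   ; inv = λ {i} hi → let (y , hy , e) = inverses (el i) hi in respects y _ (≈-trans (inverse-unique (⊆PΓL y hy) (el-PΓL i) e) (el-⁻¹ i)) hy }
   where
   inverse-unique : ∀ {x y} (py : PΓL y) (px : PΓL x) → y · x ≈ one → y ≈ inverse-of x px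
   inverse-unique {x} {y} py px e = ≈-trans (≈-sym (·-identityʳ y py)) (≈-trans (·-cong py ≈-refl (≈-sym (inverse-ofʳ x px)))
    (≈-trans (≈-sym (·-assoc y x (inverse-of x px) py)) (≈-trans (·-cong (PΓL-· y x py px) e (≈-refl {inverse-of x px})) (·-identityˡ (inverse-of x px)))))

  ⟦⟧-el : ∀ {x} (p : PΓL x) → H x → ⟦ H ⟧ (ixΓ x p)
  ⟦⟧-el p h = respects _ _ (el-ixΓ _ p) h

 -- Takes subgroups found on indices back to subsets closed under `≈`, to which the hypothesis of
 -- maximality applies.
 Lift : Pred → Subset
 Lift S x = ∃ λ i → S i × x ≈ el i

 lift-subgroup : ∀ {S} → Subgroup S → IsSubgroup (Lift S)
 lift-subgroup {S} sS = record
  { ⊆PΓL = λ { x (i , _ , e) → PΓL-respects _ _ (≈-sym e) (el-PΓL i) }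
  ; respects = λ { x y e (i , s , f) → i , s , ≈-trans (≈-sym e) f }
  ; has-one = ε , unit sS , el-ε
  ; closed = λ { x y (i , s , e) (j , t , f) → i ∙ j , mul sS s t , ≈-trans (·-cong (PΓL-respects _ _ (≈-sym e) (el-PΓL i)) e f) (el-∙ i j) }
  ; inverses = λ { x (i , s , e) → el (i ⁻¹) , (i ⁻¹ , inv sS s , ≈-refl) ,
   ≈-trans (·-cong (el-PΓL (i ⁻¹)) ≈-refl e) (≈-trans (el-∙ _ _) (subst (λ k → el k ≈ one) (sym (inverseˡ i)) (≈-sym el-ε))) } }

 ⟦Lift⟧ : ∀ {S i} → Lift S (el i) → S i
 ⟦Lift⟧ {S} (j , s , e) = subst S (sym (el-injective e)) s

 ⊑⇒⊆ : ∀ {H L} → IsSubgroup H → IsSubgroup L → ⟦ H ⟧ ⊑ ⟦ L ⟧ → H ⊆ L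
 ⊑⇒⊆ sH sL f x h = let p = IsSubgroup.⊆PΓL sH x h in
  IsSubgroup.respects sL _ _ (≈-sym (el-ixΓ x p)) (f _ (IsSubgroup.respects sH _ _ (el-ixΓ x p) h))

 hasOrder⇒# : ∀ {H n} → IsSubgroup H → HasOrder H n → # ⟦ H ⟧ ≡ n
 hasOrder⇒# sH (L , refl , all , sep , comp) =
  list-count (IsSubgroup.respects sH) (IsSubgroup.⊆PΓL sH) L all sep comp

 #⇒hasOrder : ∀ {H} → IsSubgroup H → HasOrder H (# ⟦ H ⟧)
 #⇒hasOrder {H} sH = reps , sym (list-count respects ⊆PΓL reps reps-all reps-separated complete) , reps-all , reps-separated , complete
  where
  open IsSubgroup sH
  open Enumeration {Q = H} respects (λ x _ → any-elem x) using (reps; complete; reps-all; reps-separated)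

 product-el : ∀ {s c j k} → s ≈ el j → c ≈ el k → s · c ≈ el (j ∙ k)
 product-el {s} {c} {j} {k} e f = ≈-trans {s · c} {el j · el k} {el (j ∙ k)}
  (·-cong {s} {el j} {c} {el k} (PΓL-respects (el j) s (≈-sym {s} {el j} e) (el-PΓL j)) e f) (el-∙ j k)

 product-≡ : ∀ {s c g j k i} → s ≈ el j → c ≈ el k → g ≈ el i → g ≈ s · c → i ≡ j ∙ k
 product-≡ {s} {c} {g} {j} {k} {i} e f h p = el-injective (≈-trans {el i} {g} {el (j ∙ k)} (≈-sym {g} {el i} h)
  (≈-trans {g} {s · c} {el (j ∙ k)} p (product-el {s} {c} e f)))

 module _ {G M : Subset} (sG : IsSubgroup G) (sM : IsSubgroup M) (M⊆G : M ⊆ G) where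
  private
   module G = IsSubgroup sG
   module M = IsSubgroup sM
   sM̂ : Subgroup ⟦ M ⟧
   sM̂ = ⟦⟧-subgroup sM

  ⟦⟧-code : IsPerfectCode G M → PerfectCode ⟦ G ⟧ ⟦ M ⟧
  ⟦⟧-code (S , S⊆G , S≉1 , S⁻ , indep , dom , once) = record
   { S = Ŝ
   ; S⊆G = λ { i (s , Ss , e) → G.respects s (el i) e (S⊆G s Ss) }
   ; S⁻ = λ { {i} (s , Ss , e) → inverse-in i s Ss e (S⁻ s Ss) }
   ; S∩M = λ { {i} (s , Ss , e) → disjoint i s Ss e }
   ; meets = λ i Gi nMi → meet i (dom (el i) Gi nMi)
   ; meets-once = λ { {i} {j} (s , Ss , e) (t , St , f) → meet-once i j s t Ss St e f } }
   where
   pS : ∀ s → S s → PΓL s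
   pS s Ss = G.⊆PΓL s (S⊆G s Ss)
   -- The connection set S need not respect `≈`, so an index belongs to the image when it is
   -- equivalent to some member of S.
   Ŝ : Pred
   Ŝ i = ∃ λ s → S s × s ≈ el i
   inverse-in : ∀ i s → S s → s ≈ el i → (∃ λ t → S t × t · s ≈ one) → Ŝ (i ⁻¹)
   inverse-in i s Ss e (t , St , f) = t , St , subst (λ k → t ≈ el k) (inverseˡ-unique j i (el-injective
    (≈-trans {el (j ∙ i)} {t · s} {el ε} (≈-sym {t · s} {el (j ∙ i)} (product-el {t} {s} (el-ixΓ t _) e)) (≈-trans {t · s} {one} {el ε} f el-ε)))) (el-ixΓ t (pS t St))
    where j = ixΓ t (pS t St)
   disjoint : ∀ i s → S s → s ≈ el i → ¬ ⟦ M ⟧ i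
   disjoint i s Ss e Mi = indep one (el i) s M.has-one Mi Ss
    (≈-trans {el i} {s} {s · one} (≈-sym {s} {el i} e) (≈-sym {s · one} {s} (·-identityʳ s (pS s Ss))))
   meet : ∀ i → (∃ λ c → M c × ∃ λ s → S s × el i ≈ s · c) → ∃ λ j → Ŝ j × ⟦ M ⟧ ((i ⁻¹) ∙ j)
   meet i (c , Mc , s , Ss , e) = j , (s , Ss , el-ixΓ s _) ,
    move ⟦ M ⟧ (trans (g-solve 2 (λ j k → k :⁻ ⊜ (j :∙ k) :⁻ :∙ j) refl j k) (cong (λ z → (z ⁻¹) ∙ j) (sym i≡)))
     (inv sM̂ (M.respects c (el k) (el-ixΓ c _) Mc))
    where
    j = ixΓ s (pS s Ss)
    k = ixΓ c (M.⊆PΓL c Mc)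
    i≡ : i ≡ j ∙ k
    i≡ = product-≡ {s} {c} {el i} (el-ixΓ s _) (el-ixΓ c _) (≈-refl {el i}) e
   meet-once : ∀ i j s t → S s → S t → s ≈ el i → t ≈ el j → ⟦ M ⟧ ((i ⁻¹) ∙ j) → i ≡ j
   meet-once i j s t Ss St e f Mij = trans (sym (identityʳ i)) (trans (cong (i ∙_) (sym c≡ε)) (g-solve 2 (λ i j → i :∙ (i :⁻ :∙ j) ⊜ j) refl i j))
    where
    c = (i ⁻¹) ∙ j
    e₁ : el j ≈ s · el c
    e₁ = ≈-sym {s · el c} {el j} (subst (λ k → s · el c ≈ el k) (g-solve 2 (λ i j → i :∙ (i :⁻ :∙ j) ⊜ j) refl i j)
     (product-el {s} {el c} {i} {c} e (≈-refl {el c})))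
    e₂ : el j ≈ t · el ε
    e₂ = ≈-sym {t · el ε} {el j} (subst (λ k → t · el ε ≈ el k) (identityʳ j) (product-el {t} {el ε} {j} {ε} f (≈-refl {el ε})))
    c≡ε : c ≡ ε
    c≡ε = el-injective (once (el j) (el c) (el ε) s t (G.respects t (el j) f (S⊆G t St)) (disjoint j t St f) Mij (unit sM̂) Ss St e₁ e₂)

  code-⟦⟧ : PerfectCode ⟦ G ⟧ ⟦ M ⟧ → IsPerfectCode G M
  code-⟦⟧ code = Lift S
   , (λ { x (i , Si , e) → G.respects (el i) x (≈-sym {x} {el i} e) (S⊆G i Si) })
   , (λ { x (i , Si , e) x≈1 → S∩M Si (M.respects one (el i) (≈-trans {one} {x} {el i} (≈-sym {x} {one} x≈1) e) M.has-one) })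
   , (λ { x (i , Si , e) → el (i ⁻¹) , (i ⁻¹ , S⁻ Si , ≈-refl {el (i ⁻¹)}) ,
    ≈-trans {el (i ⁻¹) · x} {el (i ⁻¹ ∙ i)} {one} (product-el {el (i ⁻¹)} {x} (≈-refl {el (i ⁻¹)}) e)
     (subst (λ k → el k ≈ one) (sym (inverseˡ i)) (≈-sym {one} {el ε} el-ε)) })
   , (λ { c c′ x Mc Mc′ (i , Si , e) f → S∩M Si (independent c c′ x i Mc Mc′ e f) })
   , (λ g Gg nMg → dominate g Gg (meets (ixΓ g (G.⊆PΓL g Gg)) (G.respects g _ (el-ixΓ g _) Gg)
    (λ Mj → nMg (M.respects _ g (≈-sym {g} {el (ixΓ g (G.⊆PΓL g Gg))} (el-ixΓ g _)) Mj))))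
   , (λ { g c c′ s s′ Gg _ Mc Mc′ (i , Si , e) (j , Sj , f) → unique g c c′ s s′ i j Gg Mc Mc′ Si Sj e f })
   where
   open PerfectCode code
   ι : ∀ c → M c → Γ
   ι c Mc = ixΓ c (M.⊆PΓL c Mc)
   Mι : ∀ c (Mc : M c) → ⟦ M ⟧ (ι c Mc)
   Mι c Mc = M.respects c (el (ι c Mc)) (el-ixΓ c _) Mc
   quotient : ∀ i j k l → i ∙ k ≡ j ∙ l → k ∙ (l ⁻¹) ≡ (i ⁻¹) ∙ j
   quotient i j k l e = trans (g-solve 3 (λ i k l → k :∙ l :⁻ ⊜ i :⁻ :∙ (i :∙ k) :∙ l :⁻) refl i k l)
    (trans (cong (λ z → (i ⁻¹) ∙ z ∙ (l ⁻¹)) e) (g-solve 3 (λ i j l → i :⁻ :∙ (j :∙ l) :∙ l :⁻ ⊜ i :⁻ :∙ j) refl i j l))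
   independent : ∀ c c′ x i → M c → M c′ → x ≈ el i → c′ ≈ x · c → ⟦ M ⟧ i
   independent c c′ x i Mc Mc′ e f = move ⟦ M ⟧ (trans (cong (_∙ (ι c Mc ⁻¹)) (product-≡ {x} {c} {c′} e (el-ixΓ c _) (el-ixΓ c′ _) f))
    (g-solve 2 (λ i k → i :∙ k :∙ k :⁻ ⊜ i) refl i (ι c Mc)))
    (mul sM̂ (Mι c′ Mc′) (inv sM̂ (Mι c Mc)))
   dominate : ∀ g (Gg : G g) → (∃ λ s → S s × ⟦ M ⟧ ((ixΓ g (G.⊆PΓL g Gg) ⁻¹) ∙ s)) → ∃ λ c → M c × ∃ λ s → Lift S s × g ≈ s · c
   dominate g Gg (i , Si , m) = el c , move ⟦ M ⟧ (g-solve 2 (λ i j → (j :⁻ :∙ i) :⁻ ⊜ i :⁻ :∙ j) refl i j) (inv sM̂ m) ,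
    el i , (i , Si , ≈-refl {el i}) , ≈-trans {g} {el j} {el i · el c} (el-ixΓ g _)
     (≈-sym {el i · el c} {el j} (subst (λ k → el i · el c ≈ el k) (g-solve 2 (λ i j → i :∙ (i :⁻ :∙ j) ⊜ j) refl i j) (el-∙ i c)))
    where
    j = ixΓ g (G.⊆PΓL g Gg)
    c = (i ⁻¹) ∙ j
   unique : ∀ g c c′ s s′ i j → G g → M c → M c′ → S i → S j → s ≈ el i → s′ ≈ el j → g ≈ s · c → g ≈ s′ · c′ → c ≈ c′
   unique g c c′ s s′ i j Gg Mc Mc′ Si Sj e f p p′ = ≈-trans {c} {el k′} {c′}
    (subst (λ l → c ≈ el l) (∙-cancelˡ j k k′ (trans (cong (_∙ k) (sym i≡j)) eq)) (el-ixΓ c _)) (≈-sym {c′} {el k′} (el-ixΓ c′ _))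
    where
    k = ι c Mc
    k′ = ι c′ Mc′
    ĝ = ixΓ g (G.⊆PΓL g Gg)
    eq : i ∙ k ≡ j ∙ k′
    eq = trans (sym (product-≡ {s} {c} {g} e (el-ixΓ c _) (el-ixΓ g _) p)) (product-≡ {s′} {c′} {g} f (el-ixΓ c′ _) (el-ixΓ g (G.⊆PΓL g Gg)) p′)
    i≡j : i ≡ j
    i≡j = meets-once Si Sj (move ⟦ M ⟧ (quotient i j k k′ eq) (mul sM̂ (Mι c Mc) (inv sM̂ (Mι c′ Mc′))))

 Linear : Pred
 Linear i = ∀ z → aut-of i z ≡ z

 -- Scaling by l multiplies the determinant by l², so this property is well defined modulo scalars.
 SqDet : Mat → Set
 SqDet A = Square (det A)

 sqDet-∝ : ∀ {A B} → A ∝ B → SqDet A → SqDet B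
 sqDet-∝ {A} (l , _ , refl) s = subst Square (sym (det-scale l A)) (square-* (l , refl) s)

 T̂ : Pred
 T̂ = ⟦ PSL ⟧

 T-linear : ∀ {i} → T̂ i → Linear i
 T-linear ((_ , e) , _) = e

 scalable-square : ∀ A → (∃ λ l → det (scale l A) ≡ 1#) → SqDet A
 scalable-square A (l , e) = square-quotient l²≢0 (l , refl) (1# , trans (*-comm (det A) (l * l)) (trans (sym (det-scale l A)) (trans e (sym (*-identityʳ 1#)))))
  where
  l²≢0 : l * l ≢ 0#
  l²≢0 z = 1≢0 (trans (sym e) (trans (det-scale l A) (trans (cong (_* det A) z) (zeroˡ _))))

 square-scalable : ∀ A → det A ≢ 0# → SqDet A → ∃ λ l → det (scale l A) ≡ 1#
 square-scalable A dA (s , d) = recip s , trans (det-scale (recip s) A) (trans (cong (recip s * recip s *_) d)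
  (trans (solve 2 (λ l r → r :* r :* (l :* l) := l :* r :* (l :* r)) refl s (recip s)) (trans (cong₂ _*_ (*-recip s≢0) (*-recip s≢0)) (*-identityˡ 1#))))
  where
  s≢0 : s ≢ 0#
  s≢0 = nonzero-*ˡ (subst (_≢ 0#) d dA)

 T-square : ∀ {i} → T̂ i → SqDet (mtx i)
 T-square {i} (_ , e) = scalable-square (mtx i) e

 T-intro : ∀ {i} → Linear i → SqDet (mtx i) → T̂ i
 T-intro {i} e s = (el-PΓL i , e) , square-scalable (mtx i) (det-of i) s

 linear-∙ : ∀ {i} j → Linear i → mtx i ·ₘ mtx j ∝ mtx (i ∙ j)
 linear-∙ {i} j e = subst (λ A → mtx i ·ₘ A ∝ mtx (i ∙ j)) (mapMat-id e (mtx j)) (mat-∙ i j)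

 linear-mul : ∀ {i j} → Linear i → Linear j → Linear (i ∙ j)
 linear-mul e f z = trans (aut-∙ _ _ z) (trans (e _) (f z))

 aut-⁻¹ : ∀ i z → aut-of (i ⁻¹) (aut-of i z) ≡ z
 aut-⁻¹ i z = trans (sym (aut-∙ (i ⁻¹) i z)) (trans (cong (λ k → aut-of k z) (inverseˡ i)) (aut-ε z))

 linear-inv : ∀ {i} → Linear i → Linear (i ⁻¹)
 linear-inv {i} e z = trans (cong (aut-of (i ⁻¹)) (sym (e z))) (aut-⁻¹ i z)

 linear-⁻¹ : ∀ {i} → Linear i → adj (mtx i) ∝ mtx (i ⁻¹)
 linear-⁻¹ {i} e = subst (_∝ mtx (i ⁻¹)) (mapMat-id {FieldAut.σ⁻ (aut-is i)} (λ y → trans (sym (e _)) (FieldAut.σσ⁻ (aut-is i) y)) (adj (mtx i))) (proj₂ (el-⁻¹ i))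

 linear-≡ : ∀ {i j} → Linear i → Linear j → mtx i ∝ mtx j → i ≡ j
 linear-≡ e f p = Γ-≡ (λ z → trans (e z) (sym (f z))) p

 linear-ε : Linear ε
 linear-ε = aut-ε

 scalar-ε : ∀ {i} → Linear i → Scalar (mtx i) → i ≡ ε
 scalar-ε {i} e s = linear-≡ e linear-ε (∝-trans (∝-sym (scalar-∝ (mtx i) (det-of i) s)) mat-ε)

 nonscalar : ∀ {i} → Linear i → i ≢ ε → ¬ Scalar (mtx i)
 nonscalar e ne s = ne (scalar-ε e s)

 ε-scalar : Scalar (mtx ε)
 ε-scalar = ∝-scalar mat-ε

 sq-mul : ∀ {A B} → SqDet A → SqDet B → SqDet (A ·ₘ B)
 sq-mul {A} {B} s t = subst Square (sym (det-·ₘ A B)) (square-* s t)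

 T-mul : ∀ {i j} → T̂ i → T̂ j → T̂ (i ∙ j)
 T-mul {i} {j} t u = T-intro (linear-mul (T-linear t) (T-linear u))
  (sqDet-∝ (linear-∙ j (T-linear t)) (sq-mul {mtx i} {mtx j} (T-square t) (T-square u)))

 sT : Subgroup T̂
 sT = record
  { unit = T-intro linear-ε (sqDet-∝ mat-ε (1# , trans det-id (sym (*-identityˡ 1#))))
  ; mul = T-mul
  ; inv = λ {i} t → T-intro (linear-inv (T-linear t)) (sqDet-∝ (linear-⁻¹ (T-linear t)) (subst Square (sym (det-adj (mtx i))) (T-square t))) }

 conj-∙ : ∀ g a → g ∙ conj g a ≡ a ∙ g
 conj-∙ = g-solve 2 (λ g a → g :∙ (g :⁻ :∙ a :∙ g) ⊜ a :∙ g) refl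

 conj-linear : ∀ g {a} → Linear a → Linear (conj g a)
 conj-linear g {a} e z = FieldAut.σ-injective (aut-is g) _ _
  (trans (sym (aut-∙ g (conj g a) z)) (trans (cong (λ k → aut-of k z) (conj-∙ g a)) (trans (aut-∙ a g z) (e _))))

 conj-mat : ∀ g {a} → Linear a → mtx a ·ₘ mtx g ∝ mtx g ·ₘ mapMat (aut-of g) (mtx (conj g a))
 conj-mat g {a} e = ∝-trans (linear-∙ g e) (subst (λ k → mtx k ∝ mtx g ·ₘ mapMat (aut-of g) (mtx (conj g a))) (conj-∙ g a) (∝-sym (mat-∙ g (conj g a))))

 map-square : ∀ {σ} → IsFieldAut σ → ∀ {x} → Square x → Square (σ x)
 map-square s (t , refl) = _ , FieldAut.σ-* s t t

 unmap-square : ∀ {σ} → IsFieldAut σ → ∀ {x} → Square (σ x) → Square x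
 unmap-square s {x} p = subst Square (FieldAut.σ⁻σ s x) (map-square (FieldAut.σ⁻-aut s) p)

 conj-sqDet : ∀ g {a} → Linear a → SqDet (mtx a) → SqDet (mtx (conj g a))
 conj-sqDet g {a} e s = from (conj-mat g e)
  where
  module S = FieldAut (aut-is g)
  G A B : Mat
  G = mtx g
  A = mtx a
  B = mtx (conj g a)
  from : A ·ₘ G ∝ G ·ₘ mapMat (aut-of g) B → SqDet B
  from (l , l≢0 , eq) = unmap-square (aut-is g) (subst Square (*-cancelˡ (det-of g) (begin
   det G * (l * l * det A)              ≡⟨ solve 3 (λ g m a → g :* (m :* a) := m :* (a :* g)) refl (det G) (l * l) (det A) ⟩
   l * l * (det A * det G)              ≡⟨ cong (l * l *_) (det-·ₘ A G) ⟨
   l * l * det (A ·ₘ G)                 ≡⟨ det-scale l _ ⟨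
   det (scale l (A ·ₘ G))               ≡⟨ cong det eq ⟨
   det (G ·ₘ mapMat (aut-of g) B)       ≡⟨ det-·ₘ G _ ⟩
   det G * det (mapMat (aut-of g) B)    ≡⟨ cong (det G *_) (S.det-map _) ⟩
   det G * aut-of g (det B)             ∎)) (square-* (l , refl) s))
   where open ≡-Reasoning

 T-normal : ∀ g → Normalizes g T̂
 T-normal g a t = T-intro (conj-linear g (T-linear t)) (conj-sqDet g (T-linear t) (T-square t))

 -- Stronger than commuting in PGL₂(q), where the matrices may also anticommute, and independent of
 -- the chosen matrices.
 Cm : Γ → Γ → Set
 Cm i j = Commute (mtx i) (mtx j)

 cm-∙ : ∀ {i j} → Linear i → Linear j → Cm i j → i ∙ j ≡ j ∙ i
 cm-∙ {i} {j} e f c = linear-≡ (linear-mul e f) (linear-mul f e)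
  (∝-trans (∝-sym (linear-∙ j e)) (subst (_∝ mtx (j ∙ i)) (sym c) (linear-∙ i f)))

 ∙-cm : ∀ {i j} → Linear i → Linear j → i ∙ j ≡ j ∙ i → Cm i j ⊎ Anticomm (mtx i) (mtx j)
 ∙-cm {i} {j} e f c = projective-commute (det-of i) (det-of j)
  (∝-trans (linear-∙ j e) (subst (λ k → mtx k ∝ mtx j ·ₘ mtx i) (sym c) (∝-sym (linear-∙ i f))))

 cm-mulˡ : ∀ {a b c} → Linear a → Cm a c → Cm b c → Cm (a ∙ b) c
 cm-mulˡ {a} {b} {c} e x y = commute-∝ (linear-∙ b e) ∝-refl (commute-mul {mtx a} {mtx b} {mtx c} x y)

 cm-invˡ : ∀ {a c} → Linear a → Cm a c → Cm (a ⁻¹) c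
 cm-invˡ {a} {c} e x = by-cases (em (Scalar (mtx a)))
  where
  by-cases : Dec (Scalar (mtx a)) → Cm (a ⁻¹) c
  by-cases (no ns) = commute-∝ (linear-⁻¹ e) ∝-refl (subst (λ A → Commute A (mtx c)) (sym (adj≡lin (mtx a)))
   (commute-trans {lin (tr (mtx a)) (- 1#) (mtx a)} {mtx a} {mtx c} ns (lin-self _ _ (mtx a)) x))
  by-cases (yes s) = subst (λ k → Cm k c) (sym (trans (cong _⁻¹ (scalar-ε e s)) (g-solve 0 (:ε :⁻ ⊜ :ε) refl))) (scalar-commute (mtx ε) (mtx c) ε-scalar)

 map-injective : ∀ {σ} → IsFieldAut σ → ∀ A B → mapMat σ A ≡ mapMat σ B → A ≡ B
 map-injective s (mat _ _ _ _) (mat _ _ _ _) eq with x , y , z , w ← mat-inj eq =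
  mat-≡ (S.σ-injective _ _ x) (S.σ-injective _ _ y) (S.σ-injective _ _ z) (S.σ-injective _ _ w)
  where module S = FieldAut s

 intertwine : ∀ {G A B A′ B′} l m → G ·ₘ A′ ≡ scale l (A ·ₘ G) → G ·ₘ B′ ≡ scale m (B ·ₘ G) →
  G ·ₘ (A′ ·ₘ B′) ≡ scale (l * m) ((A ·ₘ B) ·ₘ G)
 intertwine {G} {A} {B} {A′} {B′} l m p r = begin
  G ·ₘ (A′ ·ₘ B′)                ≡⟨ ·ₘ-assoc G A′ B′ ⟨
  (G ·ₘ A′) ·ₘ B′                ≡⟨ cong (_·ₘ B′) p ⟩
  scale l (A ·ₘ G) ·ₘ B′         ≡⟨ scale-·ₘ l _ B′ ⟩
  scale l ((A ·ₘ G) ·ₘ B′)       ≡⟨ cong (scale l) (·ₘ-assoc A G B′) ⟩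
  scale l (A ·ₘ (G ·ₘ B′))       ≡⟨ cong (λ X → scale l (A ·ₘ X)) r ⟩
  scale l (A ·ₘ scale m (B ·ₘ G))  ≡⟨ cong (scale l) (·ₘ-scale m A _) ⟩
  scale l (scale m (A ·ₘ (B ·ₘ G)))  ≡⟨ scale-scale l m _ ⟩
  scale (l * m) (A ·ₘ (B ·ₘ G))  ≡⟨ cong (scale (l * m)) (·ₘ-assoc A B G) ⟨
  scale (l * m) ((A ·ₘ B) ·ₘ G)  ∎
  where open ≡-Reasoning

 -- Conjugation by the semilinear g turns each matrix into its conjugate up to a scalar. AB and BA
 -- acquire the same product of scalars, so their equality survives.
 cm-conjugate : ∀ g {a b} → Linear a → Linear b → Cm a b → Cm (conj g a) (conj g b)
 cm-conjugate g {a} {b} e f c = from (conj-mat g e) (conj-mat g f)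
  where
  module S = FieldAut (aut-is g)
  G A B A′ B′ : Mat
  G = mtx g
  A = mtx a
  B = mtx b
  A′ = mapMat (aut-of g) (mtx (conj g a))
  B′ = mapMat (aut-of g) (mtx (conj g b))
  from : A ·ₘ G ∝ G ·ₘ A′ → B ·ₘ G ∝ G ·ₘ B′ → Cm (conj g a) (conj g b)
  from (l , _ , p) (m , _ , r) = map-injective (aut-is g) _ _ (trans (S.map-·ₘ _ _) (trans (cancel-·ₘ (det-of g)
   (trans (intertwine {G} {A} {B} {A′} {B′} l m p r) (trans (cong₂ scale (*-comm l m) (cong (_·ₘ G) c)) (sym (intertwine {G} {B} {A} {B′} {A′} m l r p)))))
   (sym (S.map-·ₘ _ _))))

 sq-∙ : ∀ {i j} → SqDet (mtx i) → SqDet (mtx j) → SqDet (mtx (i ∙ j))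
 sq-∙ {i} {j} si sj = sqDet-∝ (mat-∙ i j) (sq-mul {mtx i} {mapMat (aut-of i) (mtx j)} si (subst Square (sym (FieldAut.det-map (aut-is i) (mtx j))) (map-square (aut-is i) sj)))

 ∝-Scalar : ∀ {A B} → A ∝ B → Scalar A → Scalar B
 ∝-Scalar {mat _ _ _ _} (l , _ , refl) (refl , refl , refl) = zeroʳ l , zeroʳ l , refl

 tr-∝ : ∀ {A B} → A ∝ B → tr A ≡ 0# → tr B ≡ 0#
 tr-∝ {mat a _ _ d} (l , _ , refl) e = trans (sym (distribˡ l a d)) (trans (cong (l *_) e) (zeroʳ l))

 traceless-involution : ∀ {i} → Linear i → tr (mtx i) ≡ 0# → i ∙ i ≡ ε
 traceless-involution {i} e t = scalar-ε (linear-mul e e) (∝-Scalar (linear-∙ i e) (subst Scalar (sym (traceless-square (mtx i) t)) (scale-scalar _)))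

 involution-traceless : ∀ {i} → Linear i → i ∙ i ≡ ε → i ≢ ε → tr (mtx i) ≡ 0#
 involution-traceless {i} e i² ne = square-scalar-traceless (mtx i) (nonscalar e ne)
  (∝-Scalar (∝-sym (linear-∙ i e)) (subst (λ k → Scalar (mtx k)) (sym i²) ε-scalar))

 opaque
  mk : Mat → Γ
  mk A with em (det A ≢ 0#)
  ... | yes ne = ixΓ ⟨ A , (λ z → z) ⟩ (ne , id-aut (λ _ → refl))
  ... | no _ = ε

  mk-lin : ∀ A → Linear (mk A)
  mk-lin A z with em (det A ≢ 0#)
  ... | yes ne = sym (proj₁ (el-ixΓ ⟨ A , (λ z → z) ⟩ _) z)
  ... | no _ = linear-ε z

  mk-mat : ∀ {A} → det A ≢ 0# → A ∝ mtx (mk A)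
  mk-mat {A} d with em (det A ≢ 0#)
  ... | yes ne = proj₂ (el-ixΓ ⟨ A , (λ z → z) ⟩ _)
  ... | no n = ⊥-elim (n d)

 module OddCharacteristic (two≢0 : two ≢ 0#) where
  open Odd two≢0 public

  commutation : Commutation sT T-normal Cm
  commutation = record
   { cm-sym = λ _ _ → sym
   ; cm-trans = λ {a} {b} {c} _ tb _ ne → commute-trans {mtx a} {mtx b} {mtx c} (nonscalar (T-linear tb) ne)
   ; cm-comm = λ ta tb → cm-∙ (T-linear ta) (T-linear tb)
   ; comm-cm = λ {a} {b} ta tb e → Sum.map id (λ anti →
    traceless-involution (T-linear ta) (anticommute-traceless {mtx a} {mtx b} (det-of b) anti) ,
    traceless-involution (T-linear tb) (anticommute-traceless {mtx b} {mtx a} (det-of a) (anticommute-sym {mtx a} {mtx b} anti)))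
    (∙-cm (T-linear ta) (T-linear tb) e)
   ; cm-mul = λ {a} {b} {c} ta _ _ → cm-mulˡ {a} {b} {c} (T-linear ta)
   ; cm-inv = λ {a} {c} ta _ → cm-invˡ {a} {c} (T-linear ta)
   ; cm-one = λ {c} _ → scalar-commute (mtx ε) (mtx c) ε-scalar
   ; cm-refl = λ _ → refl
   ; cm-conj = λ g {a} {b} ta tb → cm-conjugate g {a} {b} (T-linear ta) (T-linear tb)
   ; cm-involution = λ {a} {b} ta tb a² b² na nb c → linear-≡ (T-linear ta) (T-linear tb)
    (∝-sym (traceless-commute {mtx a} {mtx b} (involution-traceless (T-linear ta) a² na) (involution-traceless (T-linear tb) b² nb)
     (nonscalar (T-linear ta) na) (nonscalar (T-linear tb) nb) c)) }

 open CyclicGroups em isGroup public using (_^^_; IsOrder; order; finite-subgroup; power-∈; ^^-+; ^^-*; ε^^; cyclic; powers-injective; module IsOrder)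

 Maximal : Pred → Pred → Set₁
 Maximal Ĝ M̂ = ∀ L → Subgroup L → M̂ ⊑ L → L ⊑ Ĝ → (L ⊑ M̂) ⊎ (Ĝ ⊑ L)

 -- MT is a subgroup between M and G, and it is not M because T is not contained in M.
 supplement : ∀ {Ĝ M̂} → Subgroup Ĝ → Subgroup M̂ → M̂ ⊑ Ĝ → T̂ ⊑ Ĝ →
  Maximal Ĝ M̂ → ¬ (T̂ ⊑ M̂) → ∀ g → Ĝ g → ∃ λ m → M̂ m × T̂ (m ⁻¹ ∙ g)
 supplement {Ĝ} {M̂} sG sM M⊑G T⊑G maximal ¬T⊑M =
  [ (λ f → ⊥-elim (¬T⊑M λ t Tt → f t (ε , unit sM , move T̂ (g-solve 1 (λ t → t ⊜ :ε :⁻ :∙ t) refl t) Tt))) , id ]′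
   (maximal (Product M̂ T̂) (product-subgroup sT T-normal sM) (λ m → product-left sT T-normal m)
    λ { g (m , Mm , t) → move Ĝ (g-solve 2 (λ m g → m :∙ (m :⁻ :∙ g) ⊜ g) refl m g) (mul sG (M⊑G m Mm) (T⊑G _ t)) })

 PSL-subgroup : IsSubgroup PSL
 PSL-subgroup = record
  { ⊆PΓL = λ _ → proj₁ ∘ proj₁
  ; respects = respects
  ; has-one = respects _ _ (≈-sym {one} {el ε} el-ε) (unit sT)
  ; closed = λ x y p q → let (i , e) = index-of x p ; (j , f) = index-of y q in
   respects _ _ (≈-sym {x · y} {el (i ∙ j)} (product-el {x} {y} e f)) (T-mul (respects _ _ e p) (respects _ _ f q))
  ; inverses = λ x p → let (i , e) = index-of x p in el (i ⁻¹) , inv sT (respects _ _ e p) ,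
   ≈-trans {el (i ⁻¹) · x} {el (i ⁻¹ ∙ i)} {one} (product-el {el (i ⁻¹)} {x} (≈-refl {el (i ⁻¹)}) e) (subst (λ k → el k ≈ one) (sym (inverseˡ i)) (≈-sym {one} {el ε} el-ε)) }
  where
  respects : ∀ x y → x ≈ y → PSL x → PSL y
  respects x y e@(a , l , l≢0 , eq) ((p , f) , s , d) = (PΓL-respects x y e p , λ z → trans (sym (a z)) (f z)) ,
   s * recip l , trans (cong (det ∘ scale (s * recip l)) eq) (trans (cong det (scale-scale (s * recip l) l (matrix x)))
    (trans (cong (λ z → det (scale z (matrix x))) (trans (*-assoc s _ l) (trans (cong (s *_) (recip-* l≢0)) (*-identityʳ s)))) d))
  index-of : ∀ x → PSL x → ∃ λ i → x ≈ el i
  index-of x ((p , _) , _) = ixΓ x p , el-ixΓ x p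

 index-is : ∀ {G} → IsSubgroup G → T̂ ⊑ ⟦ G ⟧ → IndexIs G PSL (index sT ⟦ G ⟧)
 index-is {G} sG T⊑G = # T̂ , #⇒hasOrder PSL-subgroup , subst (HasOrder G) (lagrange sT (⟦⟧-subgroup sG) T⊑G) (#⇒hasOrder sG)

 index-unique : ∀ {G i} → IsSubgroup G → T̂ ⊑ ⟦ G ⟧ → IndexIs G PSL i → i ≡ index sT ⟦ G ⟧
 index-unique {G} {i} sG T⊑G (t , ht , hG) = ℕ.*-cancelʳ-≡ i _ (# T̂) ⦃ order-pos sT ⦄
  (trans (cong (i ℕ.*_) (hasOrder⇒# PSL-subgroup ht)) (trans (sym (hasOrder⇒# sG hG)) (lagrange sT (⟦⟧-subgroup sG) T⊑G)))

 SquarePart : Pred → Pred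
 SquarePart S g = S g × SqDet (mtx g)

 square-subgroup : ∀ {S} → Subgroup S → Subgroup (SquarePart S)
 square-subgroup sS = finite-subgroup (unit sS , T-square (unit sT)) (λ {i} {j} (a , s) (b , t) → mul sS a b , sq-∙ {i} {j} s t)

 T⊑square : ∀ {S} → T̂ ⊑ S → T̂ ⊑ SquarePart S
 T⊑square T⊑S t Tt = T⊑S t Tt , T-square Tt

 -- As products of two nonsquares are squares, S is the union of its square part and the coset of
 -- the square part by g.
 square-index : ∀ {S} → Subgroup S → T̂ ⊑ S → (∀ {x y} → ¬ Square x → ¬ Square y → Square (x * y)) →
  ∀ g → S g → ¬ SqDet (mtx g) → let n = index sT (SquarePart S) in index sT S ≡ n ℕ.+ n
 square-index {S} sS T⊑S nonsquare g Sg ¬sq = ℕ.*-cancelʳ-≡ _ _ (# T̂) ⦃ order-pos sT ⦄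
  (trans (sym (lagrange sT sS T⊑S)) (trans #S (trans (cong₂ ℕ._+_ part part) (sym (ℕ.*-distribʳ-+ (# T̂) (index sT (SquarePart S)) _)))))
  where
  sQ : Subgroup (SquarePart S)
  sQ = square-subgroup sS
  part : # (SquarePart S) ≡ index sT (SquarePart S) ℕ.* # T̂
  part = lagrange sT sQ (T⊑square T⊑S)
  back : ∀ i → Adjoin (SquarePart S) g i → S i
  back i (inj₁ a) = proj₁ a
  back i (inj₂ a) = move S (g-solve 2 (λ m i → m :∙ (m :⁻ :∙ i) ⊜ i) refl g i) (mul sS Sg (proj₁ a))
  to : ∀ i → S i → Adjoin (SquarePart S) g i
  to i Si = by-cases (em (SqDet (mtx i)))
   where
   u : Γ
   u = (g ⁻¹) ∙ i
   square-u : ¬ SqDet (mtx i) → SqDet (mtx u)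
   square-u ¬sqi = dne λ ¬squ → ¬sqi (subst (SqDet ∘ mtx) (g-solve 2 (λ m i → m :∙ (m :⁻ :∙ i) ⊜ i) refl g i)
    (sqDet-∝ (mat-∙ g u) (subst Square (sym (trans (det-·ₘ (mtx g) _) (cong (det (mtx g) *_) (FieldAut.det-map (aut-is g) (mtx u)))))
     (nonsquare ¬sq (¬squ ∘ unmap-square (aut-is g))))))
   by-cases : Dec (SqDet (mtx i)) → Adjoin (SquarePart S) g i
   by-cases (yes s) = inj₁ (Si , s)
   by-cases (no n) = inj₂ (mul sS (inv sS Sg) Si , square-u n)
  #S : # S ≡ # (SquarePart S) ℕ.+ # (SquarePart S)
  #S = trans (#-cong to back) (adjoin-order sQ g (¬sq ∘ proj₂))

 -- In characteristic two the trace of A² is the square of the trace of A.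
 two-group-traceless : two ≡ 0# → ∀ {P} → TwoGroup P → ∀ y → P y → Linear y → tr (mtx y) ≡ 0#
 two-group-traceless two≡0 (trivial _ only) y Py _ = subst (λ k → tr (mtx k) ≡ 0#) (sym (only y Py)) (tr-∝ mat-ε two≡0)
 two-group-traceless two≡0 {P} (extend {Q = Q} _ tQ g norm g² _ _ adj) y Py ly = [ in-Q , in-coset ]′ (adj y Py)
  where
  in-Q : Q y → tr (mtx y) ≡ 0#
  in-Q Qy = two-group-traceless two≡0 tQ y Qy ly
  root : ∀ A → tr (A ·ₘ A) ≡ 0# → tr A ≡ 0#
  root (mat a b c d) e = dne λ n → *-nonzero n n (trans (trans (solve 4 (λ a b c d → (a :+ d) :* (a :+ d) := (a :* a :+ b :* c :+ (c :* b :+ d :* d)) :+ (:1 :+ :1) :* (a :* d :- b :* c)) refl a b c d)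
   (cong₂ _+_ e (cong (_* (a * d - b * c)) two≡0))) (solve 1 (λ x → :0 :+ :0 :* x := :0) refl (a * d - b * c)))
  in-coset : Q ((g ⁻¹) ∙ y) → tr (mtx y) ≡ 0#
  in-coset Qu = root (mtx y) (tr-∝ (∝-sym (linear-∙ y ly)) (two-group-traceless two≡0 tQ (y ∙ y) Qy² (linear-mul ly ly)))
   where
   Qy² : Q (y ∙ y)
   Qy² = move Q (g-solve 2 (λ g y → g :∙ g :∙ (g :⁻ :∙ (g :⁻ :∙ y) :∙ g) :∙ (g :⁻ :∙ y) ⊜ y :∙ y) refl g y)
    (mul (sub₂ tQ) (mul (sub₂ tQ) g² (norm _ Qu)) Qu)

 -- x lies in the 2-group generated by x and `Syl`, so its matrix is traceless and x is an
 -- involution, which xM does not contain.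
 no-obstruction-in-characteristic-two : two ≡ 0# → ∀ {M̂} → Subgroup M̂ → ¬ SocleObstruction sT T-normal M̂
 no-obstruction-in-characteristic-two two≡0 sM o = no-involution ε (unit sM) (trans (cong₂ _∙_ (identityʳ x) (identityʳ x))
  (traceless-involution (T-linear Tx) (two-group-traceless two≡0 (two-adjoin t x normal square) x (inj₂ (move Syl (g-solve 1 (λ x → :ε ⊜ x :⁻ :∙ x) refl x) (unit (sub₂ t)))) (T-linear Tx))))
  where
  open SocleObstruction o renaming (two to t)

open import Algebra.Structures using (IsCommutativeRing)
import Algebra.Properties.Semiring.Exp as Exp

-- Field automorphisms and the quadratic character of 2.

module ResidueTheory (em : (P : Set) → Dec P) {p e : ℕ} (pr : Prime p) (K : FiniteField (p ℕ.^ e)) where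
 open Classical em
 open FieldTheory em K
 open UnitTheory em K

 private
  q : ℕ
  q = p ℕ.^ e

 open Exp semiring using (_^_)

 p×1 : p ⋆ 1# ≡ 0#
 p×1 = go e q×1
  where
  go : ∀ n → (p ℕ.^ n) ⋆ 1# ≡ 0# → p ⋆ 1# ≡ 0#
  go zero z = ⊥-elim (1≢0 (trans (sym (+-identityʳ 1#)) z))
  go (suc n) z = dne λ ne → ne (go n (zero-product (trans (sym (×1-homo-* p (p ℕ.^ n))) z) ne))

 module KF = FrobeniusPower commutativeRing

 multiple≢0 : ∀ m → ¬ (p ∣ m) → m ⋆ 1# ≢ 0#
 multiple≢0 m nd z = from (Bézout.identity (coprime⇒GCD≡1 (prime-coprime pr nd)))
  where
  open import Data.Nat.GCD using (module Bézout)
  open import Data.Nat.Coprimality using (coprime⇒GCD≡1)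
  kill : ∀ x {n} → n ⋆ 1# ≡ 0# → (x ℕ.* n) ⋆ 1# ≡ 0#
  kill x {n} e = trans (×1-homo-* x n) (trans (cong ((x ⋆ 1#) *_) e) (zeroʳ _))
  contra : ∀ {a b} → 1 ℕ.+ a ≡ b → a ⋆ 1# ≡ 0# → b ⋆ 1# ≡ 0# → ⊥
  contra {a} e za zb = 1≢0 (trans (sym (+-identityʳ 1#)) (trans (cong (1# +_) (sym za)) (trans (cong (_⋆ 1#) e) zb)))
  from : Bézout.Identity 1 m p → ⊥
  from (Bézout.+- x y eq) = contra eq (kill y p×1) (kill x z)
  from (Bézout.-+ x y eq) = contra eq (kill x z) (kill y p×1)

 pow≡^ : ∀ x n → pow x n ≡ x ^ n
 pow≡^ x zero = refl
 pow≡^ x (suc n) = cong (x *_) (pow≡^ x n)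

 frobenius : Carrier → Carrier
 frobenius x = pow x p

 iter-frobenius : ∀ k x → iter k frobenius x ≡ pow x (p ℕ.^ k)
 iter-frobenius zero x = sym (*-identityʳ x)
 iter-frobenius (suc k) x = trans (cong frobenius (iter-frobenius k x)) (sym (pow-* x p (p ℕ.^ k)))

 frobenius-power-+ : ∀ k x y → pow (x + y) (p ℕ.^ k) ≡ pow x (p ℕ.^ k) + pow y (p ℕ.^ k)
 frobenius-power-+ k x y = trans (pow≡^ _ (p ℕ.^ k)) (trans (KF.frobenius-power pr p×1 k x y) (cong₂ _+_ (sym (pow≡^ _ (p ℕ.^ k))) (sym (pow≡^ _ (p ℕ.^ k)))))

 frobenius-power-injective : ∀ k {x y} → pow x (p ℕ.^ k) ≡ pow y (p ℕ.^ k) → x ≡ y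
 frobenius-power-injective k {x} {y} eq = -≡0 (dne λ ne → pow-nonzero (p ℕ.^ k) ne (cancel
  (trans (sym (frobenius-power-+ k (x - y) y)) (trans (cong (λ z → pow z (p ℕ.^ k)) (solve 2 (λ x y → x :- y :+ y := x) refl x y)) eq))))
  where
  cancel : ∀ {a b} → a + b ≡ b → a ≡ 0#
  cancel {a} {b} eq = trans (solve 2 (λ a b → a := a :+ b :- b) refl a b) (≡⇒-≡0 eq)

 -- (1+y)ᵐ = 1 + y·expand m y, with expand m 0 = m.
 expand : ℕ → Carrier → Carrier
 expand zero y = 0#
 expand (suc m) y = 1# + expand m y + y * expand m y

 expand-pow : ∀ m y → pow (1# + y) m ≡ 1# + y * expand m y
 expand-pow zero y = solve 1 (λ y → :1 := :1 :+ y :* :0) refl y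
 expand-pow (suc m) y = trans (cong ((1# + y) *_) (expand-pow m y)) (solve 2 (λ y h → (:1 :+ y) :* (:1 :+ y :* h) := :1 :+ y :* (:1 :+ h :+ y :* h)) refl y (expand m y))

 expand-poly : ∀ m → Polynomial m (expand m)
 expand-poly zero x = refl
 expand-poly (suc m) = poly-+ (suc m) (poly-+ (suc m) (poly-const m 1#) (poly-weaken m (expand-poly m))) (poly-X* m (expand-poly m))

 expand-0 : ∀ m → expand m 0# ≡ m ⋆ 1#
 expand-0 zero = refl
 expand-0 (suc m) = trans (solve 1 (λ h → :1 :+ h :+ :0 :* h := :1 :+ h) refl (expand m 0#)) (cong (1# +_) (expand-0 m))

 -- An additive power map is a power of the Frobenius: after dividing out p-th powers the exponent is prime to p,
 -- and the binomial expansion then vanishes too often.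
 additive-exponent : ∀ m → ¬ (p ∣ m) → 0 < m → m ≤ units → (∀ y → pow (1# + y) m ≡ 1# + pow y m) → m ≡ 1
 additive-exponent (suc zero) nd _ _ _ = refl
 additive-exponent (suc (suc n)) nd _ le add = ⊥-elim (multiple≢0 (suc (suc n)) nd
  (trans (sym (expand-0 m)) (trans (solve 2 (λ a b → a := a :+ (:- :1) :* :0) refl (expand m 0#) 0#) (trans (cong (λ z → expand m 0# + - 1# * z) (sym (zeroˡ (pow 0# n)))) (poly-roots m polynomial roots 0#)))))
  where
  m = suc (suc n)
  g : Carrier → Carrier
  g y = expand m y + - 1# * pow y (suc n)
  polynomial : Polynomial m g
  polynomial = poly-+ m (expand-poly m) (poly-scale m (- 1#) (poly-pow (suc n)))
  vanish : ∀ y → y ≢ 0# → g y ≡ 0#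
  vanish y ne = zero-product (trans (solve 3 (λ y h z → y :* (h :+ (:- :1) :* z) := :1 :+ y :* h :- (:1 :+ y :* z)) refl y (expand m y) (pow y (suc n)))
   (≡⇒-≡0 (trans (sym (expand-pow m y)) (add y)))) ne
  roots : m ≤ #K (λ y → g y ≡ 0#)
  roots = ℕ.≤-trans le (ℕ.≤-trans (ℕ.≤-reflexive (ℕ.suc-injective (trans suc-units (sym #K-nonzero)))) (#-mono λ i → vanish (at i)))

 -- σ raises the generator γ, and hence every unit, to some power j = pⁱm with m prime to p. Powers
 -- with exponent pⁱ are additive and injective, so taking m-th powers is compatible with adding 1,
 -- which forces m = 1.
 automorphism-power : ∀ {σ} → IsFieldAut σ → ∃ λ k → ∀ z → σ z ≡ iter k frobenius z
 automorphism-power {σ} (σ-+ , σ-* , σ-1 , σ-inj , _) = from (γ-generates (σ γ) σγ≢0)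
  where
  σ-0 : σ 0# ≡ 0#
  σ-0 = trans (solve 1 (λ s → s := s :+ s :- s) refl (σ 0#)) (≡⇒-≡0 (trans (sym (σ-+ 0# 0#)) (cong σ (+-identityˡ 0#))))
  σγ≢0 : σ γ ≢ 0#
  σγ≢0 z = γ≢0 (σ-inj _ _ (trans z (sym σ-0)))
  σ-pow : ∀ x n → σ (pow x n) ≡ pow (σ x) n
  σ-pow x zero = σ-1
  σ-pow x (suc n) = trans (σ-* _ _) (cong (σ x *_) (σ-pow x n))
  from : (∃ λ j → j < units × σ γ ≡ pow γ j) → ∃ λ k → ∀ z → σ z ≡ iter k frobenius z
  -- Exponent 0 means γ = 1, so 0 and 1 are the only elements of K.
  from (zero , lt , eq) = 0 , λ z → by-cases z (em (z ≡ 0#))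
   where
   γ≡1 : γ ≡ 1#
   γ≡1 = σ-inj _ _ (trans eq (sym σ-1))
   by-cases : ∀ z → Dec (z ≡ 0#) → σ z ≡ z
   by-cases z (yes refl) = σ-0
   by-cases z (no ne) with k , _ , refl ← γ-generates z ne = trans (cong σ 1≡) (trans σ-1 (sym 1≡))
    where
    1≡ : pow γ k ≡ 1#
    1≡ = trans (cong (λ y → pow y k) γ≡1) (pow-1 k)
  from (suc j , lt , eq) with i , m , j≡ , nd ← p-part pr (suc j) (s≤s z≤n) = i , λ z →
   trans (σ-power z) (trans (cong (pow z) (trans j≡ (trans (cong (p ℕ.^ i ℕ.*_) m≡1) (ℕ.*-identityʳ (p ℕ.^ i))))) (sym (iter-frobenius i z)))
   where
   σ-power : ∀ z → σ z ≡ pow z (suc j)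
   σ-power z = by-cases (em (z ≡ 0#))
    where
    by-cases : Dec (z ≡ 0#) → σ z ≡ pow z (suc j)
    by-cases (yes refl) = trans σ-0 (sym (zeroˡ _))
    by-cases (no ne) with k , _ , refl ← γ-generates z ne = trans (σ-pow γ k) (trans (cong (λ y → pow y k) eq)
     (trans (sym (pow-* γ k (suc j))) (trans (cong (pow γ) (ℕ.*-comm k (suc j))) (pow-* γ (suc j) k))))
   m>0 : 0 < m
   m>0 = ℕ.n≢0⇒n>0 λ { refl → ℕ.1+n≢0 (trans j≡ (ℕ.*-zeroʳ (p ℕ.^ i))) }
   m≤units : m ≤ units
   m≤units = ℕ.≤-trans (ℕ.m≤n*m m (p ℕ.^ i) {{ℕ.m^n≢0 p i {{prime⇒nonZero pr}}}}) (ℕ.≤-trans (ℕ.≤-reflexive (sym j≡)) (ℕ.<⇒≤ lt))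
    where open import Data.Nat.Primality using (prime⇒nonZero)
   m≡1 : m ≡ 1
   m≡1 = additive-exponent m nd m>0 m≤units λ y → frobenius-power-injective i
    (trans (split (1# + y)) (trans (sym (σ-power (1# + y))) (trans (σ-+ 1# y) (trans (cong₂ _+_ σ-1 (trans (σ-power y) (sym (split y))))
     (trans (cong (_+ pow (pow y m) (p ℕ.^ i)) (sym (pow-1 (p ℕ.^ i)))) (sym (frobenius-power-+ i 1# (pow y m))))))))
    where
    split : ∀ y → pow (pow y m) (p ℕ.^ i) ≡ pow y (suc j)
    split y = trans (sym (pow-* y (p ℕ.^ i) m)) (cong (pow y) (sym j≡))

 -- K[i] with i² = -1.
 K[i] : CommutativeRing 0ℓ 0ℓ
 K[i] = record { isCommutativeRing = ring }
  where
  C : Set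
  C = Carrier × Carrier
  _⊕_ _⊗_ : C → C → C
  (a , b) ⊕ (c , d) = a + c , b + d
  (a , b) ⊗ (c , d) = a * c - b * d , a * d + b * c
  ⊝_ : C → C
  ⊝ (a , b) = - a , - b
  pair : ∀ {a b c d : Carrier} → a ≡ c → b ≡ d → (a , b) ≡ (c , d)
  pair refl refl = refl
  ring : IsCommutativeRing _≡_ _⊕_ _⊗_ ⊝_ (0# , 0#) (1# , 0#)
  ring = record
   { isRing = record
    { +-isAbelianGroup = record
     { isGroup = record
      { isMonoid = record
       { isSemigroup = record
        { isMagma = record { isEquivalence = isEquivalence ; ∙-cong = cong₂ _⊕_ }
        ; assoc = λ (a , b) (c , d) (e , f) → pair (+-assoc a c e) (+-assoc b d f) }
       ; identity = (λ (a , b) → pair (+-identityˡ a) (+-identityˡ b)) , (λ (a , b) → pair (+-identityʳ a) (+-identityʳ b)) }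
      ; inverse = (λ (a , b) → pair (-‿inverseˡ a) (-‿inverseˡ b)) , (λ (a , b) → pair (-‿inverseʳ a) (-‿inverseʳ b))
      ; ⁻¹-cong = cong ⊝_ }
     ; comm = λ (a , b) (c , d) → pair (+-comm a c) (+-comm b d) }
    ; *-cong = cong₂ _⊗_
    ; *-assoc = λ (a , b) (c , d) (e , f) → pair
     (solve 6 (λ a b c d e f → (a :* c :- b :* d) :* e :- (a :* d :+ b :* c) :* f := a :* (c :* e :- d :* f) :- b :* (c :* f :+ d :* e)) refl a b c d e f)
     (solve 6 (λ a b c d e f → (a :* c :- b :* d) :* f :+ (a :* d :+ b :* c) :* e := a :* (c :* f :+ d :* e) :+ b :* (c :* e :- d :* f)) refl a b c d e f)
    ; *-identity = (λ (a , b) → pair (solve 2 (λ a b → :1 :* a :- :0 :* b := a) refl a b) (solve 2 (λ a b → :1 :* b :+ :0 :* a := b) refl a b)) ,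
     (λ (a , b) → pair (solve 2 (λ a b → a :* :1 :- b :* :0 := a) refl a b) (solve 2 (λ a b → a :* :0 :+ b :* :1 := b) refl a b))
    ; distrib = (λ (a , b) (c , d) (e , f) → pair
     (solve 6 (λ a b c d e f → a :* (c :+ e) :- b :* (d :+ f) := a :* c :- b :* d :+ (a :* e :- b :* f)) refl a b c d e f)
     (solve 6 (λ a b c d e f → a :* (d :+ f) :+ b :* (c :+ e) := a :* d :+ b :* c :+ (a :* f :+ b :* e)) refl a b c d e f)) ,
     (λ (a , b) (c , d) (e , f) → pair
      (solve 6 (λ a b c d e f → (c :+ e) :* a :- (d :+ f) :* b := c :* a :- d :* b :+ (e :* a :- f :* b)) refl a b c d e f)
      (solve 6 (λ a b c d e f → (c :+ e) :* b :+ (d :+ f) :* a := c :* b :+ d :* a :+ (e :* b :+ f :* a)) refl a b c d e f)) }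
   ; *-comm = λ (a , b) (c , d) → pair (solve 4 (λ a b c d → a :* c :- b :* d := c :* a :- d :* b) refl a b c d) (solve 4 (λ a b c d → a :* d :+ b :* c := c :* b :+ d :* a) refl a b c d) }

 module _ (two≢0 : two ≢ 0#) where
  open OddUnits two≢0

  private
   module C = CommutativeRing K[i]
   module CM = Mult C.semiring
   module CE = Exp C.semiring
   i : C.Carrier
   i = 0# , 1#
   ι : Carrier → C.Carrier
   ι c = c , 0#

   ι-* : ∀ c d → ι c C.* ι d ≡ ι (c * d)
   ι-* c d = cong₂ _,_ (solve 2 (λ c d → c :* d :- :0 :* :0 := c :* d) refl c d) (solve 2 (λ c d → c :* :0 :+ :0 :* d := :0) refl c d)

   ι-pow : ∀ c n → ι c CE.^ n ≡ ι (pow c n)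
   ι-pow c zero = refl
   ι-pow c (suc n) = trans (cong (ι c C.*_) (ι-pow c n)) (ι-* c (pow c n))

   i² : i C.* i ≡ ι (- 1#)
   i² = cong₂ _,_ (solve 0 (:0 :* :0 :- :1 :* :1 := :- :1) refl) (solve 0 (:0 :* :1 :+ :1 :* :0 := :0) refl)

   square-pow : ∀ x n → (x C.* x) CE.^ n ≡ x CE.^ (n ℕ.+ n)
   square-pow x zero = refl
   square-pow x (suc n) = trans (cong (x C.* x C.*_) (square-pow x n)) (trans (C.*-assoc x x _) (cong (λ k → x C.* (x CE.^ k)) (sym (ℕ.+-suc n n))))

   char : p CM.× C.1# ≡ C.0#
   char = trans (mult p) (cong ι p×1)
    where
    mult : ∀ n → n CM.× C.1# ≡ ι (n ⋆ 1#)
    mult zero = refl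
    mult (suc n) = trans (cong (C.1# C.+_) (mult n)) (cong (1# + n ⋆ 1# ,_) (+-identityʳ 0#))

   1+i : C.Carrier
   1+i = 1# , 1#

   i^q : i CE.^ q ≡ (0# , pow (- 1#) h)
   i^q = trans (cong (i CE.^_) q≡) (trans (cong (i C.*_) (trans (sym (square-pow i h)) (trans (cong (CE._^ h) i²) (ι-pow (- 1#) h))))
    (cong₂ _,_ (solve 1 (λ x → :0 :* x :- :1 :* :0 := :0) refl (pow (- 1#) h)) (solve 1 (λ x → :0 :* :0 :+ :1 :* x := x) refl (pow (- 1#) h))))

   -- (1+i)^q, computed by the Frobenius and by (1+i)² = 2i.
   key : ι 1# C.+ (0# , pow (- 1#) h) ≡ 1+i C.* (ι (pow two h) C.* (i CE.^ h))
   key = begin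
    ι 1# C.+ (0# , pow (- 1#) h)               ≡⟨ cong₂ C._+_ (sym (trans (ι-pow 1# q) (cong ι (pow-1 q)))) (sym i^q) ⟩
    ι 1# CE.^ q C.+ i CE.^ q                   ≡⟨ FrobeniusPower.frobenius-power K[i] pr char e (ι 1#) i ⟨
    (ι 1# C.+ i) CE.^ q                        ≡⟨ cong₂ (λ z n → z CE.^ n) (cong₂ _,_ (+-identityʳ 1#) (+-identityˡ 1#)) q≡ ⟩
    1+i C.* (1+i CE.^ (h ℕ.+ h))               ≡⟨ cong (1+i C.*_) (square-pow 1+i h) ⟨
    1+i C.* ((1+i C.* 1+i) CE.^ h)             ≡⟨ cong (λ z → 1+i C.* (z CE.^ h)) (cong₂ _,_ (solve 0 (:1 :* :1 :- :1 :* :1 := (:1 :+ :1) :* :0 :- :0 :* :1) refl) (solve 0 (:1 :* :1 :+ :1 :* :1 := (:1 :+ :1) :* :1 :+ :0 :* :0) refl)) ⟩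
    1+i C.* ((ι two C.* i) CE.^ h)             ≡⟨ cong (1+i C.*_) (^-distrib-* (ι two) i h) ⟩
    1+i C.* (ι two CE.^ h C.* i CE.^ h)        ≡⟨ cong (λ z → 1+i C.* (z C.* i CE.^ h)) (ι-pow two h) ⟩
    1+i C.* (ι (pow two h) C.* i CE.^ h)       ∎
    where
    open ≡-Reasoning
    open import Algebra.Properties.CommutativeSemiring.Exp C.commutativeSemiring using (^-distrib-*)

   i⁴ : ∀ t → i CE.^ (4 ℕ.* t) ≡ C.1#
   i⁴ t = trans (cong (i CE.^_) (four t)) (trans (sym (square-pow i (t ℕ.+ t))) (trans (cong (CE._^ (t ℕ.+ t)) i²) (trans (ι-pow (- 1#) (t ℕ.+ t)) (cong ι (pow-minus-one (t , refl))))))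
    where
    four : ∀ t → 4 ℕ.* t ≡ t ℕ.+ t ℕ.+ (t ℕ.+ t)
    four = solve-∀

   i^ : ∀ r t → h ≡ r ℕ.+ 4 ℕ.* t → i CE.^ h ≡ i CE.^ r
   i^ r t eq = trans (cong (i CE.^_) eq) (trans (CE.^-homo-* i r (4 ℕ.* t)) (trans (cong (i CE.^ r C.*_) (i⁴ t)) (C.*-identityʳ _)))

   -- K[i] may have zero divisors, so instead of dividing by 1 + i the real parts are compared.
   compare : ∀ {c s x y} → ι 1# C.+ (0# , s) ≡ 1+i C.* (ι c C.* (x , y)) → 1# ≡ c * (x - y)
   compare {c} {s} {x} {y} eq = trans (sym (+-identityʳ 1#)) (trans (cong proj₁ eq)
    (solve 3 (λ c x y → :1 :* (c :* x :- :0 :* y) :- :1 :* (c :* y :+ :0 :* x) := c :* (x :- y)) refl c x y))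

  i-powers : ∀ r → i CE.^ suc r ≡ (- proj₂ (i CE.^ r) , proj₁ (i CE.^ r))
  i-powers r = cong₂ _,_ (solve 2 (λ x y → :0 :* x :- :1 :* y := :- y) refl _ _) (solve 2 (λ x y → :0 :* y :+ :1 :* x := x) refl _ _)

  -- The real part of `key`. Since i⁴ = 1, it depends on h modulo 4 only, that is, on q modulo 8.
  two^h : ∀ r t → h ≡ r ℕ.+ 4 ℕ.* t → 1# ≡ pow two h * (proj₁ (i CE.^ r) - proj₂ (i CE.^ r))
  two^h r t eq = compare (trans key (cong (λ z → 1+i C.* (ι (pow two h) C.* z)) (i^ r t eq)))

  two^h-0 : ∀ t → h ≡ 4 ℕ.* t → pow two h ≡ 1#
  two^h-0 t eq = trans (solve 1 (λ x → x := x :* (:1 :- :0)) refl (pow two h)) (sym (two^h 0 t eq))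

  two^h-1 : ∀ t → h ≡ 1 ℕ.+ 4 ℕ.* t → pow two h ≡ - 1#
  two^h-1 t eq = trans (solve 1 (λ x → x := :- (x :* (:- :0 :- :1))) refl (pow two h))
   (cong -_ (sym (trans (two^h 1 t eq) (cong (λ z → pow two h * (proj₁ z - proj₂ z)) (i-powers 0)))))

  two^h-2 : ∀ t → h ≡ 2 ℕ.+ 4 ℕ.* t → pow two h ≡ - 1#
  two^h-2 t eq = trans (solve 1 (λ x → x := :- (x :* (:- :1 :- (:- :0)))) refl (pow two h))
   (cong -_ (sym (trans (two^h 2 t eq) (cong (λ z → pow two h * (proj₁ z - proj₂ z)) (trans (i-powers 1) (cong (λ z → - proj₂ z , proj₁ z) (i-powers 0)))))))

  two^h-3 : ∀ t → h ≡ 3 ℕ.+ 4 ℕ.* t → pow two h ≡ 1#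
  two^h-3 t eq = trans (solve 1 (λ x → x := x :* (:- (:- :0) :- (:- :1))) refl (pow two h))
   (sym (trans (two^h 3 t eq) (cong (λ z → pow two h * (proj₁ z - proj₂ z)) (trans (i-powers 2) (cong (λ z → - proj₂ z , proj₁ z)
    (trans (i-powers 1) (cong (λ z → - proj₂ z , proj₁ z) (i-powers 0))))))))

  two-square⇒ : Square two → (∃ λ t → h ≡ 4 ℕ.* t) ⊎ (∃ λ t → h ≡ 3 ℕ.+ 4 ℕ.* t)
  two-square⇒ s = from (h % 4) (h / 4) (m%n<n h 4) (trans (m≡m%n+[m/n]*n h 4) (cong (h % 4 ℕ.+_) (ℕ.*-comm (h / 4) 4)))
   where
   from : ∀ r t → r < 4 → h ≡ r ℕ.+ 4 ℕ.* t → (∃ λ t → h ≡ 4 ℕ.* t) ⊎ (∃ λ t → h ≡ 3 ℕ.+ 4 ℕ.* t)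
   from 0 t _ eq = inj₁ (t , eq)
   from 1 t _ eq = ⊥-elim (minus-one≢one (trans (sym (two^h-1 t eq)) (square-euler two≢0 s)))
   from 2 t _ eq = ⊥-elim (minus-one≢one (trans (sym (two^h-2 t eq)) (square-euler two≢0 s)))
   from 3 t _ eq = inj₂ (t , eq)
   from (suc (suc (suc (suc _)))) t (s≤s (s≤s (s≤s (s≤s ())))) eq

  two-square : (∃ λ t → h ≡ 4 ℕ.* t) ⊎ (∃ λ t → h ≡ 3 ℕ.+ 4 ℕ.* t) → Square two
  two-square (inj₁ (t , eq)) = euler-square two≢0 (two^h-0 t eq)
  two-square (inj₂ (t , eq)) = euler-square two≢0 (two^h-3 t eq)

-- Finite computations over the fields with 7 and 9 elements.

import Data.Product.Properties as Product
open import Relation.Nullary.Decidable using (_⊎-dec_)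

-- The pair (a , b) stands for a + b ι with ι² = n over the prime field of order p.
module Model (p n : ℕ) .⦃ _ : NonZero p ⦄ where

 Code : Set
 Code = ℕ × ℕ

 infixl 6 _⊕_
 infixl 7 _⊗_
 _⊕_ _⊗_ : Code → Code → Code
 (a , b) ⊕ (c , d) = (a ℕ.+ c) % p , (b ℕ.+ d) % p
 (a , b) ⊗ (c , d) = (a ℕ.* c ℕ.+ n ℕ.* (b ℕ.* d)) % p , (a ℕ.* d ℕ.+ b ℕ.* c) % p

 𝟘 𝟙 −𝟙 : Code
 𝟘 = 0 , 0
 𝟙 = 1 , 0
 −𝟙 = p ℕ.∸ 1 , 0

 _≟ᶜ_ : (c d : Code) → Dec (c ≡ d)
 _≟ᶜ_ = Product.≡-dec ℕ._≟_ ℕ._≟_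

 record CMat : Set where
  constructor cmat
  field
   c₁₁ c₁₂ c₂₁ c₂₂ : Code

 infixl 7 _⊛_
 _⊛_ : CMat → CMat → CMat
 cmat a b c d ⊛ cmat e f g h = cmat (a ⊗ e ⊕ b ⊗ g) (a ⊗ f ⊕ b ⊗ h) (c ⊗ e ⊕ d ⊗ g) (c ⊗ f ⊕ d ⊗ h)

 -- Two nonsingular matrices are proportional when these pairs agree.
 cross : CMat → CMat → List (Code × Code)
 cross (cmat a b c d) (cmat a′ b′ c′ d′) = (a ⊗ b′ , b ⊗ a′) ∷ (a ⊗ c′ , c ⊗ a′) ∷ (a ⊗ d′ , d ⊗ a′) ∷
  (b ⊗ c′ , c ⊗ b′) ∷ (b ⊗ d′ , d ⊗ b′) ∷ (c ⊗ d′ , d ⊗ c′) ∷ []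

 module Tables (codes : List Code) where

  -- u inverts c - d, written without subtraction. Such a witness shows that the decoded elements
  -- differ in any field in which the codes are read.
  Apart : Code → Code → Set
  Apart c d = Any (λ u → c ⊗ u ≡ d ⊗ u ⊕ 𝟙) codes

  apart? : ∀ c d → Dec (Apart c d)
  apart? c d = any? (λ u → (c ⊗ u) ≟ᶜ (d ⊗ u ⊕ 𝟙)) codes

  Proportional Disproportional : CMat → CMat → Set
  Proportional A B = All (λ (c , d) → c ≡ d) (cross A B)
  Disproportional A B = Any (λ (c , d) → Apart c d) (cross A B)

  proportional? : ∀ A B → Dec (Proportional A B)
  proportional? A B = all? (λ (c , d) → c ≟ᶜ d) (cross A B)

  disproportional? : ∀ A B → Dec (Disproportional A B)
  disproportional? A B = any? (λ (c , d) → apart? c d) (cross A B)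

  Permutes : List CMat → CMat → Set
  Permutes axes A = All (λ X → Any (λ Y → Proportional (A ⊛ X) (Y ⊛ A)) axes) axes

  permutes? : ∀ axes A → Dec (Permutes axes A)
  permutes? axes A = all? (λ X → any? (λ Y → proportional? (A ⊛ X) (Y ⊛ A)) axes) axes

  -- The companion matrix with square δ and determinant -δ, the normal form of the axis of M.
  base : Code → CMat
  base δ = cmat 𝟘 δ 𝟙 𝟘

  -- The matrices with first column (x, y) that commute or anticommute with `base δ`; they represent
  -- the elements of PGL₂(q) fixing this axis.
  commuting anticommuting : Code → Code → Code → CMat
  commuting δ x y = cmat x (δ ⊗ y) y x
  anticommuting δ x y = cmat x (−𝟙 ⊗ (δ ⊗ y)) y (−𝟙 ⊗ x)

  SquareDet : CMat → Code → Set
  SquareDet (cmat a b c d) s = a ⊗ d ≡ s ⊗ s ⊕ b ⊗ c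

  -- To be read as an implication: if A has determinant s² with s ≠ 0, then A permutes the axes.
  Stable : List CMat → CMat → Code → Set
  Stable axes A@(cmat a b c d) s = (Apart (a ⊗ d) (s ⊗ s ⊕ b ⊗ c)) ⊎ (s ≡ 𝟘) ⊎ Permutes axes A

  stable? : ∀ axes A s → Dec (Stable axes A s)
  stable? axes A@(cmat a b c d) s = apart? (a ⊗ d) (s ⊗ s ⊕ b ⊗ c) ⊎-dec (s ≟ᶜ 𝟘) ⊎-dec permutes? axes A

  AllStable : List CMat → (Code → Code → CMat) → Set
  AllStable axes form = All (λ x → All (λ y → All (Stable axes (form x y)) codes) codes) codes

  allStable? : ∀ axes form → Dec (AllStable axes form)
  allStable? axes form = all? (λ x → all? (λ y → all? (stable? axes (form x y)) codes) codes) codes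

  Moves : List CMat → CMat → CMat → Set
  Moves axes X A = All (λ Y → Disproportional (A ⊛ X) (Y ⊛ A)) axes

  moves? : ∀ axes X A → Dec (Moves axes X A)
  moves? axes X A = all? (λ Y → disproportional? (A ⊛ X) (Y ⊛ A)) axes

  NonSquare : Code → Set
  NonSquare δ = All (λ c → Apart (−𝟙 ⊗ δ) (c ⊗ c)) codes

  nonSquare? : ∀ δ → Dec (NonSquare δ)
  nonSquare? δ = all? (λ c → apart? (−𝟙 ⊗ δ) (c ⊗ c)) codes

  Nonsingular : CMat → Set
  Nonsingular (cmat a b c d) = Apart (a ⊗ d) (b ⊗ c)

  nonsingular? : ∀ A → Dec (Nonsingular A)
  nonsingular? (cmat a b c d) = apart? (a ⊗ d) (b ⊗ c)

module Separation (p n : ℕ) .⦃ _ : NonZero p ⦄ {q : ℕ} (code : Fin q → ℕ × ℕ) where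
 open Model p n
 codes : List Code
 codes = List.map code (allFin q)
 open Tables codes

 -- Codes of distinct indices stay distinct in K. As there are q of them, every element of K then
 -- has a code.
 Separated : Set
 Separated = All (λ i → All (λ j → i ≡ j ⊎ Apart (code i) (code j)) (allFin q)) (allFin q)

 separated? : Dec Separated
 separated? = all? (λ i → all? (λ j → (i Fin.≟ j) ⊎-dec apart? (code i) (code j)) (allFin q)) (allFin q)

 -- A set of axes containing that of M, whose stabilizer is proper and contains an element v moving the axis of M.
 record Certificate : Set where
  field
   separated : Separated
   δ : Code
   nonsquare : NonSquare δ
   axes : List CMat
   nonsingular : All Nonsingular axes
   stable : AllStable axes (commuting δ)
   stable′ : AllStable axes (anticommuting δ)
   v u X : CMat
   root-v root-u : Code
   det-v : SquareDet v root-v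
   det-u : SquareDet u root-u
   nonsingular-v : Nonsingular v
   nonsingular-u : Nonsingular u
   v-permutes : Permutes axes v
   v-moves : Disproportional (v ⊛ base δ) (base δ ⊛ v)
   X∈ : X ∈ axes
   u-moves : Moves axes X u

open import Relation.Nullary.Decidable using (toWitness)

module Seven where
 -- The field is a prime field, so ι is taken to be 0, whence n = 0 in the model.
 code : Fin 7 → ℕ × ℕ
 code i = toℕ i , 0

 open Model 7 0
 open Separation 7 0 code
 open Tables codes

 f : ℕ → Code
 f k = k , 0

 -- One axis for each of the four Sylow 3-subgroups of a subgroup S₄ of PSL₂(7); the dihedral group
 -- of order 6 is the normalizer of one of them in S₄.
 axes₇ : List CMat
 axes₇ = base 𝟙 ∷ cmat (f 1) (f 0) (f 3) (f 6) ∷ cmat (f 1) (f 1) (f 1) (f 6) ∷ cmat (f 1) (f 3) (f 0) (f 6) ∷ []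

 -- The stabilizer of these axes is S₄.
 certificate : Certificate
 certificate = record
  { separated = toWitness {a? = separated?} _
  ; δ = 𝟙
  ; nonsquare = toWitness {a? = nonSquare? 𝟙} _
  ; axes = axes₇
  ; nonsingular = toWitness {a? = all? nonsingular? axes₇} _
  ; stable = toWitness {a? = allStable? axes₇ (commuting 𝟙)} _
  ; stable′ = toWitness {a? = allStable? axes₇ (anticommuting 𝟙)} _
  ; v = v ; u = u ; X = base 𝟙 ; root-v = f 2 ; root-u = f 2
  ; det-v = refl ; det-u = refl
  ; nonsingular-v = toWitness {a? = nonsingular? v} _
  ; nonsingular-u = toWitness {a? = nonsingular? u} _
  ; v-permutes = toWitness {a? = permutes? axes₇ v} _
  ; v-moves = toWitness {a? = disproportional? (v ⊛ base 𝟙) (base 𝟙 ⊛ v)} _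
  ; X∈ = here refl
  ; u-moves = toWitness {a? = moves? axes₇ (base 𝟙) u} _ }
  where
  v u : CMat
  v = cmat (f 0) (f 1) (f 3) (f 6)
  u = cmat (f 0) (f 1) (f 3) (f 0)

module Nine where
 -- The field is F₃(ι) with ι² = -1, which is 2 modulo 3.
 code : Fin 9 → ℕ × ℕ
 code i = toℕ i % 3 , toℕ i / 3

 open Model 3 2
 open Separation 3 2 code
 open Tables codes

 δ₉ : Code
 δ₉ = 1 , 1

 -- One axis for each of the six Sylow 5-subgroups of a subgroup A₅ of PSL₂(9); the dihedral group
 -- of order 10 is the normalizer of one of them in A₅.
 axes₉ : List CMat
 axes₉ = base δ₉ ∷ cmat 𝟘 𝟙 (1 , 1) 𝟘 ∷ cmat 𝟙 (1 , 1) (1 , 1) (2 , 0) ∷ cmat 𝟙 (1 , 1) (2 , 2) (2 , 0)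
  ∷ cmat 𝟙 (2 , 2) (1 , 1) (2 , 0) ∷ cmat 𝟙 (2 , 2) (2 , 2) (2 , 0) ∷ []

 -- The stabilizer of these axes is A₅.
 certificate : Certificate
 certificate = record
  { separated = toWitness {a? = separated?} _
  ; δ = δ₉
  ; nonsquare = toWitness {a? = nonSquare? δ₉} _
  ; axes = axes₉
  ; nonsingular = toWitness {a? = all? nonsingular? axes₉} _
  ; stable = toWitness {a? = allStable? axes₉ (commuting δ₉)} _
  ; stable′ = toWitness {a? = allStable? axes₉ (anticommuting δ₉)} _
  ; v = v ; u = u ; X = base δ₉ ; root-v = 0 , 1 ; root-u = 1 , 1
  ; det-v = refl ; det-u = refl
  ; nonsingular-v = toWitness {a? = nonsingular? v} _
  ; nonsingular-u = toWitness {a? = nonsingular? u} _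
  ; v-permutes = toWitness {a? = permutes? axes₉ v} _
  ; v-moves = toWitness {a? = disproportional? (v ⊛ base δ₉) (base δ₉ ⊛ v)} _
  ; X∈ = here refl
  ; u-moves = toWitness {a? = moves? axes₉ (base δ₉) u} _ }
  where
  v u : CMat
  v = cmat 𝟘 𝟙 𝟙 𝟘
  u = cmat 𝟘 𝟙 (0 , 1) 𝟘

-- Residues modulo 4 and 8.

open import Data.Nat using (_^_)
residue : ∀ r t → (r ℕ.+ 8 ℕ.* t) % 8 ≡ r % 8
residue r t = trans (cong (λ n → (r ℕ.+ n) % 8) (ℕ.*-comm 8 t)) ([m+kn]%n≡m%n r t 8)

double-odd%4 : ∀ {n} → Odd n → (n ℕ.+ n) % 4 ≡ 2
double-odd%4 (k , refl) = trans (cong (_% 4) (lemma k)) ([m+kn]%n≡m%n 2 k 4)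
 where
 lemma : ∀ k → suc (k ℕ.+ k) ℕ.+ suc (k ℕ.+ k) ≡ 2 ℕ.+ k ℕ.* 4
 lemma = solve-∀
quotient-8 : ∀ {n r} → n % 8 ≡ r → ∃ λ t → n ≡ r ℕ.+ t ℕ.* 8
quotient-8 {n} e = n / 8 , trans (m≡m%n+[m/n]*n n 8) (cong (ℕ._+ n / 8 ℕ.* 8) e)

odd-residue : ∀ {n r} → Odd r → n % 8 ≡ r → Odd n
odd-residue {n} {r} o e = from (quotient-8 {n} e)
 where
 lemma : ∀ t → t ℕ.* 8 ≡ t ℕ.* 4 ℕ.+ t ℕ.* 4
 lemma = solve-∀
 from : (∃ λ t → n ≡ r ℕ.+ t ℕ.* 8) → Odd n
 from (t , e) = subst Odd (sym (trans e (ℕ.+-comm r (t ℕ.* 8)))) (even+odd (t ℕ.* 4 , lemma t) o)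

%4≡2⇒double-odd : ∀ {i} → i % 4 ≡ 2 → ∃ λ n → Odd n × i ≡ n ℕ.+ n
%4≡2⇒double-odd {i} e = suc (i / 4 ℕ.+ i / 4) , (i / 4 , refl) , trans (m≡m%n+[m/n]*n i 4) (trans (cong (ℕ._+ i / 4 ℕ.* 4) e) (lemma (i / 4)))
 where
 lemma : ∀ k → 2 ℕ.+ k ℕ.* 4 ≡ suc (k ℕ.+ k) ℕ.+ suc (k ℕ.+ k)
 lemma = solve-∀

double≡ : ∀ n → 2 ℕ.* n ≡ n ℕ.+ n
double≡ = solve-∀

reflection-square : ∀ k → dihMul k (zero , true) (zero , true) ≡ (zero , false)
reflection-square k = cong (_, false) (Fin.toℕ-injective (trans (Fin.toℕ-fromℕ< (m%n<n (suc k) (suc k))) (n%n≡0 (suc k))))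

identity-square : ∀ k → dihMul k (zero , false) (zero , false) ≡ (zero , false)
identity-square k = cong (_, false) (Fin.toℕ-injective (trans (Fin.toℕ-fromℕ< (m%n<n 0 (suc k))) refl))

-- Odd characteristic: axes of tori and their normalizers.

module OddTheory (em : (P : Set) → Dec P) {q : ℕ} (K : FiniteField q)
 (two≢0 : FieldTheory.two em K ≢ FiniteField.0# K) where
 open Classical em
 open ProjectiveTheory em K
 open OddCharacteristic two≢0
 open UnitTheory em K
 open OddUnits two≢0

 scale-inj : ∀ {l A B} → l ≢ 0# → scale l A ≡ scale l B → A ≡ B
 scale-inj {A = mat _ _ _ _} {mat _ _ _ _} ne e with x , y , z , w ← mat-inj e =
  mat-≡ (*-cancelˡ ne x) (*-cancelˡ ne y) (*-cancelˡ ne z) (*-cancelˡ ne w)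

 commute-∝ˡ : ∀ {A A′ B} → A ∝ A′ → Commute A B → Commute A′ B
 commute-∝ˡ p = commute-∝ p ∝-refl

 anticommute-∝ : ∀ {A A′ B} → A ∝ A′ → Anticomm A B → Anticomm A′ B
 anticommute-∝ {A} {B = B} (l , _ , refl) e = trans (scale-·ₘ l A B) (trans (cong (scale l) e) (trans (scale-scale l (- 1#) _)
  (trans (cong (λ z → scale z (B ·ₘ A)) (*-comm l (- 1#))) (trans (sym (scale-scale (- 1#) l _)) (cong neg (sym (·ₘ-scale l B A)))))))

 commute-anticommute-⊥ : ∀ {A B} → det A ≢ 0# → det B ≢ 0# → Commute A B → Anticomm A B → ⊥
 commute-anticommute-⊥ {A} {B} dA dB c a = contra (A ·ₘ B) (subst (_≢ 0#) (sym (det-·ₘ A B)) (*-nonzero dA dB)) (trans a (cong neg (sym c)))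
  where
  contra : ∀ X → det X ≢ 0# → X ≡ neg X → ⊥
  contra (mat a b c d) ne e with x , y , z , w ← mat-inj e = ne (trans (cong₂ (λ a b → a * d - b * c) (zero-if x) (zero-if y)) (solve 2 (λ c d → :0 :* d :- :0 :* c := :0) refl c d))
   where
   zero-if : ∀ {a} → a ≡ - 1# * a → a ≡ 0#
   zero-if {a} e = half-zero (trans (cong (a +_) e) (solve 1 (λ a → a :+ (:- :1) :* a := :0) refl a))

 trace-·ₘ-adj : ∀ G A → tr ((G ·ₘ A) ·ₘ adj G) ≡ det G * tr A
 trace-·ₘ-adj (mat a b c d) (mat e f g h) = solve 8 (λ a b c d e f g h →
  ((a :* e :+ b :* g) :* d :+ (a :* f :+ b :* h) :* (:- c)) :+ ((c :* e :+ d :* g) :* (:- b) :+ (c :* f :+ d :* h) :* a) := (a :* d :- b :* c) :* (e :+ h)) refl a b c d e f g h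

 trace-·ₘ-·ₘ-adj : ∀ A G → tr ((A ·ₘ G) ·ₘ adj G) ≡ det G * tr A
 trace-·ₘ-·ₘ-adj (mat e f g h) (mat a b c d) = solve 8 (λ a b c d e f g h →
  ((e :* a :+ f :* c) :* d :+ (e :* b :+ f :* d) :* (:- c)) :+ ((g :* a :+ h :* c) :* (:- b) :+ (g :* b :+ h :* d) :* a) := (a :* d :- b :* c) :* (e :+ h)) refl a b c d e f g h

 tr-scale : ∀ l A → tr (scale l A) ≡ l * tr A
 tr-scale l (mat a b c d) = sym (distribˡ l a d)

 intertwine-trace : ∀ {G A A′ l} → det G ≢ 0# → G ·ₘ A′ ≡ scale l (A ·ₘ G) → tr A′ ≡ l * tr A
 intertwine-trace {G} {A} {A′} {l} dG e = *-cancelˡ dG (trans (sym (trace-·ₘ-adj G A′)) (trans (cong (λ X → tr (X ·ₘ adj G)) e)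
  (trans (cong tr (scale-·ₘ l (A ·ₘ G) (adj G))) (trans (tr-scale l ((A ·ₘ G) ·ₘ adj G)) (trans (cong (l *_) (trace-·ₘ-·ₘ-adj A G))
   (solve 3 (λ l g t → l :* (g :* t) := g :* (l :* t)) refl l (det G) (tr A)))))))

 -- Twice the traceless part of B. Together with the scalars it spans the same algebra as B and,
 -- being traceless, it is determined by that algebra up to a factor.
 axis-of : Mat → Mat
 axis-of B = lin (- tr B) two B

 axis-traceless : ∀ B → tr (axis-of B) ≡ 0#
 axis-traceless (mat a b c d) = solve 2 (λ a d → (:- (a :+ d) :+ (:1 :+ :1) :* a) :+ (:- (a :+ d) :+ (:1 :+ :1) :* d) := :0) refl a d

 lin-nonscalar : ∀ {α β B} → β ≢ 0# → ¬ Scalar B → ¬ Scalar (lin α β B)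
 lin-nonscalar {α} {β} {mat a b c d} ne ns (x , y , z) = ns (zero-product x ne , zero-product y ne ,
  *-cancelˡ ne (trans (solve 2 (λ α x → x := :- α :+ (α :+ x)) refl α (β * a)) (trans (cong (- α +_) z) (solve 2 (λ α x → :- α :+ (α :+ x) := x) refl α (β * d)))))

 axis-nonscalar : ∀ {B} → ¬ Scalar B → ¬ Scalar (axis-of B)
 axis-nonscalar = lin-nonscalar two≢0

 axis-commute : ∀ B → Commute (axis-of B) B
 axis-commute B = lin-self _ _ B

 lin-·ₘ : ∀ α β B G → lin α β B ·ₘ G ≡ mat (α * m₁₁ G + β * m₁₁ (B ·ₘ G)) (α * m₁₂ G + β * m₁₂ (B ·ₘ G)) (α * m₂₁ G + β * m₂₁ (B ·ₘ G)) (α * m₂₂ G + β * m₂₂ (B ·ₘ G))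
 lin-·ₘ α β (mat a b c d) (mat e f g h) = mat-≡ (top a b e g) (top a b f h) (bottom c d g e) (bottom c d h f)
  where
  top : ∀ a b e g → (α + β * a) * e + β * b * g ≡ α * e + β * (a * e + b * g)
  top a b e g = solve 6 (λ α β a b e g → (α :+ β :* a) :* e :+ β :* b :* g := α :* e :+ β :* (a :* e :+ b :* g)) refl α β a b e g
  bottom : ∀ c d g e → β * c * e + (α + β * d) * g ≡ α * g + β * (c * e + d * g)
  bottom c d g e = solve 6 (λ α β c d g e → β :* c :* e :+ (α :+ β :* d) :* g := α :* g :+ β :* (c :* e :+ d :* g)) refl α β c d g e

 ·ₘ-lin : ∀ α β B G → G ·ₘ lin α β B ≡ mat (α * m₁₁ G + β * m₁₁ (G ·ₘ B)) (α * m₁₂ G + β * m₁₂ (G ·ₘ B)) (α * m₂₁ G + β * m₂₁ (G ·ₘ B)) (α * m₂₂ G + β * m₂₂ (G ·ₘ B))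
 ·ₘ-lin α β (mat a b c d) (mat e f g h) = mat-≡ (left e f) (right e f) (left g h) (right g h)
  where
  left : ∀ e f → e * (α + β * a) + f * (β * c) ≡ α * e + β * (e * a + f * c)
  left e f = solve 6 (λ α β a c e f → e :* (α :+ β :* a) :+ f :* (β :* c) := α :* e :+ β :* (e :* a :+ f :* c)) refl α β a c e f
  right : ∀ e f → e * (β * b) + f * (α + β * d) ≡ α * f + β * (e * b + f * d)
  right e f = solve 6 (λ α β b d e f → e :* (β :* b) :+ f :* (α :+ β :* d) := α :* f :+ β :* (e :* b :+ f :* d)) refl α β b d e f

 intertwine-axis : ∀ {G A A′ l} → det G ≢ 0# → G ·ₘ A′ ≡ scale l (A ·ₘ G) → G ·ₘ axis-of A′ ≡ scale l (axis-of A ·ₘ G)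
 intertwine-axis {G} {A} {A′} {l} dG e = trans (·ₘ-lin (- tr A′) two A′ G)
  (trans (mat-≡ (entry (cong m₁₁ e)) (entry (cong m₁₂ e)) (entry (cong m₂₁ e)) (entry (cong m₂₂ e))) (cong (scale l) (sym (lin-·ₘ (- tr A) two A G))))
  where
  entry : ∀ {g x y} → x ≡ l * y → - tr A′ * g + two * x ≡ l * (- tr A * g + two * y)
  entry {g} {y = y} refl = trans (cong (λ t → - t * g + two * (l * y)) (intertwine-trace {G} {A} {A′} dG e))
   (solve 4 (λ l t g y → :- (l :* t) :* g :+ (:1 :+ :1) :* (l :* y) := l :* (:- t :* g :+ (:1 :+ :1) :* y)) refl l (tr A) g y)

 cancel-·ₘʳ : ∀ {G A B} → det G ≢ 0# → A ·ₘ G ≡ B ·ₘ G → A ≡ B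
 cancel-·ₘʳ {G} {A} {B} ne e = scale-inj ne (trans (sym (expand-right A)) (trans (cong (_·ₘ adj G) e) (expand-right B)))
  where
  expand-right : ∀ A → (A ·ₘ G) ·ₘ adj G ≡ scale (det G) A
  expand-right A = trans (·ₘ-assoc A G _) (trans (cong (A ·ₘ_) (·ₘ-adj G)) (trans (·ₘ-scale (det G) A idMat) (cong (scale (det G)) (·ₘ-identityʳ A))))

 lin-eigen : ∀ {α β B G c} → B ·ₘ G ≡ scale c G → lin α β B ·ₘ G ≡ scale (α + β * c) G
 lin-eigen {α} {β} {B} {G} {c} e = trans (lin-·ₘ α β B G) (mat-≡ (entry (cong m₁₁ e)) (entry (cong m₁₂ e)) (entry (cong m₂₁ e)) (entry (cong m₂₂ e)))
  where
  entry : ∀ {g x} → x ≡ c * g → α * g + β * x ≡ (α + β * c) * g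
  entry {g} refl = solve 4 (λ α β c g → α :* g :+ β :* (c :* g) := (α :+ β :* c) :* g) refl α β c g

 eigen-lin : ∀ {α β B G c} → G ·ₘ B ≡ scale c G → G ·ₘ lin α β B ≡ scale (α + β * c) G
 eigen-lin {α} {β} {B} {G} {c} e = trans (·ₘ-lin α β B G) (mat-≡ (entry (cong m₁₁ e)) (entry (cong m₁₂ e)) (entry (cong m₂₁ e)) (entry (cong m₂₂ e)))
  where
  entry : ∀ {g x} → x ≡ c * g → α * g + β * x ≡ (α + β * c) * g
  entry {g} refl = solve 4 (λ α β c g → α :* g :+ β :* (c :* g) := (α :+ β :* c) :* g) refl α β c g

 scale-0-scalar : ∀ {A} → A ≡ scale 0# A → Scalar A
 scale-0-scalar {mat a b c d} e with x , y , z , w ← mat-inj e = trans y (zeroˡ b) , trans z (zeroˡ c) , trans (trans x (zeroˡ a)) (sym (trans w (zeroˡ d)))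

 scale-0 : ∀ A B → scale 0# A ≡ scale 0# B
 scale-0 A B = mat-≡ (trans (zeroˡ _) (sym (zeroˡ _))) (trans (zeroˡ _) (sym (zeroˡ _))) (trans (zeroˡ _) (sym (zeroˡ _))) (trans (zeroˡ _) (sym (zeroˡ _)))

 -- If J² = 0, then ZJ and JZ are multiples of J, hence so are XJ and JX for X = α + βZ.
 nilpotent-normalized : ∀ {J Z} α β → tr J ≡ 0# → ¬ Scalar J → det J ≡ 0# → Z ·ₘ J ∝ J ·ₘ Z → det (lin α β Z) ≢ 0# →
  J ·ₘ lin α β Z ∝ lin α β Z ·ₘ J
 nilpotent-normalized {J} {Z} α β tJ nsJ dJ (l , l≢0 , e) dX = multiples (centralizer (Z ·ₘ J) J nsJ (trans WJ (sym JW)))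
  where
  X : Mat
  X = lin α β Z
  J² : J ·ₘ J ≡ scale 0# J
  J² = trans (traceless-square J tJ) (trans (cong (λ z → scale z idMat) (trans (cong -_ dJ) (solve 0 (:- :0 := :0) refl))) (scale-0 idMat J))
  WJ : (Z ·ₘ J) ·ₘ J ≡ scale 0# J
  WJ = trans (·ₘ-assoc Z J J) (trans (cong (Z ·ₘ_) J²) (trans (·ₘ-scale 0# Z J) (scale-0 _ J)))
  JW : J ·ₘ (Z ·ₘ J) ≡ scale 0# J
  JW = trans (sym (·ₘ-assoc J Z J)) (trans (cong (_·ₘ J) e) (trans (scale-·ₘ l (Z ·ₘ J) J) (trans (cong (scale l) WJ) (trans (scale-scale l 0# J) (cong (λ z → scale z J) (zeroʳ l))))))
  multiples : (∃ λ a → ∃ λ c → Z ·ₘ J ≡ lin a c J) → J ·ₘ X ∝ X ·ₘ J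
  multiples (a , c , eW) = ∝-trans (∝-sym (_ , JX≢0 , JX)) (_ , XJ≢0 , XJ)
   where
   a≡0 : a ≡ 0#
   a≡0 = dne λ a≢0 → nsJ (scale-0-scalar (scale-inj a≢0 (trans (trans (cong (λ z → scale z J) (solve 2 (λ a c → a := a :+ c :* :0) refl a c)) (sym (lin-eigen J²)))
    (trans (cong (_·ₘ J) (sym eW)) (trans WJ (trans (cong (λ z → scale z J) (sym (zeroʳ a))) (sym (scale-scale a 0# J))))))))
   lin-0 : ∀ A → a ≡ 0# → lin a c A ≡ scale c A
   lin-0 (mat x y z w) refl = mat-≡ (+-identityˡ _) refl refl (+-identityˡ _)
   ZJ : Z ·ₘ J ≡ scale c J
   ZJ = trans eW (lin-0 J a≡0)
   JZ : J ·ₘ Z ≡ scale (l * c) J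
   JZ = trans e (trans (cong (scale l) ZJ) (scale-scale l c J))
   XJ : X ·ₘ J ≡ scale (α + β * c) J
   XJ = lin-eigen ZJ
   JX : J ·ₘ X ≡ scale (α + β * (l * c)) J
   JX = eigen-lin JZ
   XJ≢0 : α + β * c ≢ 0#
   XJ≢0 z = nsJ (scale-0-scalar (cancel-·ₘ dX (trans XJ (trans (cong (λ s → scale s J) z) (trans (scale-0 J _) (sym (·ₘ-scale 0# X J)))))))
   JX≢0 : α + β * (l * c) ≢ 0#
   JX≢0 z = nsJ (scale-0-scalar (cancel-·ₘʳ dX (trans JX (trans (cong (λ s → scale s J) z) (trans (scale-0 J _) (sym (scale-·ₘ 0# J X)))))))

 anticommute-commute : ∀ {A B C} → Anticomm A C → Anticomm B C → Commute (A ·ₘ B) C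
 anticommute-commute {A} {B} {C} e f = trans (·ₘ-assoc A B C) (trans (cong (A ·ₘ_) f) (trans (·ₘ-scale (- 1#) A (C ·ₘ B))
  (trans (cong neg (trans (sym (·ₘ-assoc A C B)) (trans (cong (_·ₘ B) e) (trans (scale-·ₘ (- 1#) (C ·ₘ A) B) (cong neg (·ₘ-assoc C A B))))))
   (trans (scale-scale _ _ _) (trans (cong (λ z → scale z (C ·ₘ (A ·ₘ B))) (solve 0 ((:- :1) :* (:- :1) := :1) refl)) (scale-1 _))))))

 -- (α+βZ)J = J(α-βZ) when Z and J anticommute.
 lin-anticommute : ∀ {J Z} α β → Anticomm Z J → lin α β Z ·ₘ J ≡ J ·ₘ lin α (- β) Z
 lin-anticommute {J} {Z} α β e = trans (lin-·ₘ α β Z J) (trans (mat-≡ (entry (cong m₁₁ e)) (entry (cong m₁₂ e)) (entry (cong m₂₁ e)) (entry (cong m₂₂ e))) (sym (·ₘ-lin α (- β) Z J)))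
  where
  entry : ∀ {g x y} → x ≡ - 1# * y → α * g + β * x ≡ α * g + - β * y
  entry {g} {y = y} refl = solve 4 (λ α β g y → α :* g :+ β :* ((:- :1) :* y) := α :* g :+ (:- β) :* y) refl α β g y

 lin-injective : ∀ {α β α′ β′ B} → ¬ Scalar B → lin α β B ≡ lin α′ β′ B → α ≡ α′ × β ≡ β′
 lin-injective {α} {β} {α′} {β′} {mat a b c d} ns e with e₁ , e₂ , e₃ , e₄ ← mat-inj e = α≡ , β≡
  where
  diff : ∀ {x} → β * x ≡ β′ * x → (β - β′) * x ≡ 0#
  diff {x} f = trans (solve 3 (λ β γ x → (β :- γ) :* x := β :* x :- γ :* x) refl β β′ x) (≡⇒-≡0 f)
  β≡ : β ≡ β′
  β≡ = dne λ ne → let n = ne ∘ -≡0 in ns (zero-product (diff e₂) n , zero-product (diff e₃) n ,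
   -≡0 (zero-product (trans (solve 6 (λ α γ β δ a d → (β :- δ) :* (a :- d) := (α :+ β :* a :- (γ :+ δ :* a)) :- (α :+ β :* d :- (γ :+ δ :* d))) refl α α′ β β′ a d)
    (trans (cong₂ _-_ (≡⇒-≡0 e₁) (≡⇒-≡0 e₄)) (solve 0 (:0 :- :0 := :0) refl))) n))
  α≡ : α ≡ α′
  α≡ = trans (solve 2 (λ α x → α := α :+ x :- x) refl α (β * a)) (trans (cong₂ _-_ e₁ (cong (_* a) β≡)) (solve 2 (λ α x → α :+ x :- x := α) refl α′ (β′ * a)))

 lin-square : ∀ α β Z → tr Z ≡ 0# → lin α β Z ·ₘ lin α β Z ≡ lin (α * α - β * β * det Z) (two * (α * β)) Z
 lin-square α β (mat a b c d) t = mat-≡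
  (reduce (solve 5 (λ α β a b c → (α :+ β :* a) :* (α :+ β :* a) :+ β :* b :* (β :* c) := α :* α :- β :* β :* (a :* (:- a) :- b :* c) :+ (:1 :+ :1) :* (α :* β) :* a) refl α β a b c))
  (subst (λ d → (α + β * a) * (β * b) + β * b * (α + β * d) ≡ two * (α * β) * b) (sym d≡) (solve 4 (λ α β a b → (α :+ β :* a) :* (β :* b) :+ β :* b :* (α :+ β :* (:- a)) := (:1 :+ :1) :* (α :* β) :* b) refl α β a b))
  (subst (λ d → β * c * (α + β * a) + (α + β * d) * (β * c) ≡ two * (α * β) * c) (sym d≡) (solve 4 (λ α β a c → β :* c :* (α :+ β :* a) :+ (α :+ β :* (:- a)) :* (β :* c) := (:1 :+ :1) :* (α :* β) :* c) refl α β a c))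
  (subst (λ d → β * c * (β * b) + (α + β * d) * (α + β * d) ≡ α * α - β * β * (a * d - b * c) + two * (α * β) * d) (sym d≡)
   (solve 5 (λ α β a b c → β :* c :* (β :* b) :+ (α :+ β :* (:- a)) :* (α :+ β :* (:- a)) := α :* α :- β :* β :* (a :* (:- a) :- b :* c) :+ (:1 :+ :1) :* (α :* β) :* (:- a)) refl α β a b c))
  where
  d≡ : d ≡ - a
  d≡ = trans (solve 2 (λ a d → d := a :+ d :- a) refl a d) (trans (cong (_- a) t) (+-identityˡ _))
  reduce : (α + β * a) * (α + β * a) + β * b * (β * c) ≡ α * α - β * β * (a * - a - b * c) + two * (α * β) * a →
   (α + β * a) * (α + β * a) + β * b * (β * c) ≡ α * α - β * β * (a * d - b * c) + two * (α * β) * a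
  reduce e = subst (λ d → (α + β * a) * (α + β * a) + β * b * (β * c) ≡ α * α - β * β * (a * d - b * c) + two * (α * β) * a) (sym d≡) e

 det-lin : ∀ α β Z → tr Z ≡ 0# → det (lin α β Z) ≡ α * α + β * β * det Z
 det-lin α β (mat a b c d) t = trans (solve 6 (λ α β a b c d → (α :+ β :* a) :* (α :+ β :* d) :- β :* b :* (β :* c) := α :* α :+ β :* β :* (a :* d :- b :* c) :+ α :* β :* (a :+ d)) refl α β a b c d)
  (trans (cong (λ z → α * α + β * β * (a * d - b * c) + α * β * z) t) (solve 2 (λ x y → x :+ y :* :0 := x) refl _ (α * β)))

 -- The normalizer of the torus (or root subgroup) through b.
 Axial : Γ → Pred
 Axial b g = Cm (conj g b) b

 module _ {b : Γ} (lb : Linear b) (b≢ε : b ≢ ε) where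
  private
   B J : Mat
   B = mtx b
   J = axis-of B

  B-nonscalar : ¬ Scalar B
  B-nonscalar = nonscalar lb b≢ε

  J-nonscalar : ¬ Scalar J
  J-nonscalar = axis-nonscalar B-nonscalar

  commute-J⇒B : ∀ {A} → Commute A J → Commute A B
  commute-J⇒B {A} c = commute-trans {A} {J} {B} J-nonscalar c (axis-commute B)

  commute-B⇒J : ∀ {A} → Commute A B → Commute A J
  commute-B⇒J {A} c = commute-trans {A} {B} {J} B-nonscalar c (sym (axis-commute B))

  -- Closure under products is transitivity of matrix commutation through a conjugate of b, which is
  -- not scalar.
  axial-subgroup : Subgroup (Axial b)
  axial-subgroup = finite-subgroup one-axial closed
   where
   one-axial : Axial b ε
   one-axial = subst (λ k → Cm k b) (g-solve 1 (λ b → b ⊜ :ε :⁻ :∙ b :∙ :ε) refl b) refl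
   closed : ∀ {g h} → Axial b g → Axial b h → Axial b (g ∙ h)
   closed {g} {h} x y = subst (λ k → Cm k b) (g-solve 3 (λ b g h → h :⁻ :∙ (g :⁻ :∙ b :∙ g) :∙ h ⊜ (g :∙ h) :⁻ :∙ b :∙ (g :∙ h)) refl b g h)
    (commute-trans {mtx (conj h (conj g b))} {mtx (conj h b)} {B}
     (nonscalar (conj-linear h lb) λ e → b≢ε (conj-injective h b ε (trans e (g-solve 1 (λ h → :ε ⊜ h :⁻ :∙ :ε :∙ h) refl h))))
     (cm-conjugate h (conj-linear g lb) lb x) y)

  commuting-axial : ∀ {g} → Linear g → Cm g b → Axial b g
  commuting-axial {g} lg c = subst (λ k → Cm k b) (sym (conj-commute (sym (cm-∙ lg lb c)))) refl

  -- The axes of b and of its conjugate are traceless and commute, hence are proportional. This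
  -- turns the condition on the semilinear g into a matrix equation.
  axial-intertwines : ∀ {g} → Axial b g → mtx g ·ₘ mapMat (aut-of g) J ∝ J ·ₘ mtx g
  axial-intertwines {g} ax = from (conj-mat g lb)
   where
   module S = FieldAut (aut-is g)
   G B′ : Mat
   G = mtx g
   B′ = mtx (conj g b)
   map-axis : ∀ A → mapMat (aut-of g) (axis-of A) ≡ axis-of (mapMat (aut-of g) A)
   map-axis (mat a b c d) = mat-≡ (diagonal a d a) (off b) (off c) (diagonal a d d)
    where
    σtwo : aut-of g two ≡ two
    σtwo = trans (S.σ-+ _ _) (cong₂ _+_ S.σ-1 S.σ-1)
    off : ∀ b → aut-of g (two * b) ≡ two * aut-of g b
    off b = trans (S.σ-* _ _) (cong (_* aut-of g b) σtwo)
    diagonal : ∀ a d e → aut-of g (- (a + d) + two * e) ≡ - (aut-of g a + aut-of g d) + two * aut-of g e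
    diagonal a d e = trans (S.σ-+ _ _) (cong₂ _+_ (trans (S.σ-neg _) (cong -_ (S.σ-+ a d))) (off e))
   J∝J′ : J ∝ axis-of B′
   J∝J′ = traceless-commute {axis-of B′} {J} (axis-traceless B′) (axis-traceless B) (axis-nonscalar B′-nonscalar) J-nonscalar
    (commute-trans {axis-of B′} {B′} {J} B′-nonscalar (axis-commute B′) (commute-B⇒J ax))
    where
    B′-nonscalar : ¬ Scalar B′
    B′-nonscalar = nonscalar (conj-linear g lb) λ e → b≢ε (conj-injective g b ε (trans e (g-solve 1 (λ h → :ε ⊜ h :⁻ :∙ :ε :∙ h) refl g)))
   from : B ·ₘ G ∝ G ·ₘ mapMat (aut-of g) B′ → G ·ₘ mapMat (aut-of g) J ∝ J ·ₘ G
   from (l , l≢0 , e) = ∝-trans (∝-·ₘ {G} {G} ∝-refl (∝-map (aut-is g) J∝J′))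
    (∝-sym (l , l≢0 , trans (cong (G ·ₘ_) (map-axis B′)) (intertwine-axis {G} {B} {mapMat (aut-of g) B′} (det-of g) e)))

  intertwines-axial : ∀ {g} → Linear g → J ·ₘ mtx g ∝ mtx g ·ₘ J → Axial b g
  intertwines-axial {g} lg (m , m≢0 , r) = from (conj-mat g lb)
   where
   G B′ : Mat
   G = mtx g
   B′ = mtx (conj g b)
   from : B ·ₘ G ∝ G ·ₘ mapMat (aut-of g) B′ → Axial b g
   from (l , l≢0 , e) = commute-J⇒B {B′} (cancel-·ₘ (det-of g) (trans (intertwine {G} {B} {J} {B′} {J} l m e′ r)
    (trans (cong₂ scale (*-comm l m) (cong (_·ₘ G) (sym (axis-commute B)))) (sym (intertwine {G} {J} {B} {J} {B′} m l r e′)))))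
    where
    e′ : G ·ₘ B′ ≡ scale l (B ·ₘ G)
    e′ = subst (λ X → G ·ₘ X ≡ scale l (B ·ₘ G)) (mapMat-id lg B′) e

  linear-intertwines : ∀ {g} → Linear g → Axial b g → mtx g ·ₘ J ∝ J ·ₘ mtx g
  linear-intertwines {g} lg ax = subst (λ X → mtx g ·ₘ X ∝ J ·ₘ mtx g) (mapMat-id lg J) (axial-intertwines ax)

  -- The two standard transvections cannot both normalize a torus.
  ¬T-axial : ¬ (T̂ ⊑ Axial b)
  ¬T-axial f = B-nonscalar (from B (constraint upper det-upper) (constraint lower det-lower))
   where
   upper lower : Mat
   upper = mat 1# 1# 0# 1#
   lower = mat 1# 0# 1# 1#
   det-upper : det upper ≡ 1#
   det-upper = solve 0 (:1 :* :1 :- :1 :* :0 := :1) refl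
   det-lower : det lower ≡ 1#
   det-lower = solve 0 (:1 :* :1 :- :0 :* :1 := :1) refl
   constraint : ∀ U → det U ≡ 1# → U ·ₘ J ∝ J ·ₘ U
   constraint U dU = ∝-trans (∝-·ₘ U∝ ∝-refl) (∝-trans (linear-intertwines (mk-lin U) (f (mk U) TU)) (∝-·ₘ {J} {J} ∝-refl (∝-sym U∝)))
    where
    dU≢0 : det U ≢ 0#
    dU≢0 e = 1≢0 (trans (sym dU) e)
    U∝ : U ∝ mtx (mk U)
    U∝ = mk-mat dU≢0
    TU : T̂ (mk U)
    TU = T-intro (mk-lin U) (sqDet-∝ U∝ (1# , trans dU (sym (*-identityˡ 1#))))
   one-or-zero : ∀ {l z} → z ≡ l * z → z ≢ 0# → l ≡ 1#
   one-or-zero {l} {z} e ne = *-cancelˡ ne (trans (*-comm z l) (trans (sym e) (sym (*-identityʳ z))))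
   upper-zero : ∀ x y z w → w ≡ - x → upper ·ₘ mat x y z w ∝ mat x y z w ·ₘ upper → z ≡ 0# × x ≡ 0#
   upper-zero x y z _ refl (l , _ , e) with e₁ , e₂ , e₃ , _ ← mat-inj e = z≡0 , dne λ ne → ne (half-zero (double (one-or-zero (x≡lx z≡0) ne)))
    where
    z≡lz : z ≡ l * z
    z≡lz = trans (solve 2 (λ z w → z := z :* :1 :+ w :* :0) refl z (- x)) (trans e₃ (solve 3 (λ l x z → l :* (:0 :* x :+ :1 :* z) := l :* z) refl l x z))
    x≡ : x ≡ l * (x + z)
    x≡ = trans (solve 2 (λ x y → x := x :* :1 :+ y :* :0) refl x y) (trans e₁ (solve 3 (λ l x z → l :* (:1 :* x :+ :1 :* z) := l :* (x :+ z)) refl l x z))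
    z≡0 : z ≡ 0#
    z≡0 = dne λ ne → ne (trans (solve 2 (λ x z → z := x :+ z :- x) refl x z) (≡⇒-≡0 (sym (trans x≡ (trans (cong (_* (x + z)) (one-or-zero z≡lz ne)) (*-identityˡ _))))))
    x≡lx : z ≡ 0# → x ≡ l * x
    x≡lx z0 = trans x≡ (cong (l *_) (trans (cong (x +_) z0) (+-identityʳ x)))
    double : l ≡ 1# → x + x ≡ 0#
    double l1 = trans (solve 2 (λ x y → x :+ x := x :* :1 :+ y :* :1 :- (:1 :* (:1 :* y :+ :1 :* (:- x)))) refl x y)
     (≡⇒-≡0 (trans e₂ (cong (_* (1# * y + 1# * - x)) l1)))
   lower-zero : ∀ x y z w → lower ·ₘ mat x y z w ∝ mat x y z w ·ₘ lower → y ≡ 0#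
   lower-zero x y z w (l , _ , e) with e₁ , e₂ , _ , _ ← mat-inj e = dne λ ne → ne (trans (solve 2 (λ x y → y := x :+ y :- x) refl x y)
    (≡⇒-≡0 (trans x+y≡ (trans (cong (_* x) (one-or-zero y≡ly ne)) (*-identityˡ x)))))
    where
    y≡ly : y ≡ l * y
    y≡ly = trans (solve 2 (λ x y → y := x :* :0 :+ y :* :1) refl x y) (trans e₂ (solve 3 (λ l y w → l :* (:1 :* y :+ :0 :* w) := l :* y) refl l y w))
    x+y≡ : x + y ≡ l * x
    x+y≡ = trans (solve 2 (λ x y → x :+ y := x :* :1 :+ y :* :1) refl x y) (trans e₁ (solve 3 (λ l x z → l :* (:1 :* x :+ :0 :* z) := l :* x) refl l x z))
   from : ∀ B → (upper ·ₘ axis-of B ∝ axis-of B ·ₘ upper) → (lower ·ₘ axis-of B ∝ axis-of B ·ₘ lower) → Scalar B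
   from (mat a b c d) u l = halve (lower-zero _ _ _ _ l) , halve (proj₁ z,x) , -≡0 (trans (solve 2 (λ a d → a :- d := :- (a :+ d) :+ (:1 :+ :1) :* a) refl a d) (proj₂ z,x))
    where
    halve : ∀ {x} → two * x ≡ 0# → x ≡ 0#
    halve z = zero-product z two≢0
    z,x : two * c ≡ 0# × - (a + d) + two * a ≡ 0#
    z,x = upper-zero _ (two * b) _ _ (solve 2 (λ a d → :- (a :+ d) :+ (:1 :+ :1) :* d := :- (:- (a :+ d) :+ (:1 :+ :1) :* a)) refl a d) u

 trivial-group : Subgroup (_≡ ε)
 trivial-group = record { unit = refl ; mul = λ { refl refl → identityˡ ε } ; inv = λ { refl → g-solve 0 (:ε :⁻ ⊜ :ε) refl } }

 Pair : Γ → Pred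
 Pair w = Adjoin (_≡ ε) w

 pair-two : ∀ {w} → w ∙ w ≡ ε → TwoGroup (Pair w)
 pair-two {w} w² = two-adjoin (trivial trivial-group (λ _ → id)) w (λ { y refl → g-solve 1 (λ t → t :⁻ :∙ :ε :∙ t ⊜ :ε) refl w }) w²

 pair-subgroup : ∀ {w} → w ∙ w ≡ ε → Subgroup (Pair w)
 pair-subgroup w² = sub₂ (pair-two w²)

 pair-cases : ∀ {w y} → Pair w y → y ≡ ε ⊎ y ≡ w
 pair-cases (inj₁ e) = inj₁ e
 pair-cases {w} {y} (inj₂ e) = inj₂ (trans (g-solve 2 (λ w y → y ⊜ w :∙ (w :⁻ :∙ y)) refl w y) (trans (cong (w ∙_) e) (identityʳ w)))

 pair-w : ∀ {w} → Pair w w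
 pair-w {w} = inj₂ (inverseˡ w)

 -- From an obstruction to a torus whose normalizer is M.

 module _ {Ĝ M̂ : Pred} (sG : Subgroup Ĝ) (sM : Subgroup M̂) (M⊑G : M̂ ⊑ Ĝ) (T⊑G : T̂ ⊑ Ĝ)
  (maximal : Maximal Ĝ M̂) (¬T⊑M : ¬ (T̂ ⊑ M̂)) where

  M₀ : Pred
  M₀ y = M̂ y × T̂ y

  sM₀ : Subgroup M₀
  sM₀ = ∩-subgroup sM sT

  G⊑MT : ∀ g → Ĝ g → ∃ λ m → M̂ m × T̂ (m ⁻¹ ∙ g)
  G⊑MT = supplement sG sM M⊑G T⊑G maximal ¬T⊑M

  -- The normalizer of the torus in G contains M but not T, so by maximality it is M.
  axial-maximal : ∀ {b} → Linear b → b ≢ ε → M̂ ⊑ Axial b → ∀ g → Ĝ g → Axial b g → M̂ g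
  axial-maximal {b} lb b≢ε M⊑A g Gg Ag = [ (λ f → f g (Gg , Ag)) , (λ f → ⊥-elim (¬T-axial lb b≢ε (λ t Tt → proj₂ (f t (T⊑G t Tt))))) ]′
   (maximal (λ g → Ĝ g × Axial b g) (∩-subgroup sG (axial-subgroup lb b≢ε)) (λ m Mm → M⊑G m Mm , M⊑A m Mm) (λ _ → proj₁))

  -- J being the axis of b, `anticommutes` makes w invert the torus. The class of J is the
  -- involution of PGL₂(q) in that torus, and `det-axis` places it outside T.
  record TorusObstruction : Set where
   field
    x w b : Γ
    Tx : T̂ x
    Tw : T̂ w
    Tb : T̂ b
    ¬Mx : ¬ M̂ x
    Mw : M̂ w
    w² : w ∙ w ≡ ε
    w≢ε : w ≢ ε
    b≢ε : b ≢ ε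
    x² : x ∙ x ≡ w
    no-involution : ∀ m → M̂ m → (x ∙ m) ∙ (x ∙ m) ≢ ε
    M-axial : M̂ ⊑ Axial b
    axial-M : ∀ g → Ĝ g → Axial b g → M̂ g
    anticommutes : Anticomm (mtx w) (axis-of (mtx b))
    det-axis : ¬ Square (det (axis-of (mtx b)))
    Cm-xw : Cm x w
    no-torus-involution : ∀ v → T̂ v → v ∙ v ≡ ε → v ≢ ε → ¬ Cm v b
    odd-pair : Odd (index (pair-subgroup w²) M₀)

  open Frobenius sT T-normal sM sM₀ (λ _ → id) (λ _ → _,_) commutation
   using (CentralInvolution; central-involution; Axis; axis; module CentralInvolution; module Axis; centralizer-cm)

  torus-from-axis : (o : SocleObstruction sT T-normal M̂) (ci : CentralInvolution o) → Axis o ci → TorusObstruction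
  torus-from-axis o ci ax = from-kind kind
   where
   open SocleObstruction o renaming (two to two-Syl)
   open CentralInvolution ci
   open Axis ax
   Tw : T̂ w
   Tw = proj₂ M₀w
   lb : Linear b
   lb = T-linear Tb
   lw : Linear w
   lw = T-linear Tw
   lx : Linear x
   lx = T-linear Tx
   axial-M : ∀ g → Ĝ g → Axial b g → M̂ g
   axial-M = axial-maximal lb b≢ε Cm-M
   X Z B J : Mat
   X = mtx x
   Z = mtx w
   B = mtx b
   J = axis-of B
   Z-traceless : tr Z ≡ 0#
   Z-traceless = involution-traceless lw w² w≢ε
   Z-nonscalar : ¬ Scalar Z
   Z-nonscalar = nonscalar lw w≢ε
   x∉axial : ¬ Axial b x
   x∉axial a = ¬Mx (axial-M x (T⊑G x Tx) a)
   from-kind : b ≡ w ⊎ (b ∙ b ≢ ε × conj w b ≡ b ⁻¹) → TorusObstruction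
   -- x commutes with w = b as matrices, so it would normalize the torus and lie in M.
   from-kind (inj₁ e) = ⊥-elim (x∉axial (commuting-axial lb b≢ε lx (subst (Cm x) (sym e) Cm-x)))
   from-kind (inj₂ (b²≢ε , inverted)) = record
    { x = x ; w = w ; b = b ; Tx = Tx ; Tw = Tw ; Tb = Tb ; ¬Mx = ¬Mx ; Mw = proj₁ M₀w ; w² = w² ; w≢ε = w≢ε ; b≢ε = b≢ε
    ; x² = x² ; no-involution = no-involution ; M-axial = Cm-M ; axial-M = axial-M
    ; anticommutes = anticommutes ; det-axis = det-axis ; Cm-xw = Cm-x ; no-torus-involution = no-torus-involution ; odd-pair = odd-pair }
    where
    not-commute : ¬ Cm w b
    not-commute c = b²≢ε (trans (cong (b ∙_) (sym (trans (sym inverted) (conj-commute (sym (cm-∙ lw lb c)))))) (inverseʳ b))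
    ZJ : Z ·ₘ J ∝ J ·ₘ Z
    ZJ = linear-intertwines lb b≢ε lw (Cm-M w (proj₁ M₀w))
    -- Otherwise J² = 0. As Z normalizes the line of J, so does X, a polynomial in Z, and x would
    -- lie in M.
    det-J≢0 : det J ≢ 0#
    det-J≢0 dJ = from (centralizer X Z Z-nonscalar Cm-x)
     where
     from : (∃ λ α → ∃ λ β → X ≡ lin α β Z) → ⊥
     from (α , β , e) = x∉axial (intertwines-axial lb b≢ε lx (subst (λ X → J ·ₘ X ∝ X ·ₘ J) (sym e)
      (nilpotent-normalized {J} {Z} α β (axis-traceless B) (J-nonscalar lb b≢ε) dJ ZJ (subst (λ X → det X ≢ 0#) e (det-of x)))))
    anticommutes : Anticomm Z J
    anticommutes = [ (λ c → ⊥-elim (not-commute (commute-J⇒B lb b≢ε {Z} c))) , id ]′ (projective-commute (det-of w) det-J≢0 ZJ)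
    -- The matrix of v would be a multiple of J and anticommute with Z. Then v centralizes w in M₀,
    -- and by `centralizer-cm` the same matrices commute.
    no-torus-involution : ∀ v → T̂ v → v ∙ v ≡ ε → v ≢ ε → ¬ Cm v b
    no-torus-involution v Tv v² v≢ε c = commute-anticommute-⊥ {mtx v} {Z} (det-of v) (det-of w)
     (centralizer-cm o ci v (axial-M v (T⊑G v Tv) (commuting-axial lb b≢ε (T-linear Tv) c) , Tv) (linear-≡ (linear-mul (T-linear Tv) lw) (linear-mul lw (T-linear Tv)) VZ))
     anti
     where
     V : Mat
     V = mtx v
     J∝V : J ∝ V
     J∝V = traceless-commute {V} {J} (involution-traceless (T-linear Tv) v² v≢ε) (axis-traceless B) (nonscalar (T-linear Tv) v≢ε) (J-nonscalar lb b≢ε)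
      (commute-B⇒J lb b≢ε {V} c)
     anti : Anticomm V Z
     anti = anticommute-∝ {J} {V} {Z} J∝V (anticommute-sym {Z} {J} anticommutes)
     VZ : mtx (v ∙ w) ∝ mtx (w ∙ v)
     VZ = ∝-trans (∝-sym (linear-∙ w (T-linear Tv))) (∝-trans (∝-sym (- 1# , neg≢0 , anti)) (linear-∙ v lw))
      where
      neg≢0 : - 1# ≢ 0#
      neg≢0 e = 1≢0 (trans (solve 0 (:1 := :- (:- :1)) refl) (trans (cong -_ e) (solve 0 (:- :0 := :0) refl)))
    -- If det J were a square, the class of J would be an involution of T in the torus.
    det-axis : ¬ Square (det J)
    det-axis s = no-torus-involution ĵ (T-intro (mk-lin J) (sqDet-∝ (mk-mat det-J≢0) s))
     (traceless-involution (mk-lin J) (tr-∝ (mk-mat det-J≢0) (axis-traceless B)))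
     (λ e → J-nonscalar lb b≢ε (∝-Scalar (∝-sym (mk-mat det-J≢0)) (subst (λ k → Scalar (mtx k)) (sym e) ε-scalar)))
     (commute-∝ˡ {J} {mtx ĵ} {B} (mk-mat det-J≢0) (axis-commute B))
     where
     ĵ : Γ
     ĵ = mk J
    -- An element of M ∩ T commuting with Z either centralizes or inverts the torus, so it is 1 or w.
    commuting-pair : ∀ r → M̂ r → T̂ r → Cm r w → Pair w r
    commuting-pair r Mr Tr c = from (centralizer (mtx r) Z Z-nonscalar c) (projective-commute (det-of r) det-J≢0 (linear-intertwines lb b≢ε (T-linear Tr) (Cm-M r Mr)))
     where
     R : Mat
     R = mtx r
     from : (∃ λ α → ∃ λ β → R ≡ lin α β Z) → Commute R J ⊎ Anticomm R J → Pair w r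
     from (α , β , e) (inj₁ c) = inj₁ (scalar-ε (T-linear Tr) (subst Scalar (sym (trans e (cong (λ β → lin α β Z) β≡0))) (lin-0-scalar α Z)))
      where
      β≡0 : β ≡ 0#
      β≡0 = half-zero (trans (cong (β +_) (proj₂ (lin-injective {α} {β} {α} { - β} {Z} Z-nonscalar
       (cancel-·ₘ det-J≢0 (trans (sym (subst (λ X → Commute X J) e c)) (lin-anticommute {J} {Z} α β anticommutes)))))) (-‿inverseʳ β))
     from (α , β , e) (inj₂ a) = subst (Pair w) (sym (linear-≡ (T-linear Tr) lw (∝-sym (β , β≢0 , trans e (lin-scale Z α≡0))))) pair-w
      where
      neg-lin : ∀ A → neg (J ·ₘ lin α β A) ≡ J ·ₘ lin (- α) (- β) A
      neg-lin (mat a b c d) = trans (sym (·ₘ-scale (- 1#) J _)) (cong (J ·ₘ_) (mat-≡ (diag a) (off b) (off c) (diag d)))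
       where
       diag : ∀ a → - 1# * (α + β * a) ≡ - α + - β * a
       diag a = solve 3 (λ α β a → (:- :1) :* (α :+ β :* a) := :- α :+ (:- β) :* a) refl α β a
       off : ∀ b → - 1# * (β * b) ≡ - β * b
       off b = solve 2 (λ β b → (:- :1) :* (β :* b) := (:- β) :* b) refl β b
      α≡0 : α ≡ 0#
      α≡0 = half-zero (trans (cong (α +_) (proj₁ (lin-injective {α} { - β} { - α} { - β} {Z} Z-nonscalar
       (cancel-·ₘ det-J≢0 (trans (sym (lin-anticommute {J} {Z} α β anticommutes)) (trans (subst (λ X → Anticomm X J) e a) (neg-lin Z))))))) (-‿inverseʳ α))
      lin-scale : ∀ A → α ≡ 0# → lin α β A ≡ scale β A
      lin-scale (mat a b c d) refl = mat-≡ (+-identityˡ _) refl refl (+-identityˡ _)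
      β≢0 : β ≢ 0#
      β≢0 z = det-of r (trans (cong det (trans e (trans (lin-scale Z α≡0) (cong (λ s → scale s Z) z)))) (trans (det-scale 0# Z) (solve 1 (λ d → :0 :* :0 :* d := :0) refl (det Z))))
    pair⊑M₀ : Pair w ⊑ M₀
    pair⊑M₀ y p = [ (λ { refl → unit sM₀ }) , (λ { refl → M₀w }) ]′ (pair-cases p)
    Syl-pair : ∀ r → M₀ r → Syl r → Pair w r
    Syl-pair r (Mr , Tr) s = commuting-pair r Mr Tr (Cm-Syl r s Tr)
    -- M₀ ∩ Syl lies in ⟨w⟩, so |M₀ : ⟨w⟩| divides the odd index of M₀ ∩ Syl in M₀.
    odd-pair : Odd (index (pair-subgroup w²) M₀)
    odd-pair = odd-*ˡ _ _ (subst Odd (index-tower sQ₀ (pair-subgroup w²) sM₀ (λ r (m , s) → Syl-pair r m s) pair⊑M₀) (odd-T sM₀ (λ _ → id) (λ _ → _,_)))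
     where
     sQ₀ : Subgroup (λ y → M₀ y × Syl y)
     sQ₀ = ∩-subgroup sM₀ (sub₂ two-Syl)
    -- x² lies in Syl ∩ T, hence in ⟨w⟩, and it is not trivial.
    x² : x ∙ x ≡ w
    x² = [ (λ e → ⊥-elim (no-involution ε (unit sM) (trans (cong₂ _∙_ (identityʳ x) (identityʳ x)) e))) , id ]′
     (pair-cases (Syl-pair (x ∙ x) (Syl⊆M _ square , T-mul Tx Tx) square))

  torus-obstruction : SocleObstruction sT T-normal M̂ → TorusObstruction
  torus-obstruction o = torus-from-axis o (central-involution o) (axis o (central-involution o))

 -- The torus in coordinates: order, cyclicity and dihedral normalizer.

 module Torus {b : Γ} (lb : Linear b) (b≢ε : b ≢ ε) (det-J≢0 : det (axis-of (mtx b)) ≢ 0#) where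
  B J : Mat
  B = mtx b
  J = axis-of B

  d : Carrier
  d = det J

  J-ns : ¬ Scalar J
  J-ns = J-nonscalar lb b≢ε

  E : Pred
  E i = Linear i × Commute (mtx i) J

  sE : Subgroup E
  sE = finite-subgroup (linear-ε , scalar-commute (mtx ε) J ε-scalar)
   (λ {i} {j} (li , ci) (lj , cj) → linear-mul li lj , commute-∝ˡ {B = J} (linear-∙ j li) (commute-mul {mtx i} {mtx j} {J} ci cj))

  E-comm : ∀ {i j} → E i → E j → i ∙ j ≡ j ∙ i
  E-comm {i} {j} (li , ci) (lj , cj) = cm-∙ li lj (commute-trans {mtx i} {J} {mtx j} J-ns ci (sym cj))

  -- Up to scalars every nonidentity element of the torus is α + J for exactly one α; this matrix is
  -- nonsingular exactly when α² + d ≠ 0.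
  point : Carrier → Mat
  point α = lin α 1# J

  det-point : ∀ α → det (point α) ≡ α * α + d
  det-point α = trans (det-lin α 1# J (axis-traceless B)) (cong (α * α +_) (solve 1 (λ d → :1 :* :1 :* d := d) refl d))

  Finite : Carrier → Set
  Finite α = α * α + d ≢ 0#

  coordinate : ∀ i → E i → i ≢ ε → ∃ λ α → Finite α × point α ∝ mtx i
  coordinate i (li , ci) ne = from (centralizer (mtx i) J J-ns ci)
   where
   from : (∃ λ α → ∃ λ β → mtx i ≡ lin α β J) → ∃ λ α → Finite α × point α ∝ mtx i
   from (α , β , e) = recip β * α , (λ z → ∝-det (∝-sym prop) (det-of i) (trans (det-point (recip β * α)) z)) , prop
    where
    β≢0 : β ≢ 0#
    β≢0 z = nonscalar li ne (subst Scalar (sym (trans e (cong (λ β → lin α β J) z))) (lin-0-scalar α J))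
    scale-point : ∀ A → lin α β A ≡ scale β (lin (recip β * α) 1# A)
    scale-point (mat a b c d) = mat-≡ (diag a) (off b) (off c) (diag d)
     where
     diag : ∀ a → α + β * a ≡ β * (recip β * α + 1# * a)
     diag a = trans (cong (_+ β * a) (trans (sym (*-identityˡ α)) (cong (_* α) (sym (*-recip β≢0))))) (solve 4 (λ α β r a → β :* r :* α :+ β :* a := β :* (r :* α :+ :1 :* a)) refl α β (recip β) a)
     off : ∀ b → β * b ≡ β * (1# * b)
     off b = cong (β *_) (sym (*-identityˡ b))
    prop : point (recip β * α) ∝ mtx i
    prop = β , β≢0 , trans e (scale-point J)

  element : Carrier → Γ
  element α = mk (point α)

  finite-det : ∀ {α} → Finite α → det (point α) ≢ 0#
  finite-det {α} f e = f (trans (sym (det-point α)) e)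

  element-mat : ∀ {α} → Finite α → point α ∝ mtx (element α)
  element-mat f = mk-mat (finite-det f)

  element-E : ∀ {α} → Finite α → E (element α)
  element-E {α} f = mk-lin _ , commute-∝ˡ {B = J} (element-mat f) (lin-self α 1# J)

  point-nonscalar : ∀ α → ¬ Scalar (point α)
  point-nonscalar α = lin-nonscalar {α} {1#} {J} 1≢0 J-ns

  element≢ε : ∀ {α} → Finite α → element α ≢ ε
  element≢ε {α} f e = point-nonscalar α (∝-Scalar (∝-sym (element-mat f)) (subst (λ k → Scalar (mtx k)) (sym e) ε-scalar))

  point-injective : ∀ {α β} → point α ∝ point β → α ≡ β
  point-injective {α} {β} (l , _ , e) = trans (sym (*-identityˡ α)) (trans (cong (_* α) (sym l≡1)) (sym (proj₁ coefficients)))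
   where
   scale-lin : ∀ A → scale l (lin α 1# A) ≡ lin (l * α) (l * 1#) A
   scale-lin (mat a b c d) = mat-≡ (diag a) (sym (*-assoc l 1# b)) (sym (*-assoc l 1# c)) (diag d)
    where
    diag : ∀ a → l * (α + 1# * a) ≡ l * α + l * 1# * a
    diag a = solve 3 (λ l α a → l :* (α :+ :1 :* a) := l :* α :+ l :* :1 :* a) refl l α a
   coefficients : β ≡ l * α × 1# ≡ l * 1#
   coefficients = lin-injective {β} {1#} {l * α} {l * 1#} {J} J-ns (trans e (scale-lin J))
   l≡1 : l ≡ 1#
   l≡1 = trans (sym (*-identityʳ l)) (sym (proj₂ coefficients))

  #E : # E ≡ suc (#K Finite)
  #E = trans (#-remove ε (unit sE)) (cong suc (sym (#-bij (element ∘ at)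
   (λ i f → element-E f , element≢ε f)
   (λ i j f g e → at-injective (point-injective (∝-trans (element-mat f) (subst (λ k → mtx k ∝ point (at j)) (sym e) (∝-sym (element-mat g))))))
   λ i (Ei , ne) → let (α , f , p) = coordinate i Ei ne
                       f′ = subst Finite (sym (at-ix α)) f
    in ix α , f′ , linear-≡ (proj₁ (element-E f′)) (proj₁ Ei) (∝-trans (∝-sym (element-mat f′)) (subst (λ β → point β ∝ mtx i) (sym (at-ix α)) p)))))

  #E-nonsplit : ¬ Square (- d) → # E ≡ suc q
  #E-nonsplit ns = trans #E (cong suc (#K-all λ α z → ns (α , trans (solve 2 (λ d x → :- d := x :- (x :+ d)) refl d (α * α)) (trans (cong (λ x → α * α - x) z) (solve 1 (λ x → x :- :0 := x) refl (α * α))))))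

  #E-split : Square (- d) → suc (# E) ≡ q
  #E-split (s , e) = trans (cong suc #E) (sym (trans (sym (#K-all {λ _ → ⊤} _)) (trans (#K-remove {λ _ → ⊤} s _)
   (cong suc (trans (#K-remove {λ x → ⊤ × x ≢ s} (- s) (_ , λ f → s≢-s (sym f))) (cong suc (#-cong
    (λ i ((_ , n₁) , n₂) z → [ n₁ , n₂ ]′ (square-roots (root z)))
    (λ i f → (_ , λ z → f (trans (cong (λ x → x * x + d) z) is-root)) , λ z → f (trans (cong (λ x → x * x + d) z) (trans (cong (_+ d) (solve 1 (λ s → (:- s) :* (:- s) := s :* s) refl s)) is-root))))))))))
   where
   is-root : s * s + d ≡ 0#
   is-root = trans (cong (_+ d) (sym e)) (-‿inverseˡ d)
   root : ∀ {x} → x * x + d ≡ 0# → x * x ≡ s * s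
   root {x} z = trans (-≡0 (trans (solve 2 (λ x d → x :- (:- d) := x :+ d) refl (x * x) d) z)) e
   s≢-s : s ≢ - s
   s≢-s = -≢ λ { refl → det-J≢0 (trans (solve 1 (λ d → d := :- (:- d)) refl d) (trans (cong -_ e) (solve 0 (:- (:0 :* :0) := :0) refl))) }

  C : Pred
  C i = E i × T̂ i

  sC : Subgroup C
  sC = ∩-subgroup sE sT

  -- J has nonsquare determinant, so the torus is the union of C and the coset of C by the class of
  -- J.
  #E≡#C+#C : ¬ Square d → (∀ {x y} → ¬ Square x → ¬ Square y → Square (x * y)) → # E ≡ # C ℕ.+ # C
  #E≡#C+#C nsd ns-mul = trans (#-cong to from) (adjoin-order sC ĵ ĵ∉C)
   where
   ĵ : Γ
   ĵ = mk J
   J∝ : J ∝ mtx ĵ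
   J∝ = mk-mat det-J≢0
   Eĵ : E ĵ
   Eĵ = mk-lin J , commute-∝ˡ {B = J} J∝ refl
   ĵ-ns : ¬ SqDet (mtx ĵ)
   ĵ-ns s = nsd (sqDet-∝ (∝-sym J∝) s)
   ĵ∉C : ¬ C ĵ
   ĵ∉C (_ , t) = ĵ-ns (T-square t)
   from : ∀ i → Adjoin C ĵ i → E i
   from i (inj₁ c) = proj₁ c
   from i (inj₂ c) = move E (g-solve 2 (λ j i → j :∙ (j :⁻ :∙ i) ⊜ i) refl ĵ i) (mul sE Eĵ (proj₁ c))
   to : ∀ i → E i → Adjoin C ĵ i
   to i Ei = by-cases (em (SqDet (mtx i)))
    where
    by-cases : Dec (SqDet (mtx i)) → Adjoin C ĵ i
    by-cases (yes s) = inj₁ (Ei , T-intro (proj₁ Ei) s)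
    by-cases (no n) = inj₂ (Eji , T-intro (proj₁ Eji) (sqDet-∝ (linear-∙ i (linear-inv (mk-lin J)))
     (subst Square (sym (det-·ₘ _ _)) (ns-mul (λ s → ĵ-ns (subst Square (det-adj _) (sqDet-∝ (∝-sym (linear-⁻¹ (mk-lin J))) s))) n))))
     where
     Eji : E ((ĵ ⁻¹) ∙ i)
     Eji = mul sE (inv sE Eĵ) Ei

  -- (α + J)ⁿ = `re n α` + `im n α` · J, computed from J² = -d.
  re im : ℕ → Carrier → Carrier
  re zero α = 1#
  re (suc n) α = α * re n α + - d * im n α
  im zero α = 0#
  im (suc n) α = re n α + α * im n α

  point-mul : ∀ α r s → point α ·ₘ lin r s J ≡ lin (α * r + - d * s) (r + α * s) J
  point-mul α r s = go J (axis-traceless B)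
   where
   go : ∀ A → tr A ≡ 0# → lin α 1# A ·ₘ lin r s A ≡ lin (α * r + - det A * s) (r + α * s) A
   go (mat x y z w) t = mat-≡
    (subst (λ w → (α + 1# * x) * (r + s * x) + 1# * y * (s * z) ≡ α * r + - (x * w - y * z) * s + (r + α * s) * x) (sym w≡)
     (solve 6 (λ α r s x y z → (α :+ :1 :* x) :* (r :+ s :* x) :+ :1 :* y :* (s :* z) := α :* r :+ (:- (x :* (:- x) :- y :* z)) :* s :+ (r :+ α :* s) :* x) refl α r s x y z))
    (subst (λ w → (α + 1# * x) * (s * y) + 1# * y * (r + s * w) ≡ (r + α * s) * y) (sym w≡)
     (solve 5 (λ α r s x y → (α :+ :1 :* x) :* (s :* y) :+ :1 :* y :* (r :+ s :* (:- x)) := (r :+ α :* s) :* y) refl α r s x y))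
    (subst (λ w → 1# * z * (r + s * x) + (α + 1# * w) * (s * z) ≡ (r + α * s) * z) (sym w≡)
     (solve 5 (λ α r s x z → :1 :* z :* (r :+ s :* x) :+ (α :+ :1 :* (:- x)) :* (s :* z) := (r :+ α :* s) :* z) refl α r s x z))
    (subst (λ w → 1# * z * (s * y) + (α + 1# * w) * (r + s * w) ≡ α * r + - (x * w - y * z) * s + (r + α * s) * w) (sym w≡)
     (solve 6 (λ α r s x y z → :1 :* z :* (s :* y) :+ (α :+ :1 :* (:- x)) :* (r :+ s :* (:- x)) := α :* r :+ (:- (x :* (:- x) :- y :* z)) :* s :+ (r :+ α :* s) :* (:- x)) refl α r s x y z))
    where
    w≡ : w ≡ - x
    w≡ = trans (solve 2 (λ a d → d := a :+ d :- a) refl x w) (trans (cong (_- x) t) (+-identityˡ _))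

  power-mat : ∀ {i α} → Linear i → point α ∝ mtx i → ∀ n → lin (re n α) (im n α) J ∝ mtx (i ^^ n)
  power-mat li p zero = ∝-trans (∝-reflexive (lin-10 J)) mat-ε
   where
   lin-10 : ∀ A → lin 1# 0# A ≡ idMat
   lin-10 (mat a b c d) = mat-≡ (trans (cong (1# +_) (zeroˡ a)) (+-identityʳ 1#)) (zeroˡ b) (zeroˡ c) (trans (cong (1# +_) (zeroˡ d)) (+-identityʳ 1#))
  power-mat {i} {α} li p (suc n) = ∝-trans (∝-reflexive (sym (point-mul α (re n α) (im n α)))) (∝-trans (∝-·ₘ p (power-mat li p n)) (linear-∙ (i ^^ n) li))

  power-one : ∀ {i α n} → Linear i → point α ∝ mtx i → i ^^ n ≡ ε → im n α ≡ 0#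
  power-one {i} {α} {n} li p e = dne λ ne → lin-nonscalar {re n α} {im n α} {J} ne J-ns
   (∝-Scalar (∝-sym (power-mat li p n)) (subst (λ k → Scalar (mtx k)) (sym e) ε-scalar))

  poly-re : ∀ n → Polynomial (suc n) (re n)
  poly-im : ∀ n → Polynomial n (im n)
  poly-re zero = poly-const zero 1#
  poly-re (suc n) = poly-+ (suc (suc n)) (poly-X* (suc n) (poly-re n)) (poly-scale (suc (suc n)) (- d) (poly-weaken (suc n) (poly-weaken n (poly-im n))))
  poly-im zero x = refl
  poly-im (suc n) = poly-+ (suc n) (poly-re n) (poly-X* n (poly-im n))

  -- Since J² = -d, the coefficient of J in its power with exponent 2k + 1 is (-d)ᵏ.
  im-odd : ∀ k → im (suc (k ℕ.+ k)) 0# ≢ 0#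
  im-odd zero e = 1≢0 (trans (sym (trans (cong (1# +_) (zeroˡ 0#)) (+-identityʳ 1#))) e)
  im-odd (suc k) e = im-odd k (zero-product { - d} (trans (solve 4 (λ r s d t → (:- d) :* s := :0 :* r :+ (:- d) :* s :+ :0 :* t) refl _ _ d _)
   (trans (cong (λ n → im (suc n) 0#) (cong suc (sym (ℕ.+-suc k k)))) e))
   λ z → det-J≢0 (trans (solve 1 (λ d → d := :- (:- d)) refl d) (trans (cong -_ z) (solve 0 (:- :0 := :0) refl))))

  module _ (no-involution : ∀ v → C v → v ∙ v ≡ ε → v ≡ ε) where

   order-odd : ∀ {g m} → C g → IsOrder g m → Odd m
   order-odd {g} {m} Cg o = [ (λ (k , e) → ⊥-elim (half k e)) , id ]′ (even⊎odd m)
    where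
    half : ∀ k → m ≡ k ℕ.+ k → ⊥
    half zero e = ℕ.<⇒≢ (IsOrder.positive o) (sym e)
    half (suc k) e = ℕ.<⇒≱ (ℕ.m<m+n (suc k) (s≤s z≤n)) (subst (_≤ suc k) e (∣⇒≤ (IsOrder.divisible o (suc k)
     (no-involution _ (power-∈ sC Cg (suc k)) (trans (sym (^^-+ g (suc k) (suc k))) (trans (cong (g ^^_) (sym e)) (IsOrder.power o)))))))

   -- The nontrivial solutions of aᵐ = 1 have coordinates α that are roots of `im m`. This
   -- polynomial has m coefficients and is nonzero at 0 because m is odd, so there are fewer than m
   -- of them; the identity completes the count.
   C-bound : ∀ g m → C g → IsOrder g m → # (λ a → C a × a ^^ m ≡ ε) ≤ m
   C-bound g m Cg o = ℕ.≤-trans (ℕ.≤-reflexive (#-remove ε (unit sC , ε^^ m))) (ℕ.≤-<-trans inject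
    (ℕ.≰⇒> λ le → im-odd′ (order-odd Cg o) (poly-roots m (poly-im m) le 0#)))
    where
    im-odd′ : ∀ {m} → Odd m → im m 0# ≢ 0#
    im-odd′ (k , refl) = im-odd k
    inject : # (λ a → (C a × a ^^ m ≡ ε) × a ≢ ε) ≤ #K (λ α → im m α ≡ 0#)
    inject = #-inj (λ a ((Ca , e) , ne) → ix (proj₁ (coordinate a (proj₁ Ca) ne)))
     (λ a ((Ca , e) , ne) → subst (λ α → im m α ≡ 0#) (sym (at-ix _)) (power-one {n = m} (proj₁ (proj₁ Ca)) (proj₂ (proj₂ (coordinate a (proj₁ Ca) ne))) e))
     λ a ((Ca , _) , ne) a′ ((Ca′ , _) , ne′) e → linear-≡ (proj₁ (proj₁ Ca)) (proj₁ (proj₁ Ca′))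
      (∝-trans (∝-sym (proj₂ (proj₂ (coordinate a (proj₁ Ca) ne)))) (subst (λ α → point α ∝ mtx a′) (sym (ix-injective e)) (proj₂ (proj₂ (coordinate a′ (proj₁ Ca′) ne′)))))

   C-cyclic : ∃ λ c → C c × IsOrder c (# C) × (∀ a → C a → ∃ λ k → k < # C × a ≡ c ^^ k)
   C-cyclic = cyclic sC (λ x y → E-comm (proj₁ x) (proj₁ y)) C-bound

   module _ {H : Subset} (respects : ∀ x y → x ≈ y → H x → H y) (H⊆PΓL : H ⊆ PΓL) {w : Γ} (Hw : ⟦ H ⟧ w) (H-mul : ∀ {i j} → ⟦ H ⟧ i → ⟦ H ⟧ j → ⟦ H ⟧ (i ∙ j))
    (C⊑H : C ⊑ ⟦ H ⟧) (w² : w ∙ w ≡ ε) (w∉C : ¬ C w) (inverts : ∀ c → C c → w ∙ c ≡ (c ⁻¹) ∙ w) (H-cases : ∀ i → ⟦ H ⟧ i → C i ⊎ C (i ∙ w)) where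

    isoDihedral : ∀ {m} → m ≡ # C ℕ.+ # C → IsoDihedral H m
    isoDihedral {m} m≡ = from (# C) m≡ C-cyclic
     where
     from : ∀ n → m ≡ n ℕ.+ n → (∃ λ c → C c × IsOrder c n × (∀ a → C a → ∃ λ k → k < n × a ≡ c ^^ k)) → IsoDihedral H m
     from zero _ (c , _ , o , _) with () ← IsOrder.positive o
     from (suc k) e (c , Cc , o , gen) = k , trans (cong (suc k ℕ.+_) (ℕ.+-identityʳ (suc k))) (sym e) ,
      (λ x → el (φ x)) , φ-H , surjective , (λ x y eq → φ-injective x y (el-injective eq)) ,
      λ x y → subst (λ i → el i ≈ el (φ x) · el (φ y)) (sym (φ-mul x y)) (≈-sym {el (φ x) · el (φ y)} {el (φ x ∙ φ y)} (el-∙ (φ x) (φ y)))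
      where
      open DihedralMap.Rotations em isGroup {⟦ H ⟧} {C} H-mul sC C⊑H Cc o gen Hw w² w∉C inverts H-cases
      surjective : ∀ y → H y → ∃ λ x → el (φ x) ≈ y
      surjective y Hy = pull (φ-surjective (ixΓ y (H⊆PΓL y Hy)) (respects y _ (el-ixΓ y _) Hy))
       where
       pull : (∃ λ x → φ x ≡ ixΓ y (H⊆PΓL y Hy)) → ∃ λ x → el (φ x) ≈ y
       pull (x , eq) = x , subst (λ k → el k ≈ y) (sym eq) (≈-sym {y} {el (ixΓ y (H⊆PΓL y Hy))} (el-ixΓ y _))

 -- Field automorphisms of order two.

 module FieldInvolution {τ : Carrier → Carrier} (τ-aut : IsFieldAut τ) (τ² : ∀ z → τ (τ z) ≡ z) (τ≢id : ¬ (∀ z → τ z ≡ z)) where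
  module S = FieldAut τ-aut

  -- t = a - τ(a) for any a moved by τ.
  negated : ∃ λ t → t ≢ 0# × τ t ≡ - t
  negated = dne λ none → τ≢id λ a → dne λ ne → none (a - τ a , (λ e → ne (sym (-≡0 e))) ,
   trans (S.σ-+ a (- τ a)) (trans (cong (τ a +_) (trans (S.σ-neg (τ a)) (cong -_ (τ² a)))) (solve 2 (λ a b → b :- a := :- (a :- b)) refl a (τ a))))

  τ-pow : ∀ x n → τ (pow x n) ≡ pow (τ x) n
  τ-pow x zero = S.σ-1
  τ-pow x (suc n) = trans (S.σ-* _ _) (cong (τ x *_) (τ-pow x n))

  -- With f = γⁱ and t = γᵏ, the element tⁱ = fᵏ is fixed by τ, which multiplies it by (-1)ⁱ.
  fixed-square : ∀ {f} → τ f ≡ f → Square f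
  fixed-square {f} τf = by-cases (em (f ≡ 0#))
   where
   by-cases : Dec (f ≡ 0#) → Square f
   by-cases (yes z) = subst Square (sym z) zero-square
   by-cases (no f≢0) = from negated (γ-generates f f≢0)
    where
    from : (∃ λ t → t ≢ 0# × τ t ≡ - t) → (∃ λ i → i < units × f ≡ pow γ i) → Square f
    from (t , t≢0 , τt) (i , _ , fi) = from′ (γ-generates t t≢0)
     where
     from′ : (∃ λ k → k < units × t ≡ pow γ k) → Square f
     from′ (k , _ , tk) = subst Square (sym fi) (even-power-square ([ id , (λ o → ⊥-elim (odd-contra o)) ]′ (even⊎odd i)))
      where
      y : Carrier
      y = pow t i
      y≡ : y ≡ pow f k
      y≡ = trans (cong (λ z → pow z i) tk) (trans (sym (pow-* γ i k)) (trans (cong (pow γ) (ℕ.*-comm i k)) (trans (pow-* γ k i) (cong (λ z → pow z k) (sym fi)))))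
      fixed : τ y ≡ y
      fixed = trans (cong τ y≡) (trans (τ-pow f k) (trans (cong (λ z → pow z k) τf) (sym y≡)))
      odd-contra : Odd i → ⊥
      odd-contra o = -≢ (pow-nonzero i t≢0) (trans (sym fixed) (trans (τ-pow t i) (trans (cong (λ z → pow z i) (trans τt (solve 1 (λ t → :- t := (:- :1) :* t) refl t)))
       (trans (pow-distrib (- 1#) t i) (trans (cong (_* pow t i) (pow-minus-one-odd o)) (solve 1 (λ y → (:- :1) :* y := :- y) refl y))))))

  -- A form of Hilbert 90: c = ν + d satisfies d τ(c) = ν c.
  norm-square : ∀ {d ν} → d * τ d ≡ ν * ν → τ ν ≡ ν → Square d
  norm-square {d} {ν} e τν = by-cases (em (ν + d ≡ 0#))
   where
   c : Carrier
   c = ν + d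
   by-cases : Dec (c ≡ 0#) → Square d
   by-cases (yes z) = fixed-square (trans (cong τ d≡) (trans (S.σ-neg ν) (trans (cong -_ τν) (sym d≡))))
    where
    d≡ : d ≡ - ν
    d≡ = -≡0 (trans (solve 2 (λ d ν → d :- (:- ν) := ν :+ d) refl d ν) z)
   by-cases (no c≢0) = square-quotient (*-nonzero τc≢0 τc≢0) (τ c , refl)
    (subst Square (sym dτcτc) (square-* (fixed-square τν) (fixed-square (trans (S.σ-* c (τ c)) (trans (cong (τ c *_) (τ² c)) (*-comm (τ c) c))))))
    where
    τc≢0 : τ c ≢ 0#
    τc≢0 = S.σ-nonzero c≢0
    dτc : d * τ c ≡ ν * c
    dτc = trans (cong (d *_) (trans (S.σ-+ ν d) (cong (_+ τ d) τν))) (trans (distribˡ d ν (τ d)) (trans (cong (d * ν +_) e) (solve 2 (λ d ν → d :* ν :+ ν :* ν := ν :* (ν :+ d)) refl d ν)))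
    dτcτc : d * (τ c * τ c) ≡ ν * (c * τ c)
    dτcτc = trans (sym (*-assoc d _ _)) (trans (cong (_* τ c) dτc) (*-assoc ν c (τ c)))

  scalars : ∀ C {s t} → det C ≢ 0# → scale s C ≡ scale t C → s ≡ t
  scalars (mat a b c d) {s} {t} ne eq with x , y , z , w ← mat-inj eq = -≡0 (dne λ n → ne (trans (cong₂ (λ a b → a * d - b * c) (zero-product (diff x) n) (zero-product (diff y) n)) (solve 2 (λ c d → :0 :* d :- :0 :* c := :0) refl c d)))
   where
   diff : ∀ {x} → s * x ≡ t * x → (s - t) * x ≡ 0#
   diff {x} f = trans (solve 3 (λ s t x → (s :- t) :* x := s :* x :- t :* x) refl s t x) (≡⇒-≡0 f)

  -- An involution (A,τ) has square determinant.
  involution-square : ∀ {A} l → A ·ₘ mapMat τ A ≡ scale l idMat → l ≢ 0# → Square (det A)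
  involution-square {A} l e l≢0 = norm-square dets τl
   where
   dets : det A * τ (det A) ≡ l * l
   dets = trans (cong (det A *_) (sym (S.det-map A))) (trans (sym (det-·ₘ A _)) (trans (cong det e) (trans (det-scale l idMat) (trans (cong (l * l *_) det-id) (*-identityʳ _)))))
   dA≢0 : det A ≢ 0#
   dA≢0 z = *-nonzero l≢0 l≢0 (trans (sym dets) (trans (cong (_* τ (det A)) z) (zeroˡ _)))
   τA·A : mapMat τ A ·ₘ A ≡ scale (τ l) idMat
   τA·A = trans (cong (mapMat τ A ·ₘ_) (sym (mapMat-id τ² A))) (trans (sym (S.map-·ₘ A _)) (trans (cong (mapMat τ) e) (trans (S.map-scale l idMat) (cong (scale (τ l)) S.map-id))))
   τl : τ l ≡ l
   τl = scalars A dA≢0 (trans (sym (trans (·ₘ-scale (τ l) A idMat) (cong (scale (τ l)) (·ₘ-identityʳ A))))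
    (trans (cong (A ·ₘ_) (sym τA·A)) (trans (sym (·ₘ-assoc A _ A)) (trans (cong (_·ₘ A) e) (trans (scale-·ₘ l idMat A) (cong (scale l) (·ₘ-identityˡ A)))))))

  -- JA = l·Aτ(J) gives det J = l²τ(det J), and applying the relation twice gives lτ(l) = 1. So ν =
  -- lτ(det J) is fixed by τ, and its square is the norm of det J.
  axis-square : ∀ {A J} → det A ≢ 0# → det J ≢ 0# → A ·ₘ mapMat τ J ∝ J ·ₘ A → A ·ₘ mapMat τ A ∝ idMat → Square (det J)
  axis-square {A} {J} dA dJ≢0 (l , l≢0 , e) p = norm-square {det J} {l * τ (det J)}
   (trans (cong (_* τ (det J)) dJ) (solve 2 (λ l t → l :* l :* t :* t := l :* t :* (l :* t)) refl l (τ (det J)))) τν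
   where
   dJ : det J ≡ l * l * τ (det J)
   dJ = *-cancelˡ dA (trans (*-comm _ _) (trans (sym (det-·ₘ J A)) (trans (cong det e) (trans (det-scale l _) (trans (cong (l * l *_) (trans (det-·ₘ A _) (cong (det A *_) (S.det-map J))))
    (solve 3 (λ l a t → l :* l :* (a :* t) := a :* (l :* l :* t)) refl l (det A) (τ (det J))))))))
   from : A ·ₘ mapMat τ A ∝ idMat → l * τ l ≡ 1#
   from q = from′ (∝-sym q)
    where
    from′ : idMat ∝ A ·ₘ mapMat τ A → l * τ l ≡ 1#
    from′ (m , m≢0 , eA) = *-cancelˡ m≢0 (trans (*-comm m _) (trans (scalars J dJ≢0 (trans (sym J-right) J-left)) (sym (*-identityʳ m))))
     where
     J-left : J ·ₘ (A ·ₘ mapMat τ A) ≡ scale m J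
     J-left = trans (cong (J ·ₘ_) eA) (trans (·ₘ-scale m J idMat) (cong (scale m) (·ₘ-identityʳ J)))
     τe : mapMat τ J ·ₘ mapMat τ A ≡ scale (τ l) (mapMat τ A ·ₘ J)
     τe = trans (sym (S.map-·ₘ J A)) (trans (cong (mapMat τ) e) (trans (S.map-scale l _) (cong (scale (τ l)) (trans (S.map-·ₘ A _) (cong (mapMat τ A ·ₘ_) (mapMat-id τ² J))))))
     inner : A ·ₘ (mapMat τ J ·ₘ mapMat τ A) ≡ scale (τ l) (scale m J)
     inner = trans (cong (A ·ₘ_) τe) (trans (·ₘ-scale (τ l) A _) (cong (scale (τ l)) (trans (sym (·ₘ-assoc A _ J)) (trans (cong (_·ₘ J) eA) (trans (scale-·ₘ m idMat J) (cong (scale m) (·ₘ-identityˡ J)))))))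
     J-right : J ·ₘ (A ·ₘ mapMat τ A) ≡ scale (l * τ l * m) J
     J-right = trans (sym (·ₘ-assoc J A _)) (trans (cong (_·ₘ mapMat τ A) e) (trans (scale-·ₘ l _ _) (trans (cong (scale l) (trans (·ₘ-assoc A _ _) inner))
      (trans (scale-scale l (τ l) _) (scale-scale (l * τ l) m J)))))
   τν : τ (l * τ (det J)) ≡ l * τ (det J)
   τν = trans (S.σ-* l _) (trans (cong (τ l *_) (τ² (det J))) (trans (cong (τ l *_) dJ) (trans (solve 3 (λ s l t → s :* (l :* l :* t) := l :* s :* (l :* t)) refl (τ l) l (τ (det J)))
    (trans (cong (_* (l * τ (det J))) (from p)) (*-identityˡ _)))))

  map-lin : ∀ C → mapMat τ (lin 1# 1# C) ≡ lin 1# 1# (mapMat τ C)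
  map-lin (mat a b c d) = mat-≡ (diag a) (off b) (off c) (diag d)
   where
   off : ∀ b → τ (1# * b) ≡ 1# * τ b
   off b = trans (S.σ-* 1# b) (cong (_* τ b) S.σ-1)
   diag : ∀ a → τ (1# + 1# * a) ≡ 1# + 1# * τ a
   diag a = trans (S.σ-+ _ _) (cong₂ _+_ S.σ-1 (off a))

  -- With Aτ(A) = mZ and Aτ(Z) = μZA one has μ = ±1; the sign -1 would give τ(m) = -m, whereas m² is the norm of
  -- the square det A = s², so that m = ±sτ(s).
  twist-trivial : ∀ {A Z s} → det A ≢ 0# → det A ≡ s * s → det Z ≡ 1# → A ·ₘ mapMat τ A ∝ Z → A ·ₘ mapMat τ Z ∝ Z ·ₘ A →
   A ·ₘ mapMat τ (lin 1# 1# Z) ≡ lin 1# 1# Z ·ₘ A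
  twist-trivial {A} {Z} {s} dA det-s dZ p (l , l≢0 , e) = from (∝-sym p)
   where
   l² : l * l ≡ 1# * 1#
   l² = *-cancelˡ dA (trans (*-comm _ _) (trans (cong (λ z → l * l * z) (solve 1 (λ a → a := a :* :1) refl (det A)))
    (trans (cong (λ z → l * l * (det A * z)) (sym (trans (S.det-map Z) (trans (cong τ dZ) S.σ-1)))) (trans (cong (l * l *_) (sym (det-·ₘ A _))) (trans (sym (det-scale l _)) (trans (cong det (sym e))
     (trans (det-·ₘ Z A) (trans (cong (_* det A) dZ) (solve 1 (λ a → :1 :* a := a :* (:1 :* :1)) refl (det A))))))))))
   plus : l ≡ 1# → A ·ₘ mapMat τ (lin 1# 1# Z) ≡ lin 1# 1# Z ·ₘ A
   plus l1 = trans (cong (A ·ₘ_) (map-lin Z)) (trans (·ₘ-lin 1# 1# (mapMat τ Z) A)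
    (trans (cong (λ C → mat (1# * m₁₁ A + 1# * m₁₁ C) (1# * m₁₂ A + 1# * m₁₂ C) (1# * m₂₁ A + 1# * m₂₁ C) (1# * m₂₂ A + 1# * m₂₂ C)) (sym e₁)) (sym (lin-·ₘ 1# 1# Z A))))
    where
    e₁ : Z ·ₘ A ≡ A ·ₘ mapMat τ Z
    e₁ = trans e (trans (cong (λ z → scale z (A ·ₘ mapMat τ Z)) l1) (scale-1 _))
   from : Z ∝ A ·ₘ mapMat τ A → A ·ₘ mapMat τ (lin 1# 1# Z) ≡ lin 1# 1# Z ·ₘ A
   from (m , m≢0 , AτA) = [ plus , (λ l-1 → ⊥-elim (minus l-1)) ]′ (square-roots l²)
    where
    minus : l ≡ - 1# → ⊥
    minus l-1 = -≢ m≢0 (trans (sym τm-fixed) τm)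
     where
     e₁ : A ·ₘ mapMat τ Z ≡ neg (Z ·ₘ A)
     e₁ = sym (trans (cong neg (trans e (cong (λ z → scale z (A ·ₘ mapMat τ Z)) l-1))) (trans (scale-scale _ _ _) (trans (cong (λ z → scale z (A ·ₘ mapMat τ Z)) minus-one²) (scale-1 _))))
     τAA : mapMat τ A ·ₘ A ≡ scale (τ m) (mapMat τ Z)
     τAA = trans (cong (mapMat τ A ·ₘ_) (sym (mapMat-id τ² A))) (trans (sym (S.map-·ₘ A _)) (trans (cong (mapMat τ) AτA) (S.map-scale m Z)))
     both : scale m (Z ·ₘ A) ≡ scale (τ m * - 1#) (Z ·ₘ A)
     both = trans (sym (scale-·ₘ m Z A)) (trans (cong (_·ₘ A) (sym AτA)) (trans (·ₘ-assoc A _ A) (trans (cong (A ·ₘ_) τAA) (trans (·ₘ-scale (τ m) A _) (trans (cong (scale (τ m)) e₁) (scale-scale (τ m) (- 1#) _))))))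
     m≡-τm : m ≡ τ m * - 1#
     m≡-τm = scalars (Z ·ₘ A) (subst (_≢ 0#) (sym (trans (det-·ₘ Z A) (trans (cong (_* det A) dZ) (*-identityˡ _)))) dA) both
     τm : τ m ≡ - m
     τm = trans (solve 1 (λ t → t := :- (t :* (:- :1))) refl (τ m)) (cong -_ (sym m≡-τm))
     m² : (s * τ s) * (s * τ s) ≡ m * m
     m² = trans (solve 2 (λ s t → s :* t :* (s :* t) := s :* s :* (t :* t)) refl s (τ s)) (trans (cong₂ _*_ (sym det-s) (trans (sym (S.σ-* s s)) (cong τ (sym det-s))))
      (trans (cong (det A *_) (sym (S.det-map A))) (trans (sym (det-·ₘ A _)) (trans (cong det AτA) (trans (det-scale m Z) (trans (cong (m * m *_) dZ) (*-identityʳ _)))))))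
     τss : τ (s * τ s) ≡ s * τ s
     τss = trans (S.σ-* s (τ s)) (trans (cong (τ s *_) (τ² s)) (*-comm (τ s) s))
     m≡ : s * τ s ≡ - m → m ≡ - (s * τ s)
     m≡ e = trans (solve 1 (λ m → m := :- (:- m)) refl m) (cong -_ (sym e))
     τm-fixed : τ m ≡ m
     τm-fixed = [ (λ e → trans (cong τ (sym e)) (trans τss e)) ,
      (λ e → trans (cong τ (m≡ e)) (trans (S.σ-neg _) (trans (cong -_ τss) (sym (m≡ e))))) ]′ (square-roots m²)

 -- Consequences of a torus obstruction for q and G.

 module _ {Ĝ M̂ : Pred} (sG : Subgroup Ĝ) (sM : Subgroup M̂) (M⊑G : M̂ ⊑ Ĝ) (T⊑G : T̂ ⊑ Ĝ)
  (maximal : Maximal Ĝ M̂) (¬T⊑M : ¬ (T̂ ⊑ M̂))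
  (t : TorusObstruction sG sM M⊑G T⊑G maximal ¬T⊑M) where
  open TorusObstruction t

  private
   lb : Linear b
   lb = T-linear Tb
   lw : Linear w
   lw = T-linear Tw
   lx : Linear x
   lx = T-linear Tx
   X Z B J : Mat
   X = mtx x
   Z = mtx w
   B = mtx b
   J = axis-of B
   Z-traceless : tr Z ≡ 0#
   Z-traceless = involution-traceless lw w² w≢ε
   Z-ns : ¬ Scalar Z
   Z-ns = nonscalar lw w≢ε
   det-J≢0 : det J ≢ 0#
   det-J≢0 = nonsquare≢0 det-axis

  -- X commutes with Z, hence is a polynomial in it. In X² = (α² - β² det Z) + 2αβZ the scalar part
  -- vanishes because x² = w.
  record Root : Set where
   field
    α β : Carrier
    X≡ : X ≡ lin α β Z
    α≢0 : α ≢ 0#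
    β≢0 : β ≢ 0#
    α² : α * α ≡ β * β * det Z

  root : Root
  root = from (centralizer X Z Z-ns Cm-xw)
   where
   from : (∃ λ α → ∃ λ β → X ≡ lin α β Z) → Root
   from (α , β , e) = record { α = α ; β = β ; X≡ = e ; α² = α²
    ; α≢0 = λ z → *-nonzero β≢0 β≢0 (zero-product {det Z} (trans (*-comm _ _) (trans (sym α²) (trans (cong (_* α) z) (zeroˡ α)))) (det-of w)) ; β≢0 = β≢0 }
    where
    XX : X ·ₘ X ∝ Z
    XX = subst (λ k → X ·ₘ X ∝ mtx k) x² (linear-∙ x lx)
    β≢0 : β ≢ 0#
    β≢0 z = w≢ε (trans (sym x²) (trans (cong₂ _∙_ x≡ε x≡ε) (identityˡ ε)))
     where
     x≡ε : x ≡ ε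
     x≡ε = scalar-ε lx (subst Scalar (sym (trans e (cong (λ β → lin α β Z) z))) (lin-0-scalar α Z))
    α² : α * α ≡ β * β * det Z
    α² = -≡0 (square-part XX)
     where
     square-part : X ·ₘ X ∝ Z → α * α - β * β * det Z ≡ 0#
     square-part (l , l≢0 , eq) = zero-product (trans (solve 2 (λ l s → l :* s := l :* s :+ :0) refl l _) (trans (+-identityʳ _)
      (sym (proj₁ (lin-injective {0#} {1#} {l * (α * α - β * β * det Z)} {l * (two * (α * β))} {Z} Z-ns
       (trans (lin-01 Z) (trans eq (trans (cong (scale l) (trans (cong₂ _·ₘ_ e e) (lin-square α β Z Z-traceless))) (scale-lin Z)))))))) ) l≢0
      where
      scale-lin : ∀ A {s r} → scale l (lin s r A) ≡ lin (l * s) (l * r) A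
      scale-lin (mat a b c d) {s} {r} = mat-≡ (diag a) (sym (*-assoc l r b)) (sym (*-assoc l r c)) (diag d)
       where
       diag : ∀ a → l * (s + r * a) ≡ l * s + l * r * a
       diag a = trans (distribˡ l s _) (cong (l * s +_) (sym (*-assoc l r a)))

  two-is-square : Square two
  two-is-square = square-quotient (*-nonzero α≢0 α≢0) (α , refl) (subst Square det-X (T-square Tx))
   where
   open Root root
   det-X : det X ≡ two * (α * α)
   det-X = trans (cong det X≡) (trans (det-lin α β Z Z-traceless) (trans (cong (α * α +_) (sym α²)) (solve 1 (λ a → a :+ a := (:1 :+ :1) :* a) refl (α * α))))

  -- If h had nonsquare determinant, G would contain the class of J, whose determinant is nonsquare
  -- too; that class centralizes the torus and so lies in M. Since X = α + βZ and Z anticommutes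
  -- with J, XJ is traceless, so xM would contain an involution.
  linear-in-T : ∀ h → Ĝ h → Linear h → T̂ h
  linear-in-T h Gh lh = T-intro lh (dne contra)
   where
   ĵ : Γ
   ĵ = mk J
   J∝ : J ∝ mtx ĵ
   J∝ = mk-mat det-J≢0
   contra : ¬ SqDet (mtx h) → ⊥
   contra ns = no-involution ĵ (axial-M ĵ Gĵ (commuting-axial lb b≢ε (mk-lin J) (commute-∝ˡ {B = B} J∝ (axis-commute B))))
    (traceless-involution (linear-mul lx (mk-lin J)) (∝-traceless (∝-trans (∝-·ₘ {X} {X} ∝-refl J∝) (linear-∙ ĵ lx)) XJ-traceless))
    where
    Gĵ : Ĝ ĵ
    Gĵ = move Ĝ (g-solve 2 (λ j h → j :∙ h :⁻ :∙ h ⊜ j) refl ĵ h) (mul sG (T⊑G _ (T-intro (linear-mul (mk-lin J) (linear-inv lh))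
     (sqDet-∝ (linear-∙ (h ⁻¹) (mk-lin J)) (subst Square (sym (det-·ₘ _ _)) (nonsquare-* (λ s → det-axis (sqDet-∝ (∝-sym J∝) s))
      (λ s → ns (subst Square (det-adj _) (sqDet-∝ (∝-sym (linear-⁻¹ lh)) s)))))))) Gh)
    ∝-traceless : ∀ {A C} → A ∝ C → tr A ≡ 0# → tr C ≡ 0#
    ∝-traceless {A} (l , _ , refl) t = trans (tr-scale l A) (trans (cong (l *_) t) (zeroʳ l))
    open Root root
    tr-comm : ∀ A C → tr (A ·ₘ C) ≡ tr (C ·ₘ A)
    tr-comm (mat a b c d) (mat e f g h) = solve 8 (λ a b c d e f g h → a :* e :+ b :* g :+ (c :* f :+ d :* h) := e :* a :+ f :* c :+ (g :* b :+ h :* d)) refl a b c d e f g h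
    ZJ-traceless : tr (Z ·ₘ J) ≡ 0#
    ZJ-traceless = half-zero (trans (cong₂ _+_ (tr-comm Z J) (trans (cong tr anticommutes) (tr-scale (- 1#) (J ·ₘ Z)))) (solve 1 (λ t → t :+ (:- :1) :* t := :0) refl (tr (J ·ₘ Z))))
    XJ-traceless : tr (X ·ₘ J) ≡ 0#
    XJ-traceless = trans (cong (λ A → tr (A ·ₘ J)) X≡) (trans (cong tr (lin-·ₘ α β Z J))
     (trans (solve 6 (λ α β a d e h → α :* a :+ β :* e :+ (α :* d :+ β :* h) := α :* (a :+ d) :+ β :* (e :+ h)) refl α β (m₁₁ J) (m₂₂ J) (m₁₁ (Z ·ₘ J)) (m₂₂ (Z ·ₘ J)))
      (trans (cong₂ (λ u v → α * u + β * v) (axis-traceless B) ZJ-traceless) (solve 2 (λ α β → α :* :0 :+ β :* :0 := :0) refl α β))))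

  private
   M₀′ : Pred
   M₀′ = M₀ sG sM M⊑G T⊑G maximal ¬T⊑M
   sM₀′ : Subgroup M₀′
   sM₀′ = sM₀ sG sM M⊑G T⊑G maximal ¬T⊑M

  -- An involution normalizing the axis with field part of order two would make det J a square, by
  -- `axis-square`.
  involution-case : ∀ y → M̂ y → (∀ z → aut-of y (aut-of y z) ≡ z) → ¬ Linear y → y ∙ y ≢ ε
  involution-case y My τ² τ≢id y² = det-axis (FieldInvolution.axis-square (aut-is y) τ² τ≢id {mtx y} {J} (det-of y) det-J≢0
   (axial-intertwines lb b≢ε (M-axial y My)) (∝-trans (subst (λ k → mtx y ·ₘ mapMat (aut-of y) (mtx y) ∝ mtx k) y² (mat-∙ y y)) (∝-sym mat-ε)))

  -- If y² = w, then `twist-trivial` shows that y commutes with x, so (xy)² = x²y² = w² = 1 and xM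
  -- would contain an involution.
  w-case : ∀ y → M̂ y → SqDet (mtx y) → (∀ z → aut-of y (aut-of y z) ≡ z) → ¬ Linear y → y ∙ w ≡ w ∙ y → y ∙ y ≢ w
  w-case y My (s , det-s) τ² τ≢id yw y² = no-involution y My (trans (cong (λ z → x ∙ y ∙ z) (sym yx)) (trans (g-solve 2 (λ x y → x :∙ y :∙ (y :∙ x) ⊜ x :∙ (y :∙ y) :∙ x) refl x y)
   (trans (cong (λ z → x ∙ z ∙ x) (trans y² (sym x²))) (trans (g-solve 1 (λ x → x :∙ (x :∙ x) :∙ x ⊜ x :∙ x :∙ (x :∙ x)) refl x) (trans (cong₂ _∙_ x² x²) w²)))))
   where
   A : Mat
   A = mtx y
   open Root root
   open FieldInvolution (aut-is y) τ² τ≢id using (twist-trivial)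
   -- r = β/α scales Z to a matrix Z₁ of determinant 1, for which X is proportional to 1 + Z₁.
   r : Carrier
   r = recip α * β
   r≢0 : r ≢ 0#
   r≢0 = *-nonzero (recip-nonzero α≢0) β≢0
   Z₁ : Mat
   Z₁ = scale r Z
   det-Z₁ : det Z₁ ≡ 1#
   det-Z₁ = trans (det-scale r Z) (trans (solve 3 (λ i β d → i :* β :* (i :* β) :* d := i :* i :* (β :* β :* d)) refl (recip α) β (det Z))
    (trans (cong (recip α * recip α *_) (sym α²)) (trans (solve 2 (λ i α → i :* i :* (α :* α) := α :* i :* (α :* i)) refl (recip α) α)
     (trans (cong₂ _*_ (*-recip α≢0) (*-recip α≢0)) (*-identityˡ 1#)))))
   Z∝Z₁ : Z ∝ Z₁
   Z∝Z₁ = r , r≢0 , refl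
   scale-X : ∀ C → lin α β C ≡ scale α (lin 1# 1# (scale r C))
   scale-X (mat a b c d) = mat-≡ (diag a) (off b) (off c) (diag d)
    where
    off : ∀ b → β * b ≡ α * (1# * (r * b))
    off b = trans (trans (sym (*-identityˡ _)) (cong (_* (β * b)) (sym (*-recip α≢0)))) (solve 4 (λ α i β b → α :* i :* (β :* b) := α :* (:1 :* (i :* β :* b))) refl α (recip α) β b)
    diag : ∀ a → α + β * a ≡ α * (1# + 1# * (r * a))
    diag a = trans (cong₂ _+_ (sym (*-identityʳ α)) (off a)) (sym (distribˡ α 1# _))
   X₁∝X : lin 1# 1# Z₁ ∝ X
   X₁∝X = α , α≢0 , trans X≡ (scale-X Z)
   AτA : A ·ₘ mapMat (aut-of y) A ∝ Z₁
   AτA = ∝-trans (subst (λ k → A ·ₘ mapMat (aut-of y) A ∝ mtx k) y² (mat-∙ y y)) Z∝Z₁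
   AτZ : A ·ₘ mapMat (aut-of y) Z₁ ∝ Z₁ ·ₘ A
   AτZ = ∝-trans (∝-·ₘ {A} {A} ∝-refl (∝-sym (∝-map (aut-is y) Z∝Z₁)))
    (∝-trans (mat-∙ y w) (∝-trans (subst (λ k → mtx k ∝ Z ·ₘ A) (sym yw) (∝-sym (linear-∙ y lw))) (∝-·ₘ Z∝Z₁ ∝-refl)))
   yx : y ∙ x ≡ x ∙ y
   yx = Γ-≡ (λ z → trans (aut-∙ y x z) (trans (cong (aut-of y) (lx z)) (sym (trans (aut-∙ x y z) (lx _)))))
    (∝-trans (∝-sym (mat-∙ y x)) (∝-trans (∝-·ₘ {A} {A} ∝-refl (∝-map (aut-is y) (∝-sym X₁∝X)))
     (subst (_∝ mtx (x ∙ y)) (sym (twist-trivial {A} {Z₁} {s} (det-of y) det-s det-Z₁ AτA AτZ)) (∝-trans (∝-·ₘ X₁∝X ∝-refl) (linear-∙ y lx)))))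

  pair⊑M₀ : Pair w ⊑ M₀′
  pair⊑M₀ y p = [ (λ { refl → unit sM₀′ }) , (λ { refl → Mw , Tw }) ]′ (pair-cases p)

  -- The square-determinant elements of M with field part 1 or τ contain M ∩ T with index two, so some such y with
  -- field part τ normalizes ⟨w⟩ and has y² ∈ ⟨w⟩.
  no-square-field-involution-M : ∀ m → M̂ m → SqDet (mtx m) → (∀ z → aut-of m (aut-of m z) ≡ z) → ¬ Linear m → ⊥
  no-square-field-involution-M m Mm sq-m τ² τ≢id = from-extension (two-extension (pair-two w²) sM₁ pair⊑M₁ even-M₁)
   where
   Twisted : Γ → Set
   Twisted i = ∀ z → aut-of i z ≡ aut-of m z
   M₁ : Pred
   M₁ i = M̂ i × SqDet (mtx i) × (Linear i ⊎ Twisted i)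
   twist : ∀ {i j} → Linear i ⊎ Twisted i → Linear j ⊎ Twisted j → Linear (i ∙ j) ⊎ Twisted (i ∙ j)
   twist {i} {j} (inj₁ a) (inj₁ b) = inj₁ (linear-mul a b)
   twist {i} {j} (inj₁ a) (inj₂ b) = inj₂ λ z → trans (aut-∙ i j z) (trans (a _) (b z))
   twist {i} {j} (inj₂ a) (inj₁ b) = inj₂ λ z → trans (aut-∙ i j z) (trans (a _) (cong (aut-of m) (b z)))
   twist {i} {j} (inj₂ a) (inj₂ b) = inj₁ λ z → trans (aut-∙ i j z) (trans (a _) (trans (cong (aut-of m) (b z)) (τ² z)))
   sM₁ : Subgroup M₁
   sM₁ = finite-subgroup (unit sM , T-square (unit sT) , inj₁ linear-ε)
    (λ {i} {j} (a , s , e) (a′ , s′ , e′) → mul sM a a′ , sq-∙ {i} {j} s s′ , twist {i} {j} e e′)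
   M₁m : M₁ m
   M₁m = Mm , sq-m , inj₂ λ _ → refl
   M₀⊑M₁ : M₀′ ⊑ M₁
   M₀⊑M₁ i (Mi , Ti) = Mi , T-square Ti , inj₁ (T-linear Ti)
   pair⊑M₁ : Pair w ⊑ M₁
   pair⊑M₁ y p = M₀⊑M₁ y (pair⊑M₀ y p)
   #M₁ : # M₁ ≡ # M₀′ ℕ.+ # M₀′
   #M₁ = trans (#-cong to back) (adjoin-order sM₀′ m (λ (_ , Tm) → τ≢id (T-linear Tm)))
    where
    back : ∀ i → Adjoin M₀′ m i → M₁ i
    back i (inj₁ a) = M₀⊑M₁ i a
    back i (inj₂ a) = move M₁ (g-solve 2 (λ m i → m :∙ (m :⁻ :∙ i) ⊜ i) refl m i) (mul sM₁ M₁m (M₀⊑M₁ _ a))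
    to : ∀ i → M₁ i → Adjoin M₀′ m i
    to i (Mi , s , inj₁ l) = inj₁ (Mi , T-intro l s)
    to i M₁i@(Mi , s , inj₂ e) = inj₂ (proj₁ mi , T-intro linear (proj₁ (proj₂ mi)))
     where
     mi : M₁ ((m ⁻¹) ∙ i)
     mi = mul sM₁ (inv sM₁ M₁m) M₁i
     linear : Linear ((m ⁻¹) ∙ i)
     linear z = trans (aut-∙ _ i z) (trans (cong (aut-of (m ⁻¹)) (e z)) (aut-⁻¹ m z))
   even-M₁ : Even (index (sub₂ (pair-two w²)) M₁)
   even-M₁ = index sP M₀′ , ℕ.*-cancelʳ-≡ _ _ (# (Pair w)) {{order-pos sP}} (trans (sym (lagrange sP sM₁ pair⊑M₁))
    (trans #M₁ (trans (cong₂ ℕ._+_ (lagrange sP sM₀′ pair⊑M₀) (lagrange sP sM₀′ pair⊑M₀)) (sym (ℕ.*-distribʳ-+ (# (Pair w)) (index sP M₀′) _)))))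
    where
    sP : Subgroup (Pair w)
    sP = sub₂ (pair-two w²)
   from-extension : (∃ λ y → M₁ y × ¬ Pair w y × Normalizes y (Pair w) × Pair w (y ∙ y)) → ⊥
   from-extension (y , (My , sy , inj₁ ly) , n , norm , y²) = n (odd-index-norm (pair-subgroup w²) sM₀′ pair⊑M₀ odd-pair y (My , T-intro ly sy) norm y²)
   from-extension (y , (My , sy , inj₂ ey) , n , norm , y²) = [ involution-case y My τy² τy≢id , w-case y My sy τy² τy≢id (sym (commute-conj conj-w)) ]′ (pair-cases y²)
    where
    τy² : ∀ z → aut-of y (aut-of y z) ≡ z
    τy² z = trans (ey _) (trans (cong (aut-of m) (ey z)) (τ² z))
    τy≢id : ¬ Linear y
    τy≢id ly = τ≢id λ z → trans (sym (ey z)) (ly z)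
    conj-w : conj y w ≡ w
    conj-w = [ (λ e → ⊥-elim (w≢ε (conj-injective y w ε (trans e (g-solve 1 (λ h → :ε ⊜ h :⁻ :∙ :ε :∙ h) refl y))))) , id ]′ (pair-cases (norm w pair-w))

  -- G = MT, and elements of T change neither the field part nor the square class of the
  -- determinant, so g may be replaced by an element of M.
  no-square-field-involution : ∀ g → Ĝ g → SqDet (mtx g) → (∀ z → aut-of g (aut-of g z) ≡ z) → ¬ Linear g → ⊥
  no-square-field-involution g Gg sq τ² τ≢id = from-M (G⊑MT sG sM M⊑G T⊑G maximal ¬T⊑M g Gg)
   where
   from-M : (∃ λ m → M̂ m × T̂ ((m ⁻¹) ∙ g)) → ⊥
   from-M (m , Mm , Tmg) = no-square-field-involution-M m Mm
    (subst (λ k → SqDet (mtx k)) (g-solve 2 (λ m g → g :∙ (m :⁻ :∙ g) :⁻ ⊜ m) refl m g) (sq-∙ sq (T-square (inv sT Tmg))))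
    (λ z → trans (τ-m _) (trans (cong (aut-of g) (τ-m z)) (τ² z))) (λ lm → τ≢id λ z → trans (sym (τ-m z)) (lm z))
    where
    τ-m : ∀ z → aut-of m z ≡ aut-of g z
    τ-m z = trans (cong (aut-of m) (sym (T-linear Tmg z))) (trans (sym (aut-∙ m _ z)) (cong (λ k → aut-of k z) (g-solve 2 (λ m g → m :∙ (m :⁻ :∙ g) ⊜ g) refl m g)))

 -- Square roots of involutions, and contradictions from a perfect code.

 lin-0 : ∀ r A → lin 0# r A ≡ scale r A
 lin-0 r (mat a b c d) = mat-≡ (+-identityˡ _) refl refl (+-identityˡ _)

 lin-α0 : ∀ α A → lin α 0# A ≡ scale α idMat
 lin-α0 α (mat a b c d) = mat-≡ (solve 2 (λ α a → α :+ :0 :* a := α :* :1) refl α a) (solve 2 (λ α b → :0 :* b := α :* :0) refl α b)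
  (solve 2 (λ α b → :0 :* b := α :* :0) refl α c) (solve 2 (λ α a → α :+ :0 :* a := α :* :1) refl α d)

 -- Uniqueness up to inversion will show that x normalizes a Sylow 2-subgroup of order four.
 record SquareRoot (w : Γ) : Set where
  field
   x : Γ
   Tx : T̂ x
   x² : x ∙ x ≡ w
   unique : ∀ u → Linear u → u ∙ u ≡ w → u ≡ x ⊎ u ≡ x ⁻¹

 -- x = [a + Z] with a² = det Z, so that x² = [2aZ].
 square-root : Square two → ∀ {w} → T̂ w → w ∙ w ≡ ε → w ≢ ε → SquareRoot w
 square-root sq-two {w} Tw w² w≢ε = from (T-square Tw)
  where
  Z : Mat
  Z = mtx w
  tZ : tr Z ≡ 0#
  tZ = involution-traceless (T-linear Tw) w² w≢ε
  from : SqDet Z → SquareRoot w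
  from (a , dZ) = record { x = x ; Tx = Tx ; x² = x² ; unique = unique }
   where
   a≢0 : a ≢ 0#
   a≢0 = nonzero-*ˡ (subst (_≢ 0#) dZ (det-of w))
   X : Mat
   X = lin a 1# Z
   dX : det X ≡ two * (a * a)
   dX = trans (det-lin a 1# Z tZ) (trans (cong (λ d → a * a + 1# * 1# * d) dZ) (solve 1 (λ a → a :* a :+ :1 :* :1 :* (a :* a) := (:1 :+ :1) :* (a :* a)) refl a))
   dX≢0 : det X ≢ 0#
   dX≢0 e = *-nonzero two≢0 (*-nonzero a≢0 a≢0) (trans (sym dX) e)
   x : Γ
   x = mk X
   lx : Linear x
   lx = mk-lin X
   X∝ : X ∝ mtx x
   X∝ = mk-mat dX≢0
   Tx : T̂ x
   Tx = T-intro lx (sqDet-∝ X∝ (subst Square (sym dX) (square-* sq-two (a , refl))))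
   XX : X ·ₘ X ≡ scale (two * (a * 1#)) Z
   XX = trans (lin-square a 1# Z tZ) (trans (cong (λ s → lin s (two * (a * 1#)) Z) (trans (cong (λ d → a * a - 1# * 1# * d) dZ) (solve 1 (λ a → a :* a :- :1 :* :1 :* (a :* a) := :0) refl a))) (lin-0 _ Z))
   x² : x ∙ x ≡ w
   x² = linear-≡ (linear-mul lx lx) (T-linear Tw) (∝-trans (∝-sym (linear-∙ x lx)) (∝-trans (∝-sym (∝-·ₘ X∝ X∝))
    (∝-sym (_ , *-nonzero two≢0 (*-nonzero a≢0 1≢0) , XX))))
   -- u commutes with w. If the matrices anticommute, u is an involution and u² is not w. Otherwise
   -- U is a multiple of a + Z or of -a + Z, and the latter is inverse to X up to a scalar.
   unique : ∀ u → Linear u → u ∙ u ≡ w → u ≡ x ⊎ u ≡ x ⁻¹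
   unique u lu u² = from-commute (∙-cm lu (T-linear Tw) (trans (cong (u ∙_) (sym u²)) (trans (sym (∙-assoc u u u)) (cong (_∙ u) u²))))
    where
    U : Mat
    U = mtx u
    Z-ns : ¬ Scalar Z
    Z-ns = nonscalar (T-linear Tw) w≢ε
    from-lin : (∃ λ r → ∃ λ c → U ≡ lin r c Z) → u ≡ x ⊎ u ≡ x ⁻¹
    from-lin (r , c , e) = Sum.map same opposite (square-roots r²)
     where
     UU : U ·ₘ U ∝ Z
     UU = subst (λ k → U ·ₘ U ∝ mtx k) u² (linear-∙ u lu)
     c≢0 : c ≢ 0#
     c≢0 z = w≢ε (trans (sym u²) (trans (cong₂ _∙_ u≡ε u≡ε) (identityˡ ε)))
      where
      u≡ε : u ≡ ε
      u≡ε = scalar-ε lu (subst Scalar (sym (trans e (trans (cong (λ c → lin r c Z) z) (lin-α0 r Z)))) (scale-scalar r))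
     r² : r * r ≡ (c * a) * (c * a)
     r² = -≡0 (trans (trans (solve 3 (λ r c a → r :* r :- c :* a :* (c :* a) := r :* r :- c :* c :* (a :* a)) refl r c a) (cong (λ d → r * r - c * c * d) (sym dZ))) (square-part UU))
      where
      scale-lin : ∀ A {l s t} → scale l (lin s t A) ≡ lin (l * s) (l * t) A
      scale-lin (mat a b c d) {l} {s} {t} = mat-≡ (diag a) (sym (*-assoc l t b)) (sym (*-assoc l t c)) (diag d)
       where
       diag : ∀ a → l * (s + t * a) ≡ l * s + l * t * a
       diag a = trans (distribˡ l s _) (cong (l * s +_) (sym (*-assoc l t a)))
      square-part : U ·ₘ U ∝ Z → r * r - c * c * det Z ≡ 0#
      square-part (l , l≢0 , eq) = zero-product (sym (proj₁ (lin-injective {0#} {1#} {l * (r * r - c * c * det Z)} {l * (two * (r * c))} {Z} Z-ns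
       (trans (lin-01 Z) (trans eq (trans (cong (scale l) (trans (cong₂ _·ₘ_ e e) (lin-square r c Z tZ))) (scale-lin Z))))))) l≢0
     factor : ∀ s A → lin (c * s) c A ≡ scale c (lin s 1# A)
     factor s (mat a b c′ d) = mat-≡ (diag a) (off b) (off c′) (diag d)
      where
      off : ∀ b → c * b ≡ c * (1# * b)
      off b = cong (c *_) (sym (*-identityˡ b))
      diag : ∀ a → c * s + c * a ≡ c * (s + 1# * a)
      diag a = solve 3 (λ c s a → c :* s :+ c :* a := c :* (s :+ :1 :* a)) refl c s a
     same : r ≡ c * a → u ≡ x
     same r≡ = linear-≡ lu lx (∝-trans (∝-sym (c , c≢0 , trans e (trans (cong (λ r → lin r c Z) r≡) (factor a Z)))) X∝)
     opposite : r ≡ - (c * a) → u ≡ x ⁻¹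
     opposite r≡ = inverseˡ-unique u x (scalar-ε (linear-mul lu lx) (∝-Scalar (∝-trans (∝-·ₘ {U} {U} ∝-refl X∝) (linear-∙ x lu))
      (subst Scalar (sym UX) (scale-scalar _))))
      where
      conjugate : ∀ A → tr A ≡ 0# → lin (- a) 1# A ·ₘ lin a 1# A ≡ scale (- (a * a) - det A) idMat
      conjugate A t = trans (·ₘ-lin a 1# A (lin (- a) 1# A)) (trans (cong (λ C → mat (a * m₁₁ L + 1# * m₁₁ C) (a * m₁₂ L + 1# * m₁₂ C) (a * m₂₁ L + 1# * m₂₁ C) (a * m₂₂ L + 1# * m₂₂ C)) LA) (entries A))
       where
       L : Mat
       L = lin (- a) 1# A
       LA : L ·ₘ A ≡ mat (- a * m₁₁ A + 1# * (- det A * 1#)) (- a * m₁₂ A + 1# * (- det A * 0#)) (- a * m₂₁ A + 1# * (- det A * 0#)) (- a * m₂₂ A + 1# * (- det A * 1#))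
       LA = trans (lin-·ₘ (- a) 1# A A) (cong (λ C → mat (- a * m₁₁ A + 1# * m₁₁ C) (- a * m₁₂ A + 1# * m₁₂ C) (- a * m₂₁ A + 1# * m₂₁ C) (- a * m₂₂ A + 1# * m₂₂ C)) (traceless-square A t))
       entries : ∀ A → mat (a * m₁₁ (lin (- a) 1# A) + 1# * (- a * m₁₁ A + 1# * (- det A * 1#))) (a * m₁₂ (lin (- a) 1# A) + 1# * (- a * m₁₂ A + 1# * (- det A * 0#)))
        (a * m₂₁ (lin (- a) 1# A) + 1# * (- a * m₂₁ A + 1# * (- det A * 0#))) (a * m₂₂ (lin (- a) 1# A) + 1# * (- a * m₂₂ A + 1# * (- det A * 1#))) ≡ scale (- (a * a) - det A) idMat
       entries A@(mat e f g h) = mat-≡ (diag e (det A)) (off f (det A)) (off g (det A)) (diag h (det A))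
        where
        diag : ∀ e d → a * (- a + 1# * e) + 1# * (- a * e + 1# * (- d * 1#)) ≡ (- (a * a) - d) * 1#
        diag e d = solve 3 (λ a e d → a :* (:- a :+ :1 :* e) :+ :1 :* ((:- a) :* e :+ :1 :* ((:- d) :* :1)) := (:- (a :* a) :- d) :* :1) refl a e d
        off : ∀ e d → a * (1# * e) + 1# * (- a * e + 1# * (- d * 0#)) ≡ (- (a * a) - d) * 0#
        off e d = solve 3 (λ a e d → a :* (:1 :* e) :+ :1 :* ((:- a) :* e :+ :1 :* ((:- d) :* :0)) := (:- (a :* a) :- d) :* :0) refl a e d
      UX : U ·ₘ X ≡ scale (c * (- (a * a) - det Z)) idMat
      UX = trans (cong (_·ₘ X) (trans e (trans (cong (λ r → lin r c Z) (trans r≡ (solve 2 (λ c a → :- (c :* a) := c :* (:- a)) refl c a))) (factor (- a) Z))))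
       (trans (scale-·ₘ c _ X) (trans (cong (scale c) (conjugate Z tZ)) (scale-scale c _ idMat)))
    from-commute : Cm u w ⊎ Anticomm U Z → u ≡ x ⊎ u ≡ x ⁻¹
    from-commute (inj₁ cm) = from-lin (centralizer U Z Z-ns cm)
    from-commute (inj₂ anti) = ⊥-elim (w≢ε (trans (sym u²) (traceless-involution lu (anticommute-traceless {U} {Z} (det-of w) anti))))

 module _ {Ĝ M̂ : Pred} (sG : Subgroup Ĝ) (sM : Subgroup M̂) (M⊑G : M̂ ⊑ Ĝ) (T⊑G : T̂ ⊑ Ĝ) (code : PerfectCode Ĝ M̂)
  {w : Γ} (Mw : M̂ w) (Tw : T̂ w) (w² : w ∙ w ≡ ε) (w≢ε : w ≢ ε) (sq-two : Square two) where

  open SquareRoot (square-root sq-two Tw w² w≢ε)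

  sP : Subgroup (Pair w)
  sP = pair-subgroup w²

  xw : conj x w ≡ w
  xw = trans (cong (conj x) (sym x²)) (trans (g-solve 1 (λ x → x :⁻ :∙ (x :∙ x) :∙ x ⊜ x :∙ x) refl x) x²)

  pair-normal : Normalizes x (Pair w)
  pair-normal y p = [ (λ { refl → inj₁ (g-solve 1 (λ x → x :⁻ :∙ :ε :∙ x ⊜ :ε) refl x) }) , (λ { refl → subst (Pair w) (sym xw) pair-w }) ]′ (pair-cases p)

  pair-no-involution : ∀ {y} → Pair w y → (x ∙ y) ∙ (x ∙ y) ≢ ε
  pair-no-involution p e = [ (λ { refl → w≢ε (trans (sym x²) (trans (cong₂ _∙_ (sym (identityʳ x)) (sym (identityʳ x))) e)) })
   , (λ { refl → w≢ε (trans (sym w³) (trans (cong (w ∙_) (trans (cong (_∙ w) (sym xw)) (trans (cong (λ z → (x ⁻¹) ∙ w ∙ x ∙ z) (sym (identityˡ w))) refl))) refl) ⟨≡⟩ lemma e) }) ]′ (pair-cases p)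
   where
   infixl 1 _⟨≡⟩_
   _⟨≡⟩_ : {x y z : Γ} → x ≡ y → y ≡ z → x ≡ z
   _⟨≡⟩_ = trans
   w³ : w ∙ (w ∙ w) ≡ w
   w³ = trans (cong (w ∙_) w²) (identityʳ w)
   lemma : (x ∙ w) ∙ (x ∙ w) ≡ ε → w ∙ ((x ⁻¹) ∙ w ∙ x ∙ (ε ∙ w)) ≡ ε
   lemma e = trans (cong (λ z → z ∙ ((x ⁻¹) ∙ w ∙ x ∙ (ε ∙ w))) (sym x²)) (trans (g-solve 2 (λ x w → x :∙ x :∙ (x :⁻ :∙ w :∙ x :∙ (:ε :∙ w)) ⊜ x :∙ w :∙ (x :∙ w)) refl x w) e)

  x∉pair : ¬ Pair w x
  x∉pair p = [ (λ e → w≢ε (trans (sym x²) (trans (cong₂ _∙_ e e) (identityˡ ε)))) , (λ e → w≢ε (trans (sym x²) (trans (cong₂ _∙_ e e) w²))) ]′ (pair-cases p)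

  -- ⟨w⟩ is here a Sylow 2-subgroup of M, normalized by x. A perfect code would give an involution
  -- in x⟨w⟩, but both elements of that coset have square w.
  odd-index-⊥ : Odd (index sP M̂) → ⊥
  odd-index-⊥ o = from (involution-of-code sG sM M⊑G code sP pair⊑M o x (T⊑G x Tx)
   (λ Mx → x∉pair (odd-index-norm sP sM pair⊑M o x Mx pair-normal (subst (Pair w) (sym x²) pair-w))) pair-normal (subst (Pair w) (sym x²) pair-w))
   where
   pair⊑M : Pair w ⊑ M̂
   pair⊑M y p = [ (λ { refl → unit sM }) , (λ { refl → Mw }) ]′ (pair-cases p)
   from : (∃ λ y → Pair w y × (x ∙ y) ∙ (x ∙ y) ≡ ε) → ⊥
   from (y , p , e) = pair-no-involution p e

  M₀ᵇ : Pred
  M₀ᵇ y = M̂ y × T̂ y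

  sM₀ᵇ : Subgroup M₀ᵇ
  sM₀ᵇ = ∩-subgroup sM sT

  pair⊑M₀ᵇ : Pair w ⊑ M₀ᵇ
  pair⊑M₀ᵇ y p = [ (λ { refl → unit sM₀ᵇ }) , (λ { refl → Mw , Tw }) ]′ (pair-cases p)

  -- Here a Sylow 2-subgroup of M is ⟨y⟩ of order 4, where y has nonsquare determinant and y² = w.
  twice-odd-index-⊥ : Odd (index sP M₀ᵇ) → ∀ {n} → Odd n → index sP M̂ ≡ n ℕ.+ n →
   (∀ g → Ĝ g → g ∙ g ≡ ε → SqDet (mtx g)) → (∀ g → Ĝ g → SqDet (mtx g) → T̂ (g ∙ g) → T̂ g) → ⊥
  twice-odd-index-⊥ o₀ {n} on eM no-inv square-T = from-y (two-extension (pair-two w²) sM pair⊑M (n , eM))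
   where
   pair⊑M : Pair w ⊑ M̂
   pair⊑M y p = proj₁ (pair⊑M₀ᵇ y p)
   from-y : (∃ λ y → M̂ y × ¬ Pair w y × Normalizes y (Pair w) × Pair w (y ∙ y)) → ⊥
   from-y (y , My , y∉ , norm , y²) = finish (involution-of-code sG sM M⊑G code sQ Q⊑M odd-Q x (T⊑G x Tx) ¬Mx x-norm (inj₁ (subst (Pair w) (sym x²) pair-w)))
    where
    Q : Pred
    Q = Adjoin (Pair w) y
    sQ : Subgroup Q
    sQ = adjoin-subgroup sP y norm y²
    Q⊑M : Q ⊑ M̂
    Q⊑M z (inj₁ p) = pair⊑M z p
    Q⊑M z (inj₂ p) = move M̂ (g-solve 2 (λ y z → y :∙ (y :⁻ :∙ z) ⊜ z) refl y z) (mul sM My (pair⊑M _ p))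
    odd-Q : Odd (index sQ M̂)
    odd-Q = subst Odd (double-injective (trans (sym eM) (trans (index-tower sP sQ sM (λ _ → inj₁) Q⊑M) (trans (cong (index sQ M̂ ℕ.*_) index-2) (two* (index sQ M̂)))))) on
     where
     two* : ∀ m → m ℕ.* 2 ≡ m ℕ.+ m
     two* m = trans (ℕ.*-comm m 2) (cong (m ℕ.+_) (ℕ.+-identityʳ m))
     index-2 : index sP Q ≡ 2
     index-2 = ℕ.*-cancelʳ-≡ _ _ (# (Pair w)) {{order-pos sP}} (trans (sym (lagrange sP sQ (λ _ → inj₁))) (trans (adjoin-order sP y y∉) (cong (# (Pair w) ℕ.+_) (sym (ℕ.+-identityʳ _)))))
    ¬Mx : ¬ M̂ x
    ¬Mx Mx = x∉pair (odd-index-norm sP sM₀ᵇ pair⊑M₀ᵇ o₀ x (Mx , Tx) pair-normal (subst (Pair w) (sym x²) pair-w))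
    y∉T : ¬ T̂ y
    y∉T Ty = y∉ (odd-index-norm sP sM₀ᵇ pair⊑M₀ᵇ o₀ y (My , Ty) norm y²)
    ns-y : ¬ SqDet (mtx y)
    ns-y s = y∉T (square-T y (M⊑G y My) s (proj₂ (pair⊑M₀ᵇ _ y²)))
    conj-yw : conj y w ≡ w
    conj-yw = [ (λ e → ⊥-elim (w≢ε (conj-injective y w ε (trans e (g-solve 1 (λ h → :ε ⊜ h :⁻ :∙ :ε :∙ h) refl y))))) , id ]′ (pair-cases (norm w pair-w))
    -- Conjugation by y fixes w, so it sends x to one of the two square roots x, x⁻¹ of w.
    -- Accordingly the conjugate of y by x is y or yw.
    conj-xy : Q (conj x y)
    conj-xy = [ (λ e → inj₂ (move (Pair w) (sym (trans (rearrange) (trans (cong (λ u → (u ⁻¹) ∙ x) e) (inverseˡ x)))) (unit sP)))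
     , (λ e → inj₂ (move (Pair w) (sym (trans rearrange (trans (cong (λ u → (u ⁻¹) ∙ x) e) (trans (cong (_∙ x) (⁻¹-involutive x)) x²)))) pair-w)) ]′
     (unique (conj y x) (conj-linear y (T-linear Tx)) (trans (conj-mul y x x) (trans (cong (conj y) x²) conj-yw)))
     where
     rearrange : (y ⁻¹) ∙ conj x y ≡ (conj y x ⁻¹) ∙ x
     rearrange = g-solve 2 (λ x y → y :⁻ :∙ (x :⁻ :∙ y :∙ x) ⊜ (y :⁻ :∙ x :∙ y) :⁻ :∙ x) refl x y
    x-norm : Normalizes x Q
    x-norm z (inj₁ p) = inj₁ (pair-normal z p)
    x-norm z (inj₂ p) = move Q (g-solve 3 (λ x y z → x :⁻ :∙ y :∙ x :∙ (x :⁻ :∙ (y :⁻ :∙ z) :∙ x) ⊜ x :⁻ :∙ z :∙ x) refl x y z) (mul sQ conj-xy (inj₁ (pair-normal _ p)))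
    finish : (∃ λ z → Q z × (x ∙ z) ∙ (x ∙ z) ≡ ε) → ⊥
    finish (z , inj₁ p , e) = pair-no-involution p e
    -- The involution xz has square determinant by hypothesis. Then so has y, which differs from it
    -- by elements of T.
    finish (z , inj₂ p , e) = ns-y (subst (λ k → SqDet (mtx k)) (g-solve 3 (λ x y z → x :⁻ :∙ (x :∙ z) :∙ (y :⁻ :∙ z) :⁻ ⊜ y) refl x y z)
     (sq (sq (T-square (inv sT Tx)) (no-inv (x ∙ z) (mul sG (T⊑G x Tx) (M⊑G z (Q⊑M z (inj₂ p)))) e)) (T-square (inv sT (proj₂ (pair⊑M₀ᵇ _ p))))))
     where
     sq : ∀ {i j} → SqDet (mtx i) → SqDet (mtx j) → SqDet (mtx (i ∙ j))
     sq {i} {j} si sj = sqDet-∝ (mat-∙ i j) (sq-mul {mtx i} {mapMat (aut-of i) (mtx j)} si (subst Square (sym (FieldAut.det-map (aut-is i) (mtx j))) (map-square (aut-is i) sj)))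

 -- The matrix of A with respect to the basis v, A v is [[0, δ], [1, 0]].
 rational-form : ∀ {δ} A → tr A ≡ 0# → ¬ Scalar A → det A ≡ - δ → ∃ λ H → det H ≢ 0# × A ·ₘ H ≡ H ·ₘ mat 0# δ 1# 0#
 rational-form {δ} A@(mat a b c d) t ns dA = by-cases (em (c ≡ 0#)) (em (b ≡ 0#))
  where
  d≡ : d ≡ - a
  d≡ = trans (solve 2 (λ a d → d := :- a :+ (a :+ d)) refl a d) (trans (cong (- a +_) t) (+-identityʳ (- a)))
  δ≡ : a * a + b * c ≡ δ
  δ≡ = trans (solve 3 (λ a b c → a :* a :+ b :* c := :- (a :* (:- a) :- b :* c)) refl a b c) (trans (cong -_ (trans (cong (λ d → a * d - b * c) (sym d≡)) dA)) (solve 1 (λ δ → :- (:- δ) := δ) refl δ))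
  δ≡′ : c * b + d * d ≡ δ
  δ≡′ = trans (cong (λ d → c * b + d * d) d≡) (trans (solve 3 (λ a b c → c :* b :+ (:- a) :* (:- a) := a :* a :+ b :* c) refl a b c) δ≡)
  by-cases : Dec (c ≡ 0#) → Dec (b ≡ 0#) → ∃ λ H → det H ≢ 0# × A ·ₘ H ≡ H ·ₘ mat 0# δ 1# 0#
  by-cases (no c≢0) _ = mat 1# a 0# c , (λ z → c≢0 (trans (solve 2 (λ a c → c := :1 :* c :- a :* :0) refl a c) z)) ,
   mat-≡ (solve 2 (λ a b → a :* :1 :+ b :* :0 := :1 :* :0 :+ a :* :1) refl a b) (trans δ≡ (solve 2 (λ δ a → δ := :1 :* δ :+ a :* :0) refl δ a))
    (solve 2 (λ c d → c :* :1 :+ d :* :0 := :0 :* :0 :+ c :* :1) refl c d) (trans (solve 3 (λ a c d → c :* a :+ d :* c := c :* (a :+ d)) refl a c d) (trans (cong (c *_) t) (solve 2 (λ c δ → c :* :0 := :0 :* δ :+ c :* :0) refl c δ)))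
  by-cases (yes _) (no b≢0) = mat 0# b 1# d , (λ z → b≢0 (-≡0 (trans (solve 2 (λ b d → b :- :0 := :- (:0 :* d :- b :* :1)) refl b d) (trans (cong -_ z) (solve 0 (:- :0 := :0) refl))))) ,
   mat-≡ (solve 2 (λ a b → a :* :0 :+ b :* :1 := :0 :* :0 :+ b :* :1) refl a b) (trans (solve 3 (λ a b d → a :* b :+ b :* d := b :* (a :+ d)) refl a b d) (trans (cong (b *_) t) (solve 2 (λ b δ → b :* :0 := :0 :* δ :+ b :* :0) refl b δ)))
    (solve 2 (λ c d → c :* :0 :+ d :* :1 := :1 :* :0 :+ d :* :1) refl c d) (trans δ≡′ (solve 2 (λ δ d → δ := :1 :* δ :+ d :* :0) refl δ d))
  by-cases (yes c≡0) (yes b≡0) = mat 1# a 1# d , (λ z → a≢0 (half-zero (trans (solve 2 (λ a d → a :+ a := a :+ d :- (:1 :* d :- a :* :1)) refl a d) (trans (cong₂ _-_ t z) (solve 0 (:0 :- :0 := :0) refl))))) ,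
   mat-≡ (trans (cong (λ b → a * 1# + b * 1#) b≡0) (solve 1 (λ a → a :* :1 :+ :0 :* :1 := :1 :* :0 :+ a :* :1) refl a))
    (trans (cong (λ z → a * a + z * d) b≡0) (trans (solve 3 (λ a c d → a :* a :+ :0 :* d := a :* a :+ :0 :* c) refl a c d) (trans (cong (λ z → a * a + z * c) (sym b≡0)) (trans δ≡ (solve 2 (λ δ a → δ := :1 :* δ :+ a :* :0) refl δ a)))))
    (trans (cong (λ c → c * 1# + d * 1#) c≡0) (solve 1 (λ d → :0 :* :1 :+ d :* :1 := :1 :* :0 :+ d :* :1) refl d))
    (trans (cong (λ z → z * a + d * d) c≡0) (trans (solve 3 (λ a b d → :0 :* a :+ d :* d := :0 :* b :+ d :* d) refl a b d) (trans (cong (λ z → z * b + d * d) (sym c≡0)) (trans δ≡′ (solve 2 (λ δ d → δ := :1 :* δ :+ d :* :0) refl δ d)))))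
   where
   a≢0 : a ≢ 0#
   a≢0 z = ns (b≡0 , c≡0 , trans z (sym (trans d≡ (trans (cong -_ z) (solve 0 (:- :0 := :0) refl)))))

 -- The 2×2 minors of the two matrices regarded as vectors of length four: proportionality without
 -- division.
 CrossZero : Mat → Mat → Set
 CrossZero (mat a b c d) (mat a′ b′ c′ d′) = a * b′ ≡ b * a′ × a * c′ ≡ c * a′ × a * d′ ≡ d * a′ × b * c′ ≡ c * b′ × b * d′ ≡ d * b′ × c * d′ ≡ d * c′

 cross-∝ : ∀ {A B} → det A ≢ 0# → det B ≢ 0# → CrossZero A B → A ∝ B
 cross-∝ {mat a b c d} {mat a′ b′ c′ d′} dA dB (ab , ac , ad , bc , bd , cd) = by-cases (em (a ≡ 0#))
  where
  ratio : ∀ {a a′ b b′} → a ≢ 0# → a * b′ ≡ b * a′ → b′ ≡ (recip a * a′) * b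
  ratio {a} {a′} {b} {b′} ne e = *-cancelˡ ne (trans e (trans (solve 2 (λ b a′ → b :* a′ := :1 :* a′ :* b) refl b a′)
   (trans (cong (λ z → z * a′ * b) (sym (*-recip ne))) (solve 4 (λ a r a′ b → a :* r :* a′ :* b := a :* (r :* a′ :* b)) refl a (recip a) a′ b))))
  kill : ∀ {l x} → l ≡ 0# → x ≡ l * b → x ≡ 0#
  kill z e = trans e (trans (cong (_* b) z) (zeroˡ b))
  singular : a′ ≡ 0# → b′ ≡ 0# → ⊥
  singular za zb = dB (trans (cong₂ (λ x y → x * d′ - y * c′) za zb) (solve 2 (λ c d → :0 :* d :- :0 :* c := :0) refl c′ d′))
  by-cases : Dec (a ≡ 0#) → mat a b c d ∝ mat a′ b′ c′ d′
  by-cases (no a≢0) = recip a * a′ , (λ z → let z′ = trans (ratio a≢0 refl) (trans (cong (_* a) z) (zeroˡ a)) in singular z′ (kill z (ratio a≢0 ab))) ,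
   mat-≡ (ratio a≢0 refl) (ratio a≢0 ab) (ratio a≢0 ac) (ratio a≢0 ad)
  by-cases (yes a≡0) = recip b * b′ , (λ z → singular (trans a′≡ (trans (cong (_* a) z) (zeroˡ a))) (kill z (ratio b≢0 refl))) ,
   mat-≡ a′≡ (ratio b≢0 refl) (ratio b≢0 bc) (ratio b≢0 bd)
   where
   b≢0 : b ≢ 0#
   b≢0 z = dA (trans (cong₂ (λ x y → x * d - y * c) a≡0 z) (solve 2 (λ c d → :0 :* d :- :0 :* c := :0) refl c d))
   a′≡ : a′ ≡ recip b * b′ * a
   a′≡ = ratio b≢0 (sym ab)

 ∝-cross : ∀ {A B} → A ∝ B → CrossZero A B
 ∝-cross {mat a b c d} (l , _ , refl) = swap a b , swap a c , swap a d , swap b c , swap b d , swap c d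
  where
  swap : ∀ x y → x * (l * y) ≡ y * (l * x)
  swap x y = solve 3 (λ l x y → x :* (l :* y) := y :* (l :* x)) refl l x y

 -- Reading the tables in K: overgroups of M for q = 7 and q = 9.

 module Decode {p n : ℕ} ⦃ _ : NonZero p ⦄ (ι : Carrier) (ι² : ι * ι ≡ n ⋆ 1#) (p×1≡0 : p ⋆ 1# ≡ 0#)
  {code : Fin q → ℕ × ℕ} (certificate : Separation.Certificate p n code) where
  open Model p n
  open Separation p n code
  open Tables codes
  open Certificate certificate

  decode : Code → Carrier
  decode (a , b) = a ⋆ 1# + b ⋆ 1# * ι

  mod-× : ∀ m → (m % p) ⋆ 1# ≡ m ⋆ 1#
  mod-× m = sym (trans (cong (_⋆ 1#) (m≡m%n+[m/n]*n m p)) (trans (×-homo-+ 1# (m % p) (m / p ℕ.* p))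
   (trans (cong ((m % p) ⋆ 1# +_) (trans (×1-homo-* (m / p) p) (trans (cong ((m / p) ⋆ 1# *_) p×1≡0) (zeroʳ _)))) (+-identityʳ _))))

  decode-⊕ : ∀ c d → decode (c ⊕ d) ≡ decode c + decode d
  decode-⊕ (a , b) (c , d) = trans (cong₂ (λ x y → x + y * ι) (trans (mod-× (a ℕ.+ c)) (×-homo-+ 1# a c)) (trans (mod-× (b ℕ.+ d)) (×-homo-+ 1# b d)))
   (solve 5 (λ a b c d i → a :+ c :+ (b :+ d) :* i := a :+ b :* i :+ (c :+ d :* i)) refl (a ⋆ 1#) (b ⋆ 1#) (c ⋆ 1#) (d ⋆ 1#) ι)

  decode-⊗ : ∀ c d → decode (c ⊗ d) ≡ decode c * decode d
  decode-⊗ (a , b) (c , d) = trans (cong₂ (λ x y → x + y * ι)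
   (trans (mod-× _) (trans (×-homo-+ 1# (a ℕ.* c) (n ℕ.* (b ℕ.* d))) (cong₂ _+_ (×1-homo-* a c) (trans (×1-homo-* n (b ℕ.* d)) (cong₂ _*_ (sym ι²) (×1-homo-* b d))))))
   (trans (mod-× _) (trans (×-homo-+ 1# (a ℕ.* d) (b ℕ.* c)) (cong₂ _+_ (×1-homo-* a d) (×1-homo-* b c)))))
   (solve 5 (λ a b c d i → a :* c :+ i :* i :* (b :* d) :+ (a :* d :+ b :* c) :* i := (a :+ b :* i) :* (c :+ d :* i)) refl (a ⋆ 1#) (b ⋆ 1#) (c ⋆ 1#) (d ⋆ 1#) ι)

  decode-𝟘 : decode 𝟘 ≡ 0#
  decode-𝟘 = solve 1 (λ i → :0 :+ :0 :* i := :0) refl ι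

  decode-𝟙 : decode 𝟙 ≡ 1#
  decode-𝟙 = solve 1 (λ i → :1 :+ :0 :+ :0 :* i := :1) refl ι

  decode-−𝟙 : decode −𝟙 ≡ - 1#
  decode-−𝟙 = trans (solve 2 (λ x i → x :+ :0 :* i := :1 :+ x :- :1) refl ((p ℕ.∸ 1) ⋆ 1#) ι)
   (trans (cong (_- 1#) (trans (cong (_⋆ 1#) (ℕ.suc-pred p)) p×1≡0)) (+-identityˡ (- 1#)))

  apart-≢ : ∀ c d → Apart c d → decode c ≢ decode d
  apart-≢ c d a e = from (find a)
   where
   from : (∃ λ u → u ∈ codes × c ⊗ u ≡ d ⊗ u ⊕ 𝟙) → ⊥
   from (u , _ , f) = 1≢0 (trans (solve 2 (λ x o → o := x :+ o :- x) refl (decode d * decode u) 1#)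
    (≡⇒-≡0 (trans (sym (trans (decode-⊕ (d ⊗ u) 𝟙) (cong₂ _+_ (decode-⊗ d u) decode-𝟙))) (trans (cong decode (sym f)) (trans (decode-⊗ c u) (cong (_* decode u) e))))))

  -- By `separated`, decoding is injective on q codes, hence onto.
  decode-surjective : ∀ z → ∃ λ c → c ∈ codes × decode c ≡ z
  decode-surjective z = from (inj⇒surj {P = λ _ → ⊤} {Q = λ _ → ⊤} (ix ∘ decode ∘ code) (λ _ _ → tt)
   (λ i j _ _ e → [ id , (λ a → ⊥-elim (apart-≢ (code i) (code j) a (ix-injective e))) ]′ (All.lookup (All.lookup separated (∈-allFin i)) (∈-allFin j))) ℕ.≤-refl (ix z) tt)
   where
   from : (∃ λ i → ⊤ × ix (decode (code i)) ≡ ix z) → ∃ λ c → c ∈ codes × decode c ≡ z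
   from (i , _ , e) = code i , ∈-map⁺ code (∈-allFin i) , ix-injective e

  -- σ fixes the prime field, which contains ι², so σ(ι) = ι or σ(ι) = -ι; and every element has the
  -- form a + bι.
  aut-involutive : ∀ {σ} → IsFieldAut σ → ∀ z → σ (σ z) ≡ z
  aut-involutive {σ} aut z = from (decode-surjective z)
   where
   module S = FieldAut aut
   σ-× : ∀ m → σ (m ⋆ 1#) ≡ m ⋆ 1#
   σ-× zero = S.σ-0
   σ-× (suc m) = trans (S.σ-+ 1# (m ⋆ 1#)) (cong₂ _+_ S.σ-1 (σ-× m))
   σσι : σ (σ ι) ≡ ι
   σσι = [ (λ e → trans (cong σ e) e) , (λ e → trans (cong σ e) (trans (S.σ-neg ι) (trans (cong -_ e) (solve 1 (λ i → :- (:- i) := i) refl ι)))) ]′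
    (square-roots (trans (sym (S.σ-* ι ι)) (trans (cong σ ι²) (trans (σ-× n) (sym ι²)))))
   σ-decode : ∀ a b x → σ (a ⋆ 1# + b ⋆ 1# * x) ≡ a ⋆ 1# + b ⋆ 1# * σ x
   σ-decode a b x = trans (S.σ-+ _ _) (cong₂ _+_ (σ-× a) (trans (S.σ-* _ x) (cong (_* σ x) (σ-× b))))
   from : (∃ λ c → c ∈ codes × decode c ≡ z) → σ (σ z) ≡ z
   from ((a , b) , _ , refl) = trans (cong σ (σ-decode a b ι)) (trans (σ-decode a b (σ ι)) (cong (λ x → a ⋆ 1# + b ⋆ 1# * x) σσι))

  dm : CMat → Mat
  dm (cmat a b c d) = mat (decode a) (decode b) (decode c) (decode d)

  dm-⊛ : ∀ A B → dm (A ⊛ B) ≡ dm A ·ₘ dm B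
  dm-⊛ (cmat a b c d) (cmat e f g h) = mat-≡ (entry a e b g) (entry a f b h) (entry c e d g) (entry c f d h)
   where
   entry : ∀ a e b g → decode (a ⊗ e ⊕ b ⊗ g) ≡ decode a * decode e + decode b * decode g
   entry a e b g = trans (decode-⊕ (a ⊗ e) (b ⊗ g)) (cong₂ _+_ (decode-⊗ a e) (decode-⊗ b g))

  nonsingular-det : ∀ A → Nonsingular A → det (dm A) ≢ 0#
  nonsingular-det (cmat a b c d) s z = apart-≢ (a ⊗ d) (b ⊗ c) s (trans (decode-⊗ a d) (trans (-≡0 z) (sym (decode-⊗ b c))))

  square-det : ∀ A s → SquareDet A s → det (dm A) ≡ decode s * decode s
  square-det (cmat a b c d) s e = trans (cong (_- decode b * decode c) (trans (sym (decode-⊗ a d)) (trans (cong decode e) (trans (decode-⊕ (s ⊗ s) (b ⊗ c)) (cong₂ _+_ (decode-⊗ s s) (decode-⊗ b c))))))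
   (solve 2 (λ s x → s :+ x :- x := s) refl (decode s * decode s) (decode b * decode c))

  proportional-∝ : ∀ A B → det (dm A) ≢ 0# → det (dm B) ≢ 0# → Proportional A B → dm A ∝ dm B
  proportional-∝ (cmat a b c d) (cmat a′ b′ c′ d′) dA dB (e₁ ∷ e₂ ∷ e₃ ∷ e₄ ∷ e₅ ∷ e₆ ∷ []) =
   cross-∝ dA dB (pair a b′ b a′ e₁ , pair a c′ c a′ e₂ , pair a d′ d a′ e₃ , pair b c′ c b′ e₄ , pair b d′ d b′ e₅ , pair c d′ d c′ e₆)
   where
   pair : ∀ x y z w → x ⊗ y ≡ z ⊗ w → decode x * decode y ≡ decode z * decode w
   pair x y z w e = trans (sym (decode-⊗ x y)) (trans (cong decode e) (decode-⊗ z w))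

  disproportional-∝ : ∀ A B → Disproportional A B → ¬ (dm A ∝ dm B)
  disproportional-∝ (cmat a b c d) (cmat a′ b′ c′ d′) dis p = go dis (∝-cross p)
   where
   pair : ∀ x y z w → Apart (x ⊗ y) (z ⊗ w) → decode x * decode y ≢ decode z * decode w
   pair x y z w s e = apart-≢ (x ⊗ y) (z ⊗ w) s (trans (decode-⊗ x y) (trans e (sym (decode-⊗ z w))))
   go : Disproportional (cmat a b c d) (cmat a′ b′ c′ d′) → ¬ CrossZero (mat (decode a) (decode b) (decode c) (decode d)) (mat (decode a′) (decode b′) (decode c′) (decode d′))
   go (here s) (e , _) = pair a b′ b a′ s e
   go (there (here s)) (_ , e , _) = pair a c′ c a′ s e
   go (there (there (here s))) (_ , _ , e , _) = pair a d′ d a′ s e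
   go (there (there (there (here s)))) (_ , _ , _ , e , _) = pair b c′ c b′ s e
   go (there (there (there (there (here s))))) (_ , _ , _ , _ , e , _) = pair b d′ d b′ s e
   go (there (there (there (there (there (here s)))))) (_ , _ , _ , _ , _ , e) = pair c d′ d c′ s e

  Δ : Carrier
  Δ = decode δ

  J₀ : Mat
  J₀ = dm (base δ)

  J₀≡ : J₀ ≡ mat 0# Δ 1# 0#
  J₀≡ = mat-≡ decode-𝟘 refl decode-𝟙 decode-𝟘

  det-J₀ : det J₀ ≡ - Δ
  det-J₀ = trans (cong det J₀≡) (solve 1 (λ x → :0 :* :0 :- x :* :1 := :- x) refl Δ)

  -Δ-nonsquare : ¬ Square (- Δ)
  -Δ-nonsquare (s , e) = from (decode-surjective s)
   where
   from : (∃ λ c → c ∈ codes × decode c ≡ s) → ⊥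
   from (c , c∈ , refl) = apart-≢ (−𝟙 ⊗ δ) (c ⊗ c) (All.lookup nonsquare c∈) (trans (decode-⊗ −𝟙 δ) (trans (cong (_* Δ) decode-−𝟙)
    (trans (solve 1 (λ x → (:- :1) :* x := :- x) refl Δ) (trans e (sym (decode-⊗ c c))))))

  -Δ≢0 : det J₀ ≢ 0#
  -Δ≢0 z = nonsquare≢0 -Δ-nonsquare (trans (sym det-J₀) z)

  ∙-intro : ∀ {a b c d A B C D} → Linear a → Linear b → Linear c → Linear d → A ∝ mtx a → B ∝ mtx b → C ∝ mtx c → D ∝ mtx d →
   A ·ₘ B ∝ C ·ₘ D → a ∙ b ≡ c ∙ d
  ∙-intro {a} {b} {c} {d} {A} {B} {C} {D} la lb lc ld pa pb pc pd e = linear-≡ (linear-mul la lb) (linear-mul lc ld)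
   (∝-trans (∝-sym (linear-∙ b la)) (∝-trans (∝-sym (∝-·ₘ {A} {mtx a} {B} {mtx b} pa pb)) (∝-trans e (∝-trans (∝-·ₘ {C} {mtx c} {D} {mtx d} pc pd) (linear-∙ d lc)))))

  ∙-elim : ∀ {a b c d A B C D} → Linear a → Linear b → Linear c → Linear d → A ∝ mtx a → B ∝ mtx b → C ∝ mtx c → D ∝ mtx d →
   a ∙ b ≡ c ∙ d → A ·ₘ B ∝ C ·ₘ D
  ∙-elim {a} {b} {c} {d} {A} {B} {C} {D} la lb lc ld pa pb pc pd e = ∝-trans (∝-·ₘ {A} {mtx a} {B} {mtx b} pa pb) (∝-trans (linear-∙ b la)
   (subst (λ k → mtx k ∝ C ·ₘ D) (sym e) (∝-trans (∝-sym (linear-∙ d lc)) (∝-sym (∝-·ₘ {C} {mtx c} {D} {mtx d} pc pd)))))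

  μ : CMat → Γ
  μ A = mk (dm A)

  Stab : Pred
  Stab k = ∀ X → X ∈ axes → ∃ λ Y → Y ∈ axes × k ∙ μ X ≡ μ Y ∙ k

  stab-ε : Stab ε
  stab-ε X X∈ = X , X∈ , trans (identityˡ _) (sym (identityʳ _))

  stab-mul : ∀ k l → Stab k → Stab l → Stab (k ∙ l)
  stab-mul k l sk sl X X∈ = from (sl X X∈)
   where
   from : (∃ λ Y → Y ∈ axes × l ∙ μ X ≡ μ Y ∙ l) → ∃ λ Z → Z ∈ axes × (k ∙ l) ∙ μ X ≡ μ Z ∙ (k ∙ l)
   from (Y , Y∈ , e) = from′ (sk Y Y∈)
    where
    from′ : (∃ λ Z → Z ∈ axes × k ∙ μ Y ≡ μ Z ∙ k) → ∃ λ Z → Z ∈ axes × (k ∙ l) ∙ μ X ≡ μ Z ∙ (k ∙ l)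
    from′ (Z , Z∈ , f) = Z , Z∈ , trans (∙-assoc k l (μ X)) (trans (cong (k ∙_) e) (trans (sym (∙-assoc k (μ Y) l)) (trans (cong (_∙ l) f) (∙-assoc (μ Z) k l))))

  axis-det : ∀ X → X ∈ axes → det (dm X) ≢ 0#
  axis-det X X∈ = nonsingular-det X (All.lookup nonsingular X∈)

  permutes-stab : ∀ k A → Linear k → dm A ∝ mtx k → Permutes axes A → Stab k
  permutes-stab k A lk A∝ perm X X∈ = from (find (All.lookup perm X∈))
   where
   dA : det (dm A) ≢ 0#
   dA = ∝-det (∝-sym A∝) (det-of k)
   from : (∃ λ Y → Y ∈ axes × Proportional (A ⊛ X) (Y ⊛ A)) → ∃ λ Y → Y ∈ axes × k ∙ μ X ≡ μ Y ∙ k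
   from (Y , Y∈ , p) = Y , Y∈ , ∙-intro lk (mk-lin _) (mk-lin _) lk A∝ (mk-mat dX) (mk-mat dY) A∝
    (subst₂ _∝_ (dm-⊛ A X) (dm-⊛ Y A) (proportional-∝ (A ⊛ X) (Y ⊛ A) (subst (_≢ 0#) (sym AX) (*-nonzero dA dX)) (subst (_≢ 0#) (sym YA) (*-nonzero dY dA)) p))
    where
    dX : det (dm X) ≢ 0#
    dX = axis-det X X∈
    dY : det (dm Y) ≢ 0#
    dY = axis-det Y Y∈
    AX : det (dm (A ⊛ X)) ≡ det (dm A) * det (dm X)
    AX = trans (cong det (dm-⊛ A X)) (det-·ₘ (dm A) (dm X))
    YA : det (dm (Y ⊛ A)) ≡ det (dm Y) * det (dm A)
    YA = trans (cong det (dm-⊛ Y A)) (det-·ₘ (dm Y) (dm A))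

  j₀ : Γ
  j₀ = μ (base δ)

  -- Carries the exhaustive check over codes to K: x, y and a square root of the determinant all
  -- have codes.
  coded : ∀ {form : Code → Code → CMat} → AllStable axes form → ∀ {k x y} → T̂ k → x ∈ codes → y ∈ codes → mtx k ≡ dm (form x y) → Stab k
  coded {form} all {k} {x} {y} Tk x∈ y∈ e = from (T-square Tk)
   where
   from : Square (det (mtx k)) → Stab k
   from (s , ds) = from′ (decode-surjective s)
    where
    from′ : (∃ λ c → c ∈ codes × decode c ≡ s) → Stab k
    from′ (c , c∈ , refl) = cases (form x y) e (All.lookup (All.lookup (All.lookup all x∈) y∈) c∈)
     where
     cases : ∀ A → mtx k ≡ dm A → Stable axes A c → Stab k
     cases (cmat a b g d) e (inj₁ s) = ⊥-elim (apart-≢ (a ⊗ d) (c ⊗ c ⊕ b ⊗ g) s (trans (decode-⊗ a d) (trans (solve 2 (λ x y → x := x :- y :+ y) refl (decode a * decode d) (decode b * decode g))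
      (trans (cong (_+ decode b * decode g) (trans (sym (cong det e)) ds)) (sym (trans (decode-⊕ (c ⊗ c) (b ⊗ g)) (cong₂ _+_ (decode-⊗ c c) (decode-⊗ b g))))))))
     cases (cmat _ _ _ _) e (inj₂ (inj₁ refl)) = ⊥-elim (det-of k (trans ds (trans (cong (_* decode 𝟘) decode-𝟘) (zeroˡ _))))
     cases A@(cmat _ _ _ _) e (inj₂ (inj₂ perm)) = permutes-stab k A (T-linear Tk) (∝-reflexive (sym e)) perm

  -- A matrix that commutes or anticommutes with J₀ is determined by its first column, so it is
  -- among the coded matrices that were checked.
  normalizer-stab : ∀ k → T̂ k → k ∙ j₀ ≡ j₀ ∙ k → Stab k
  normalizer-stab k Tk e = from (decode-surjective (m₁₁ (mtx k))) (decode-surjective (m₂₁ (mtx k)))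
   (projective-commute (det-of k) -Δ≢0 (∙-elim (T-linear Tk) (mk-lin _) (mk-lin _) (T-linear Tk) ∝-refl (mk-mat -Δ≢0) (mk-mat -Δ≢0) ∝-refl e))
   where
   commute-form : ∀ A → Commute A (mat 0# Δ 1# 0#) → A ≡ mat (m₁₁ A) (Δ * m₂₁ A) (m₂₁ A) (m₁₁ A)
   commute-form (mat a b c d) e with e₁ , _ , e₃ , _ ← mat-inj e = mat-≡ refl (trans (solve 2 (λ a b → b := a :* :0 :+ b :* :1) refl a b) (trans e₁ (solve 3 (λ a c x → :0 :* a :+ x :* c := x :* c) refl a c Δ)))
    refl (trans (solve 2 (λ c d → d := c :* :0 :+ d :* :1) refl c d) (trans e₃ (solve 2 (λ a c → :1 :* a :+ :0 :* c := a) refl a c)))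
   anticommute-form : ∀ A → Anticomm A (mat 0# Δ 1# 0#) → A ≡ mat (m₁₁ A) (- 1# * (Δ * m₂₁ A)) (m₂₁ A) (- 1# * m₁₁ A)
   anticommute-form (mat a b c d) e with e₁ , _ , e₃ , _ ← mat-inj e = mat-≡ refl (trans (solve 2 (λ a b → b := a :* :0 :+ b :* :1) refl a b) (trans e₁ (solve 3 (λ a c x → (:- :1) :* (:0 :* a :+ x :* c) := (:- :1) :* (x :* c)) refl a c Δ)))
    refl (trans (solve 2 (λ c d → d := c :* :0 :+ d :* :1) refl c d) (trans e₃ (solve 2 (λ a c → (:- :1) :* (:1 :* a :+ :0 :* c) := (:- :1) :* a) refl a c)))
   from : (∃ λ x → x ∈ codes × decode x ≡ m₁₁ (mtx k)) → (∃ λ y → y ∈ codes × decode y ≡ m₂₁ (mtx k)) →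
    Commute (mtx k) J₀ ⊎ Anticomm (mtx k) J₀ → Stab k
   from (x , x∈ , ex) (y , y∈ , ey) (inj₁ c) = coded {commuting δ} stable Tk x∈ y∈ (trans (commute-form (mtx k) (subst (Commute (mtx k)) J₀≡ c))
    (mat-≡ (sym ex) (trans (cong (Δ *_) (sym ey)) (sym (decode-⊗ δ y))) (sym ey) (sym ex)))
   from (x , x∈ , ex) (y , y∈ , ey) (inj₂ a) = coded {anticommuting δ} stable′ Tk x∈ y∈ (trans (anticommute-form (mtx k) (subst (Anticomm (mtx k)) J₀≡ a))
    (mat-≡ (sym ex) (trans (cong (λ z → - 1# * (Δ * z)) (sym ey)) (sym (trans (decode-⊗ −𝟙 (δ ⊗ y)) (cong₂ _*_ decode-−𝟙 (decode-⊗ δ y))))) (sym ey)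
     (trans (cong (- 1# *_) (sym ex)) (sym (trans (decode-⊗ −𝟙 x) (cong (_* decode x) decode-−𝟙))))))

  μ-T : ∀ A s → Nonsingular A → SquareDet A s → T̂ (μ A)
  μ-T A s ns sd = T-intro (mk-lin _) (sqDet-∝ (mk-mat (nonsingular-det A ns)) (decode s , square-det A s sd))

  v-moves-axis : μ v ∙ j₀ ≢ j₀ ∙ μ v
  v-moves-axis e = disproportional-∝ (v ⊛ base δ) (base δ ⊛ v) v-moves (subst₂ _∝_ (sym (dm-⊛ v (base δ))) (sym (dm-⊛ (base δ) v))
   (∙-elim (mk-lin _) (mk-lin _) (mk-lin _) (mk-lin _) (mk-mat (nonsingular-det v nonsingular-v)) (mk-mat -Δ≢0) (mk-mat -Δ≢0) (mk-mat (nonsingular-det v nonsingular-v)) e))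

  u-unstable : ¬ Stab (μ u)
  u-unstable s = from (s X X∈)
   where
   from : (∃ λ Y → Y ∈ axes × μ u ∙ μ X ≡ μ Y ∙ μ u) → ⊥
   from (Y , Y∈ , e) = disproportional-∝ (u ⊛ X) (Y ⊛ u) (All.lookup u-moves Y∈) (subst₂ _∝_ (sym (dm-⊛ u X)) (sym (dm-⊛ Y u))
    (∙-elim (mk-lin _) (mk-lin _) (mk-lin _) (mk-lin _) (mk-mat (nonsingular-det u nonsingular-u)) (mk-mat (axis-det X X∈)) (mk-mat (axis-det Y Y∈)) (mk-mat (nonsingular-det u nonsingular-u)) e))

  -- det J and -Δ are nonsquares, so their product is a square r². Scaling J by t = r / det J makes
  -- its determinant -Δ, and `rational-form` then takes tJ to J₀.
  axis-conjugate : ∀ J → tr J ≡ 0# → ¬ Scalar J → ¬ Square (det J) → ∃ λ η → conj η (mk J) ≡ j₀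
  axis-conjugate J tJ ns nsq = from-square (nonsquare-* nsq -Δ-nonsquare)
   where
   dJ : det J ≢ 0#
   dJ = nonsquare≢0 nsq
   from-square : Square (det J * - Δ) → ∃ λ η → conj η (mk J) ≡ j₀
   from-square (r , e) = from (rational-form (scale t J) (trans (tr-scale t J) (trans (cong (t *_) tJ) (zeroʳ t))) (λ s → ns (unscale J s)) det-tJ)
    where
    t : Carrier
    t = r * recip (det J)
    r≢0 : r ≢ 0#
    r≢0 = nonzero-*ˡ (subst (_≢ 0#) e (*-nonzero dJ (nonsquare≢0 -Δ-nonsquare)))
    t≢0 : t ≢ 0#
    t≢0 z = r≢0 (trans (trans (sym (*-identityʳ r)) (trans (cong (r *_) (sym (recip-* dJ))) (sym (*-assoc r _ _)))) (trans (cong (_* det J) z) (zeroˡ _)))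
    unscale : ∀ A → Scalar (scale t A) → Scalar A
    unscale (mat a b c d) (x , y , z) = zero-left x , zero-left y , *-cancelˡ t≢0 z
     where
     zero-left : ∀ {x} → t * x ≡ 0# → x ≡ 0#
     zero-left e = *-cancelˡ t≢0 (trans e (sym (zeroʳ t)))
    det-tJ : det (scale t J) ≡ - Δ
    det-tJ = *-cancelˡ dJ (trans (cong (det J *_) (det-scale t J)) (trans (solve 3 (λ r c d → d :* (r :* c :* (r :* c) :* d) := r :* r :* (d :* c) :* (d :* c)) refl r (recip (det J)) (det J))
     (trans (cong (λ x → r * r * x * x) (*-recip dJ)) (trans (solve 1 (λ x → x :* :1 :* :1 := x) refl (r * r)) (sym e)))))
    from : (∃ λ H → det H ≢ 0# × scale t J ·ₘ H ≡ H ·ₘ mat 0# Δ 1# 0#) → ∃ λ η → conj η (mk J) ≡ j₀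
    from (H , dH , f) = mk H , trans (cong (_∙ mk H) refl) (trans (∙-assoc _ _ _) (trans (cong ((mk H ⁻¹) ∙_)
     (∙-intro (mk-lin J) (mk-lin H) (mk-lin H) (mk-lin _) (mk-mat dJ) (mk-mat dH) (mk-mat dH) (mk-mat -Δ≢0)
      (t , t≢0 , trans (cong (H ·ₘ_) J₀≡) (trans (sym f) (scale-·ₘ t J H)))))
     (g-solve 2 (λ h j → h :⁻ :∙ (h :∙ j) ⊜ j) refl (mk H) j₀)))

  module _ {Ĝ M̂ : Pred} (sG : Subgroup Ĝ) (sM : Subgroup M̂) (M⊑G : M̂ ⊑ Ĝ) (T⊑G : T̂ ⊑ Ĝ)
   (maximal : Maximal Ĝ M̂) (¬T⊑M : ¬ (T̂ ⊑ M̂))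
   (t : TorusObstruction sG sM M⊑G T⊑G maximal ¬T⊑M) (odd : Odd (index sT Ĝ)) where
   open TorusObstruction t

   -- The square of every automorphism of K is trivial, so g² is linear and lies in T; since |G/T|
   -- is odd, g lies in T as well.
   G⊑T : Ĝ ⊑ T̂
   G⊑T g Gg = odd-index-norm sT sG T⊑G odd g Gg (T-normal g)
    (linear-in-T sG sM M⊑G T⊑G maximal ¬T⊑M t (g ∙ g) (mul sG Gg Gg) (λ z → trans (aut-∙ g g z) (aut-involutive (aut-is g) z)))

   -- After conjugating the axis of M to its normal form, the stabilizer of all the axes lies
   -- between M and G. It contains v, which is not in M, and omits u, which is in G.
   overgroup-⊥ : ⊥
   overgroup-⊥ = from (axis-conjugate J (axis-traceless (mtx b)) (J-nonscalar lb b≢ε) det-axis)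
    where
    lb : Linear b
    lb = T-linear Tb
    J : Mat
    J = axis-of (mtx b)
    commutes : ∀ m → M̂ m → m ∙ mk J ≡ mk J ∙ m
    commutes m Mm = ∙-intro lm (mk-lin J) (mk-lin J) lm ∝-refl (mk-mat dJ) (mk-mat dJ) ∝-refl (linear-intertwines lb b≢ε lm (M-axial m Mm))
     where
     lm : Linear m
     lm = T-linear (G⊑T m (M⊑G m Mm))
     dJ : det J ≢ 0#
     dJ = nonsquare≢0 det-axis
    from : (∃ λ η → conj η (mk J) ≡ j₀) → ⊥
    from (η , e) = [ (λ f → v-moves-axis (commutes₀ (μ v) (f (back (μ v)) (L-back (μ-T v root-v nonsingular-v det-v) (permutes-stab (μ v) v (mk-lin _) (mk-mat (nonsingular-det v nonsingular-v)) v-permutes)))))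
     , (λ f → u-unstable (move Stab (back-conj (μ u)) (proj₂ (f (back (μ u)) (T⊑G _ (T-normal (η ⁻¹) (μ u) (μ-T u root-u nonsingular-u det-u))))))) ]′
     (maximal L sL M⊑L λ g (Tg , _) → T⊑G g Tg)
     where
     L : Pred
     L g = T̂ g × Stab (conj η g)
     sL : Subgroup L
     sL = finite-subgroup (unit sT , move Stab (g-solve 1 (λ x → :ε ⊜ x :⁻ :∙ :ε :∙ x) refl η) stab-ε)
      (λ {g} {h} (Tg , s) (Th , s′) → T-mul Tg Th , move Stab (conj-mul η g h) (stab-mul (conj η g) (conj η h) s s′))
     commutes-conj : ∀ m → m ∙ mk J ≡ mk J ∙ m → conj η m ∙ j₀ ≡ j₀ ∙ conj η m
     commutes-conj m c = trans (cong (conj η m ∙_) (sym e)) (trans (conj-mul η m (mk J)) (trans (cong (conj η) c) (trans (sym (conj-mul η (mk J) m)) (cong (_∙ conj η m) e))))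
     M⊑L : M̂ ⊑ L
     M⊑L m Mm = G⊑T m (M⊑G m Mm) , normalizer-stab (conj η m) (T-normal η m (G⊑T m (M⊑G m Mm))) (commutes-conj m (commutes m Mm))
     back : Γ → Γ
     back k = conj (η ⁻¹) k
     back-conj : ∀ k → conj η (back k) ≡ k
     back-conj k = g-solve 2 (λ h k → h :⁻ :∙ (h :⁻ :⁻ :∙ k :∙ h :⁻) :∙ h ⊜ k) refl η k
     L-back : ∀ {k} → T̂ k → Stab k → L (back k)
     L-back {k} Tk s = T-normal (η ⁻¹) k Tk , move Stab (sym (back-conj k)) s
     commutes₀ : ∀ k → M̂ (back k) → k ∙ j₀ ≡ j₀ ∙ k
     commutes₀ k M = subst (λ x → x ∙ j₀ ≡ j₀ ∙ x) (back-conj k) (commutes-conj (back k) (commutes (back k) M))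

 module _ {Ĝ M̂ : Pred} (sG : Subgroup Ĝ) (sM : Subgroup M̂) (M⊑G : M̂ ⊑ Ĝ) (T⊑G : T̂ ⊑ Ĝ)
  (maximal : Maximal Ĝ M̂) (¬T⊑M : ¬ (T̂ ⊑ M̂))
  (t : TorusObstruction sG sM M⊑G T⊑G maximal ¬T⊑M) (odd : Odd (index sT Ĝ)) where

  q≢7 : q ≢ 7
  q≢7 refl = Decode.overgroup-⊥ {7} {0} 0# (zeroˡ 0#) q×1 Seven.certificate sG sM M⊑G T⊑G maximal ¬T⊑M t odd

  q≢9 : q ≢ 9
  -- Here h = 4 is even, so -1 is a square; a root of it serves as ι, with ι² = -1 = 2.
  q≢9 refl = from (even-h⇒-1-square (2 , double-injective {h} {4} (ℕ.suc-injective (sym q≡))))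
   where
   three≡0 : 3 ⋆ 1# ≡ 0#
   three≡0 = dne λ ne → *-nonzero ne ne (trans (sym (×1-homo-* 3 3)) q×1)
   from : Square (- 1#) → ⊥
   from (s , e) = Decode.overgroup-⊥ {3} {2} s (trans (sym e) (-≡0 (trans (solve 0 (:- :1 :- (:1 :+ (:1 :+ :0)) := :- (:1 :+ (:1 :+ (:1 :+ :0)))) refl)
    (trans (cong -_ three≡0) (solve 0 (:- :0 := :0) refl))))) three≡0 Nine.certificate sG sM M⊑G T⊑G maximal ¬T⊑M t odd

 -- The three cases: necessity and sufficiency.

 module Classification {p : ℕ} (two-square⇒ : Square two → (∃ λ t → h ≡ 4 ℕ.* t) ⊎ (∃ λ t → h ≡ 3 ℕ.+ 4 ℕ.* t))
  (two-square : (∃ λ t → h ≡ 4 ℕ.* t) ⊎ (∃ λ t → h ≡ 3 ℕ.+ 4 ℕ.* t) → Square two)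
  (automorphism-power : ∀ {σ} → IsFieldAut σ → ∃ λ k → ∀ z → σ z ≡ iter k (λ w → pow w p) z) where

  q-from-h : ∀ {r t} → h ≡ r ℕ.+ 4 ℕ.* t → q ≡ suc (r ℕ.+ r) ℕ.+ 8 ℕ.* t
  q-from-h {r} {t} e = trans q≡ (trans (cong (λ h → suc (h ℕ.+ h)) e) (lemma r t))
   where
   lemma : ∀ r t → suc (r ℕ.+ 4 ℕ.* t ℕ.+ (r ℕ.+ 4 ℕ.* t)) ≡ suc (r ℕ.+ r) ℕ.+ 8 ℕ.* t
   lemma = solve-∀

  four-even : ∀ t → Even (4 ℕ.* t)
  four-even t = 2 ℕ.* t , lemma t
   where
   lemma : ∀ t → 4 ℕ.* t ≡ 2 ℕ.* t ℕ.+ 2 ℕ.* t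
   lemma = solve-∀

  four-odd : ∀ t → Odd (3 ℕ.+ 4 ℕ.* t)
  four-odd t = 1 ℕ.+ 2 ℕ.* t , lemma t
   where
   lemma : ∀ t → 3 ℕ.+ 4 ℕ.* t ≡ suc (1 ℕ.+ 2 ℕ.* t ℕ.+ (1 ℕ.+ 2 ℕ.* t))
   lemma = solve-∀

  module _ {G M : Subset} (sG : IsSubgroup G) (sM : IsSubgroup M) where
   private
    Ĝ M̂ : Pred
    Ĝ = ⟦ G ⟧
    M̂ = ⟦ M ⟧
    sĜ : Subgroup Ĝ
    sĜ = ⟦⟧-subgroup sG
    sM̂ : Subgroup M̂
    sM̂ = ⟦⟧-subgroup sM

   module _ (M⊑G : M̂ ⊑ Ĝ) (T⊑G : T̂ ⊑ Ĝ)
    (maximal : Maximal Ĝ M̂) (¬T⊑M : ¬ (T̂ ⊑ M̂))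
    (t : TorusObstruction sĜ sM̂ M⊑G T⊑G maximal ¬T⊑M) where
    open TorusObstruction t

    private
     i : ℕ
     i = index sT Ĝ
     lb : Linear b
     lb = T-linear Tb
     lw : Linear w
     lw = T-linear Tw
     Z J : Mat
     Z = mtx w
     J = axis-of (mtx b)
     det-J≢0 : det J ≢ 0#
     det-J≢0 = nonsquare≢0 det-axis
     module To = Torus lb b≢ε det-J≢0
     E1 : ∀ h → Ĝ h → Linear h → T̂ h
     E1 = linear-in-T sĜ sM̂ M⊑G T⊑G maximal ¬T⊑M t
     E2 : ∀ g → Ĝ g → SqDet (mtx g) → (∀ z → aut-of g (aut-of g z) ≡ z) → ¬ Linear g → ⊥
     E2 = no-square-field-involution sĜ sM̂ M⊑G T⊑G maximal ¬T⊑M t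

    no-C-involution : ∀ v → To.C v → v ∙ v ≡ ε → v ≡ ε
    no-C-involution v ((_ , c) , Tv) v² = dne λ v≢ε → no-torus-involution v Tv v² v≢ε (commute-J⇒B lb b≢ε c)

    anticommuting-involution : ∀ {g} → Linear g → Anticomm (mtx g) J → g ∙ g ≡ ε
    anticommuting-involution {g} lg a = traceless-involution lg (anticommute-traceless {mtx g} {J} det-J≢0 a)

    w∉C : ¬ To.C w
    w∉C ((_ , c) , _) = commute-anticommute-⊥ {Z} {J} (det-of w) det-J≢0 c anticommutes

    C⊑M : To.C ⊑ M̂
    C⊑M v ((lv , c) , Tv) = axial-M v (T⊑G v Tv) (commuting-axial lb b≢ε lv (commute-J⇒B lb b≢ε c))

    inverts : ∀ c → To.C c → w ∙ c ≡ (c ⁻¹) ∙ w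
    inverts c ((lc , cc) , _) = inverseˡ-flip (anticommuting-involution (linear-mul lw lc)
     (anticommute-∝ {Z ·ₘ mtx c} {mtx (w ∙ c)} {J} (linear-∙ c lw) wc))
     where
     C′ : Mat
     C′ = mtx c
     wc : Anticomm (Z ·ₘ C′) J
     wc = trans (·ₘ-assoc Z C′ J) (trans (cong (Z ·ₘ_) cc) (trans (sym (·ₘ-assoc Z J C′)) (trans (cong (_·ₘ C′) anticommutes)
      (trans (scale-·ₘ (- 1#) (J ·ₘ Z) C′) (cong neg (·ₘ-assoc J Z C′))))))
     inverseˡ-flip : (w ∙ c) ∙ (w ∙ c) ≡ ε → w ∙ c ≡ (c ⁻¹) ∙ w
     inverseˡ-flip s = trans (sym (invol-inv s)) (trans (g-solve 2 (λ w c → (w :∙ c) :⁻ ⊜ c :⁻ :∙ w :⁻) refl w c) (cong ((c ⁻¹) ∙_) (invol-inv w²)))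

    M-cases : ∀ m → ⟦ M ∩ PSL ⟧ m → To.C m ⊎ To.C (m ∙ w)
    M-cases m (Mm , Tm) = Sum.map (λ c → (lm , c) , Tm)
     (λ a → (linear-mul lm lw , commute-∝ˡ {B = J} (linear-∙ w lm) (anticommute-commute {mtx m} {Z} {J} a anticommutes)) , T-mul Tm Tw)
     (projective-commute (det-of m) det-J≢0 (linear-intertwines lb b≢ε lm (M-axial m Mm)))
     where
     lm : Linear m
     lm = T-linear Tm

    dihedral : ∀ {m} → m ≡ # To.E → IsoDihedral (M ∩ PSL) m
    dihedral m≡ = To.isoDihedral no-C-involution {M ∩ PSL}
     (λ x y x≈y (a , b) → IsSubgroup.respects sM x y x≈y a , IsSubgroup.respects PSL-subgroup x y x≈y b) (λ x (a , _) → IsSubgroup.⊆PΓL sM x a)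
     (Mw , Tw) (λ {i} {j} (a , b) (a′ , b′) → mul sM̂ {i} {j} a a′ , T-mul b b′) (λ v Cv → C⊑M v Cv , proj₂ Cv) w² w∉C inverts M-cases
     (trans m≡ (To.#E≡#C+#C det-axis nonsquare-*))

    -- For h even, -1 is a square, so -det J is a nonsquare like det J; the torus is nonsplit, of
    -- order q + 1.
    dihedral-even : Even h → IsoDihedral (M ∩ PSL) (q ℕ.+ 1)
    dihedral-even eh = dihedral (trans (ℕ.+-comm q 1) (sym (To.#E-nonsplit λ s → det-axis
     (subst Square (solve 1 (λ d → (:- :1) :* (:- d) := d) refl (det J)) (square-* (even-h⇒-1-square eh) s)))))

    -- For h odd, -1 is a nonsquare, so -det J is a square; the torus is split, of order q - 1.
    dihedral-odd : Odd h → IsoDihedral (M ∩ PSL) (q ℕ.∸ 1)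
    dihedral-odd oh = dihedral (cong (ℕ._∸ 1) (sym (To.#E-split
     (subst Square (solve 1 (λ d → (:- :1) :* d := :- d) refl (det J)) (nonsquare-* (λ s → even-odd-⊥ (-1-square s) oh) det-axis)))))

    odd-index-is : Odd i → ∃ λ i → IndexIs G PSL i × i % 2 ≡ 1
    odd-index-is o = i , index-is sG T⊑G , odd⇒%2≡1 o

    field-involution : Even i → ∃ λ g → Ĝ g × ¬ T̂ g × T̂ (g ∙ g)
    field-involution = even-index-inv sT sĜ T⊑G (λ g _ → T-normal g)

    aut-square : ∀ {g} → T̂ (g ∙ g) → ∀ z → aut-of g (aut-of g z) ≡ z
    aut-square {g} Tg² z = trans (sym (aut-∙ g g z)) (T-linear Tg² z)

    nonlinear : ∀ {g} → Ĝ g → ¬ T̂ g → ¬ Linear g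
    nonlinear Gg ¬Tg lg = ¬Tg (E1 _ Gg lg)

    -- An element of order two modulo T induces a field automorphism of order two, and whatever such
    -- an automorphism fixes is a square; in particular -1.
    even-index-even-h : Even i → Even h
    even-index-even-h ei = from (field-involution ei)
     where
     from : (∃ λ g → Ĝ g × ¬ T̂ g × T̂ (g ∙ g)) → Even h
     from (g , Gg , ¬Tg , Tg²) = -1-square (FieldInvolution.fixed-square (aut-is g) (aut-square Tg²) (nonlinear Gg ¬Tg)
      (trans (S.σ-neg 1#) (cong -_ S.σ-1)))
      where module S = FieldAut (aut-is g)

    -- Otherwise the square part would contain an element of order two modulo T, which
    -- `no-square-field-involution` excludes.
    square-part-odd : Odd (index sT (SquarePart Ĝ))
    square-part-odd = ¬even⇒odd λ ev → from (even-index-inv sT (square-subgroup sĜ) (T⊑square T⊑G) (λ g _ → T-normal g) ev)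
     where
     from : (∃ λ g → SquarePart Ĝ g × ¬ T̂ g × T̂ (g ∙ g)) → ⊥
     from (g , (Gg , sq) , ¬Tg , Tg²) = E2 g Gg sq (aut-square Tg²) (nonlinear Gg ¬Tg)

    -- The class of diag(γ, 1) is linear with nonsquare determinant.
    ¬PGL⊆G : ¬ (PGL ⊆ G)
    ¬PGL⊆G f = γ-nonsquare (subst Square (solve 1 (λ g → g :* :1 :- :0 :* :0 := g) refl γ) (sqDet-∝ (∝-sym (mk-mat D≢0)) (T-square (E1 (mk D) (f _ (el-PΓL (mk D) , mk-lin D)) (mk-lin D)))))
     where
     D : Mat
     D = mat γ 0# 0# 1#
     D≢0 : det D ≢ 0#
     D≢0 z = γ≢0 (trans (solve 1 (λ g → g := g :* :1 :- :0 :* :0) refl γ) z)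

    even-condition : Even i → (∃ λ t → h ≡ 4 ℕ.* t) → CondC p G M
    even-condition ei (t , h≡) = from (field-involution ei)
     where
     from : (∃ λ g → Ĝ g × ¬ T̂ g × T̂ (g ∙ g)) → CondC p G M
     from (g , Gg , ¬Tg , Tg²) = trans (cong (_% 8) (q-from-h {0} {t} h≡)) (residue 1 t)
      , (i , index-is sG T⊑G , trans (cong (_% 4) (square-index sĜ T⊑G nonsquare-* g Gg ¬sq)) (double-odd%4 square-part-odd))
      , (λ f → ¬sq (scalable-square (mtx g) (proj₂ (proj₂ (f (el g) Gg))))) , ¬PGL⊆G , dihedral-even (subst Even (sym h≡) (four-even t))
      where
      ¬sq : ¬ SqDet (mtx g)
      ¬sq sq = E2 g Gg sq (aut-square Tg²) (nonlinear Gg ¬Tg)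

    module _ (q≢7 : Odd i → q ≢ 7) (q≢9 : Odd i → q ≢ 9) where

     -- The values h = 0, 4 and 3 to be excluded mean q = 1, 9 and 7.
     odd-condition : Odd i → (∃ λ t → h ≡ 4 ℕ.* t) ⊎ (∃ λ t → h ≡ 3 ℕ.+ 4 ℕ.* t) → CondA G M ⊎ CondB G M
     odd-condition oi (inj₁ (zero , h≡)) = ⊥-elim (ℕ.<-irrefl (sym h≡) h>0)
     odd-condition oi (inj₁ (suc zero , h≡)) = ⊥-elim (q≢9 oi (q-from-h {0} {1} h≡))
     odd-condition oi (inj₁ (suc (suc t) , h≡)) = inj₂
      ( subst (9 <_) (sym q17) (ℕ.m≤m+n 10 _) , trans (cong (_% 8) (q-from-h {0} {suc (suc t)} h≡)) (residue 1 (suc (suc t)))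
      , odd-index-is oi , dihedral-even (subst Even (sym h≡) (four-even (suc (suc t)))) )
      where
      lemma : ∀ t → 1 ℕ.+ 8 ℕ.* suc (suc t) ≡ 10 ℕ.+ (7 ℕ.+ 8 ℕ.* t)
      lemma = solve-∀
      q17 : q ≡ 10 ℕ.+ (7 ℕ.+ 8 ℕ.* t)
      q17 = trans (q-from-h {0} {suc (suc t)} h≡) (lemma t)
     odd-condition oi (inj₂ (zero , h≡)) = ⊥-elim (q≢7 oi (q-from-h {3} {0} h≡))
     odd-condition oi (inj₂ (suc t , h≡)) = inj₁
      ( subst (7 <_) (sym q15) (ℕ.m≤m+n 8 _) , trans (cong (_% 8) (q-from-h {3} {suc t} h≡)) (residue 7 (suc t))
      , odd-index-is oi , dihedral-odd (subst Odd (sym h≡) (four-odd (suc t))) )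
      where
      lemma : ∀ t → 7 ℕ.+ 8 ℕ.* suc t ≡ 8 ℕ.+ (7 ℕ.+ 8 ℕ.* t)
      lemma = solve-∀
      q15 : q ≡ 8 ℕ.+ (7 ℕ.+ 8 ℕ.* t)
      q15 = trans (q-from-h {3} {suc t} h≡) (lemma t)

     condition : CondA G M ⊎ CondB G M ⊎ CondC p G M
     condition = cases (even⊎odd i) (two-square⇒ (two-is-square sĜ sM̂ M⊑G T⊑G maximal ¬T⊑M t))
      where
      cases : Even i ⊎ Odd i → (∃ λ t → h ≡ 4 ℕ.* t) ⊎ (∃ λ t → h ≡ 3 ℕ.+ 4 ℕ.* t) → CondA G M ⊎ CondB G M ⊎ CondC p G M
      cases (inj₂ oi) c = [ inj₁ , inj₂ ∘ inj₁ ]′ (odd-condition oi c)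
      cases (inj₁ ei) (inj₁ c) = inj₂ (inj₂ (even-condition ei c))
      cases (inj₁ ei) (inj₂ (t , h≡)) = ⊥-elim (even-odd-⊥ (subst Even h≡ (even-index-even-h ei)) (four-odd t))

  h-from-residue : ∀ r → q % 8 ≡ suc (r ℕ.+ r) → ∃ λ t → h ≡ r ℕ.+ 4 ℕ.* t
  h-from-residue r e = from (quotient-8 {q} e)
   where
   lemma : ∀ r t → suc (r ℕ.+ r) ℕ.+ t ℕ.* 8 ≡ suc (r ℕ.+ 4 ℕ.* t ℕ.+ (r ℕ.+ 4 ℕ.* t))
   lemma = solve-∀
   from : (∃ λ t → q ≡ suc (r ℕ.+ r) ℕ.+ t ℕ.* 8) → ∃ λ t → h ≡ r ℕ.+ 4 ℕ.* t
   from (t , e) = t , double-injective (ℕ.suc-injective (trans (sym q≡) (trans e (lemma r t))))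

  module _ {G M : Subset} (sG : IsSubgroup G) (sM : IsSubgroup M) where
   private
    Ĝ M̂ : Pred
    Ĝ = ⟦ G ⟧
    M̂ = ⟦ M ⟧
    sĜ : Subgroup Ĝ
    sĜ = ⟦⟧-subgroup sG
    sM̂ : Subgroup M̂
    sM̂ = ⟦⟧-subgroup sM
    M₀̂ : Pred
    M₀̂ y = M̂ y × T̂ y

   -- What is kept of a dihedral M ∩ T of order 2n: an involution and the order. For n odd, ⟨w⟩ is a
   -- Sylow 2-subgroup of M ∩ T.
   record Reflection (n : ℕ) : Set where
    field
     w : Γ
     Mw : M̂ w
     Tw : T̂ w
     w² : w ∙ w ≡ ε
     w≢ε : w ≢ ε
     size : # M₀̂ ≡ n ℕ.+ n

   reflection : ∀ {m} → IsoDihedral (M ∩ PSL) m → ∃ λ n → m ≡ n ℕ.+ n × Reflection n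
   reflection {m} (k , m≡ , f , Hf , surj , inj , hom) = suc k , trans (sym m≡) (double≡ (suc k)) , record
    { w = φ (zero , true) ; Mw = proj₁ (Hφ (zero , true)) ; Tw = proj₂ (Hφ (zero , true))
    ; w² = trans (sym (φ-mul (zero , true) (zero , true))) (trans (cong φ (reflection-square k)) φ-ε)
    ; w≢ε = λ e → true≢false (cong proj₂ (φ-inj (zero , true) (zero , false) (trans e (sym φ-ε))))
    ; size = trans (#-disjoint cover (λ { j (a , refl) → Hφ (a , false) }) (λ { j (a , refl) → Hφ (a , true) }) disjoint) (cong₂ ℕ._+_ (half false) (half true)) }
    where
    pf : ∀ x → PΓL (f x)
    pf x = IsSubgroup.⊆PΓL sM (f x) (proj₁ (Hf x))
    φ : DihCarrier k → Γ
    φ x = ixΓ (f x) (pf x)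
    f≈ : ∀ x → f x ≈ el (φ x)
    f≈ x = el-ixΓ (f x) (pf x)
    true≢false : true ≢ false
    true≢false ()
    Hφ : ∀ x → M₀̂ (φ x)
    Hφ x = IsSubgroup.respects sM _ _ (f≈ x) (proj₁ (Hf x)) , IsSubgroup.respects PSL-subgroup _ _ (f≈ x) (proj₂ (Hf x))
    φ-mul : ∀ x y → φ (dihMul k x y) ≡ φ x ∙ φ y
    φ-mul x y = product-≡ {f x} {f y} {f (dihMul k x y)} (f≈ x) (f≈ y) (f≈ (dihMul k x y)) (hom x y)
    φ-inj : ∀ x y → φ x ≡ φ y → x ≡ y
    φ-inj x y e = inj x y (≈-trans {f x} {el (φ x)} {f y} (f≈ x) (subst (λ i → el i ≈ f y) (sym e) (≈-sym {f y} {el (φ y)} (f≈ y))))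
    φ-ε : φ (zero , false) ≡ ε
    φ-ε = ∙-cancelˡ _ _ _ (trans (sym (φ-mul (zero , false) (zero , false))) (trans (cong φ (identity-square k)) (sym (identityʳ _))))
    Side : Bool → Pred
    Side s j = ∃ λ a → φ (a , s) ≡ j
    cover : ∀ j → M₀̂ j → Side false j ⊎ Side true j
    cover j (Mj , Tj) = from (surj (el j) (Mj , Tj))
     where
     from : (∃ λ x → f x ≈ el j) → Side false j ⊎ Side true j
     from ((a , s) , e) = side s (el-injective (≈-trans {el (φ (a , s))} {f (a , s)} {el j} (≈-sym {f (a , s)} {el (φ (a , s))} (f≈ (a , s))) e))
      where
      side : ∀ s → φ (a , s) ≡ j → Side false j ⊎ Side true j
      side false e = inj₁ (a , e)
      side true e = inj₂ (a , e)
    disjoint : ∀ j → Side false j → Side true j → ⊥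
    disjoint j (a , e) (b , e′) = true≢false (sym (cong proj₂ (φ-inj (a , false) (b , true) (trans e (sym e′)))))
    half : ∀ s → # (Side s) ≡ suc k
    half s = trans (sym (#-bij {P = λ (_ : Fin (suc k)) → ⊤} (λ a → φ (a , s)) (λ a _ → a , refl) (λ a b _ _ e → cong proj₁ (φ-inj (a , s) (b , s) e)) (λ { j (a , e) → a , tt , e })))
     (#-all λ _ → tt)

   module _ (M⊑G : M̂ ⊑ Ĝ) (T⊑G : T̂ ⊑ Ĝ)
    (maximal : Maximal Ĝ M̂) (¬T⊑M : ¬ (T̂ ⊑ M̂)) where

    pair-index₀ : ∀ {n} (r : Reflection n) → index (pair-subgroup (Reflection.w² r)) M₀̂ ≡ n
    pair-index₀ {n} r = ℕ.*-cancelʳ-≡ _ n 2 (trans (trans (cong (index (pair-subgroup w²) M₀̂ ℕ.*_) (sym #P)) (sym (lagrange (pair-subgroup w²) (∩-subgroup sM̂ sT) pair⊑)))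
     (trans size (trans (sym (double≡ n)) (ℕ.*-comm 2 n))))
     where
     open Reflection r
     #P : # (Pair w) ≡ 2
     #P = trans (adjoin-order trivial-group w w≢ε) (cong₂ ℕ._+_ (#-singleton ε refl λ _ → id) (#-singleton ε refl λ _ → id))
     pair⊑ : Pair w ⊑ M₀̂
     pair⊑ y p = [ (λ { refl → unit sM̂ , unit sT }) , (λ { refl → Mw , Tw }) ]′ (pair-cases p)

    -- |M : M ∩ T| = |G : T| because G = MT.
    pair-index : ∀ {n} (r : Reflection n) → index (pair-subgroup (Reflection.w² r)) M̂ ≡ index sT Ĝ ℕ.* n
    pair-index {n} r = trans (index-tower (pair-subgroup w²) (∩-subgroup sM̂ sT) sM̂ pair⊑ (λ _ → proj₁))
     (cong₂ ℕ._*_ (index-product sM̂ sT sĜ M⊑G T⊑G (supplement sĜ sM̂ M⊑G T⊑G maximal ¬T⊑M)) (pair-index₀ r))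
     where
     open Reflection r
     pair⊑ : Pair w ⊑ M₀̂
     pair⊑ y p = [ (λ { refl → unit sM̂ , unit sT }) , (λ { refl → Mw , Tw }) ]′ (pair-cases p)

    module _ (code : PerfectCode Ĝ M̂) (sq-two : Square two) where

     odd-⊥ : ∀ {n} → Reflection n → Odd n → Odd (index sT Ĝ) → ⊥
     odd-⊥ r on oi = odd-index-⊥ sĜ sM̂ M⊑G T⊑G code Mw Tw w² w≢ε sq-two (subst Odd (sym (pair-index r)) (odd*odd oi on))
      where open Reflection r

     -- G is not inside PΣL₂(q), so it has elements of nonsquare determinant and its square part has
     -- odd index over T. G does not contain PGL₂(q), so its linear elements have square
     -- determinant; nonlinear involutions have it by `involution-square`.
     twice-odd-⊥ : ∀ {n j} → Reflection n → Odd n → Odd j → index sT Ĝ ≡ j ℕ.+ j → ¬ (G ⊆ PΣL p) → ¬ (PGL ⊆ G) → ⊥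
     twice-odd-⊥ {n} {j} r on oj i≡ ¬PΣL ¬PGL = twice-odd-index-⊥ sĜ sM̂ M⊑G T⊑G code Mw Tw w² w≢ε sq-two (subst Odd (sym (pair-index₀ r)) on)
      (odd*odd oj on) (trans (pair-index r) (trans (cong (ℕ._* n) i≡) (ℕ.*-distribʳ-+ n j j))) no-inv square-T
      where
      open Reflection r
      -- Every field automorphism is a power of the Frobenius map, so elements of square determinant
      -- lie in PΣL₂(q).
      nonsquare-element : ∃ λ g → Ĝ g × ¬ SqDet (mtx g)
      nonsquare-element = dne λ none → ¬PΣL λ x Gx → let px = IsSubgroup.⊆PΓL sG x Gx in
       px , automorphism-power (proj₂ px) , square-scalable (matrix x) (proj₁ px) (sqDet-∝ (∝-sym (proj₂ (el-ixΓ x px))) (dne λ ¬s → none (ixΓ x px , ⟦⟧-el sG px Gx , ¬s)))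
      odd-square-part : Odd (index sT (SquarePart Ĝ))
      odd-square-part = from nonsquare-element
       where
       from : (∃ λ g → Ĝ g × ¬ SqDet (mtx g)) → Odd (index sT (SquarePart Ĝ))
       from (g , Gg , ¬sq) = subst Odd (double-injective (trans (sym i≡) (square-index sĜ T⊑G nonsquare-* g Gg ¬sq))) oj
      square-T : ∀ g → Ĝ g → SqDet (mtx g) → T̂ (g ∙ g) → T̂ g
      square-T g Gg sq Tg² = odd-index-norm sT (square-subgroup sĜ) (T⊑square T⊑G) odd-square-part g (Gg , sq) (T-normal g) Tg²
      linear-square : ∀ g → Ĝ g → Linear g → SqDet (mtx g)
      linear-square g Gg lg = dne λ ¬sq → ¬PGL λ x x∈ → ⊑⇒⊆-at x x∈ (all-linear ¬sq (ixΓ x (proj₁ x∈)) (linear-ix x x∈))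
       where
       ⊑⇒⊆-at : ∀ x (x∈ : PGL x) → Ĝ (ixΓ x (proj₁ x∈)) → G x
       ⊑⇒⊆-at x x∈ = IsSubgroup.respects sG _ _ (≈-sym {x} {el (ixΓ x (proj₁ x∈))} (el-ixΓ x (proj₁ x∈)))
       linear-ix : ∀ x (x∈ : PGL x) → Linear (ixΓ x (proj₁ x∈))
       linear-ix x x∈ z = trans (sym (proj₁ (el-ixΓ x (proj₁ x∈)) z)) (proj₂ x∈ z)
       all-linear : ¬ SqDet (mtx g) → ∀ i → Linear i → Ĝ i
       all-linear ¬sq i li = by-cases (em (SqDet (mtx i)))
        where
        by-cases : Dec (SqDet (mtx i)) → Ĝ i
        by-cases (yes s) = T⊑G i (T-intro li s)
        by-cases (no n) = move Ĝ (g-solve 2 (λ g i → g :⁻ :∙ (g :∙ i) ⊜ i) refl g i) (mul sĜ (inv sĜ Gg)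
         (T⊑G (g ∙ i) (T-intro (linear-mul lg li) (sqDet-∝ (linear-∙ i lg) (subst Square (sym (det-·ₘ (mtx g) (mtx i))) (nonsquare-* ¬sq n))))))
      no-inv : ∀ g → Ĝ g → g ∙ g ≡ ε → SqDet (mtx g)
      no-inv g Gg g² = by-cases (em (Linear g))
       where
       by-cases : Dec (Linear g) → SqDet (mtx g)
       by-cases (yes lg) = linear-square g Gg lg
       by-cases (no nl) = from (∝-trans mat-ε (subst (λ k → mtx k ∝ mtx g ·ₘ mapMat (aut-of g) (mtx g)) g² (∝-sym (mat-∙ g g))))
        where
        from : idMat ∝ mtx g ·ₘ mapMat (aut-of g) (mtx g) → SqDet (mtx g)
        from (l , l≢0 , e) = FieldInvolution.involution-square (aut-is g) (λ z → trans (sym (aut-∙ g g z)) (trans (cong (λ k → aut-of k z) g²) (aut-ε z))) nl l e l≢0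

    no-code : CondA G M ⊎ CondB G M ⊎ CondC p G M → ¬ IsPerfectCode G M
    no-code c code = cases c
     where
     ĉ : PerfectCode Ĝ M̂
     ĉ = ⟦⟧-code sG sM (⊑⇒⊆ sM sG M⊑G) code
     odd-i : (∃ λ i → IndexIs G PSL i × i % 2 ≡ 1) → Odd (index sT Ĝ)
     odd-i (i , ix , o) = subst Odd (index-unique sG T⊑G ix) (%2≡1⇒odd i o)
     plus : ∀ {n} → q ℕ.+ 1 ≡ n ℕ.+ n → (∃ λ t → h ≡ 4 ℕ.* t) → Odd n
     plus {n} e (t , h≡) = subst Odd (sym (double-injective (trans (sym e) (trans (cong (ℕ._+ 1) (trans q≡ (cong (λ h → suc (h ℕ.+ h)) h≡))) (lemma t))))) (suc-even (four-even t))
      where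
      lemma : ∀ t → suc (4 ℕ.* t ℕ.+ 4 ℕ.* t) ℕ.+ 1 ≡ suc (4 ℕ.* t) ℕ.+ suc (4 ℕ.* t)
      lemma = solve-∀
     minus : ∀ {n} → q ℕ.∸ 1 ≡ n ℕ.+ n → (∃ λ t → h ≡ 3 ℕ.+ 4 ℕ.* t) → Odd n
     minus {n} e (t , h≡) = subst Odd (sym (double-injective (trans (sym e) (cong (ℕ._∸ 1) (trans q≡ (cong (λ h → suc (h ℕ.+ h)) h≡)))))) (four-odd t)
     cases : CondA G M ⊎ CondB G M ⊎ CondC p G M → ⊥
     cases (inj₁ (_ , q7 , i , D)) = from (reflection D) (h-from-residue 3 q7)
      where
      from : (∃ λ n → q ℕ.∸ 1 ≡ n ℕ.+ n × Reflection n) → (∃ λ t → h ≡ 3 ℕ.+ 4 ℕ.* t) → ⊥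
      from (n , e , r) t = odd-⊥ ĉ (two-square (inj₂ t)) r (minus e t) (odd-i i)
     cases (inj₂ (inj₁ (_ , q1 , i , D))) = from (reflection D) (h-from-residue 0 q1)
      where
      from : (∃ λ n → q ℕ.+ 1 ≡ n ℕ.+ n × Reflection n) → (∃ λ t → h ≡ 4 ℕ.* t) → ⊥
      from (n , e , r) t = odd-⊥ ĉ (two-square (inj₁ t)) r (plus e t) (odd-i i)
     cases (inj₂ (inj₂ (q1 , (i , ix , i2) , ¬PΣL , ¬PGL , D))) = from (reflection D) (h-from-residue 0 q1) (%4≡2⇒double-odd i2)
      where
      from : (∃ λ n → q ℕ.+ 1 ≡ n ℕ.+ n × Reflection n) → (∃ λ t → h ≡ 4 ℕ.* t) → (∃ λ j → Odd j × i ≡ j ℕ.+ j) → ⊥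
      from (n , e , r) t (j , oj , i≡) = twice-odd-⊥ ĉ (two-square (inj₁ t)) r (plus e t) oj (trans (sym (index-unique sG T⊑G ix)) i≡) ¬PΣL ¬PGL

-- Deciding arbitrary small types by maximality and core-freeness.

module ExcludedMiddle {q : ℕ} (K : FiniteField q) {G M : ProjectiveGroups.Subset K} where
 open FiniteField K
 open ProjectiveGroups K

 commutativeRing : CommutativeRing 0ℓ 0ℓ
 commutativeRing = record { isCommutativeRing = isCommutativeRing }

 open CommutativeRing commutativeRing using (+-identityʳ; *-identityˡ; *-identityʳ; zeroˡ; *-assoc; +-assoc; -‿inverseʳ)
 open IntegerSolver commutativeRing using (solve; _:=_; _:+_; _:*_; :-_; _:-_; con; :0; :1)

 -- `elements-complete` assigns each element one position in the list, and positions can be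
 -- compared.
 equal? : ∀ (x y : Carrier) → Dec (x ≡ y)
 equal? x y = from (Any.index (elements-complete x) Fin.≟ Any.index (elements-complete y))
  where
  from : Dec (Any.index (elements-complete x) ≡ Any.index (elements-complete y)) → Dec (x ≡ y)
  from (yes e) = yes (trans (Any.lookup-index (elements-complete x)) (trans (cong (lookup elements) e) (sym (Any.lookup-index (elements-complete y)))))
  from (no n) = no λ { refl → n refl }

 mat-≡ : ∀ {a b c d a′ b′ c′ d′ : Carrier} → a ≡ a′ → b ≡ b′ → c ≡ c′ → d ≡ d′ → mat a b c d ≡ mat a′ b′ c′ d′
 mat-≡ refl refl refl refl = refl

 linear : Mat → Elem
 linear A = ⟨ A , (λ z → z) ⟩

 linear-PSL : ∀ A → det A ≡ 1# → PSL (linear A)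
 linear-PSL A@(mat a b c d) e = (((λ z → 0≢1 (trans (sym z) e)) , (λ _ _ → refl) , (λ _ _ → refl) , refl , (λ _ _ → id) , (λ y → y , refl)) , λ _ → refl) ,
  1# , trans (solve 4 (λ a b c d → :1 :* a :* (:1 :* d) :- :1 :* b :* (:1 :* c) := a :* d :- b :* c) refl a b c d) e

 transvection : Elem
 transvection = linear (mat 1# 1# 0# 1#)

 -- g·X·g⁻¹ for X = 1 + N and N = E₁₂ is 1 + (g N adj g) / det g.
 conjugate : ∀ g h → PΓL g → h · g ≈ one → ∃ λ A → det A ≡ 1# × linear A ≈ g · transvection · h
 conjugate ⟨ mat a b c d , σ ⟩ ⟨ mat e f g h , τ ⟩ (D≢0 , σ-+ , σ-* , σ-1 , _ , σ-surj) (τσ , l , l≢0 , one≡) = from (inverse (det (mat a b c d)) D≢0) (inverse (σ l) σl≢0)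
  where
  D : Carrier
  D = det (mat a b c d)
  σ-0 : σ 0# ≡ 0#
  σ-0 = trans (solve 1 (λ x → x := x :+ x :- x) refl (σ 0#)) (trans (cong (_+ - σ 0#) (trans (sym (σ-+ 0# 0#)) (cong σ (+-identityʳ 0#)))) (-‿inverseʳ (σ 0#)))
  στ : ∀ z → z ≡ σ (τ z)
  στ z with y , refl ← σ-surj z = cong σ (sym (τσ y))
  entry : ∀ {x u y v w} → w ≡ l * (x * τ y + u * τ v) → σ l * (σ x * y + σ u * v) ≡ σ w
  entry {x} {u} {y} {v} {w} eq = sym (trans (cong σ eq) (trans (σ-* _ _) (cong (σ l *_) (trans (σ-+ _ _)
   (cong₂ _+_ (trans (σ-* _ _) (cong (σ x *_) (sym (στ y)))) (trans (σ-* _ _) (cong (σ u *_) (sym (στ v)))))))))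
  one-entry : ∀ {x u y v} → 1# ≡ l * (x * τ y + u * τ v) → σ l * (σ x * y + σ u * v) ≡ 1#
  one-entry {x} {u} {y} {v} eq = trans (entry {x} {u} {y} {v} eq) σ-1
  zero-entry : ∀ {x u y v} → 0# ≡ l * (x * τ y + u * τ v) → σ l * (σ x * y + σ u * v) ≡ 0#
  zero-entry {x} {u} {y} {v} eq = trans (entry {x} {u} {y} {v} eq) σ-0
  e₁ : σ l * (σ e * a + σ f * c) ≡ 1#
  e₁ = one-entry (cong m₁₁ one≡)
  e₂ : σ l * (σ e * b + σ f * d) ≡ 0#
  e₂ = zero-entry (cong m₁₂ one≡)
  e₃ : σ l * (σ g * a + σ h * c) ≡ 0#
  e₃ = zero-entry (cong m₂₁ one≡)
  e₄ : σ l * (σ g * b + σ h * d) ≡ 1#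
  e₄ = one-entry (cong m₂₂ one≡)
  σl≢0 : σ l ≢ 0#
  σl≢0 z = 0≢1 (trans (sym (trans (cong (_* (σ e * a + σ f * c)) z) (zeroˡ _))) e₁)
  from : (∃ λ r → D * r ≡ 1#) → (∃ λ m → σ l * m ≡ 1#) → ∃ λ A → det A ≡ 1# × linear A ≈ ⟨ mat a b c d , σ ⟩ · transvection · ⟨ mat e f g h , τ ⟩
  from (r , Dr) (m , lm) = mat (1# + - (r * (a * c))) (r * (a * a)) (- (r * (c * c))) (1# + r * (a * c)) ,
   solve 3 (λ a c r → (:1 :- r :* (a :* c)) :* (:1 :+ r :* (a :* c)) :- r :* (a :* a) :* (:- (r :* (c :* c))) := :1) refl a c r ,
   στ , m , (λ z → 0≢1 (trans (sym (trans (cong (σ l *_) z) (solve 1 (λ x → x :* :0 := :0) refl (σ l)))) lm)) ,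
   mat-≡ (trans (product a b e₁₁ e₂₁) sq₁) (trans (product a b e₁₂ e₂₂) sq₂) (trans (product c d e₁₁ e₂₁) sq₃) (trans (product c d e₁₂ e₂₂) sq₄)
   where
   -- Cramer's rule: h inverts g up to a scalar, so the images of its entries under σ are the
   -- entries of the adjugate of g times m·r, where r inverts the determinant and m inverts σ(l).
   solve-entry : ∀ {s t x y u v α β} → σ l * (s * x + t * y) ≡ α → σ l * (s * u + t * v) ≡ β → D ≡ x * v + - (u * y) → s ≡ m * r * (v * α + - (y * β))
   solve-entry {s} {t} {x} {y} {u} {v} {α} {β} p q D≡ = sym (trans (cong₂ (λ α β → m * r * (v * α + - (y * β))) (sym p) (sym q))
    (trans (solve 9 (λ m r v l s x t y u → m :* r :* (v :* (l :* (s :* x :+ t :* y)) :- y :* (l :* (s :* u :+ t :* v))) := (l :* m) :* ((x :* v :- u :* y) :* r) :* s) refl m r v (σ l) s x t y u)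
     (trans (cong₂ (λ i j → i * j * s) lm (trans (cong (_* r) (sym D≡)) Dr)) (solve 1 (λ s → :1 :* :1 :* s := s) refl s))))
   e₁₁ : σ e ≡ m * r * (d * 1# + - (c * 0#))
   e₁₁ = solve-entry e₁ e₂ refl
   e₂₁ : σ g ≡ m * r * (d * 0# + - (c * 1#))
   e₂₁ = solve-entry e₃ e₄ refl
   swap : ∀ s t x y → σ l * (s * x + t * y) ≡ σ l * (t * y + s * x)
   swap s t x y = cong (σ l *_) (solve 4 (λ s t x y → s :* x :+ t :* y := t :* y :+ s :* x) refl s t x y)
   D≡ : D ≡ d * a + - (c * b)
   D≡ = solve 4 (λ a b c d → a :* d :- b :* c := d :* a :- c :* b) refl a b c d
   e₁₂ : σ f ≡ m * r * (a * 0# + - (b * 1#))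
   e₁₂ = solve-entry {σ f} {σ e} {d} {b} {c} {a} (trans (swap (σ f) (σ e) d b) e₂) (trans (swap (σ f) (σ e) c a) e₁) D≡
   e₂₂ : σ h ≡ m * r * (a * 1# + - (b * 0#))
   e₂₂ = solve-entry {σ h} {σ g} {d} {b} {c} {a} (trans (swap (σ h) (σ g) d b) e₄) (trans (swap (σ h) (σ g) c a) e₃) D≡
   product : ∀ u v {x y x′ y′} → x ≡ x′ → y ≡ y′ → (u * σ 1# + v * σ 0#) * x + (u * σ 1# + v * σ 1#) * y ≡ (u * 1# + v * 0#) * x′ + (u * 1# + v * 1#) * y′
   product u v refl refl = cong₂ _+_ (cong₂ (λ i z → (u * i + v * z) * _) σ-1 σ-0) (cong (λ i → (u * i + v * i) * _) σ-1)
   sq₁ : (a * 1# + b * 0#) * (m * r * (d * 1# + - (c * 0#))) + (a * 1# + b * 1#) * (m * r * (d * 0# + - (c * 1#))) ≡ m * (1# + - (r * (a * c)))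
   sq₁ = trans (solve 6 (λ a b c d m r → (a :* :1 :+ b :* :0) :* (m :* r :* (d :* :1 :- c :* :0)) :+ (a :* :1 :+ b :* :1) :* (m :* r :* (d :* :0 :- c :* :1)) := m :* ((a :* d :- b :* c) :* r :- r :* (a :* c))) refl a b c d m r)
    (cong (λ z → m * (z + - (r * (a * c)))) Dr)
   sq₂ : (a * 1# + b * 0#) * (m * r * (a * 0# + - (b * 1#))) + (a * 1# + b * 1#) * (m * r * (a * 1# + - (b * 0#))) ≡ m * (r * (a * a))
   sq₂ = solve 4 (λ a b m r → (a :* :1 :+ b :* :0) :* (m :* r :* (a :* :0 :- b :* :1)) :+ (a :* :1 :+ b :* :1) :* (m :* r :* (a :* :1 :- b :* :0)) := m :* (r :* (a :* a))) refl a b m r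
   sq₃ : (c * 1# + d * 0#) * (m * r * (d * 1# + - (c * 0#))) + (c * 1# + d * 1#) * (m * r * (d * 0# + - (c * 1#))) ≡ m * - (r * (c * c))
   sq₃ = solve 4 (λ c d m r → (c :* :1 :+ d :* :0) :* (m :* r :* (d :* :1 :- c :* :0)) :+ (c :* :1 :+ d :* :1) :* (m :* r :* (d :* :0 :- c :* :1)) := m :* (:- (r :* (c :* c)))) refl c d m r
   sq₄ : (c * 1# + d * 0#) * (m * r * (a * 0# + - (b * 1#))) + (c * 1# + d * 1#) * (m * r * (a * 1# + - (b * 0#))) ≡ m * (1# + r * (a * c))
   sq₄ = trans (solve 6 (λ a b c d m r → (c :* :1 :+ d :* :0) :* (m :* r :* (a :* :0 :- b :* :1)) :+ (c :* :1 :+ d :* :1) :* (m :* r :* (a :* :1 :- b :* :0)) := m :* ((a :* d :- b :* c) :* r :+ r :* (a :* c))) refl a b c d m r)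
    (cong (λ z → m * (z + r * (a * c))) Dr)

 module _ (sG : IsSubgroup G) (PSL⊆G : PSL ⊆ G) (sM : IsSubgroup M) (core-free : IsCoreFree G M) where

  -- All conjugates of the transvection are represented by matrices of determinant 1, so the
  -- transvection would lie in the core of M.
  core-free-⊥ : ¬ (∀ A → det A ≡ 1# → M (linear A))
  core-free-⊥ f = not-one (core-free transvection λ g h Gg Gh e → in-M (conjugate g h (IsSubgroup.⊆PΓL sG g Gg) e))
   where
   in-M : ∀ {x} → (∃ λ A → det A ≡ 1# × linear A ≈ x) → M x
   in-M (A , d , e) = IsSubgroup.respects sM _ _ e (f A d)
   not-one : ¬ (transvection ≈ one)
   not-one (_ , l , l≢0 , e) = l≢0 (trans (sym (*-identityʳ l)) (sym (cong m₁₂ e)))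

  module _ (maximal : IsMaximal G M) (P : Set) where

   -- A search through the finite field that may stop at any element with a proof of P.
   exhaust : ∀ {Q : Carrier → Set} → (∀ x → Q x ⊎ P) → (∀ x → Q x) ⊎ P
   exhaust {Q} f = Sum.map₁ (λ all x → All.lookup all (elements-complete x)) (go elements)
    where
    go : ∀ xs → All Q xs ⊎ P
    go [] = inj₁ []
    go (x ∷ xs) = [ (λ q → Sum.map₁ (q ∷_) (go xs)) , inj₂ ]′ (f x)

   -- If L lies in M, a proof of P would put all of G into M. If G lies in L, every matrix of
   -- determinant 1 yields membership in M or a proof of P; all memberships together contradict
   -- core-freeness, so the search finds P.
   excluded-middle : Dec P
   excluded-middle = [ (λ L⊆M → no λ p → proj₁ (proj₂ maximal) λ x Gx → L⊆M x (Gx , inj₂ p)) , (λ G⊆L → from (exhaust λ a → exhaust λ b → exhaust λ c → exhaust λ d → entry G⊆L (mat a b c d))) ]′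
    (proj₂ (proj₂ maximal) L sL (λ x Mx → proj₁ maximal x Mx , inj₁ Mx) (λ _ → proj₁))
    where
    module SG = IsSubgroup sG
    module SM = IsSubgroup sM
    L : Subset
    L x = G x × (M x ⊎ P)
    sL : IsSubgroup L
    sL = record
     { ⊆PΓL = λ x (Gx , _) → SG.⊆PΓL x Gx
     ; respects = λ x y e (Gx , m) → SG.respects x y e Gx , Sum.map₁ (SM.respects x y e) m
     ; has-one = SG.has-one , inj₁ SM.has-one
     ; closed = λ { x y (Gx , m) (Gy , m′) → SG.closed x y Gx Gy , both m m′ }
     ; inverses = λ { x (Gx , inj₁ m) → let (y , My , e) = SM.inverses x m in y , (proj₁ maximal y My , inj₁ My) , e
      ; x (Gx , inj₂ p) → let (y , Gy , e) = SG.inverses x Gx in y , (Gy , inj₂ p) , e } }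
     where
     both : ∀ {x y} → M x ⊎ P → M y ⊎ P → M (x · y) ⊎ P
     both (inj₁ m) (inj₁ m′) = inj₁ (SM.closed _ _ m m′)
     both (inj₂ p) _ = inj₂ p
     both (inj₁ _) (inj₂ p) = inj₂ p
    entry : G ⊆ L → ∀ A → (det A ≡ 1# → M (linear A)) ⊎ P
    entry G⊆L A = by-cases (equal? (det A) 1#)
     where
     by-cases : Dec (det A ≡ 1#) → (det A ≡ 1# → M (linear A)) ⊎ P
     by-cases (yes e) = Sum.map₁ (λ m _ → m) (proj₂ (G⊆L _ (PSL⊆G _ (linear-PSL A e))))
     by-cases (no n) = inj₁ λ e → ⊥-elim (n e)
    from : (∀ a b c d → det (mat a b c d) ≡ 1# → M (linear (mat a b c d))) ⊎ P → Dec P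
    from (inj₁ f) = ⊥-elim (core-free-⊥ λ { (mat a b c d) → f a b c d })
    from (inj₂ p) = yes p

-- The equivalence.

open import Function.Bundles using (_⇔_; mk⇔)

module _ (em : (P : Set) → Dec P) {p e : ℕ} (pr : Prime p) (K : FiniteField (p ^ e)) where
 open ProjectiveTheory em K

 classification : ∀ {G M} (sG : IsSubgroup G) (sM : IsSubgroup M) → T̂ ⊑ ⟦ G ⟧ → IsMaximal G M → ¬ (T̂ ⊑ ⟦ M ⟧) →
  (¬ IsPerfectCode G M) ⇔ (CondA G M ⊎ CondB G M ⊎ CondC p G M)
 classification {G} {M} sG sM T⊑G (M⊆G , _ , maximal) ¬T⊑M = mk⇔ (forward (em (two ≡ 0#))) backward
  where
  M⊑G : ⟦ M ⟧ ⊑ ⟦ G ⟧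
  M⊑G i = M⊆G (el i)
  sĜ : Subgroup ⟦ G ⟧
  sĜ = ⟦⟧-subgroup sG
  sM̂ : Subgroup ⟦ M ⟧
  sM̂ = ⟦⟧-subgroup sM
  maximalΓ : Maximal ⟦ G ⟧ ⟦ M ⟧
  maximalΓ L sL M⊑L L⊑G = Sum.map (λ f i Li → f (el i) (i , Li , ≈-refl {el i})) (λ f i Gi → ⟦Lift⟧ {L} (f (el i) Gi))
   (maximal (Lift L) (lift-subgroup sL) (λ x Mx → let px = IsSubgroup.⊆PΓL sM x Mx in ixΓ x px , M⊑L _ (IsSubgroup.respects sM _ _ (el-ixΓ x px) Mx) , el-ixΓ x px)
    (λ { x (i , Li , e) → IsSubgroup.respects sG _ _ (≈-sym {x} {el i} e) (L⊑G i Li) }))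
  socle : ¬ IsPerfectCode G M → SocleObstruction sT T-normal ⟦ M ⟧
  socle nc = socle-obstruction sT T-normal sĜ sM̂ M⊑G T⊑G (supplement sĜ sM̂ M⊑G T⊑G maximalΓ ¬T⊑M)
   (obstruction sĜ sM̂ M⊑G (nc ∘ code-⟦⟧ sG sM M⊆G))
  forward : Dec (two ≡ 0#) → ¬ IsPerfectCode G M → CondA G M ⊎ CondB G M ⊎ CondC p G M
  forward (yes two≡0) nc = ⊥-elim (no-obstruction-in-characteristic-two two≡0 sM̂ (socle nc))
  forward (no two≢0) nc = from (OddTheory.torus-obstruction em K two≢0 sĜ sM̂ M⊑G T⊑G maximalΓ ¬T⊑M (socle nc))
   where
   open ResidueTheory em {p} {e} pr K using (two-square; two-square⇒; automorphism-power)
   from : OddTheory.TorusObstruction em K two≢0 sĜ sM̂ M⊑G T⊑G maximalΓ ¬T⊑M → CondA G M ⊎ CondB G M ⊎ CondC p G M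
   from t = OddTheory.Classification.condition em K two≢0 {p} (two-square⇒ two≢0) (two-square two≢0) automorphism-power sG sM M⊑G T⊑G maximalΓ ¬T⊑M t
    (OddTheory.q≢7 em K two≢0 sĜ sM̂ M⊑G T⊑G maximalΓ ¬T⊑M t) (OddTheory.q≢9 em K two≢0 sĜ sM̂ M⊑G T⊑G maximalΓ ¬T⊑M t)
  odd-order : CondA G M ⊎ CondB G M ⊎ CondC p G M → Odd (p ^ e)
  odd-order (inj₁ (_ , q7 , _)) = odd-residue (3 , _≡_.refl) q7
  odd-order (inj₂ (inj₁ (_ , q1 , _))) = odd-residue (0 , _≡_.refl) q1
  odd-order (inj₂ (inj₂ (q1 , _))) = odd-residue (0 , _≡_.refl) q1
  backward : CondA G M ⊎ CondB G M ⊎ CondC p G M → ¬ IsPerfectCode G M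
  backward c = OddTheory.Classification.no-code em K two≢0 {p} (two-square⇒ two≢0) (two-square two≢0) automorphism-power sG sM M⊑G T⊑G maximalΓ ¬T⊑M c
   where
   open ResidueTheory em {p} {e} pr K using (two-square; two-square⇒; automorphism-power)
   two≢0 : two ≢ 0#
   two≢0 z = even-odd-⊥ (UnitTheory.two≡0⇒even em K z) (odd-order c)

theorem1p5 : (p e : ℕ) → Prime p → 4 ≤ p ^ e → (K : FiniteField (p ^ e))
 → (G M : ProjectiveGroups.Subset K)
 → ProjectiveGroups.IsSubgroup K G
 → ProjectiveGroups._⊆_ K (ProjectiveGroups.PSL K) G
 → ProjectiveGroups.IsSubgroup K M
 → ProjectiveGroups.IsMaximal K G M
 → ProjectiveGroups.IsCoreFree K G M
 → ((¬ ProjectiveGroups.IsPerfectCode K G M)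
 ⇔ (ProjectiveGroups.CondA K G M ⊎ ProjectiveGroups.CondB K G M ⊎ ProjectiveGroups.CondC K p G M))
theorem1p5 p e pr _ K G M sG PSL⊆G sM maximal core-free =
 classification em {p} {e} pr K sG sM (λ i → PSL⊆G _) maximal λ T⊑M → core-free-⊥ sG PSL⊆G sM core-free λ A d →
  ProjectiveTheory.⊑⇒⊆ em K (ProjectiveTheory.PSL-subgroup em K) sM T⊑M (linear A) (linear-PSL A d)
 where
 open ExcludedMiddle K {G} {M} using (excluded-middle; core-free-⊥; linear; linear-PSL)
 em : (P : Set) → Dec P
 em = excluded-middle sG PSL⊆G sM core-free maximal
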